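{- Let $m$ be a positive integer, and let $L$ be a lattice (positive definite integral $\mathbb{Z}$-lattice) of rank $n$ on the $n$-dimensional quadratic $\mathbb{Q}$-space $V=L\otimes\mathbb{Q}$. Suppose that one of the following holds: (a) $m=n$, and for each prime $p$, $\det(V_p)=1$ and $S_p(V)=1$; (b) $m=n+1$, and for each prime $p$, $S_p(V)(\det(V),\det(V))_p=1$; (c) $m=n+2$, and for each prime $p$: if $p>2$ and $\det(V_p)=-1$ then $S_p(V)=1$, and if $p=2$ and $\det(V_2)=-1$ then $S_2(V)=-1$; (d) $m\ge n+3$. Then $L$ is a sublattice of an odd unimodular lattice of rank $m$ if (1) $L$ is odd, or (2) $m=n+2$ and $(\det(V_2),S_2(V_2))\neq(3,1)$, or (3) $m\ge n+3$.
   Context: A unimodular lattice is a positive definite integral $\mathbb{Z}$-lattice with Gram determinant $1$. An integral lattice is even if all norms $(\mathbf{x},\mathbf{x})$ are even, and odd otherwise. For a prime $p$, $V_p=V\otimes\mathbb{Q}_p$, $\det(V_p)$ is the class of the Gram determinant in $\mathbb{Q}_p^*/(\mathbb{Q}_p^*)^2$ (equalities like $\det(V_2)=3$ are equalities of square classes), $(\cdot,\cdot)_p$ is the Hilbert symbol, and $S_p(V)=S_p(V_p)=\prod_{i<j}(q(\mathbf{u}_i),q(\mathbf{u}_j))_p$ for an orthogonal basis $\mathbf{u}_1,\dots,\mathbf{u}_n$. -}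

module Defs where

open import Data.Nat as ℕ using (ℕ; zero; suc)
open import Data.Nat.Primality using (Prime)
open import Data.Integer as ℤ using (ℤ; +_; -[1+_])
open import Data.Integer.Divisibility using (_∣_)
open import Data.Rational as ℚ using (ℚ; ↥_; ↧_; _/_)
open import Data.Fin using (Fin; zero; suc; toℕ; punchIn)
open import Data.Bool using (if_then_else_)
open import Data.Product using (Σ; ∃; _×_; _,_)
open import Data.Sum using (_⊎_)
open import Relation.Nullary using (¬_)
open import Relation.Binary.PropositionalEquality using (_≡_; _≢_)

sumℤ : ∀ {n} → (Fin n → ℤ) → ℤ
sumℤ {zero}  f = + 0
sumℤ {suc n} f = f zero ℤ.+ sumℤ (λ i → f (suc i))

prodℤ : ∀ {n} → (Fin n → ℤ) → ℤ
prodℤ {zero}  f = + 1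
prodℤ {suc n} f = f zero ℤ.* prodℤ (λ i → f (suc i))

sumℚ : ∀ {n} → (Fin n → ℚ) → ℚ
sumℚ {zero}  f = ℚ.0ℚ
sumℚ {suc n} f = f zero ℚ.+ sumℚ (λ i → f (suc i))

Mat : ℕ → Set
Mat n = Fin n → Fin n → ℤ

altSign : ℕ → ℤ
altSign zero          = + 1
altSign (suc zero)    = ℤ.- (+ 1)
altSign (suc (suc k)) = altSign k

det : ∀ {n} → Mat n → ℤ
det {zero}  M = + 1
det {suc n} M =
  sumℤ (λ j → altSign (toℕ j) ℤ.* (M zero j ℤ.* det (λ r c → M (suc r) (punchIn j c))))

bil : ∀ {n} → Mat n → (Fin n → ℤ) → (Fin n → ℤ) → ℤ
bil G x y = sumℤ (λ i → sumℤ (λ j → x i ℤ.* (G i j ℤ.* y j)))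

-- Lattices given by their Gram matrix (w.r.t. a Z-basis)

Symmetric : ∀ {n} → Mat n → Set
Symmetric G = ∀ i j → G i j ≡ G j i

PosDef : ∀ {n} → Mat n → Set
PosDef G = ∀ (x : Fin _ → ℤ) → (∃ λ i → x i ≢ + 0) → + 0 ℤ.< bil G x x

-- positive definite integral Z-lattice of rank n (integral: integer Gram matrix)
IsLattice : ∀ {n} → Mat n → Set
IsLattice G = Symmetric G × PosDef G

Odd : ∀ {n} → Mat n → Set
Odd G = ∃ λ x → ¬ (+ 2 ∣ bil G x x)

-- L (Gram G, rank n) is a sublattice of an odd unimodular lattice of rank m:
-- a lattice U (Gram M) with det 1, odd, and an injective Z-linear map
-- A : Z^n → Z^m preserving the bilinear forms.
EmbedsInOddUnimodular : ∀ {n} → ℕ → Mat n → Set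
EmbedsInOddUnimodular {n} m G =
  Σ (Mat m) λ M → IsLattice M × det M ≡ + 1 × Odd M ×
  Σ (Fin m → Fin n → ℤ) λ A →
    (∀ i j → bil M (λ r → A r i) (λ r → A r j) ≡ G i j) ×
    (∀ (x : Fin n → ℤ) → (∀ r → sumℤ (λ i → A r i ℤ.* x i) ≡ + 0) → ∀ i → x i ≡ + 0)

-- p-adic integers as the inverse limit of Z/p^k Z:
-- coherent sequences of integer representatives, x(k) taken mod p^k.

pk : ℕ → ℕ → ℤ
pk p k = + (p ℕ.^ k)

Zp : ℕ → Set
Zp p = Σ (ℕ → ℤ) λ x → ∀ k → pk p k ∣ (x (suc k) ℤ.- x k)

_≈[_]_ : (ℕ → ℤ) → ℕ → (ℕ → ℤ) → Set
x ≈[ p ] y = ∀ k → pk p k ∣ (x k ℤ.- y k)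

seq : ∀ {p} → Zp p → ℕ → ℤ
seq (x , _) = x

IsZeroP : ∀ p → Zp p → Set
IsZeroP p x = seq x ≈[ p ] (λ _ → + 0)

-- Hilbert symbol (a,b)_p = 1 for nonzero rationals a, b:
-- z² = a x² + b y² has a nontrivial solution in Q_p.  Writing
-- a = an/ad, b = bn/bd and clearing p-power denominators of x,y,z,
-- this is a nontrivial solution in Z_p of ad·bd·z² = an·bd·x² + bn·ad·y².
HilbertOne : ℕ → ℚ → ℚ → Set
HilbertOne p a b =
  Σ (Zp p) λ x → Σ (Zp p) λ y → Σ (Zp p) λ z →
    ¬ (IsZeroP p x × IsZeroP p y × IsZeroP p z) ×
    ((λ k → (↧ a ℤ.* ↧ b) ℤ.* (seq z k ℤ.* seq z k))
      ≈[ p ]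
     (λ k → (↥ a ℤ.* ↧ b) ℤ.* (seq x k ℤ.* seq x k)
            ℤ.+ (↥ b ℤ.* ↧ a) ℤ.* (seq y k ℤ.* seq y k)))

HilbertIs : ℕ → ℚ → ℚ → ℤ → Set
HilbertIs p a b s = (s ≡ + 1 × HilbertOne p a b) ⊎ (s ≡ ℤ.- (+ 1) × ¬ HilbertOne p a b)

-- square class: for nonzero integers d, c, "d = c in Q_p^*/(Q_p^*)^2",
-- i.e. d = c·y² with y ∈ Q_p^*, y = p^{-j} w, w ∈ Z_p:  d·p^{2j} = c·w².
SqClassEq : ℕ → ℤ → ℤ → Set
SqClassEq p d c = Σ ℕ λ j → Σ (Zp p) λ w →
  (λ k → d ℤ.* (pk p j ℤ.* pk p j)) ≈[ p ] (λ k → c ℤ.* (seq w k ℤ.* seq w k))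

DetVpIs : ∀ {n} → Mat n → ℕ → ℤ → Set
DetVpIs G p c = SqClassEq p (det G) c

toℚ : ℤ → ℚ
toℚ z = z / 1

bilℚ : ∀ {n} → Mat n → (Fin n → ℚ) → (Fin n → ℚ) → ℚ
bilℚ G x y = sumℚ (λ i → sumℚ (λ j → x i ℚ.* (toℚ (G i j) ℚ.* y j)))

qℚ : ∀ {n} → Mat n → (Fin n → ℚ) → ℚ
qℚ G x = bilℚ G x x

lincomb : ∀ {n} → (Fin n → Fin n → ℚ) → (Fin n → ℚ) → Fin n → ℚ
lincomb u c r = sumℚ (λ i → c i ℚ.* u i r)

IsBasis : ∀ {n} → (Fin n → Fin n → ℚ) → Set
IsBasis {n} u =
  (∀ c → (∀ r → lincomb u c r ≡ ℚ.0ℚ) → ∀ i → c i ≡ ℚ.0ℚ) ×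
  (∀ (v : Fin n → ℚ) → ∃ λ c → ∀ r → lincomb u c r ≡ v r)

IsOrthogonalBasis : ∀ {n} → Mat n → (Fin n → Fin n → ℚ) → Set
IsOrthogonalBasis G u = IsBasis u × (∀ i j → i ≢ j → bilℚ G (u i) (u j) ≡ ℚ.0ℚ)

prodPairs : ∀ {n} → (Fin n → Fin n → ℤ) → ℤ
prodPairs f = prodℤ (λ i → prodℤ (λ j → if toℕ i ℕ.<ᵇ toℕ j then f i j else + 1))

-- S_p(V) = s : computed from an orthogonal basis u_1..u_n as
-- ∏_{i<j} (q(u_i), q(u_j))_p   (independent of the basis).
HasseIs : ∀ {n} → Mat n → ℕ → ℤ → Set
HasseIs {n} G p s =
  Σ (Fin n → Fin n → ℚ) λ u → IsOrthogonalBasis G u ×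
  Σ (Fin n → Fin n → ℤ) λ h →
    (∀ i j → toℕ i ℕ.< toℕ j → HilbertIs p (qℚ G (u i)) (qℚ G (u j)) (h i j)) ×
    prodPairs h ≡ s

one minusOne three : ℤ
one = + 1
minusOne = ℤ.- (+ 1)
three = + 3

CaseA CaseB CaseC CaseD : ∀ {n} → ℕ → Mat n → Set
CaseA {n} m G = m ≡ n × (∀ p → Prime p → DetVpIs G p one × HasseIs G p one)
CaseB {n} m G = m ≡ suc n ×
  (∀ p → Prime p → Σ ℤ λ s → HasseIs G p s × HilbertIs p (toℚ (det G)) (toℚ (det G)) s)
  -- S_p(V)(det V, det V)_p = 1  ⇔  S_p(V) = (det V, det V)_p  (both are ±1)
CaseC {n} m G = m ≡ suc (suc n) ×
  (∀ p → Prime p →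
     (2 ℕ.< p → DetVpIs G p minusOne → HasseIs G p one) ×
     (p ≡ 2 → DetVpIs G 2 minusOne → HasseIs G 2 minusOne))
CaseD {n} m G = 3 ℕ.+ n ℕ.≤ m

Cases : ∀ {n} → ℕ → Mat n → Set
Cases m G = CaseA m G ⊎ CaseB m G ⊎ CaseC m G ⊎ CaseD m G

Extra : ∀ {n} → ℕ → Mat n → Set
Extra {n} m G =
  Odd G ⊎
  (m ≡ suc (suc n) × ¬ (DetVpIs G 2 three × HasseIs G 2 one)) ⊎
  3 ℕ.+ n ℕ.≤ m

{-# OPTIONS --safe #-}
-- A lattice whose determinant has even valuation at every prime and whose Hasse
-- symbols are trivial at the odd primes lies in a unimodular lattice of the same
-- rank: if p² divides the determinant, there is x ∉ pL with (x,L) ⊆ pℤ and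
-- p² ∣ q(x), and L + ℤx/p is a larger lattice, still odd if L is.  This gives (a).
-- For (b) one adds ⟨d⟩ to L, where d = det L, and for (c) one adds ⟨a⟩ ⟂ ⟨ad⟩,
-- where a > 0 is to satisfy (a,-d)_p = S_p(V)(d,d)_p for every odd p.  By the
-- product formula these conditions are compatible, and a is an explicit product
-- of inert primes times a norm form value n in a prescribed genus.  Such n exist
-- because the genus characters are independent: if a character ψ were 1 at every
-- n with r(n) = ∑_{b∣n} χ(b) ≠ 0, then ∑ ψ(n) r(n) (X - n) would grow like X^{3/2},
-- but by the hyperbola method it is O(X).  For (d), adding a suitable ⟨a⟩ makes
-- every prime divisor of 2 det L ramified, and then (c) imposes no condition.
module Submission where

open import Defs
open import Data.Nat as ℕ using (ℕ; zero; suc; _≤_; _<_; z≤n; s≤s; _∸_) renaming (_+_ to _+ᴺ_; _*_ to _*ᴺ_; _^_ to _^ᴺ_)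
open import Data.Nat.Properties as ℕP using (≤-trans; ≤-reflexive; ≤-refl; ≤-<-trans; <-≤-trans; <⇒≤; <⇒≢; *-mono-≤; m≤m+n; m≤n+m; m<n⇒m<1+n; <⇒≱; <-trans; ≤∧≢⇒<; ≤-pred; m∸n+n≡m; m<m*n; ≮⇒≥; <-irrefl)
import Data.Nat.Divisibility as ℕD
import Data.Nat.DivMod as ℕM
import Data.Nat.Induction as ℕI
import Data.Nat.Coprimality as ℕC
open import Data.Nat.Primality using (Prime; prime?; euclidsLemma; prime⇒nonZero; prime⇒nonTrivial; prime[2])
import Data.Nat.ListAction
open import Data.Nat.Primality.Factorisation using (factorise; PrimeFactorisation)
open import Data.Integer as ℤ using (ℤ; +_; -[1+_]; _+_; _*_; -_; _-_) renaming (∣_∣ to abs; _≤_ to _≤ℤ_; _<_ to _<ℤ_)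
open import Data.Integer.Properties as ℤP using (*-zeroʳ; *-zeroˡ; *-identityˡ; *-identityʳ; *-comm; *-assoc; pos-+; +-identityˡ; +-identityʳ; abs-*; neg-involutive)
import Data.Integer.Divisibility as ℤU
import Data.Integer.DivMod as ℤM
open import Data.Integer.Divisibility.Signed as ℤS using (_∣_; divides; ∣ᵤ⇒∣; ∣⇒∣ᵤ; _∣?_; ∣m∣n⇒∣m+n; ∣m∣n⇒∣m-n; ∣m⇒∣-m; ∣m+n∣m⇒∣n; ∣m+n∣n⇒∣m; ∣n⇒∣m*n; ∣m⇒∣m*n)
open import Data.Integer.Tactic.RingSolver using (solve-∀)
import Data.Nat.Tactic.RingSolver as ℕR
open import Data.Rational as ℚ using (ℚ; ↥_; ↧_)
import Data.Rational.Properties as ℚP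
import Data.Rational.Solver as ℚSol
import Data.Rational.Unnormalised as ℚᵘ
import Data.Rational.Unnormalised.Properties as ℚᵘP
open import Data.Fin as Fin using (Fin; zero; suc; toℕ; fromℕ<; punchIn; punchOut)
open import Data.Fin.Properties as FinP using (toℕ<n; toℕ-injective; any?)
open import Data.Bool using (Bool; true; false; if_then_else_; not; _xor_; _∧_)
open import Data.Bool.Properties as BoolP using (xor-identityʳ; xor-same; ∧-zeroʳ; ∧-identityʳ; xor-comm; xor-assoc)
open import Data.Product using (Σ; ∃; _×_; _,_; proj₁; proj₂)
open import Data.Sum using (_⊎_; inj₁; inj₂)
open import Data.Empty using (⊥; ⊥-elim)
open import Data.Unit using (⊤; tt)
open import Data.List as List using (List; []; _∷_)
open import Data.List.Relation.Unary.All as All using (All; []; _∷_)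
open import Data.Vec using (Vec; []; _∷_)
open import Relation.Nullary using (¬_; Dec; yes; no; does)
open import Relation.Nullary.Decidable using (¬?; _×-dec_; toWitness; dec-true; dec-false)
open import Relation.Binary.PropositionalEquality using (_≡_; _≢_; refl; sym; trans; cong; cong₂; subst; subst₂; module ≡-Reasoning)
open import Function using (_∘_; case_of_)
open import Induction.WellFounded using (Acc; acc)
open import Relation.Binary.Definitions using (tri<; tri≈; tri>)

-- The unweighted sum of ψ(n)r(n) over n < X would only be O(√X), the same order as the number of
-- squares that bound it from below; the weight X - n separates the two orders, so explicit
-- constants suffice and no L-function enters. The integer a matters only through its symbols
-- against -d, and at an odd unramified prime these see just the parity of its valuation. Hence a
-- number with even valuation at the inert primes can replace the customary prime in an arithmetic
-- progression. The prime 2 is exceptional twice. When the lattice is enlarged, x/2 need only have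
-- integral norm, so even an anisotropic plane gives no obstruction at 2, whereas at odd p the plane
-- ⟨pu, pw⟩ with -uw a non-residue does. When a is chosen, it has to be even if 2 is inert and the
-- sign wanted at 2 is -1; this leads to the pair (3, 1), where an odd norm must come from L itself.
-- Hilbert symbols are explicit formulas with values in 𝔽₂. They meet p-adic solubility through
-- Hensel lifting on one side and a congruence modulo p² or 16 on the other.

-- Finite sums of integers.

+ˡ : ∀ a {b c : ℤ} → b ≡ c → a + b ≡ a + c
+ˡ a = cong (λ z → a + z)

sum-cong : ∀ {n} {f g : Fin n → ℤ} → (∀ i → f i ≡ g i) → sumℤ f ≡ sumℤ g
sum-cong {zero}  e = refl
sum-cong {suc n} e = cong₂ _+_ (e zero) (sum-cong (λ i → e (suc i)))

sum-0 : ∀ {n} {f : Fin n → ℤ} → (∀ i → f i ≡ + 0) → sumℤ f ≡ + 0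
sum-0 {zero}  e = refl
sum-0 {suc n} e = cong₂ _+_ (e zero) (sum-0 (λ i → e (suc i)))

+-interchange : ∀ a b c d → (a + b) + (c + d) ≡ (a + c) + (b + d)
+-interchange = solve-∀

sum-+ : ∀ {n} (f g : Fin n → ℤ) → sumℤ (λ i → f i + g i) ≡ sumℤ f + sumℤ g
sum-+ {zero}  f g = refl
sum-+ {suc n} f g = trans (+ˡ (f zero + g zero) (sum-+ (f ∘ suc) (g ∘ suc)))
  (+-interchange (f zero) (g zero) (sumℤ (f ∘ suc)) (sumℤ (g ∘ suc)))

sum-*ˡ : ∀ {n} c (f : Fin n → ℤ) → sumℤ (λ i → c * f i) ≡ c * sumℤ f
sum-*ˡ {zero}  c f = sym (*-zeroʳ c)
sum-*ˡ {suc n} c f = trans (+ˡ (c * f zero) (sum-*ˡ c (f ∘ suc)))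
  (sym (ℤP.*-distribˡ-+ c (f zero) (sumℤ (f ∘ suc))))

sum-*ʳ : ∀ {n} c (f : Fin n → ℤ) → sumℤ (λ i → f i * c) ≡ sumℤ f * c
sum-*ʳ c f = trans (sum-cong (λ i → *-comm (f i) c)) (trans (sum-*ˡ c f) (*-comm c _))

sum-lin : ∀ {n} x y (f g : Fin n → ℤ) → sumℤ (λ i → x * f i + y * g i) ≡ x * sumℤ f + y * sumℤ g
sum-lin x y f g = trans (sum-+ (λ i → x * f i) (λ i → y * g i)) (cong₂ _+_ (sum-*ˡ x f) (sum-*ˡ y g))

sum-swap : ∀ {m n} (f : Fin m → Fin n → ℤ) →
  sumℤ (λ i → sumℤ (λ j → f i j)) ≡ sumℤ (λ j → sumℤ (λ i → f i j))
sum-swap {zero}  {n} f = sym (sum-0 {n} (λ _ → refl))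
sum-swap {suc m} {n} f = trans (+ˡ (sumℤ (f zero)) (sum-swap (f ∘ suc))) (sym (sum-+ (f zero) (λ j → sumℤ (λ i → f (suc i) j))))

δ : ∀ {n} → Fin n → Fin n → ℤ
δ zero    zero    = + 1
δ zero    (suc j) = + 0
δ (suc i) zero    = + 0
δ (suc i) (suc j) = δ i j

δ-refl : ∀ {n} (i : Fin n) → δ i i ≡ + 1
δ-refl zero    = refl
δ-refl (suc i) = δ-refl i

δ-≢ : ∀ {n} {i j : Fin n} → i ≢ j → δ i j ≡ + 0
δ-≢ {i = zero}  {zero}  ne = ⊥-elim (ne refl)
δ-≢ {i = zero}  {suc j} ne = refl
δ-≢ {i = suc i} {zero}  ne = refl
δ-≢ {i = suc i} {suc j} ne = δ-≢ (λ e → ne (cong suc e))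

δ-sym : ∀ {n} (i j : Fin n) → δ i j ≡ δ j i
δ-sym zero    zero    = refl
δ-sym zero    (suc j) = refl
δ-sym (suc i) zero    = refl
δ-sym (suc i) (suc j) = δ-sym i j

sum-single : ∀ {n} (k : Fin n) (f : Fin n → ℤ) → (∀ i → i ≢ k → f i ≡ + 0) → sumℤ f ≡ f k
sum-single zero    f z = trans (+ˡ (f zero) (sum-0 (λ i → z (suc i) (λ ())))) (+-identityʳ (f zero))
sum-single (suc k) f z = trans (cong₂ _+_ (z zero (λ ())) (sum-single k (f ∘ suc) (λ i ne → z (suc i) (λ e → ne (FinP.suc-injective e)))))
  (+-identityˡ _)

sum-δˡ : ∀ {n} (k : Fin n) (f : Fin n → ℤ) → sumℤ (λ i → δ k i * f i) ≡ f k
sum-δˡ k f = trans (sum-single k _ (λ i ne → trans (cong (_* f i) (δ-≢ (λ e → ne (sym e)))) (*-zeroˡ (f i))))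
  (trans (cong (_* f k) (δ-refl k)) (*-identityˡ (f k)))

sum-δʳ : ∀ {n} (k : Fin n) (f : Fin n → ℤ) → sumℤ (λ i → f i * δ i k) ≡ f k
sum-δʳ k f = trans (sum-cong (λ i → trans (*-comm (f i) _) (cong (_* f i) (δ-sym i k)))) (sum-δˡ k f)

sum-∣ : ∀ {n} d (f : Fin n → ℤ) → (∀ i → d ∣ f i) → d ∣ sumℤ f
sum-∣ {zero}  d f e = divides (+ 0) refl
sum-∣ {suc n} d f e = ∣m∣n⇒∣m+n (e zero) (sum-∣ d (f ∘ suc) (e ∘ suc))

*-nz : ∀ {a b} → a ≢ + 0 → b ≢ + 0 → a * b ≢ + 0
*-nz {a} a0 b0 e with ℤP.i*j≡0⇒i≡0∨j≡0 a e
... | inj₁ x = a0 x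
... | inj₂ y = b0 y

*-cancelˡ : ∀ {a b c} → a ≢ + 0 → a * b ≡ a * c → b ≡ c
*-cancelˡ {a} {b} {c} a0 e = ℤP.*-cancelˡ-≡ a b c {{ℤ.≢-nonZero a0}} e

-- Determinants

data Adj : ∀ {n} → Fin n → Fin n → Set where
  adj0 : ∀ {n} → Adj {suc (suc n)} zero (suc zero)
  adjs : ∀ {n} {k l : Fin n} → Adj k l → Adj (suc k) (suc l)

adj-inject : ∀ {n} (j : Fin n) → Adj (Fin.inject₁ j) (suc j)
adj-inject zero    = adj0
adj-inject (suc j) = adjs (adj-inject j)

adj-≢ : ∀ {n} {k l : Fin n} → Adj k l → k ≢ l
adj-≢ (adjs a) e = adj-≢ a (FinP.suc-injective e)

adj-toℕ : ∀ {n} {k l : Fin n} → Adj k l → toℕ l ≡ suc (toℕ k)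
adj-toℕ adj0     = refl
adj-toℕ (adjs a) = cong suc (adj-toℕ a)

altSign-suc : ∀ k → altSign (suc k) ≡ - altSign k
altSign-suc zero          = refl
altSign-suc (suc zero)    = refl
altSign-suc (suc (suc k)) = altSign-suc k

minor : ∀ {n} → Mat (suc n) → Fin (suc n) → Mat n
minor M j r c = M (suc r) (punchIn j c)

det-cong : ∀ {n} {A B : Mat n} → (∀ i j → A i j ≡ B i j) → det A ≡ det B
det-cong {zero}  e = refl
det-cong {suc n} e = sum-cong (λ j → cong (altSign (toℕ j) *_)
  (cong₂ _*_ (e zero j) (det-cong (λ r c → e (suc r) (punchIn j c)))))

punchIn-inj : ∀ {n} (j : Fin (suc n)) {a b} → punchIn j a ≡ punchIn j b → a ≡ b
punchIn-inj j = FinP.punchIn-injective j _ _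

-- The recursive expansion removes row zero and one column, so it treats the columns alike but
-- singles out a row. Hence linearity and alternation are proved for columns; the rows get them
-- through the transpose.
det-col-lin : ∀ {n} k x y (A B C : Mat n) →
  (∀ i j → j ≢ k → A i j ≡ B i j) → (∀ i j → j ≢ k → A i j ≡ C i j) →
  (∀ i → A i k ≡ x * B i k + y * C i k) → det A ≡ x * det B + y * det C
det-col-lin {suc n} k x y A B C eB eC ek =
  trans (sum-cong term) (sum-lin x y (λ j → s j * (B zero j * det (minor B j))) (λ j → s j * (C zero j * det (minor C j))))
  where
  s : Fin (suc n) → ℤ
  s j = altSign (toℕ j)
  r₁ : ∀ s a b x y d → s * ((x * a + y * b) * d) ≡ x * (s * (a * d)) + y * (s * (b * d))
  r₁ = solve-∀
  r₂ : ∀ s a b x y d → s * (a * (x * b + y * d)) ≡ x * (s * (a * b)) + y * (s * (a * d))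
  r₂ = solve-∀
  term : ∀ j → s j * (A zero j * det (minor A j)) ≡
    x * (s j * (B zero j * det (minor B j))) + y * (s j * (C zero j * det (minor C j)))
  term j with j FinP.≟ k
  ... | yes refl = trans (cong (λ t → s j * (t * det (minor A j))) (ek zero))
        (trans (r₁ (s j) (B zero j) (C zero j) x y (det (minor A j)))
          (cong₂ (λ u v → x * (s j * (B zero j * u)) + y * (s j * (C zero j * v)))
            (det-cong (λ r c → eB (suc r) (punchIn j c) (FinP.punchInᵢ≢i j c)))
            (det-cong (λ r c → eC (suc r) (punchIn j c) (FinP.punchInᵢ≢i j c)))))
  ... | no j≢k = trans (cong (λ t → s j * (A zero j * t)) ih)
        (trans (r₂ (s j) (A zero j) (det (minor B j)) x y (det (minor C j)))
          (cong₂ (λ u v → x * (s j * (u * det (minor B j))) + y * (s j * (v * det (minor C j))))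
            (eB zero j j≢k) (eC zero j j≢k)))
    where
    k′ = punchOut j≢k
    pk′ : punchIn j k′ ≡ k
    pk′ = FinP.punchIn-punchOut j≢k
    off : ∀ c → c ≢ k′ → punchIn j c ≢ k
    off c ne e = ne (punchIn-inj j (trans e (sym pk′)))
    ih = det-col-lin k′ x y (minor A j) (minor B j) (minor C j)
      (λ r c ne → eB (suc r) _ (off c ne)) (λ r c ne → eC (suc r) _ (off c ne))
      (λ r → subst (λ z → A (suc r) z ≡ x * B (suc r) z + y * C (suc r) z) (sym pk′) (ek (suc r)))

adj-punch : ∀ {n} {k l : Fin (suc n)} → Adj k l → ∀ j →
  j ≡ k ⊎ j ≡ l ⊎ Σ (Fin n) λ k′ → Σ (Fin n) λ l′ → Adj k′ l′ × punchIn j k′ ≡ k × punchIn j l′ ≡ l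
adj-punch adj0 zero = inj₁ refl
adj-punch adj0 (suc zero) = inj₂ (inj₁ refl)
adj-punch {suc (suc n)} adj0 (suc (suc j)) = inj₂ (inj₂ (zero , suc zero , adj0 , refl , refl))
adj-punch (adjs a) zero = inj₂ (inj₂ (_ , _ , a , refl , refl))
adj-punch {suc n} (adjs a) (suc j) with adj-punch a j
... | inj₁ e = inj₁ (cong suc e)
... | inj₂ (inj₁ e) = inj₂ (inj₁ (cong suc e))
... | inj₂ (inj₂ (k′ , l′ , a′ , e , e′)) = inj₂ (inj₂ (suc k′ , suc l′ , adjs a′ , cong suc e , cong suc e′))

adj-swap : ∀ {n} {k l : Fin (suc n)} → Adj k l → ∀ c →
  punchIn k c ≡ punchIn l c ⊎ (punchIn k c ≡ l × punchIn l c ≡ k)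
adj-swap adj0 zero    = inj₂ (refl , refl)
adj-swap adj0 (suc c) = inj₁ refl
adj-swap (adjs a) zero = inj₁ refl
adj-swap (adjs a) (suc c) with adj-swap a c
... | inj₁ e = inj₁ (cong suc e)
... | inj₂ (e , e′) = inj₂ (cong suc e , cong suc e′)

adj-sum : ∀ {n} {k l : Fin n} → Adj k l → (t : Fin n → ℤ) → t k + t l ≡ + 0 →
  (∀ j → j ≢ k → j ≢ l → t j ≡ + 0) → sumℤ t ≡ + 0
adj-sum adj0 t e z = trans (cong (λ w → t zero + (t (suc zero) + w)) (sum-0 (λ i → z (suc (suc i)) (λ ()) (λ ()))))
  (trans (+ˡ (t zero) (+-identityʳ (t (suc zero)))) e)
adj-sum (adjs a) t e z = trans (cong₂ _+_ (z zero (λ ()) (λ ()))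
  (adj-sum a (t ∘ suc) e (λ j nk nl → z (suc j) (nk ∘ FinP.suc-injective) (nl ∘ FinP.suc-injective)))) refl

-- Deleting any column other than `k` and `l` leaves the two equal columns adjacent, so those terms
-- vanish by induction; the minors at `k` and `l` coincide and carry opposite signs.
det-col-alt : ∀ {n} {k l : Fin n} → Adj k l → (A : Mat n) → (∀ i → A i k ≡ A i l) → det A ≡ + 0
det-col-alt {suc n} {k} {l} a A e = adj-sum a _ cancel rest
  where
  t : Fin (suc n) → ℤ
  t j = altSign (toℕ j) * (A zero j * det (minor A j))
  same : ∀ r c → minor A k r c ≡ minor A l r c
  same r c with adj-swap a c
  ... | inj₁ q = cong (A (suc r)) q
  ... | inj₂ (q , q′) = trans (cong (A (suc r)) q) (trans (sym (e (suc r))) (sym (cong (A (suc r)) q′)))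
  neg : ∀ s x → s * x + (- s) * x ≡ + 0
  neg = solve-∀
  cancel : t k + t l ≡ + 0
  cancel = trans (cong₂ (λ u v → t k + u * v)
      (trans (cong altSign (adj-toℕ a)) (altSign-suc (toℕ k)))
      (cong₂ _*_ (sym (e zero)) (sym (det-cong same))))
    (neg (altSign (toℕ k)) (A zero k * det (minor A k)))
  rest : ∀ j → j ≢ k → j ≢ l → t j ≡ + 0
  rest j nk nl with adj-punch a j
  ... | inj₁ q = ⊥-elim (nk q)
  ... | inj₂ (inj₁ q) = ⊥-elim (nl q)
  ... | inj₂ (inj₂ (k′ , l′ , a′ , q , q′)) =
    trans (cong (λ w → altSign (toℕ j) * (A zero j * w))
      (det-col-alt a′ (minor A j) (λ r → trans (cong (A (suc r)) q) (trans (e (suc r)) (sym (cong (A (suc r)) q′))))))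
    (trans (cong (altSign (toℕ j) *_) (*-zeroʳ (A zero j))) (*-zeroʳ (altSign (toℕ j))))

-- An alternating multilinear function of the rows, with alternation asked for adjacent rows only:
-- that much comes directly from the expansion, and `alt-any` recovers the rest.
record RowForm {n} (f : Mat n → ℤ) : Set where
  field
    rcong : ∀ {A B} → (∀ i j → A i j ≡ B i j) → f A ≡ f B
    rlin  : ∀ k x y A B C → (∀ i j → i ≢ k → A i j ≡ B i j) → (∀ i j → i ≢ k → A i j ≡ C i j) →
            (∀ j → A k j ≡ x * B k j + y * C k j) → f A ≡ x * f B + y * f C
    ralt  : ∀ {k l} → Adj k l → ∀ A → (∀ j → A k j ≡ A l j) → f A ≡ + 0

_ᵀ : ∀ {n} → Mat n → Mat n
(A ᵀ) i j = A j i

detᵀ-form : ∀ {n} → RowForm {n} (λ A → det (A ᵀ))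
detᵀ-form = record
  { rcong = λ e → det-cong (λ i j → e j i)
  ; rlin  = λ k x y A B C eB eC ek → det-col-lin k x y (A ᵀ) (B ᵀ) (C ᵀ) (λ i j → eB j i) (λ i j → eC j i) ek
  ; ralt  = λ a A e → det-col-alt a (A ᵀ) e }

setRow : ∀ {n} → Mat n → Fin n → (Fin n → ℤ) → Mat n
setRow A k v i with i FinP.≟ k
... | yes _ = v
... | no _  = A i

setRow-≡ : ∀ {n} (A : Mat n) k v j → setRow A k v k j ≡ v j
setRow-≡ A k v j with k FinP.≟ k
... | yes _ = refl
... | no ne = ⊥-elim (ne refl)

setRow-≢ : ∀ {n} (A : Mat n) k v {i} → i ≢ k → ∀ j → setRow A k v i j ≡ A i j
setRow-≢ A k v {i} ne j with i FinP.≟ k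
... | yes e = ⊥-elim (ne e)
... | no _  = refl

module FormProperties {n} {f : Mat n → ℤ} (F : RowForm f) where
  open RowForm F

  AltAt : Fin n → Fin n → Set
  AltAt k l = ∀ A → (∀ j → A k j ≡ A l j) → f A ≡ + 0

  f-add : ∀ k A (u v : Fin n → ℤ) → f (setRow A k (λ j → u j + v j)) ≡ f (setRow A k u) + f (setRow A k v)
  f-add k A u v = trans (rlin k (+ 1) (+ 1) _ _ _
      (λ i j ne → trans (setRow-≢ A k _ ne j) (sym (setRow-≢ A k u ne j)))
      (λ i j ne → trans (setRow-≢ A k _ ne j) (sym (setRow-≢ A k v ne j)))
      (λ j → trans (setRow-≡ A k _ j) (cong₂ _+_
        (trans (sym (setRow-≡ A k u j)) (sym (*-identityˡ _)))
        (trans (sym (setRow-≡ A k v j)) (sym (*-identityˡ _))))))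
    (cong₂ _+_ (*-identityˡ (f (setRow A k u))) (*-identityˡ (f (setRow A k v))))

  -- Polarisation: expand `f` on the sum of the two rows placed in both positions; the terms with a
  -- repeated row vanish.
  swap-neg : ∀ {k l} → k ≢ l → AltAt k l → ∀ A B → (∀ j → B k j ≡ A l j) → (∀ j → B l j ≡ A k j) →
    (∀ i j → i ≢ k → i ≢ l → B i j ≡ A i j) → f B ≡ - f A
  swap-neg {k} {l} k≢l alt A B ek el eo = finish (f A) (f B) (trans (cong₂ _+_ (sym fAB) (sym fBA)) sum0)
    where
    W : (Fin n → ℤ) → (Fin n → ℤ) → Mat n
    W u v = setRow (setRow A k u) l v
    Wk : ∀ u v j → W u v k j ≡ u j
    Wk u v j = trans (setRow-≢ _ l v k≢l j) (setRow-≡ A k u j)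
    Wl : ∀ u v j → W u v l j ≡ v j
    Wl u v j = setRow-≡ _ l v j
    ext : ∀ M u v → (∀ j → M k j ≡ u j) → (∀ j → M l j ≡ v j) → (∀ i j → i ≢ k → i ≢ l → M i j ≡ A i j) →
      ∀ i j → W u v i j ≡ M i j
    ext M u v mk ml mo i j with i FinP.≟ k | i FinP.≟ l
    ... | yes refl | yes e  = ⊥-elim (k≢l e)
    ... | yes refl | no nl  = trans (setRow-≡ A k u j) (sym (mk j))
    ... | no nk | yes refl  = sym (ml j)
    ... | no nk | no nl     = trans (setRow-≢ A k u nk j) (sym (mo i j nk nl))
    a b s : Fin n → ℤ
    a = A k
    b = A l
    s j = a j + b j
    fAB : f (W a b) ≡ f A
    fAB = rcong (ext A a b (λ _ → refl) (λ _ → refl) (λ _ _ _ _ → refl))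
    fBA : f (W b a) ≡ f B
    fBA = rcong (ext B b a ek el eo)
    z : ∀ u → f (W u u) ≡ + 0
    z u = alt (W u u) (λ j → trans (Wk u u j) (sym (Wl u u j)))
    addl : ∀ u → f (W u s) ≡ f (W u a) + f (W u b)
    addl u = f-add l (setRow A k u) a b
    addk : f (W s s) ≡ f (W a s) + f (W b s)
    addk = trans (rlin k (+ 1) (+ 1) (W s s) (W a s) (W b s) (o a) (o b)
        (λ j → trans (Wk s s j) (cong₂ _+_ (trans (sym (Wk a s j)) (sym (*-identityˡ _)))
           (trans (sym (Wk b s j)) (sym (*-identityˡ _))))))
      (cong₂ _+_ (*-identityˡ (f (W a s))) (*-identityˡ (f (W b s))))
      where
      o : ∀ u i j → i ≢ k → W s s i j ≡ W u s i j
      o u i j ne with i FinP.≟ l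
      ... | yes _ = refl
      ... | no nl = trans (setRow-≢ A k s ne j) (sym (setRow-≢ A k u ne j))
    sum0 : f (W a b) + f (W b a) ≡ + 0
    sum0 = trans (sym (trans addk (trans (cong₂ _+_ (addl a) (addl b))
             (trans (cong₂ (λ p q → (p + f (W a b)) + (f (W b a) + q)) (z a) (z b))
               (cong₂ _+_ (+-identityˡ (f (W a b))) (+-identityʳ (f (W b a)))))))) (z s)
    fin : ∀ x y → y ≡ (x + y) - x
    fin = solve-∀
    finish : ∀ x y → x + y ≡ + 0 → y ≡ - x
    finish x y e = trans (fin x y) (trans (cong (_- x) e) (+-identityˡ (- x)))

  -- Induction on the position of the later row: exchanging it with its predecessor only changes the
  -- sign and brings it nearer to `i`.
  alt-lt : ∀ t (i j : Fin n) → toℕ j ≡ t → toℕ i < t → AltAt i j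
  alt-lt (suc t) i (suc j) ej (s≤s i≤t) A e with Fin.inject₁ j FinP.≟ i
  ... | yes refl = ralt (adj-inject j) A e
  ... | no j′≢i = trans (sym (neg-involutive (f A)))
       (trans (cong -_ (sym (swap-neg (adj-≢ ad) (ralt ad) A B bk bl bo))) (cong -_ fB))
    where
    j′ = Fin.inject₁ j
    ad = adj-inject j
    tj′ : toℕ j′ ≡ t
    tj′ = trans (FinP.toℕ-inject₁ j) (ℕP.suc-injective ej)
    i<t : toℕ i < t
    i<t = ≤∧≢⇒< i≤t (λ q → j′≢i (toℕ-injective (trans tj′ (sym q))))
    B : Mat n
    B = setRow (setRow A j′ (A (suc j))) (suc j) (A j′)
    bk : ∀ c → B j′ c ≡ A (suc j) c
    bk c = trans (setRow-≢ _ (suc j) _ (adj-≢ ad) c) (setRow-≡ A j′ _ c)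
    bl : ∀ c → B (suc j) c ≡ A j′ c
    bl c = setRow-≡ _ (suc j) _ c
    bo : ∀ r c → r ≢ j′ → r ≢ suc j → B r c ≡ A r c
    bo r c n1 n2 = trans (setRow-≢ _ (suc j) _ n2 c) (setRow-≢ A j′ _ n1 c)
    i≢sj : i ≢ suc j
    i≢sj q = <-irrefl (trans (cong toℕ q) ej) (s≤s i≤t)
    fB : f B ≡ + 0
    fB = alt-lt t i j′ tj′ i<t B (λ c → trans (bo i c (λ q → j′≢i (sym q)) i≢sj) (trans (e c) (sym (bk c))))

  alt-any : ∀ {i j} → i ≢ j → AltAt i j
  alt-any {i} {j} ne A e with ℕP.<-cmp (toℕ i) (toℕ j)
  ... | tri< lt _ _ = alt-lt (toℕ j) i j refl lt A e
  ... | tri≈ _ q _ = ⊥-elim (ne (toℕ-injective q))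
  ... | tri> _ _ gt = alt-lt (toℕ i) j i refl gt A (λ c → sym (e c))

  swap-any : ∀ {k l} → k ≢ l → ∀ A B → (∀ j → B k j ≡ A l j) → (∀ j → B l j ≡ A k j) →
    (∀ i j → i ≢ k → i ≢ l → B i j ≡ A i j) → f B ≡ - f A
  swap-any ne = swap-neg ne (alt-any ne)

  row-add : ∀ {k l} → k ≢ l → ∀ c A B → (∀ j → B k j ≡ A k j + c * A l j) →
    (∀ i j → i ≢ k → B i j ≡ A i j) → f B ≡ f A
  row-add {k} {l} ne c A B ek eo =
    trans (rlin k (+ 1) c B A (setRow A k (A l)) eo
        (λ i j nk → trans (eo i j nk) (sym (setRow-≢ A k _ nk j)))
        (λ j → trans (ek j) (cong₂ _+_ (sym (*-identityˡ (A k j))) (cong (c *_) (sym (setRow-≡ A k (A l) j))))))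
      (trans (cong₂ _+_ (*-identityˡ (f A)) (trans (cong (c *_)
         (alt-any ne _ (λ j → trans (setRow-≡ A k _ j) (sym (setRow-≢ A k _ (λ q → ne (sym q)) j)))))
         (*-zeroʳ c))) (+-identityʳ (f A)))

  lin-sum : ∀ {m} k A (x : Fin m → ℤ) (v : Fin m → Fin n → ℤ) →
    f (setRow A k (λ c → sumℤ (λ t → x t * v t c))) ≡ sumℤ (λ t → x t * f (setRow A k (v t)))
  lin-sum {zero} k A x v = rlin k (+ 0) (+ 0) _ A A
    (λ i j ne → setRow-≢ A k _ ne j) (λ i j ne → setRow-≢ A k _ ne j) (λ j → setRow-≡ A k _ j)
  lin-sum {suc m} k A x v = trans (rlin k (x zero) (+ 1) _ (setRow A k (v zero)) (setRow A k rest)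
      (λ i j ne → trans (setRow-≢ A k _ ne j) (sym (setRow-≢ A k _ ne j)))
      (λ i j ne → trans (setRow-≢ A k _ ne j) (sym (setRow-≢ A k _ ne j)))
      (λ j → trans (setRow-≡ A k _ j) (cong₂ _+_ (cong (x zero *_) (sym (setRow-≡ A k _ j)))
        (trans (sym (setRow-≡ A k rest j)) (sym (*-identityˡ _))))))
    (+ˡ (x zero * f (setRow A k (v zero))) (trans (*-identityˡ (f (setRow A k rest))) (lin-sum k A (x ∘ suc) (v ∘ suc))))
    where
    rest : Fin n → ℤ
    rest c = sumℤ (λ t → x (suc t) * v (suc t) c)

  expand : ∀ k A → f A ≡ sumℤ (λ j → A k j * f (setRow A k (δ j)))
  expand k A = trans (rcong pt) (lin-sum k A (A k) δ)
    where
    pt : ∀ i j → A i j ≡ setRow A k (λ c → sumℤ (λ t → A k t * δ t c)) i j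
    pt i j with i FinP.≟ k
    ... | yes refl = sym (sum-δʳ j (A k))
    ... | no _ = refl

-- Zero-padding at coordinate `j`, the companion of `punchIn` on vectors; through it a row form of
-- size n + 1 is read as one of size n.
ins : ∀ {n} → Fin (suc n) → (Fin n → ℤ) → Fin (suc n) → ℤ
ins zero v zero = + 0
ins zero v (suc c) = v c
ins {suc n} (suc j) v zero = v zero
ins {suc n} (suc j) v (suc c) = ins j (v ∘ suc) c

ins-cong : ∀ {n} (j : Fin (suc n)) {u v : Fin n → ℤ} → (∀ c → u c ≡ v c) → ∀ c → ins j u c ≡ ins j v c
ins-cong zero e zero = refl
ins-cong zero e (suc c) = e c
ins-cong {suc n} (suc j) e zero = e zero
ins-cong {suc n} (suc j) e (suc c) = ins-cong j (e ∘ suc) c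

ins-lin : ∀ {n} (j : Fin (suc n)) x y (u v : Fin n → ℤ) c →
  ins j (λ c → x * u c + y * v c) c ≡ x * ins j u c + y * ins j v c
ins-lin zero x y u v zero = sym (cong₂ _+_ (*-zeroʳ x) (*-zeroʳ y))
ins-lin zero x y u v (suc c) = refl
ins-lin {suc n} (suc j) x y u v zero = refl
ins-lin {suc n} (suc j) x y u v (suc c) = ins-lin j x y (u ∘ suc) (v ∘ suc) c

ins-decomp : ∀ {n} (j : Fin (suc n)) (w : Fin (suc n) → ℤ) c →
  w c ≡ ins j (λ c → w (punchIn j c)) c + w j * δ j c
ins-decomp zero w zero = sym (trans (+-identityˡ (w zero * + 1)) (*-identityʳ (w zero)))
ins-decomp zero w (suc c) = sym (trans (+ˡ (w (suc c)) (*-zeroʳ (w zero))) (+-identityʳ (w (suc c))))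
ins-decomp {suc n} (suc j) w zero = sym (trans (+ˡ (w zero) (*-zeroʳ (w (suc j)))) (+-identityʳ (w zero)))
ins-decomp {suc n} (suc j) w (suc c) = ins-decomp j (w ∘ suc) c

ins-δ : ∀ {n} (j : Fin (suc n)) (r : Fin n) c → ins j (δ r) c ≡ δ (punchIn j r) c
ins-δ zero r zero = refl
ins-δ zero r (suc c) = refl
ins-δ {suc n} (suc j) zero zero = refl
ins-δ {suc n} (suc j) (suc r) zero = refl
ins-δ {suc n} (suc j) zero (suc c) = ins0 j c
  where
  ins0 : ∀ {m} (j : Fin (suc m)) c → ins j (λ _ → + 0) c ≡ + 0
  ins0 zero zero = refl
  ins0 zero (suc c) = refl
  ins0 {suc m} (suc j) zero = refl
  ins0 {suc m} (suc j) (suc c) = ins0 j c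
ins-δ {suc n} (suc j) (suc r) (suc c) = ins-δ j r c

consRow : ∀ {n} → (Fin (suc n) → ℤ) → (Fin n → Fin (suc n) → ℤ) → Mat (suc n)
consRow w B zero    = w
consRow w B (suc r) = B r

module _ {n} {f : Mat (suc n) → ℤ} (F : RowForm f) where
  open RowForm F
  open FormProperties F

  -- The multiples of row zero are removed one row at a time; `row t` is the state in which the
  -- first `t` rows are already clean.
  clear : ∀ w (a : Fin n → Fin (suc n) → ℤ) (c : Fin n → ℤ) →
    f (consRow w (λ r j → a r j + c r * w j)) ≡ f (consRow w a)
  clear w a c = trans (sym (rcong start)) (trans (upto n ≤-refl) (rcong end))
    where
    row : ℕ → Fin n → Fin (suc n) → ℤ
    row t r j with toℕ r ℕ.<? t
    ... | yes _ = a r j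
    ... | no _  = a r j + c r * w j
    M : ℕ → Mat (suc n)
    M t = consRow w (row t)
    start : ∀ i j → M 0 i j ≡ consRow w (λ r j → a r j + c r * w j) i j
    start zero j = refl
    start (suc r) j = refl
    end : ∀ i j → M n i j ≡ consRow w a i j
    end zero j = refl
    end (suc r) j with toℕ r ℕ.<? n
    ... | yes _ = refl
    ... | no h  = ⊥-elim (h (toℕ<n r))
    rowy : ∀ t r → toℕ r < t → ∀ j → row t r j ≡ a r j
    rowy t r h j with toℕ r ℕ.<? t
    ... | yes _ = refl
    ... | no g = ⊥-elim (g h)
    rown : ∀ t r → ¬ toℕ r < t → ∀ j → row t r j ≡ a r j + c r * w j
    rown t r h j with toℕ r ℕ.<? t
    ... | yes g = ⊥-elim (h g)
    ... | no _ = refl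
    step : ∀ t → t < n → f (M t) ≡ f (M (suc t))
    step t t<n = row-add {suc r₀} {zero} (λ ()) (c r₀) (M (suc t)) (M t)
        (λ j → trans (rown t r₀ (λ h → <-irrefl e₀ h) j)
          (cong (λ z → z + c r₀ * w j) (sym (rowy (suc t) r₀ (s≤s (≤-reflexive e₀)) j)))) off
      where
      r₀ = fromℕ< t<n
      e₀ : toℕ r₀ ≡ t
      e₀ = FinP.toℕ-fromℕ< t<n
      off : ∀ i j → i ≢ suc r₀ → M t i j ≡ M (suc t) i j
      off zero j ne = refl
      off (suc r) j ne with toℕ r ℕ.<? t
      ... | yes h = sym (rowy (suc t) r (m<n⇒m<1+n h) j)
      ... | no h = sym (rown (suc t) r (λ g → h (≤∧≢⇒< (≤-pred g)
              (λ q → ne (cong suc (toℕ-injective (trans q (sym e₀))))))) j)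
    upto : ∀ t → t ≤ n → f (M 0) ≡ f (M t)
    upto zero h = refl
    upto (suc t) h = trans (upto t (<⇒≤ h)) (step t h)

  rowP : Fin (suc n) → Mat (suc n)
  rowP j = consRow (δ j) (λ r → δ (punchIn j r))

  -- Passing from `rowP (Fin.inject₁ j)` to `rowP (suc j)` exchanges row zero with row `suc j`, so
  -- each unit of the index costs one sign.
  rowP-sign : ∀ j → f (rowP j) ≡ altSign (toℕ j) * f δ
  rowP-sign j = go (toℕ j) j refl
    where
    go : ∀ t j → toℕ j ≡ t → f (rowP j) ≡ altSign t * f δ
    go zero zero e = trans (rcong pt) (sym (*-identityˡ _))
      where
      pt : ∀ i c → rowP zero i c ≡ δ i c
      pt zero c = refl
      pt (suc i) c = refl
    go (suc t) (suc j) e = trans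
        (swap-any {zero} {suc j} (λ ()) (rowP j′) (rowP (suc j))
          (λ c → cong (λ z → δ z c) (sym pl)) (λ c → cong (λ z → δ z c) pk′) off)
        (trans (cong -_ (go t j′ (trans (FinP.toℕ-inject₁ j) (ℕP.suc-injective e))))
          (trans (ℤP.neg-distribˡ-* (altSign t) (f δ)) (cong (_* f δ) (sym (altSign-suc t)))))
      where
      j′ = Fin.inject₁ j
      pl : punchIn j′ j ≡ suc j
      pl = pl′ j where
        pl′ : ∀ {m} (j : Fin m) → punchIn (Fin.inject₁ j) j ≡ suc j
        pl′ zero = refl
        pl′ (suc j) = cong suc (pl′ j)
      pk′ : punchIn (suc j) j ≡ j′
      pk′ = pk″ j where
        pk″ : ∀ {m} (j : Fin m) → punchIn (suc j) j ≡ Fin.inject₁ j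
        pk″ zero = refl
        pk″ (suc j) = cong suc (pk″ j)
      off : ∀ i c → i ≢ zero → i ≢ suc j → rowP (suc j) i c ≡ rowP j′ i c
      off zero c ne _ = ⊥-elim (ne refl)
      off (suc r) c _ ne with adj-swap (adj-inject j) r
      ... | inj₁ q = cong (λ z → δ z c) (sym q)
      ... | inj₂ (q , _) = ⊥-elim (ne (cong suc (punchIn-inj j′ (trans q (sym pl)))))

-- The universal property from which transposition and multiplicativity both follow. Expanding row
-- zero over unit vectors and clearing column `j` below it leaves a row form in the minor, to which
-- induction applies.
det-unique : ∀ {n} {f : Mat n → ℤ} → RowForm f → ∀ A → f A ≡ det A * f δ
det-unique {zero} {f} F A = trans (RowForm.rcong F (λ ())) (sym (*-identityˡ (f δ)))
det-unique {suc n} {f} F A = trans (expand zero A) (trans (sum-cong term) (sum-*ʳ (f δ) (λ j → altSign (toℕ j) * (A zero j * det (minor A j)))))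
  where
  open RowForm F
  open FormProperties F
  g : Fin (suc n) → Mat n → ℤ
  g j B = f (consRow (δ j) (λ r → ins j (B r)))
  G : ∀ j → RowForm (g j)
  G j = record
    { rcong = λ e → rcong (λ { zero c → refl ; (suc r) c → ins-cong j (e r) c })
    ; rlin = λ k x y A B C eB eC ek → rlin (suc k) x y _ _ _
        (λ { zero c _ → refl ; (suc r) c ne → ins-cong j (λ c → eB r c (λ q → ne (cong suc q))) c })
        (λ { zero c _ → refl ; (suc r) c ne → ins-cong j (λ c → eC r c (λ q → ne (cong suc q))) c })
        (λ c → trans (ins-cong j ek c) (ins-lin j x y (B k) (C k) c))
    ; ralt = λ a A e → ralt (adjs a) _ (ins-cong j e) }
  gδ : ∀ j → g j δ ≡ altSign (toℕ j) * f δ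
  gδ j = trans (rcong (λ { zero c → refl ; (suc r) c → ins-δ j r c })) (rowP-sign F j)
  clr : ∀ j → f (setRow A zero (δ j)) ≡ g j (minor A j)
  clr j = trans (rcong (λ { zero c → refl ; (suc r) c → ins-decomp j (A (suc r)) c }))
    (clear F (δ j) (λ r → ins j (minor A j r)) (λ r → A (suc r) j))
  re : ∀ a d s t → a * (d * (s * t)) ≡ (s * (a * d)) * t
  re = solve-∀
  term : ∀ j → A zero j * f (setRow A zero (δ j)) ≡ altSign (toℕ j) * (A zero j * det (minor A j)) * f δ
  term j = trans (cong (A zero j *_) (trans (clr j) (trans (det-unique (G j) (minor A j)) (cong (det (minor A j) *_) (gδ j)))))
    (re (A zero j) (det (minor A j)) (altSign (toℕ j)) (f δ))

diag : ∀ {n} → (Fin n → ℤ) → Mat n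
diag c i j = c i * δ i j

det-diag : ∀ {n} (c : Fin n → ℤ) → det (diag c) ≡ prodℤ c
det-diag {zero} c = refl
det-diag {suc n} c = trans (sum-single zero (λ j → altSign (toℕ j) * (diag c zero j * det (minor (diag c) j))) (λ { zero ne → ⊥-elim (ne refl)
    ; (suc j) _ → trans (cong (λ z → altSign (suc (toℕ j)) * (z * det (minor (diag c) (suc j)))) (*-zeroʳ (c zero)))
       (*-zeroʳ (altSign (suc (toℕ j)))) }))
  (trans (*-identityˡ (c zero * + 1 * det (diag (c ∘ suc)))) (cong₂ _*_ (*-identityʳ (c zero)) (det-diag (c ∘ suc))))

prod-1 : ∀ n → prodℤ {n} (λ _ → + 1) ≡ + 1
prod-1 zero = refl
prod-1 (suc n) = trans (*-identityˡ (prodℤ {n} (λ _ → + 1))) (prod-1 n)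

det-δ : ∀ {n} → det (δ {n}) ≡ + 1
det-δ {n} = trans (det-cong {n} {δ} {diag (λ _ → + 1)} (λ i j → sym (*-identityˡ (δ i j)))) (trans (det-diag {n} (λ _ → + 1)) (prod-1 n))

det-transpose : ∀ {n} (A : Mat n) → det (A ᵀ) ≡ det A
det-transpose {n} A = trans (det-unique detᵀ-form A)
  (trans (cong (det A *_) (trans (det-cong {n} {δ ᵀ} {δ} (λ i j → δ-sym j i)) (det-δ {n}))) (*-identityʳ _))

infixl 7 _⊗_
_⊗_ : ∀ {n} → Mat n → Mat n → Mat n
(A ⊗ B) i j = sumℤ (λ k → A i k * B k j)

det-form : ∀ {n} → RowForm {n} det
det-form = record
  { rcong = det-cong
  ; rlin  = λ k x y A B C eB eC ek → trans (sym (det-transpose A)) (trans (RowForm.rlin detᵀ-form k x y A B C eB eC ek)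
      (cong₂ (λ u v → x * u + y * v) (det-transpose B) (det-transpose C)))
  ; ralt  = λ a A e → trans (sym (det-transpose A)) (RowForm.ralt detᵀ-form a A e) }

-- `A ↦ det (A ⊗ B)` is itself a row form, so it is `det A` times its value at the identity.
det-⊗ : ∀ {n} (A B : Mat n) → det (A ⊗ B) ≡ det A * det B
det-⊗ {n} A B = trans (det-unique form A) (cong (det A *_) (det-cong (λ i j → sum-δˡ i (λ k → B k j))))
  where
  re : ∀ x y a b c → (x * a + y * b) * c ≡ x * (a * c) + y * (b * c)
  re = solve-∀
  form : RowForm (λ A → det (A ⊗ B))
  form = record
    { rcong = λ e → det-cong (λ i j → sum-cong (λ k → cong (_* B k j) (e i k)))
    ; rlin = λ k x y A₁ B₁ C₁ eB eC ek → RowForm.rlin det-form k x y _ _ _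
        (λ i j ne → sum-cong (λ t → cong (_* B t j) (eB i t ne)))
        (λ i j ne → sum-cong (λ t → cong (_* B t j) (eC i t ne)))
        (λ j → trans (sum-cong (λ t → trans (cong (_* B t j) (ek t)) (re x y (B₁ k t) (C₁ k t) (B t j))))
           (sum-lin x y (λ t → B₁ k t * B t j) (λ t → C₁ k t * B t j)))
    ; ralt = λ a A₁ e → RowForm.ralt det-form a _ (λ j → sum-cong (λ t → cong (_* B t j) (e t))) }

-- Gram matrices and change of basis.

Vc : ℕ → Set
Vc n = Fin n → ℤ

dot : ∀ {n} → Vc n → Vc n → ℤ
dot x y = sumℤ (λ i → x i * y i)

act : ∀ {m n} → (Fin m → Fin n → ℤ) → Vc n → Vc m
act A x r = sumℤ (λ i → A r i * x i)

ê : ∀ {n} → Fin n → Vc n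
ê k r = δ r k

act-cong : ∀ {m n} {A B : Fin m → Fin n → ℤ} {x y : Vc n} → (∀ i j → A i j ≡ B i j) → (∀ i → x i ≡ y i) →
  ∀ r → act A x r ≡ act B y r
act-cong p q r = sum-cong (λ i → cong₂ _*_ (p r i) (q i))

bil≡dot : ∀ {n} (M : Mat n) x y → bil M x y ≡ dot x (act M y)
bil≡dot M x y = sum-cong (λ i → sum-*ˡ (x i) (λ j → M i j * y j))

dot-comm : ∀ {n} (x y : Vc n) → dot x y ≡ dot y x
dot-comm x y = sum-cong (λ i → *-comm (x i) (y i))

dot-sumˡ : ∀ {m n} (A : Fin m → Fin n → ℤ) x t → dot (act A x) t ≡ dot x (λ i → sumℤ (λ r → A r i * t r))
dot-sumˡ A x t = begin
  sumℤ (λ r → sumℤ (λ i → A r i * x i) * t r)   ≡⟨ sum-cong (λ r → sym (sum-*ʳ (t r) (λ i → A r i * x i))) ⟩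
  sumℤ (λ r → sumℤ (λ i → A r i * x i * t r))   ≡⟨ sum-swap (λ r i → A r i * x i * t r) ⟩
  sumℤ (λ i → sumℤ (λ r → A r i * x i * t r))   ≡⟨ sum-cong (λ i → trans (sum-cong (λ r → re (A r i) (x i) (t r))) (sum-*ˡ (x i) (λ r → A r i * t r))) ⟩
  sumℤ (λ i → x i * sumℤ (λ r → A r i * t r))   ∎
  where
  open ≡-Reasoning
  re : ∀ a x t → a * x * t ≡ x * (a * t)
  re = solve-∀

act-act : ∀ {n} (A B : Mat n) y r → act A (act B y) r ≡ act (A ⊗ B) y r
act-act A B y r = trans (dot-comm (A r) (act B y)) (trans (dot-sumˡ B y (A r))
  (sum-cong (λ i → trans (*-comm (y i) _) (cong (_* y i) (sum-cong (λ k → *-comm (B k i) (A r k)))))))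

⊗-assoc : ∀ {n} (A B C : Mat n) i j → ((A ⊗ B) ⊗ C) i j ≡ (A ⊗ (B ⊗ C)) i j
⊗-assoc A B C i j = sym (act-act A B (λ k → C k j) i)

⊗-cong : ∀ {n} {A B C D : Mat n} → (∀ i j → A i j ≡ B i j) → (∀ i j → C i j ≡ D i j) →
  ∀ i j → (A ⊗ C) i j ≡ (B ⊗ D) i j
⊗-cong p q i j = sum-cong (λ k → cong₂ _*_ (p i k) (q k j))

-- The product `EᵀME`. Its entries are written with `bil`, the shape in which the embedding
-- condition of the theorem is stated.
cgr : ∀ {n} → Mat n → Mat n → Mat n
cgr E M i j = bil M (λ r → E r i) (λ r → E r j)

cgr-⊗ : ∀ {n} (E M : Mat n) i j → cgr E M i j ≡ ((E ᵀ) ⊗ (M ⊗ E)) i j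
cgr-⊗ E M i j = bil≡dot M (λ r → E r i) (λ r → E r j)

det-cgr : ∀ {n} (E M : Mat n) → det (cgr E M) ≡ det E * (det M * det E)
det-cgr E M = trans (det-cong (cgr-⊗ E M)) (trans (det-⊗ (E ᵀ) (M ⊗ E)) (cong₂ _*_ (det-transpose E) (det-⊗ M E)))

bil-cong : ∀ {n} {M N : Mat n} {x x′ y y′ : Vc n} → (∀ i j → M i j ≡ N i j) → (∀ i → x i ≡ x′ i) → (∀ i → y i ≡ y′ i) →
  bil M x y ≡ bil N x′ y′
bil-cong p q r = sum-cong (λ i → sum-cong (λ j → cong₂ _*_ (q i) (cong₂ _*_ (p i j) (r j))))

bil-act : ∀ {n} (E M : Mat n) x y → bil (cgr E M) x y ≡ bil M (act E x) (act E y)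
bil-act E M x y = begin
  bil (cgr E M) x y                            ≡⟨ bil≡dot (cgr E M) x y ⟩
  dot x (act (cgr E M) y)                      ≡⟨ sum-cong (λ i → cong (x i *_) (act-cong (cgr-⊗ E M) (λ _ → refl) i)) ⟩
  dot x (act ((E ᵀ) ⊗ (M ⊗ E)) y)              ≡⟨ sum-cong (λ i → cong (x i *_) (sym (act-act (E ᵀ) (M ⊗ E) y i))) ⟩
  dot x (act (E ᵀ) (act (M ⊗ E) y))            ≡⟨ sum-cong (λ i → cong (x i *_) (sum-cong (λ r → cong (E r i *_) (sym (act-act M E y r))))) ⟩
  dot x (act (E ᵀ) (act M (act E y)))          ≡⟨ sym (dot-sumˡ E x (act M (act E y))) ⟩
  dot (act E x) (act M (act E y))              ≡⟨ sym (bil≡dot M (act E x) (act E y)) ⟩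
  bil M (act E x) (act E y)                    ∎
  where open ≡-Reasoning

cgr-cgr : ∀ {n} (E F M : Mat n) i j → cgr F (cgr E M) i j ≡ cgr (E ⊗ F) M i j
cgr-cgr E F M i j = bil-act E M (λ r → F r i) (λ r → F r j)

bil-comm : ∀ {n} {M : Mat n} → Symmetric M → ∀ x y → bil M x y ≡ bil M y x
bil-comm {M = M} s x y = trans (sum-swap (λ i j → x i * (M i j * y j)))
  (sum-cong (λ j → sum-cong (λ i → trans (cong (λ z → x i * (z * y j)) (s i j)) (re (x i) (M j i) (y j)))))
  where
  re : ∀ a b c → a * (b * c) ≡ c * (b * a)
  re = solve-∀

cgr-sym : ∀ {n} (E : Mat n) {M} → Symmetric M → Symmetric (cgr E M)
cgr-sym E s i j = bil-comm s (λ r → E r i) (λ r → E r j)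

bil-+ʳ : ∀ {n} (M : Mat n) x y z t → bil M x (λ i → y i + t * z i) ≡ bil M x y + t * bil M x z
bil-+ʳ M x y z t = trans (sum-cong (λ i → trans (sum-cong (λ j → re (x i) (M i j) (y j) (z j) t))
    (trans (sum-+ (λ j → x i * (M i j * y j)) (λ j → t * (x i * (M i j * z j))))
      (+ˡ (sumℤ (λ j → x i * (M i j * y j))) (sum-*ˡ t (λ j → x i * (M i j * z j)))))))
  (trans (sum-+ (λ i → sumℤ (λ j → x i * (M i j * y j))) (λ i → t * sumℤ (λ j → x i * (M i j * z j))))
    (+ˡ (bil M x y) (sum-*ˡ t (λ i → sumℤ (λ j → x i * (M i j * z j))))))
  where
  re : ∀ x m y z t → x * (m * (y + t * z)) ≡ x * (m * y) + t * (x * (m * z))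
  re = solve-∀

bil-quad : ∀ {n} {M : Mat n} → Symmetric M → ∀ x y t →
  bil M (λ i → x i + t * y i) (λ i → x i + t * y i) ≡ bil M x x + + 2 * t * bil M x y + t * t * bil M y y
bil-quad {M = M} s x y t = begin
  bil M w w                                                   ≡⟨ bil-+ʳ M w x y t ⟩
  bil M w x + t * bil M w y                                   ≡⟨ cong₂ (λ a b → a + t * b) (trans (bil-comm s w x) (bil-+ʳ M x x y t)) (trans (bil-comm s w y) (bil-+ʳ M y x y t)) ⟩
  (bil M x x + t * bil M x y) + t * (bil M y x + t * bil M y y) ≡⟨ cong (λ z → (bil M x x + t * bil M x y) + t * (z + t * bil M y y)) (bil-comm s y x) ⟩
  (bil M x x + t * bil M x y) + t * (bil M x y + t * bil M y y) ≡⟨ re (bil M x x) (bil M x y) (bil M y y) t ⟩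
  bil M x x + + 2 * t * bil M x y + t * t * bil M y y         ∎
  where
  open ≡-Reasoning
  w : Vc _
  w i = x i + t * y i
  re : ∀ a b c t → (a + t * b) + t * (b + t * c) ≡ a + + 2 * t * b + t * t * c
  re = solve-∀

bil-scale : ∀ {n} (M : Mat n) s t x y → bil M (λ i → s * x i) (λ i → t * y i) ≡ s * t * bil M x y
bil-scale M s t x y = trans (sum-cong (λ i → trans (sum-cong (λ j → re s t (x i) (M i j) (y j))) (sum-*ˡ (s * t) (λ j → x i * (M i j * y j)))))
  (sum-*ˡ (s * t) (λ i → sumℤ (λ j → x i * (M i j * y j))))
  where
  re : ∀ s t x m y → s * x * (m * (t * y)) ≡ s * t * (x * (m * y))
  re = solve-∀

act-e : ∀ {m n} (A : Fin m → Fin n → ℤ) k r → act A (ê k) r ≡ A r k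
act-e A k r = sum-δʳ k (A r)

bil-e : ∀ {n} (M : Mat n) k l → bil M (ê k) (ê l) ≡ M k l
bil-e M k l = trans (bil≡dot M (ê k) (ê l)) (trans (sum-cong (λ i → cong (δ i k *_) (act-e M l i)))
  (trans (dot-comm (ê k) (λ i → M i l)) (sum-δʳ k (λ i → M i l))))

bil-eˡ : ∀ {n} (M : Mat n) k y → bil M (ê k) y ≡ act M y k
bil-eˡ M k y = trans (bil≡dot M (ê k) y) (trans (dot-comm (ê k) (act M y)) (sum-δʳ k (act M y)))

-- Inverses are kept integral throughout: a matrix is inverted only up to a scalar `w`.
Scal : ∀ {n} → ℤ → Mat n → Set
Scal w A = ∀ i j → A i j ≡ w * δ i j

scal-sandwich : ∀ {n} u w (E F G H : Mat n) → Scal u (F ⊗ G) → Scal w (E ⊗ H) → Scal (w * u) ((E ⊗ F) ⊗ (G ⊗ H))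
scal-sandwich u w E F G H fg eh i j = begin
  ((E ⊗ F) ⊗ (G ⊗ H)) i j          ≡⟨ ⊗-assoc E F (G ⊗ H) i j ⟩
  (E ⊗ (F ⊗ (G ⊗ H))) i j          ≡⟨ ⊗-cong {A = E} {E} (λ _ _ → refl) (λ k l → sym (⊗-assoc F G H k l)) i j ⟩
  (E ⊗ ((F ⊗ G) ⊗ H)) i j          ≡⟨ ⊗-cong {A = E} {E} (λ _ _ → refl) (λ k l → trans (⊗-cong {C = H} {H} fg (λ _ _ → refl) k l)
                                        (trans (sum-cong (λ m → *-assoc u (δ k m) (H m l))) (trans (sum-*ˡ u (λ m → δ k m * H m l)) (cong (u *_) (sum-δˡ k (λ m → H m l)))))) i j ⟩
  sumℤ (λ k → E i k * (u * H k j)) ≡⟨ sum-cong (λ k → re (E i k) u (H k j)) ⟩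
  sumℤ (λ k → u * (E i k * H k j)) ≡⟨ sum-*ˡ u (λ k → E i k * H k j) ⟩
  u * (E ⊗ H) i j                  ≡⟨ cong (u *_) (eh i j) ⟩
  u * (w * δ i j)                  ≡⟨ re2 u w (δ i j) ⟩
  w * u * δ i j                    ∎
  where
  open ≡-Reasoning
  re : ∀ a u h → a * (u * h) ≡ u * (a * h)
  re = solve-∀
  re2 : ∀ u w d → u * (w * d) ≡ w * u * d
  re2 = solve-∀

scal-act : ∀ {n} w {A : Mat n} → Scal w A → ∀ x r → act A x r ≡ w * x r
scal-act w {A} s x r = trans (sum-cong (λ i → trans (cong (_* x i) (s r i)) (*-assoc w (δ r i) (x i))))
  (trans (sum-*ˡ w (λ i → δ r i * x i)) (cong (w *_) (sum-δˡ r x)))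

Nonzero : ∀ {n} → Vc n → Set
Nonzero x = ∃ λ i → x i ≢ + 0

nonzero? : ∀ {n} (x : Vc n) → Dec (Nonzero x)
nonzero? x = any? (λ i → ¬? (x i ℤ.≟ + 0))

act-0 : ∀ {m n} (A : Fin m → Fin n → ℤ) {x : Vc n} → (∀ i → x i ≡ + 0) → ∀ r → act A x r ≡ + 0
act-0 A z r = sum-0 (λ i → trans (cong (A r i *_) (z i)) (*-zeroʳ (A r i)))

¬nonzero : ∀ {n} {x : Vc n} → ¬ Nonzero x → ∀ i → x i ≡ + 0
¬nonzero {x = x} h i with x i ℤ.≟ + 0
... | yes q = q
... | no q = ⊥-elim (h (i , q))

-- Invertibility over ℤ localised at `p`, with the denominators multiplied out into `w`.
record Inv (p : ℕ) {n} (E : Mat n) : Set where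
  field
    Ei    : Mat n
    w     : ℤ
    p∤w   : ¬ (+ p ∣ w)
    right : Scal w (E ⊗ Ei)
    left  : Scal w (Ei ⊗ E)

p∣0 : ∀ {p} → p ∣ + 0
p∣0 = divides (+ 0) refl

w≢0 : ∀ {p w} → ¬ (p ∣ w) → w ≢ + 0
w≢0 h refl = h p∣0

inv-nonzero : ∀ {p n} {E : Mat n} → Inv p E → ∀ {x} → Nonzero x → Nonzero (act E x)
inv-nonzero {E = E} I {x} (i , xi) with nonzero? (act E x)
... | yes h = h
... | no h = ⊥-elim (*-nz (w≢0 p∤w) xi (trans (sym (scal-act w left x i))
               (trans (sym (act-act Ei E x i)) (act-0 Ei (¬nonzero h) i))))
  where open Inv I

posdef-cgr : ∀ {p n} {E M : Mat n} → Inv p E → PosDef M → PosDef (cgr E M)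
posdef-cgr {E = E} {M} I pd x nz = subst (+ 0 <ℤ_) (sym (bil-act E M x x)) (pd (act E x) (inv-nonzero I nz))

euclid : ∀ {p} → Prime p → ∀ a b → + p ∣ a * b → + p ∣ a ⊎ + p ∣ b
euclid {p} pr a b d with euclidsLemma (abs a) (abs b) pr (subst (p ℕD.∣_) (abs-* a b) (∣⇒∣ᵤ d))
... | inj₁ x = inj₁ (∣ᵤ⇒∣ x)
... | inj₂ y = inj₂ (∣ᵤ⇒∣ y)

∤-* : ∀ {p} → Prime p → ∀ {a b} → ¬ (+ p ∣ a) → ¬ (+ p ∣ b) → ¬ (+ p ∣ a * b)
∤-* pr {a} {b} na nb d with euclid pr a b d
... | inj₁ x = na x
... | inj₂ y = nb y

-- A diagonalisation over ℤ localised at p; since u ≠ 0 it is also one over ℚ.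
record Frame (p : ℕ) {n} (M : Mat n) : Set where
  field
    F Fi  : Mat n
    u     : ℤ
    c     : Fin n → ℤ
    p∤u   : ¬ (+ p ∣ u)
    right : Scal u (F ⊗ Fi)
    left  : Scal u (Fi ⊗ F)
    gram  : ∀ i j → cgr F M i j ≡ diag c i j

frame-cgr : ∀ {p} → Prime p → ∀ {n} {E M : Mat n} → Inv p E → Frame p (cgr E M) → Frame p M
frame-cgr pr {E = E} {M} I fr = record
  { F = E ⊗ F ; Fi = Fi ⊗ Ei ; u = w * u ; c = c ; p∤u = ∤-* pr p∤w p∤u
  ; right = scal-sandwich u w E F Fi Ei (Frame.right fr) (Inv.right I)
  ; left  = subst (λ z → Scal z ((Fi ⊗ Ei) ⊗ (E ⊗ F))) (*-comm u w) (scal-sandwich w u Fi Ei E F (Inv.left I) (Frame.left fr))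
  ; gram = λ i j → trans (sym (cgr-cgr E F M i j)) (gram i j) }
  where
  open Inv I hiding (right; left)
  open Frame fr hiding (right; left)

infixr 5 _⟂_
_⟂_ : ∀ {n} → ℤ → Mat n → Mat (suc n)
(a ⟂ G) zero    zero    = a
(a ⟂ G) zero    (suc j) = + 0
(a ⟂ G) (suc i) zero    = + 0
(a ⟂ G) (suc i) (suc j) = G i j

cons : ∀ {n} → ℤ → Vc n → Vc (suc n)
cons a x zero    = a
cons a x (suc i) = x i

tail : ∀ {n} → Mat (suc n) → Mat n
tail N i j = N (suc i) (suc j)

z+ : ∀ {a b} → a ≡ + 0 → a + b ≡ b
z+ {b = b} refl = +-identityˡ b

+z : ∀ {a b} → b ≡ + 0 → a + b ≡ a
+z {a} refl = +-identityʳ a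

bil-cons0 : ∀ {n} (N : Mat (suc n)) x y → bil N (cons (+ 0) x) (cons (+ 0) y) ≡ bil (tail N) x y
bil-cons0 N x y = trans (z+ (sum-0 (λ j → *-zeroˡ (N zero j * cons (+ 0) y j))))
  (sum-cong (λ i → z+ (trans (cong (x i *_) (*-zeroʳ (N (suc i) zero))) (*-zeroʳ (x i)))))

posdef-tail : ∀ {n} {N : Mat (suc n)} → PosDef N → PosDef (tail N)
posdef-tail {N = N} pd x (i , nz) = subst (+ 0 <ℤ_) (bil-cons0 N x x) (pd (cons (+ 0) x) (suc i , nz))

⟂-⊗ : ∀ {n} a b (A B : Mat n) i j → ((a ⟂ A) ⊗ (b ⟂ B)) i j ≡ ((a * b) ⟂ (A ⊗ B)) i j
⟂-⊗ {n} a b A B zero zero = +z (sum-0 {n} {f = λ k → + 0 * + 0} (λ k → refl))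
⟂-⊗ a b A B zero (suc j) = trans (z+ (*-zeroʳ a)) (sum-0 (λ k → *-zeroˡ (B k j)))
⟂-⊗ a b A B (suc i) zero = trans (z+ (*-zeroˡ b)) (sum-0 (λ k → *-zeroʳ (A i k)))
⟂-⊗ a b A B (suc i) (suc j) = z+ refl

⟂-scal : ∀ {n} w {A : Mat n} → Scal w A → Scal w (w ⟂ A)
⟂-scal w s zero zero = sym (*-identityʳ w)
⟂-scal w s zero (suc j) = sym (*-zeroʳ w)
⟂-scal w s (suc i) zero = sym (*-zeroʳ w)
⟂-scal w s (suc i) (suc j) = s i j

frame-⟂ : ∀ {p n} {N : Mat (suc n)} → (∀ j → N zero (suc j) ≡ + 0) → Symmetric N → Frame p (tail N) → Frame p N
frame-⟂ {p} {n} {N} z s fr = record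
  { F = + 1 ⟂ F ; Fi = u ⟂ Fi ; u = u ; c = cons (N zero zero) c ; p∤u = p∤u
  ; right = λ i j → trans (⟂-⊗ (+ 1) u F Fi i j) (trans (cong (λ z → (z ⟂ (F ⊗ Fi)) i j) (*-identityˡ u)) (⟂-scal u (Frame.right fr) i j))
  ; left = λ i j → trans (⟂-⊗ u (+ 1) Fi F i j) (trans (cong (λ z → (z ⟂ (Fi ⊗ F)) i j) (*-identityʳ u)) (⟂-scal u (Frame.left fr) i j))
  ; gram = gr }
  where
  open Frame fr hiding (right; left)
  col0 : ∀ r → (+ 1 ⟂ F) r zero ≡ ê zero r
  col0 zero = refl
  col0 (suc r) = refl
  cols : ∀ j r → (+ 1 ⟂ F) r (suc j) ≡ cons (+ 0) (λ r → F r j) r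
  cols j zero = refl
  cols j (suc r) = refl
  off : ∀ j → cgr (+ 1 ⟂ F) N zero (suc j) ≡ + 0
  off j = trans (bil-cong {M = N} {N} {y′ = λ r → (+ 1 ⟂ F) r (suc j)} (λ _ _ → refl) col0 (λ _ → refl)) (trans (bil-eˡ N zero (λ r → (+ 1 ⟂ F) r (suc j)))
    (trans (z+ (*-zeroʳ (N zero zero))) (sum-0 (λ k → trans (cong (_* F k j) (z k)) (*-zeroˡ (F k j))))))
  gr : ∀ i j → cgr (+ 1 ⟂ F) N i j ≡ diag (cons (N zero zero) c) i j
  gr zero zero = trans (bil-cong {M = N} {N} {y′ = ê zero} (λ _ _ → refl) col0 col0) (trans (bil-e N zero zero) (sym (*-identityʳ _)))
  gr zero (suc j) = trans (off j) (sym (*-zeroʳ (N zero zero)))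
  gr (suc i) zero = trans (cgr-sym (+ 1 ⟂ F) s (suc i) zero) (trans (off i) (sym (*-zeroʳ (c i))))
  gr (suc i) (suc j) = trans (bil-cong {M = N} {N} (λ _ _ → refl) (cols i) (cols j))
    (trans (bil-cons0 N (λ r → F r i) (λ r → F r j)) (gram i j))

-- Diagonalisation

splitE splitEi : ∀ {n} → Mat (suc n) → Mat (suc n)
splitE M zero    zero    = + 1
splitE M zero    (suc j) = - M zero (suc j)
splitE M (suc i) zero    = + 0
splitE M (suc i) (suc j) = M zero zero * δ i j
splitEi M zero    zero    = M zero zero
splitEi M zero    (suc j) = M zero (suc j)
splitEi M (suc i) zero    = + 0
splitEi M (suc i) (suc j) = δ i j

-- Gram-Schmidt against the first basis vector: each later vector is multiplied by `M zero zero` and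
-- loses its component along the first. The denominator this costs is the pivot itself, hence prime
-- to `p`.
split-inv : ∀ {p n} (M : Mat (suc n)) → ¬ (+ p ∣ M zero zero) → Inv p (splitE M)
split-inv {p} {n} M h = record { Ei = splitEi M ; w = a ; p∤w = h ; right = ri ; left = le }
  where
  a = M zero zero
  m : Vc n
  m j = M zero (suc j)
  r1 : ∀ x y → + 1 * x + - x ≡ y * + 0
  r1 = solve-∀
  r2 : ∀ a x → a * - x + a * x ≡ a * + 0
  r2 = solve-∀
  r3 : ∀ x a d → x * (a * d) ≡ a * (x * d)
  r3 = solve-∀
  ri : Scal a (splitE M ⊗ splitEi M)
  ri zero zero = trans (+z (sum-0 (λ k → *-zeroʳ (- m k)))) (*-comm (+ 1) a)
  ri zero (suc j) = trans (+ˡ (+ 1 * m j) (sum-δʳ j (λ k → - m k))) (r1 (m j) a)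
  ri (suc i) zero = trans (z+ (*-zeroˡ a)) (trans (sum-0 (λ k → *-zeroʳ (a * δ i k))) (sym (*-zeroʳ a)))
  ri (suc i) (suc j) = trans (z+ (*-zeroˡ (m j))) (sum-δʳ j (λ k → a * δ i k))
  le : Scal a (splitEi M ⊗ splitE M)
  le zero zero = +z (sum-0 (λ k → *-zeroʳ (m k)))
  le zero (suc j) = trans (+ˡ (a * - m j) (trans (sum-cong (λ k → r3 (m k) a (δ k j)))
      (trans (sum-*ˡ a (λ k → m k * δ k j)) (cong (a *_) (sum-δʳ j m))))) (r2 a (m j))
  le (suc i) zero = trans (z+ refl) (trans (sum-0 (λ k → *-zeroʳ (δ i k))) (sym (*-zeroʳ a)))
  le (suc i) (suc j) = trans (z+ (*-zeroˡ (- m j))) (sum-δˡ i (λ k → a * δ k j))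

split-off : ∀ {n} (M : Mat (suc n)) j → cgr (splitE M) M zero (suc j) ≡ + 0
split-off {n} M j = trans (bil-cong {M = M} {M} {y′ = λ r → splitE M r (suc j)} (λ _ _ → refl) col0 (λ _ → refl)) (trans (bil-eˡ M zero (λ r → splitE M r (suc j)))
    (trans (+ˡ (a * - m j) (trans (sum-cong (λ k → r3 (m k) a (δ k j)))
      (trans (sum-*ˡ a (λ k → m k * δ k j)) (cong (a *_) (sum-δʳ j m))))) (r2 a (m j))))
  where
  a = M zero zero
  m : Vc n
  m j = M zero (suc j)
  col0 : ∀ r → splitE M r zero ≡ ê zero r
  col0 zero = refl
  col0 (suc r) = refl
  r2 : ∀ a x → a * - x + a * x ≡ + 0
  r2 = solve-∀
  r3 : ∀ x a d → x * (a * d) ≡ a * (x * d)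
  r3 = solve-∀

transv : ∀ {n} → Fin n → Fin n → ℤ → Mat n
transv k l t i j = δ i j + t * (δ i k * δ l j)

transv-⊗ : ∀ {n} {k l : Fin n} → k ≢ l → ∀ t s → t + s ≡ + 0 → Scal (+ 1) (transv k l t ⊗ transv k l s)
transv-⊗ {n} {k} {l} ne t s ts i j = begin
  sumℤ (λ m → (δ i m + t * (δ i k * δ l m)) * (δ m j + s * (δ m k * δ l j)))
    ≡⟨ sum-cong (λ m → r (δ i m) t (δ i k) (δ l m) (δ m j) s (δ m k) (δ l j)) ⟩
  sumℤ (λ m → δ i m * (δ m j + s * (δ m k * δ l j)) + t * δ i k * (δ l m * (δ m j + s * (δ m k * δ l j))))
    ≡⟨ sum-+ (λ m → δ i m * (δ m j + s * (δ m k * δ l j))) (λ m → t * δ i k * (δ l m * (δ m j + s * (δ m k * δ l j)))) ⟩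
  _ ≡⟨ cong₂ _+_ (sum-δˡ i (λ m → δ m j + s * (δ m k * δ l j)))
       (trans (sum-*ˡ (t * δ i k) (λ m → δ l m * (δ m j + s * (δ m k * δ l j)))) (cong (t * δ i k *_) (sum-δˡ l (λ m → δ m j + s * (δ m k * δ l j))))) ⟩
  (δ i j + s * (δ i k * δ l j)) + t * δ i k * (δ l j + s * (δ l k * δ l j))
    ≡⟨ cong (λ z → (δ i j + s * (δ i k * δ l j)) + t * δ i k * (δ l j + s * (z * δ l j))) (δ-≢ (λ q → ne (sym q))) ⟩
  (δ i j + s * (δ i k * δ l j)) + t * δ i k * (δ l j + s * (+ 0 * δ l j))
    ≡⟨ r2 (δ i j) s (δ i k) (δ l j) t ⟩
  + 1 * δ i j + (t + s) * (δ i k * δ l j)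
    ≡⟨ +z (trans (cong (_* (δ i k * δ l j)) ts) (*-zeroˡ (δ i k * δ l j))) ⟩
  + 1 * δ i j ∎
  where
  open ≡-Reasoning
  r : ∀ a t b c d s f g → (a + t * (b * c)) * (d + s * (f * g)) ≡ a * (d + s * (f * g)) + t * b * (c * (d + s * (f * g)))
  r = solve-∀
  r2 : ∀ a s b c t → (a + s * (b * c)) + t * b * (c + s * (+ 0 * c)) ≡ + 1 * a + (t + s) * (b * c)
  r2 = solve-∀

¬p∣1 : ∀ {p} → Prime p → ¬ (+ p ∣ + 1)
¬p∣1 {p} pr d = ℕ.nonTrivial⇒≢1 {{prime⇒nonTrivial pr}} (ℕD.∣1⇒≡1 (∣⇒∣ᵤ d))

transv-inv : ∀ {p} → Prime p → ∀ {n} {k l : Fin n} → k ≢ l → ∀ t → Inv p (transv k l t)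
transv-inv pr {k = k} {l} ne t = record { Ei = transv k l (- t) ; w = + 1 ; p∤w = ¬p∣1 pr
  ; right = transv-⊗ ne t (- t) (ℤP.+-inverseʳ t) ; left = transv-⊗ ne (- t) t (ℤP.+-inverseˡ t) }

transv-diag : ∀ {n} {M : Mat n} → Symmetric M → ∀ k l t →
  cgr (transv k l t) M l l ≡ M l l + + 2 * t * M k l + t * t * M k k
transv-diag {M = M} s k l t = trans (bil-cong {M = M} {M} (λ _ _ → refl) col col)
  (trans (bil-quad s (ê l) (ê k) t) (cong₂ _+_ (cong₂ (λ a b → a + + 2 * t * b) (bil-e M l l) (trans (bil-e M l k) (s l k))) (cong (t * t *_) (bil-e M k k))))
  where
  col : ∀ r → transv k l t r l ≡ δ r l + t * δ r k
  col r = cong (λ z → δ r l + t * z) (trans (cong (δ r k *_) (δ-refl l)) (*-identityʳ (δ r k)))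

prime>1 : ∀ {p} → Prime p → 1 < p
prime>1 pr = ℕ.nonTrivial⇒n>1 _ {{prime⇒nonTrivial pr}}

OddPrime : ℕ → Set
OddPrime p = Prime p × p ≢ 2

∤2 : ∀ {p} → OddPrime p → ¬ (+ p ∣ + 2)
∤2 {p} (pr , ne) d = go p (prime⇒nonTrivial pr) (ℕD.∣⇒≤ (∣⇒∣ᵤ d)) ne
  where
  go : ∀ p → ℕ.NonTrivial p → p ≤ 2 → p ≢ 2 → ⊥
  go (suc (suc zero)) _ _ h = h refl
  go (suc (suc (suc p))) _ (s≤s (s≤s ())) h

pos-entry : ∀ {n} {M : Mat n} → PosDef M → ∀ i → + 0 <ℤ M i i
pos-entry {M = M} pd i = subst (+ 0 <ℤ_) (bil-e M i i) (pd (ê i) (i , λ q → case trans (sym (δ-refl i)) q of λ ()))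

module _ {p} (op : OddPrime p) where
  private
    pr = proj₁ op

    Goal : ℕ → Set
    Goal n = ∀ (M : Mat n) → IsLattice M → Frame p M

    cgr-lat : ∀ {n} {E M : Mat n} → Inv p E → IsLattice M → IsLattice (cgr E M)
    cgr-lat {E = E} {M} I (s , pd) = cgr-sym E s , posdef-cgr {M = M} I pd

    frame-00 : ∀ {n} → Goal n → ∀ (M : Mat (suc n)) → IsLattice M → ¬ (+ p ∣ M zero zero) → Frame p M
    frame-00 ih M lat h = frame-cgr pr I (frame-⟂ (split-off M) (proj₁ lat′) (ih (tail N) ((λ i j → proj₁ lat′ (suc i) (suc j)) , posdef-tail {N = N} (proj₂ lat′))))
      where
      I = split-inv M h
      N = cgr (splitE M) M
      lat′ = cgr-lat {M = M} I lat

    -- A pivot at `i` is brought to position zero by replacing e₀ with e₀ + eᵢ or e₀ - eᵢ: if q(e₀),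
    -- q(e₀ + eᵢ) and q(e₀ - eᵢ) were all divisible by `p`, so would be 2q(eᵢ).
    frame-ii : ∀ {n} → Goal n → ∀ (M : Mat (suc n)) → IsLattice M → ∀ i → ¬ (+ p ∣ M i i) → Frame p M
    frame-ii ih M lat i h with + p ∣? M zero zero
    ... | no h0 = frame-00 ih M lat h0
    ... | yes d0 with i FinP.≟ zero
    ... | yes refl = ⊥-elim (h d0)
    ... | no i≢0 with + p ∣? cgr (transv i zero (+ 1)) M zero zero
    ... | no g = frame-cgr pr (transv-inv pr i≢0 (+ 1)) (frame-00 ih _ (cgr-lat {M = M} (transv-inv pr i≢0 (+ 1)) lat) g)
    ... | yes d1 = frame-cgr pr (transv-inv pr i≢0 (- (+ 1))) (frame-00 ih _ (cgr-lat {M = M} (transv-inv pr i≢0 (- (+ 1))) lat)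
        λ d2 → ∤-* pr (∤2 op) h (∣m+n∣m⇒∣n (subst (+ p ∣_) (re (M zero zero) (M i zero) (M i i))
            (∣m∣n⇒∣m+n (subst (+ p ∣_) (transv-diag (proj₁ lat) i zero (+ 1)) d1) (subst (+ p ∣_) (transv-diag (proj₁ lat) i zero (- (+ 1))) d2)))
            (∣n⇒∣m*n (+ 2) d0)))
      where
      re : ∀ a b c → (a + + 2 * + 1 * b + + 1 * + 1 * c) + (a + + 2 * - (+ 1) * b + - (+ 1) * - (+ 1) * c) ≡ + 2 * a + + 2 * c
      re = solve-∀

    -- When every diagonal entry is divisible by `p`, an off-diagonal unit gives q(eᵢ + eⱼ) ≡ 2(eᵢ,
    -- eⱼ), a unit because `p` is odd.
    frame-ij : ∀ {n} → Goal n → ∀ (M : Mat (suc n)) → IsLattice M → ∀ i j → ¬ (+ p ∣ M i j) → Frame p M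
    frame-ij ih M lat i j h with any? (λ k → ¬? (+ p ∣? M k k))
    ... | yes (k , hk) = frame-ii ih M lat k hk
    ... | no none with i FinP.≟ j
    ... | yes refl = ⊥-elim (none (i , h))
    ... | no i≢j = frame-cgr pr (transv-inv pr i≢j (+ 1)) (frame-ii ih _ (cgr-lat {M = M} (transv-inv pr i≢j (+ 1)) lat) j
        λ d → ∤-* pr (∤2 op) h (∣m+n∣m⇒∣n (subst (+ p ∣_) (trans (transv-diag (proj₁ lat) i j (+ 1)) (re (M j j) (M i j) (M i i))) d)
            (∣m∣n⇒∣m+n (dv j) (dv i))))
      where
      dv : ∀ k → + p ∣ M k k
      dv k with + p ∣? M k k
      ... | yes q = q
      ... | no q = ⊥-elim (none (k , q))
      re : ∀ a b c → a + + 2 * + 1 * b + + 1 * + 1 * c ≡ (a + c) + + 2 * b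
      re = solve-∀

    1<p : 1 < p
    1<p = prime>1 pr

    instance
      pnz : ℤ.NonZero (+ p)
      pnz = ℤ.≢-nonZero λ q → <⇒≢ (<-trans (s≤s z≤n) 1<p) (sym (ℤP.+-injective q))

    -- If every entry is divisible by `p`, the whole form is divided by `p`. The leading entry is
    -- nonzero by positivity, so its absolute value drops and the recursion ends.
    frame-suc : ∀ {n} → Goal n → ∀ (M : Mat (suc n)) → IsLattice M → Acc _<_ (abs (M zero zero)) → Frame p M
    frame-suc {n} ih M lat@(s , pd) (acc rs) with any? (λ i → any? (λ j → ¬? (+ p ∣? M i j)))
    ... | yes (i , j , h) = frame-ij ih M lat i j h
    ... | no none = record { F = F ; Fi = Fi ; u = u ; c = λ i → c i * + p ; p∤u = p∤u ; right = right ; left = left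
        ; gram = λ i j → trans (bil-M (λ r → F r i) (λ r → F r j)) (trans (cong (_* + p) (gram i j)) (re2 (c i) (δ i j) (+ p))) }
      where
      dv : ∀ i j → + p ∣ M i j
      dv i j with + p ∣? M i j
      ... | yes q = q
      ... | no q = ⊥-elim (none (i , j , q))
      N : Mat (suc n)
      N i j = _∣_.quotient (dv i j)
      MN : ∀ i j → M i j ≡ N i j * + p
      MN i j = _∣_.equality (dv i j)
      re : ∀ x n p y → x * (n * p * y) ≡ (x * (n * y)) * p
      re = solve-∀
      re2 : ∀ c d p → c * d * p ≡ c * p * d
      re2 = solve-∀
      bil-M : ∀ x y → bil M x y ≡ bil N x y * + p
      bil-M x y = trans (sum-cong (λ i → trans (sum-cong (λ j → trans (cong (λ z → x i * (z * y j)) (MN i j)) (re (x i) (N i j) (+ p) (y j)))) (sum-*ʳ (+ p) (λ j → x i * (N i j * y j)))))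
        (sum-*ʳ (+ p) (λ i → sumℤ (λ j → x i * (N i j * y j))))
      latN : IsLattice N
      latN = (λ i j → ℤP.*-cancelʳ-≡ (N i j) (N j i) (+ p) (trans (sym (MN i j)) (trans (s i j) (MN j i))))
        , λ x nz → ℤP.*-cancelʳ-<-nonNeg (+ p) (subst (+ 0 * + p <ℤ_) (bil-M x x) (subst (_<ℤ bil M x x) (sym (*-zeroˡ (+ p))) (pd x nz)))
      smaller : abs (N zero zero) < abs (M zero zero)
      smaller = subst (abs (N zero zero) <_) (trans (sym (abs-* (N zero zero) (+ p))) (cong abs (sym (MN zero zero))))
        (m<m*n (abs (N zero zero)) p {{ℕ.≢-nonZero λ q → ℤP.<⇒≢ (pos-entry {M = N} (proj₂ latN) zero) (sym (ℤP.∣i∣≡0⇒i≡0 q))}} 1<p)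
      open Frame (frame-suc ih N latN (rs smaller))

  frame : ∀ n → Goal n
  frame zero M lat = record { F = δ ; Fi = δ ; u = + 1 ; c = λ () ; p∤u = ¬p∣1 pr ; right = λ () ; left = λ () ; gram = λ () }
  frame (suc n) M lat = frame-suc (frame n) M lat (ℕI.<-wellFounded _)

-- Quadratic residues

allB : ∀ n → (Vec Bool n → Bool) → Bool
allB zero    f = f []
allB (suc n) f = allB n (λ v → f (false ∷ v)) ∧ allB n (λ v → f (true ∷ v))

∧-true : ∀ {a b} → a ∧ b ≡ true → a ≡ true × b ≡ true
∧-true {true} {true} _ = refl , refl

allB-sound : ∀ n f → allB n f ≡ true → ∀ v → f v ≡ true
allB-sound zero    f h []          = h
allB-sound (suc n) f h (false ∷ v) = allB-sound n _ (proj₁ (∧-true h)) v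
allB-sound (suc n) f h (true ∷ v)  = allB-sound n _ (proj₂ (∧-true {allB n (λ v → f (false ∷ v))} h)) v

xor-≡ : ∀ {a b} → a xor b ≡ false → a ≡ b
xor-≡ {false} {false} _ = refl
xor-≡ {true}  {true}  _ = refl

-- Boolean identities by truth table; the `refl` supplied at each use runs through all 2ⁿ
-- assignments. Identities between symbols are reduced to such tables.
taut : ∀ n (f g : Vec Bool n → Bool) → allB n (λ v → not (f v xor g v)) ≡ true → ∀ v → f v ≡ g v
taut n f g h v = xor-≡ (BoolP.not-injective (allB-sound n _ h v))

∣-lc1 : ∀ {d a c} → d ∣ a → ∀ x → c ≡ x * a → d ∣ c
∣-lc1 {d} da x q = subst (d ∣_) (sym q) (∣n⇒∣m*n x da)

∣-lc2 : ∀ {d a b c} → d ∣ a → d ∣ b → ∀ x y → c ≡ x * a + y * b → d ∣ c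
∣-lc2 {d} da db x y q = subst (d ∣_) (sym q) (∣m∣n⇒∣m+n (∣n⇒∣m*n x da) (∣n⇒∣m*n y db))

∣-lc3 : ∀ {d a b c z} → d ∣ a → d ∣ b → d ∣ c → ∀ x y w → z ≡ x * a + y * b + w * c → d ∣ z
∣-lc3 {d} da db dc x y w q = subst (d ∣_) (sym q) (∣m∣n⇒∣m+n (∣m∣n⇒∣m+n (∣n⇒∣m*n x da) (∣n⇒∣m*n y db)) (∣n⇒∣m*n w dc))

∣-refl : ∀ {d} → d ∣ d
∣-refl {d} = divides (+ 1) (sym (*-identityˡ d))

∣≡ : ∀ {d a b} → a ≡ b → d ∣ a - b
∣≡ {d} {a} refl = subst (d ∣_) (sym (ℤP.+-inverseʳ a)) p∣0

rem : ∀ p .{{_ : ℕ.NonZero p}} → ℤ → Fin p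
rem p x = fromℕ< (ℤM.n%ℕd<d x p)

abstract
  rem-spec : ∀ p .{{_ : ℕ.NonZero p}} x → + p ∣ x - + toℕ (rem p x)
  rem-spec p x = divides (x ℤM./ℕ p) (trans (cong₂ _-_ (ℤM.a≡a%ℕn+[a/ℕn]*n x p) (cong +_ (FinP.toℕ-fromℕ< (ℤM.n%ℕd<d x p)))) (re (+ (x ℤM.%ℕ p)) ((x ℤM./ℕ p) * + p)))
    where
    re : ∀ r q → r + q - r ≡ q
    re = solve-∀

abstract
  rem-≡ : ∀ p .{{_ : ℕ.NonZero p}} x y → rem p x ≡ rem p y → + p ∣ x - y
  rem-≡ p x y q = ∣-lc2 (rem-spec p x) (rem-spec p y) (+ 1) (- (+ 1))
      (trans (re x y (+ toℕ (rem p x))) (cong (λ z → + 1 * (x - + toℕ (rem p x)) + - (+ 1) * (y - + toℕ z)) q))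
    where
    re : ∀ x y r → x - y ≡ + 1 * (x - r) + - (+ 1) * (y - r)
    re = solve-∀

pos-∸ : ∀ {k l} → l ≤ k → + k - + l ≡ + (k ∸ l)
pos-∸ {k} {l} h = trans (ℤP.[+m]-[+n]≡m⊖n k l) (ℤP.⊖-≥ h)

∣-sym : ∀ {d} a b → d ∣ a - b → d ∣ b - a
∣-sym a b h = ∣-lc1 h (- (+ 1)) (re a b)
  where
  re : ∀ a b → b - a ≡ - (+ 1) * (a - b)
  re = solve-∀

∣-trans- : ∀ {d} a b c → d ∣ a - b → d ∣ b - c → d ∣ a - c
∣-trans- a b c h g = ∣-lc2 h g (+ 1) (+ 1) (re a b c)
  where
  re : ∀ a b c → a - c ≡ + 1 * (a - b) + + 1 * (b - c)
  re = solve-∀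

small-∣ : ∀ {p k} → k < p → + p ∣ + k → k ≡ 0
small-∣ {k = zero} _ _ = refl
small-∣ {k = suc k} lt d = ⊥-elim (ℕP.≤⇒≯ (ℕD.∣⇒≤ (∣⇒∣ᵤ d)) lt)

small-≡ : ∀ {p k l} → k < p → l < p → + p ∣ + k - + l → k ≡ l
small-≡ {p} {k} {l} kp lp d with ℕP.≤-total l k
... | inj₁ h = ℕP.≤-antisym (ℕP.m∸n≡0⇒m≤n (small-∣ (≤-<-trans (ℕP.m∸n≤m k l) kp) (subst (+ p ∣_) (pos-∸ h) d))) h
... | inj₂ h = ℕP.≤-antisym h (ℕP.m∸n≡0⇒m≤n (small-∣ (≤-<-trans (ℕP.m∸n≤m l k) lp) (subst (+ p ∣_) (pos-∸ h) (∣-sym (+ k) (+ l) d))))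

abstract
  fin-surj : ∀ {n} (f : Fin n → Fin n) → (∀ {i j} → f i ≡ f j → i ≡ j) → ∀ y → ∃ λ i → f i ≡ y
  fin-surj {suc n} f inj y with any? (λ i → f i FinP.≟ y)
  ... | yes h = h
  ... | no h = ⊥-elim (FinP.<⇒notInjective {f = λ i → punchOut (λ q → h (i , sym q))} ≤-refl
      (λ {i} {j} q → inj (FinP.punchOut-injective (λ r → h (i , sym r)) (λ r → h (j , sym r)) q)))

prime-nz : ∀ {p} → Prime p → ℕ.NonZero p
prime-nz = prime⇒nonZero

abstract
  -- Multiplication by `a` is injective on the residues modulo `p`, hence hits 1.
  inverse : ∀ {p} → Prime p → ∀ {a} → ¬ (+ p ∣ a) → ∃ λ b → + p ∣ a * b - + 1
  inverse {p} pr {a} na = fin (fin-surj f inj (rem p (+ 1)))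
    where
    instance
      nzi : ℕ.NonZero p
      nzi = prime-nz pr
    f : Fin p → Fin p
    f k = rem p (a * + toℕ k)
    re : ∀ a k l → a * k - a * l ≡ a * (k - l)
    re = solve-∀
    inj : ∀ {i j} → f i ≡ f j → i ≡ j
    inj {i} {j} q = case euclid pr a (+ toℕ i - + toℕ j) (subst (+ p ∣_) (re a (+ toℕ i) (+ toℕ j)) (rem-≡ p (a * + toℕ i) (a * + toℕ j) q)) of λ where
      (inj₁ d) → ⊥-elim (na d)
      (inj₂ d) → toℕ-injective (small-≡ (toℕ<n i) (toℕ<n j) d)
    fin : (∃ λ k → f k ≡ rem p (+ 1)) → ∃ λ b → + p ∣ a * b - + 1
    fin (k , q) = + toℕ k , rem-≡ p (a * + toℕ k) (+ 1) q

half : ∀ n → (∃ λ h → n ≡ h +ᴺ h) ⊎ (∃ λ h → n ≡ suc (h +ᴺ h))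
half zero = inj₁ (0 , refl)
half (suc n) with half n
... | inj₁ (h , q) = inj₂ (h , cong suc q)
... | inj₂ (h , q) = inj₁ (suc h , cong suc (trans q (sym (ℕP.+-suc h h))))

abstract
  half-prime : ∀ {p} → OddPrime p → ∃ λ h → p ≡ suc (h +ᴺ h)
  half-prime {p} (pr , ne) with half p
  ... | inj₂ r = r
  ... | inj₁ (h , q) with Data.Nat.Primality.prime⇒irreducible pr (ℕD.divides h (trans q (h2 h)))
    where
    h2 : ∀ h → h +ᴺ h ≡ h *ᴺ 2
    h2 = ℕR.solve-∀
  ... | inj₂ r = ⊥-elim (ne (sym r))

Sq : ℕ → ℤ → Set
Sq p a = ∃ λ x → + p ∣ x * x - a

sq-cong : ∀ {p a b} → + p ∣ a - b → Sq p a → Sq p b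
sq-cong {a = a} {b} h (x , d) = x , ∣-trans- (x * x) a b d h

sq-rem : ∀ p .{{_ : ℕ.NonZero p}} x → + p ∣ + toℕ (rem p x) * + toℕ (rem p x) - x * x
sq-rem p x = ∣-lc1 (rem-spec p x) (- (x + r)) (re x r)
  where
  r = + toℕ (rem p x)
  re : ∀ x r → r * r - x * x ≡ - (x + r) * (x - r)
  re = solve-∀

abstract
  sq? : ∀ p .{{_ : ℕ.NonZero p}} a → Dec (Sq p a)
  sq? p a with any? (λ (i : Fin p) → + p ∣? (+ toℕ i * + toℕ i - a))
  ... | yes (i , d) = yes (+ toℕ i , d)
  ... | no h = no λ (x , d) → h (rem p x , ∣-trans- (+ toℕ (rem p x) * + toℕ (rem p x)) (x * x) a (sq-rem p x) d)

sq-div : ∀ {p} → Prime p → ∀ {a b j} → ¬ (+ p ∣ j) → (k : ℤ) → + p ∣ k * k - a * (j * j) * b → Sq p (a * b)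
sq-div {p} pr {a} {b} {j} nj k d with inverse pr nj
... | i , hi = k * i , ∣-lc2 d (∣-lc1 hi (j * i + + 1) (r1 j i)) (i * i) (a * b)
    (trans (cong (_- a * b) (r2 k i)) (r3 (i * i) (k * k) a b (j * j)))
  where
  r1 : ∀ j i → (j * j) * (i * i) - + 1 ≡ (j * i + + 1) * (j * i - + 1)
  r1 = solve-∀
  r2 : ∀ k i → k * i * (k * i) ≡ i * i * (k * k)
  r2 = solve-∀
  r3 : ∀ s A a b t → s * A - a * b ≡ s * (A - a * t * b) + a * b * (t * s - + 1)
  r3 = solve-∀

module OddsH {p} (op : OddPrime p) (pr : Prime p) .{{nzp : ℕ.NonZero p}} (h : ℕ) (ph : p ≡ suc (h +ᴺ h)) where

  ≤h⇒<p : ∀ {k} → k ≤ h → k < p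
  ≤h⇒<p kh = subst (_ <_) (sym ph) (s≤s (≤-trans kh (m≤m+n h h)))

  sq-inj : ∀ {u} → ¬ (+ p ∣ u) → ∀ {k l} → k ≤ h → l ≤ h → + p ∣ u * (+ k * + k) - u * (+ l * + l) → k ≡ l
  sq-inj {u} nu {k} {l} kh lh d with euclid pr u ((+ k - + l) * (+ k + + l)) (subst (+ p ∣_) (re u (+ k) (+ l)) d)
    where
    re : ∀ u k l → u * (k * k) - u * (l * l) ≡ u * ((k - l) * (k + l))
    re = solve-∀
  ... | inj₁ q = ⊥-elim (nu q)
  ... | inj₂ q with euclid pr (+ k - + l) (+ k + + l) q
  ... | inj₁ r = small-≡ (≤h⇒<p kh) (≤h⇒<p lh) r
  ... | inj₂ r = trans (ℕP.m+n≡0⇒m≡0 k z) (sym (ℕP.m+n≡0⇒n≡0 k z))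
    where
    z : k +ᴺ l ≡ 0
    z = small-∣ (subst (_ <_) (sym ph) (s≤s (ℕP.+-mono-≤ kh lh))) r

  over-h : ∀ {k m} → k < suc m +ᴺ suc h → ¬ k ≤ h → k ∸ suc h ≤ m
  over-h {k} {m} lt nh = ≤-trans (ℕP.∸-monoˡ-≤ (suc h) (≤-pred lt)) (≤-reflexive (ℕP.m+n∸n≡m m (suc h)))

  over-inj : ∀ {k l} → ¬ k ≤ h → ¬ l ≤ h → k ∸ suc h ≡ l ∸ suc h → k ≡ l
  over-inj nk nl q = ℕP.∸-cancelʳ-≡ (ℕP.≰⇒> nk) (ℕP.≰⇒> nl) q

  nv : ℤ → ℕ → ℤ
  nv a k with k ℕ.≤? h
  ... | yes _ = + 1 * (+ k * + k)
  ... | no _ = a * (+ (k ∸ h) * + (k ∸ h))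

  nv-case : ∀ a k → (k ≤ h × nv a k ≡ + 1 * (+ k * + k)) ⊎ (¬ k ≤ h × nv a k ≡ a * (+ (k ∸ h) * + (k ∸ h)))
  nv-case a k with k ℕ.≤? h
  ... | yes q = inj₁ (q , refl)
  ... | no q = inj₂ (q , refl)

  -- `nv` lists the squares of 0, ..., h and `a` times the squares of 1, ..., h. For a non-residue
  -- `a` these are p = 2h + 1 distinct residues, hence all of them; so the non-residues form a
  -- single class modulo squares.
  nr-rep : ∀ {a} → ¬ (+ p ∣ a) → ¬ Sq p a → ∀ b → Sq p b ⊎ ∃ λ j → + p ∣ a * (j * j) - b
  nr-rep {a} na ns b = fin (fin-surj f inj (rem p b))
    where
    f : Fin p → Fin p
    f k = rem p (nv a (toℕ k))
    bd : ∀ {k} → k < p → k ∸ h ≤ h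
    bd {k} lt = ≤-trans (ℕP.∸-monoˡ-≤ h (≤-pred (subst (k <_) ph lt))) (≤-reflexive (ℕP.m+n∸n≡m h h))
    nj : ∀ {k} → k < p → ¬ k ≤ h → ¬ (+ p ∣ + (k ∸ h))
    nj lt nh d = nh (ℕP.m∸n≡0⇒m≤n (small-∣ (≤h⇒<p (bd lt)) d))
    mix : ∀ {k l} → l < p → ¬ l ≤ h → ¬ (+ p ∣ + 1 * (+ k * + k) - a * (+ (l ∸ h) * + (l ∸ h)))
    mix {k} {l} lt nl d = ns (subst (Sq p) (*-identityʳ a) (sq-div pr {a} {+ 1} {+ (l ∸ h)} (nj lt nl) (+ k)
      (subst (+ p ∣_) (re (+ k) a (+ (l ∸ h))) d)))
      where
      re : ∀ k a j → + 1 * (k * k) - a * (j * j) ≡ k * k - a * (j * j) * + 1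
      re = solve-∀
    injv : ∀ {k l} → k < p → l < p → + p ∣ nv a k - nv a l → k ≡ l
    injv {k} {l} kp lp d with nv-case a k | nv-case a l
    ... | inj₁ (kh , ek) | inj₁ (lh , el) = sq-inj {+ 1} (¬p∣1 pr) kh lh (subst₂ (λ a b → + p ∣ a - b) ek el d)
    ... | inj₂ (kh , ek) | inj₂ (lh , el) = ℕP.∸-cancelʳ-≡ (<⇒≤ (ℕP.≰⇒> kh)) (<⇒≤ (ℕP.≰⇒> lh)) (sq-inj na (bd kp) (bd lp) (subst₂ (λ a b → + p ∣ a - b) ek el d))
    ... | inj₁ (kh , ek) | inj₂ (lh , el) = ⊥-elim (mix {k} lp lh (subst₂ (λ a b → + p ∣ a - b) ek el d))
    ... | inj₂ (kh , ek) | inj₁ (lh , el) = ⊥-elim (mix {l} kp kh (subst₂ (λ a b → + p ∣ a - b) el ek (∣-sym (nv a k) (nv a l) d)))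
    inj : ∀ {i j} → f i ≡ f j → i ≡ j
    inj {i} {j} q = toℕ-injective (injv (toℕ<n i) (toℕ<n j) (rem-≡ p (nv a (toℕ i)) (nv a (toℕ j)) q))
    fin : (∃ λ k → f k ≡ rem p b) → Sq p b ⊎ ∃ λ j → + p ∣ a * (j * j) - b
    fin (k , q) = fin′ (nv-case a (toℕ k)) (rem-≡ p (nv a (toℕ k)) b q)
      where
      fin′ : (toℕ k ≤ h × nv a (toℕ k) ≡ + 1 * (+ toℕ k * + toℕ k)) ⊎ (¬ toℕ k ≤ h × nv a (toℕ k) ≡ a * (+ (toℕ k ∸ h) * + (toℕ k ∸ h))) →
        + p ∣ nv a (toℕ k) - b → Sq p b ⊎ ∃ λ j → + p ∣ a * (j * j) - b
      fin′ (inj₁ (_ , ek)) d = inj₁ (+ toℕ k , subst (λ z → + p ∣ z - b) (trans ek (*-identityˡ (+ toℕ k * + toℕ k))) d)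
      fin′ (inj₂ (_ , ek)) d = inj₂ (+ (toℕ k ∸ h) , subst (λ z → + p ∣ z - b) ek d)

  pw : ℤ → ℤ → ℤ → ℕ → ℤ
  pw u v t k with k ℕ.≤? h
  ... | yes _ = u * (+ k * + k)
  ... | no _ = t - v * (+ (k ∸ suc h) * + (k ∸ suc h))

  pw-case : ∀ u v t k → (k ≤ h × pw u v t k ≡ u * (+ k * + k)) ⊎ (¬ k ≤ h × pw u v t k ≡ t - v * (+ (k ∸ suc h) * + (k ∸ suc h)))
  pw-case u v t k with k ℕ.≤? h
  ... | yes q = inj₁ (q , refl)
  ... | no q = inj₂ (q , refl)

  -- Pigeonhole on p + 1 values: ux² for x ≤ h and t - vy² for y ≤ h. Within each family they are
  -- distinct, so a coincidence joins the two.
  two-squares : ∀ {u v} → ¬ (+ p ∣ u) → ¬ (+ p ∣ v) → ∀ t → ∃ λ x → ∃ λ y → + p ∣ u * (x * x) + v * (y * y) - t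
  two-squares {u} {v} nu nv t with FinP.pigeonhole {p} {suc p} ≤-refl (λ k → rem p (pw u v t (toℕ k)))
  ... | i , j , i<j , q = go (pw-case u v t (toℕ i)) (pw-case u v t (toℕ j)) (rem-≡ p (pw u v t (toℕ i)) (pw u v t (toℕ j)) q)
    where
    re : ∀ U V t → U + V - t ≡ U - (t - V)
    re = solve-∀
    re2 : ∀ V W t → V - W ≡ (t - W) - (t - V)
    re2 = solve-∀
    lt : ∀ (k : Fin (suc p)) → toℕ k < suc h +ᴺ suc h
    lt k = subst (toℕ k <_) (trans (cong suc ph) (sym (cong suc (ℕP.+-suc h h)))) (toℕ<n k)
    ne : toℕ i ≢ toℕ j
    ne = <⇒≢ i<j
    A B : ℤ → ℕ → ℤ
    A u k = u * (+ k * + k)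
    B v k = v * (+ (k ∸ suc h) * + (k ∸ suc h))
    go : (toℕ i ≤ h × pw u v t (toℕ i) ≡ A u (toℕ i)) ⊎ (¬ toℕ i ≤ h × pw u v t (toℕ i) ≡ t - B v (toℕ i)) →
         (toℕ j ≤ h × pw u v t (toℕ j) ≡ A u (toℕ j)) ⊎ (¬ toℕ j ≤ h × pw u v t (toℕ j) ≡ t - B v (toℕ j)) →
         + p ∣ pw u v t (toℕ i) - pw u v t (toℕ j) → ∃ λ x → ∃ λ y → + p ∣ u * (x * x) + v * (y * y) - t
    go (inj₁ (ih , ei)) (inj₁ (jh , ej)) d = ⊥-elim (ne (sq-inj nu ih jh (subst₂ (λ a b → + p ∣ a - b) ei ej d)))
    go (inj₂ (ih , ei)) (inj₂ (jh , ej)) d = ⊥-elim (ne (over-inj ih jh (sq-inj nv (over-h (lt i) ih) (over-h (lt j) jh)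
            (subst (+ p ∣_) (sym (re2 (B v (toℕ i)) (B v (toℕ j)) t)) (∣-sym (t - B v (toℕ i)) (t - B v (toℕ j)) (subst₂ (λ a b → + p ∣ a - b) ei ej d))))))
    go (inj₁ (ih , ei)) (inj₂ (jh , ej)) d = + toℕ i , + (toℕ j ∸ suc h) , subst (+ p ∣_) (sym (re (A u (toℕ i)) (B v (toℕ j)) t)) (subst₂ (λ a b → + p ∣ a - b) ei ej d)
    go (inj₂ (ih , ei)) (inj₁ (jh , ej)) d = + toℕ j , + (toℕ i ∸ suc h) , subst (+ p ∣_) (sym (re (A u (toℕ j)) (B v (toℕ i)) t)) (∣-sym (t - B v (toℕ i)) (A u (toℕ j)) (subst₂ (λ a b → + p ∣ a - b) ei ej d))

  -- The Legendre symbol in 𝔽₂, `true` on non-residues. Multiples of `p` count as squares, so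
  -- multiplicativity is stated for units.
  leg : ℤ → Bool
  leg a = not (does (sq? p a))

  leg-sq : ∀ {a} → Sq p a → leg a ≡ false
  leg-sq {a} s = cong not (dec-true (sq? p a) s)

  leg-nsq : ∀ {a} → ¬ Sq p a → leg a ≡ true
  leg-nsq {a} s = cong not (dec-false (sq? p a) s)

  leg-false : ∀ {a} → leg a ≡ false → Sq p a
  leg-false {a} q with sq? p a
  ... | yes s = s

  leg-true : ∀ {a} → leg a ≡ true → ¬ Sq p a
  leg-true {a} q with sq? p a
  ... | no s = s

  leg-cong : ∀ {a b} → + p ∣ a - b → leg a ≡ leg b
  leg-cong {a} {b} d with sq? p a
  ... | yes s = sym (leg-sq (sq-cong d s))
  ... | no s = sym (leg-nsq (λ z → s (sq-cong (∣-sym a b d) z)))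

  sq-unit : ∀ {a x} → ¬ (+ p ∣ a) → + p ∣ x * x - a → ¬ (+ p ∣ x)
  sq-unit {a} {x} na d dx = na (∣-lc2 d dx (- (+ 1)) x (re x a))
    where
    re : ∀ x a → a ≡ - (+ 1) * (x * x - a) + x * x
    re = solve-∀

  sq-mul : ∀ {a b} → Sq p a → Sq p b → Sq p (a * b)
  sq-mul {a} {b} (x , d) (y , g) = x * y , ∣-lc2 d g (y * y) a (re x y a b)
    where
    re : ∀ x y a b → x * y * (x * y) - a * b ≡ y * y * (x * x - a) + a * (y * y - b)
    re = solve-∀

  sq-cancel : ∀ {a b} → ¬ (+ p ∣ a) → Sq p a → Sq p (a * b) → Sq p b
  sq-cancel {a} {b} na (x , d) (z , g) = subst (Sq p) (*-identityˡ b) (sq-div pr {+ 1} {b} {x} (sq-unit na d) z (∣-lc2 g d (+ 1) (- b) (re z a b x)))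
    where
    re : ∀ z a b x → z * z - + 1 * (x * x) * b ≡ + 1 * (z * z - a * b) + - b * (x * x - a)
    re = solve-∀

  leg-* : ∀ {a b} → ¬ (+ p ∣ a) → ¬ (+ p ∣ b) → leg (a * b) ≡ leg a xor leg b
  leg-* {a} {b} na nb with sq? p a | sq? p b
  ... | yes s | yes t = leg-sq (sq-mul s t)
  ... | yes s | no t = leg-nsq (λ z → t (sq-cancel na s z))
  ... | no s | yes t = leg-nsq (λ z → s (sq-cancel nb t (subst (Sq p) (*-comm a b) z)))
  ... | no s | no t with nr-rep na s b
  ... | inj₁ z = ⊥-elim (t z)
  ... | inj₂ (j , d) = leg-sq (a * j , ∣-lc1 d a (re a j b))
    where
    re : ∀ a j b → a * j * (a * j) - a * b ≡ a * (a * (j * j) - b)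
    re = solve-∀

module Odds {p} (op : OddPrime p) where
  open OddsH op (proj₁ op) {{prime-nz (proj₁ op)}} (proj₁ (half-prime op)) (proj₂ (half-prime op)) public

-- p-adic numbers

par : ℕ → Bool
par zero    = false
par (suc n) = not (par n)

par-+ : ∀ m n → par (m +ᴺ n) ≡ par m xor par n
par-+ zero    n = refl
par-+ (suc m) n = trans (cong not (par-+ m n)) (BoolP.not-distribˡ-xor (par m) (par n))

par-double : ∀ n → par (n +ᴺ n) ≡ false
par-double n = trans (par-+ n n) (xor-same (par n))

pk-suc : ∀ p k → pk p (suc k) ≡ + p * pk p k
pk-suc p k = ℤP.pos-* p (p ^ᴺ k)

pk-+ : ∀ p j k → pk p (j +ᴺ k) ≡ pk p j * pk p k
pk-+ p j k = trans (cong +_ (ℕP.^-distribˡ-+-* p j k)) (ℤP.pos-* (p ^ᴺ j) (p ^ᴺ k))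

+p≢0 : ∀ {p} → Prime p → + p ≢ + 0
+p≢0 pr q = ℕ.≢-nonZero⁻¹ _ {{prime-nz pr}} (ℤP.+-injective q)

pk≢0 : ∀ {p} → Prime p → ∀ k → pk p k ≢ + 0
pk≢0 {p} pr zero ()
pk≢0 {p} pr (suc k) q = *-nz (+p≢0 pr) (pk≢0 pr k) (trans (sym (pk-suc p k)) q)

pk-∣ : ∀ p {j k} → j ≤ k → pk p j ∣ pk p k
pk-∣ p {j} {k} h = divides (pk p (k ∸ j)) (trans (cong (pk p) (sym (m∸n+n≡m h))) (pk-+ p (k ∸ j) j))

p∣pk : ∀ p k → + p ∣ pk p (suc k)
p∣pk p k = divides (pk p k) (trans (pk-suc p k) (*-comm (+ p) (pk p k)))

∣-tr : ∀ {a b c} → a ∣ b → b ∣ c → a ∣ c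
∣-tr = ℤS.∣-trans

Decomp : ℕ → ℤ → Set
Decomp p a = Σ ℕ λ e → Σ ℤ λ u → a ≡ pk p e * u × ¬ (+ p ∣ u)

abstract
  decomp : ∀ {p} → Prime p → ∀ k a → a ≢ + 0 → abs a ≤ k → Decomp p a
  decomp pr zero a nz h = ⊥-elim (nz (ℤP.∣i∣≡0⇒i≡0 (ℕP.n≤0⇒n≡0 h)))
  decomp {p} pr (suc k) a nz h = go (+ p ∣? a)
    where
    re : ∀ x w p → x * w * p ≡ p * x * w
    re = solve-∀
    go : Dec (+ p ∣ a) → Decomp p a
    go (no nd) = 0 , a , sym (*-identityˡ a) , nd
    go (yes (divides q eq)) = up (decomp pr k q q0 (≤-pred (≤-trans lt h)))
      where
      q0 : q ≢ + 0
      q0 refl = nz (trans eq (*-zeroˡ (+ p)))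
      lt : abs q < abs a
      lt = subst (abs q <_) (trans (sym (abs-* q (+ p))) (cong abs (sym eq)))
        (m<m*n (abs q) p {{ℕ.≢-nonZero λ z → q0 (ℤP.∣i∣≡0⇒i≡0 z)}} (prime>1 pr))
      up : Decomp p q → Decomp p a
      up (d , w , e , nw) = suc d , w , trans eq (trans (cong (_* + p) e) (trans (re (pk p d) w (+ p)) (cong (_* w) (sym (pk-suc p d))))) , nw

  vdec : ∀ p a → Dec (Prime p) → Dec (a ≡ + 0) → ℕ × ℤ
  vdec p a (yes pr) (no nz) = proj₁ (decomp pr (abs a) a nz ≤-refl) , proj₁ (proj₂ (decomp pr (abs a) a nz ≤-refl))
  vdec p a (yes pr) (yes _) = 0 , + 1
  vdec p a (no _)   _       = 0 , + 1

  val : ℕ → ℤ → ℕ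
  val p a = proj₁ (vdec p a (prime? p) (a ℤ.≟ + 0))

  unit : ℕ → ℤ → ℤ
  unit p a = proj₂ (vdec p a (prime? p) (a ℤ.≟ + 0))

  vdec-spec : ∀ {p a} d₁ d₂ → Prime p → a ≢ + 0 → a ≡ pk p (proj₁ (vdec p a d₁ d₂)) * proj₂ (vdec p a d₁ d₂) × ¬ (+ p ∣ proj₂ (vdec p a d₁ d₂))
  vdec-spec {p} {a} (yes pr) (no nz) _ _ = proj₂ (proj₂ (decomp pr (abs a) a nz ≤-refl))
  vdec-spec (yes pr) (yes z) _ nz = ⊥-elim (nz z)
  vdec-spec (no np) _ pr _ = ⊥-elim (np pr)

  val-spec : ∀ {p} → Prime p → ∀ {a} → a ≢ + 0 → a ≡ pk p (val p a) * unit p a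
  val-spec {p} pr {a} nz = proj₁ (vdec-spec (prime? p) (a ℤ.≟ + 0) pr nz)

  unit-∤ : ∀ {p} → Prime p → ∀ {a} → a ≢ + 0 → ¬ (+ p ∣ unit p a)
  unit-∤ {p} pr {a} nz = proj₂ (vdec-spec (prime? p) (a ℤ.≟ + 0) pr nz)

val-unique : ∀ {p} → Prime p → ∀ e f {u w} → pk p e * u ≡ pk p f * w → ¬ (+ p ∣ u) → ¬ (+ p ∣ w) → e ≡ f × u ≡ w
val-unique pr zero zero {u} {w} q nu nw = refl , trans (sym (*-identityˡ u)) (trans q (*-identityˡ w))
val-unique {p} pr zero (suc f) {u} {w} q nu nw = ⊥-elim (nu (subst (+ p ∣_) (trans (sym q) (*-identityˡ u)) (∣m⇒∣m*n w (p∣pk p f))))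
val-unique {p} pr (suc e) zero {u} {w} q nu nw = ⊥-elim (nw (subst (+ p ∣_) (trans q (*-identityˡ w)) (∣m⇒∣m*n u (p∣pk p e))))
val-unique {p} pr (suc e) (suc f) {u} {w} q nu nw with val-unique pr e f {u} {w} (*-cancelˡ (+p≢0 pr)
    (trans (sym (trans (cong (_* u) (pk-suc p e)) (*-assoc (+ p) (pk p e) u))) (trans q (trans (cong (_* w) (pk-suc p f)) (*-assoc (+ p) (pk p f) w))))) nu nw
... | r , s = cong suc r , s

val-of : ∀ {p} → Prime p → ∀ {a} e u → a ≡ pk p e * u → ¬ (+ p ∣ u) → val p a ≡ e × unit p a ≡ u
val-of {p} pr {a} e u q nu = val-unique pr (val p a) e (trans (sym (val-spec pr a0)) q) (unit-∤ pr a0) nu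
  where
  a0 : a ≢ + 0
  a0 z = *-nz (pk≢0 pr e) (w≢0 nu) (trans (sym q) z)

val-* : ∀ {p} → Prime p → ∀ {a b} → a ≢ + 0 → b ≢ + 0 → val p (a * b) ≡ val p a +ᴺ val p b × unit p (a * b) ≡ unit p a * unit p b
val-* {p} pr {a} {b} a0 b0 = val-of pr (val p a +ᴺ val p b) (unit p a * unit p b)
  (trans (cong₂ _*_ (val-spec pr a0) (val-spec pr b0)) (trans (re (pk p (val p a)) (unit p a) (pk p (val p b)) (unit p b)) (cong (_* (unit p a * unit p b)) (sym (pk-+ p (val p a) (val p b))))))
  (∤-* pr (unit-∤ pr a0) (unit-∤ pr b0))
  where
  re : ∀ x u y w → x * u * (y * w) ≡ x * y * (u * w)
  re = solve-∀

-- Only the parity of the valuation matters; the value at 0 is junk.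
vp : ℕ → ℤ → Bool
vp p a = par (val p a)

vp-* : ∀ {p} → Prime p → ∀ {a b} → a ≢ + 0 → b ≢ + 0 → vp p (a * b) ≡ vp p a xor vp p b
vp-* {p} pr {a} {b} a0 b0 = trans (cong par (proj₁ (val-* pr a0 b0))) (par-+ (val p a) (val p b))

-- Representative of `a` modulo squares of powers of `p`, of valuation 0 or 1. Hilbert equations are
-- analysed directly only for these.
red : ℕ → ℤ → ℤ
red p a = (if vp p a then + p else + 1) * unit p a

abstract
  red-spec : ∀ {p} → Prime p → ∀ {a} → a ≢ + 0 → ∃ λ i → a ≡ (pk p i * pk p i) * red p a
  red-spec {p} pr {a} a0 with half (val p a)
  ... | inj₁ (i , q) = i , trans (val-spec pr a0) (trans (cong (_* unit p a) (trans (cong (pk p) q) (pk-+ p i i)))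
      (cong (λ z → pk p i * pk p i * z) (trans (sym (*-identityˡ (unit p a))) (cong (λ b → (if b then + p else + 1) * unit p a) (sym (trans (cong par q) (par-double i)))))))
  ... | inj₂ (i , q) = i , trans (val-spec pr a0) (trans (cong (_* unit p a) (trans (cong (pk p) q) (trans (pk-suc p (i +ᴺ i)) (cong (+ p *_) (pk-+ p i i)))))
      (trans (re (+ p) (pk p i * pk p i) (unit p a)) (cong (λ b → pk p i * pk p i * ((if b then + p else + 1) * unit p a)) (sym (trans (cong par q) (cong not (par-double i)))))))
    where
    re : ∀ p k u → p * k * u ≡ k * (p * u)
    re = solve-∀

cohere : ∀ {p} (x : Zp p) {k N} → k ≤ N → pk p k ∣ seq x N - seq x k
cohere {p} x {k} {N} h = subst (λ n → pk p k ∣ seq x n - seq x k) (m∸n+n≡m h) (go (N ∸ k))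
  where
  go : ∀ m → pk p k ∣ seq x (m +ᴺ k) - seq x k
  go zero = ∣≡ {a = seq x k} refl
  go (suc m) = ∣-trans- (seq x (suc m +ᴺ k)) (seq x (m +ᴺ k)) (seq x k) (∣-tr (pk-∣ p (m≤n+m k m)) (∣ᵤ⇒∣ (proj₂ x (m +ᴺ k)))) (go m)

Zc : ∀ {p} → ℤ → Zp p
Zc {p} a = (λ _ → a) , λ k → ∣⇒∣ᵤ (∣≡ {pk p k} {a} refl)

Z* : ∀ {p} → ℤ → Zp p → Zp p
Z* {p} c x = (λ k → c * seq x k) , λ k → ∣⇒∣ᵤ (∣-lc1 (∣ᵤ⇒∣ {pk p k} (proj₂ x k)) c (re c (seq x (suc k)) (seq x k)))
  where
  re : ∀ c x y → c * x - c * y ≡ c * (x - y)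
  re = solve-∀

Zero : ∀ {p} → Zp p → Set
Zero {p} x = ∀ k → pk p k ∣ seq x k

zero⇒ : ∀ {p} (x : Zp p) → Zero x → IsZeroP p x
zero⇒ {p} x z k = ∣⇒∣ᵤ (subst (pk p k ∣_) (sym (+-identityʳ (seq x k))) (z k))

zero⇐ : ∀ {p} (x : Zp p) → IsZeroP p x → Zero x
zero⇐ {p} x z k = subst (pk p k ∣_) (+-identityʳ (seq x k)) (∣ᵤ⇒∣ (z k))

pk-cancel : ∀ {p} → Prime p → ∀ k c {x} → pk p (k +ᴺ c) ∣ pk p c * x → pk p k ∣ x
pk-cancel {p} pr k c {x} (divides q eq) = divides q (*-cancelˡ (pk≢0 pr c) (trans eq (trans (cong (q *_) (pk-+ p k c)) (re q (pk p k) (pk p c)))))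
  where
  re : ∀ q a b → q * (a * b) ≡ b * (q * a)
  re = solve-∀

unit-cancel : ∀ {p} → Prime p → ∀ k {u x} → ¬ (+ p ∣ u) → pk p k ∣ u * x → pk p k ∣ x
unit-cancel {p} pr zero {u} {x} nu d = divides x (sym (*-identityʳ x))
unit-cancel {p} pr (suc k) {u} {x} nu d with unit-cancel pr k nu (∣-tr (pk-∣ p (ℕP.n≤1+n k)) d)
... | divides q eq with euclid pr u q (fact d)
  where
  re : ∀ u q a → u * (q * a) ≡ a * (u * q)
  re = solve-∀
  fact : pk p (suc k) ∣ u * x → + p ∣ u * q
  fact (divides r e) = divides r (*-cancelˡ (pk≢0 pr k) (trans (sym (trans (cong (u *_) eq) (re u q (pk p k)))) (trans e (trans (cong (r *_) (pk-suc p k)) (re2 r (+ p) (pk p k))))))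
    where
    re2 : ∀ r p a → r * (p * a) ≡ a * (r * p)
    re2 = solve-∀
... | inj₁ b = ⊥-elim (nu b)
... | inj₂ (divides r e) = divides r (trans eq (trans (cong (_* pk p k) e) (trans (*-assoc r (+ p) (pk p k)) (cong (r *_) (sym (pk-suc p k))))))

-- Multiplication by `c` can hide at most `val p c` digits, so `x` modulo pᵏ is read off at index k
-- + `val p c`.
zero-cancel : ∀ {p} → Prime p → ∀ {c} → c ≢ + 0 → (x : Zp p) → Zero (Z* c x) → Zero x
zero-cancel {p} pr {c} c0 x z k = ∣m+n∣m⇒∣n {m = seq x N - seq x k} (subst (pk p k ∣_) (re (seq x N) (seq x k)) (unit-cancel pr k (unit-∤ pr c0) (pk-cancel pr k (val p c) (subst (pk p N ∣_) (trans (cong (_* seq x N) (val-spec pr c0)) (*-assoc (pk p (val p c)) (unit p c) (seq x N))) (z N))))) (cohere x (m≤m+n k (val p c)))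
  where
  N = k +ᴺ val p c
  re : ∀ a b → a ≡ a - b + b
  re = solve-∀

k<pk : ∀ {p} → Prime p → ∀ k → k < p ^ᴺ k
k<pk pr zero = s≤s z≤n
k<pk {p} pr (suc k) = ≤-trans (s≤s (k<pk pr k)) (subst (p ^ᴺ k <_) (ℕP.*-comm (p ^ᴺ k) p) (m<m*n (p ^ᴺ k) p {{ℕ.≢-nonZero λ q → pk≢0 pr k (cong +_ q)}} (prime>1 pr)))

-- `p ^ᴺ abs a` exceeds `abs a`, so it cannot divide a nonzero `a`.
zero-const : ∀ {p} → Prime p → ∀ {a} → Zero (Zc {p} a) → a ≡ + 0
zero-const {p} pr {a} z with abs a ℕ.≟ 0
... | yes q = ℤP.∣i∣≡0⇒i≡0 q
... | no q = ⊥-elim (<⇒≱ (k<pk pr (abs a)) (ℕD.∣⇒≤ {{ℕ.≢-nonZero q}} (∣⇒∣ᵤ (z (abs a)))))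

-- Nontrivial p-adic zeros of αz² = βx² + γy². Three coefficients are allowed so that the
-- denominators in `HilbertOne` need not be divided out.
Sol3 : ℕ → ℤ → ℤ → ℤ → Set
Sol3 p α β γ = Σ (Zp p) λ x → Σ (Zp p) λ y → Σ (Zp p) λ z →
  ¬ (Zero x × Zero y × Zero z) × (∀ k → pk p k ∣ α * (seq z k * seq z k) - (β * (seq x k * seq x k) + γ * (seq y k * seq y k)))

sol⇒ : ∀ {p a b} → Sol3 p (↧ a * ↧ b) (↥ a * ↧ b) (↥ b * ↧ a) → HilbertOne p a b
sol⇒ (x , y , z , nt , eq) = x , y , z , (λ (a , b , c) → nt (zero⇐ x a , zero⇐ y b , zero⇐ z c)) , λ k → ∣⇒∣ᵤ (eq k)

sol⇐ : ∀ {p a b} → HilbertOne p a b → Sol3 p (↧ a * ↧ b) (↥ a * ↧ b) (↥ b * ↧ a)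
sol⇐ (x , y , z , nt , eq) = x , y , z , (λ (a , b , c) → nt (zero⇒ x a , zero⇒ y b , zero⇒ z c)) , λ k → ∣ᵤ⇒∣ (eq k)

sol-int : ∀ {p} → Prime p → ∀ α β γ x y z → ¬ (x ≡ + 0 × y ≡ + 0 × z ≡ + 0) → α * (z * z) ≡ β * (x * x) + γ * (y * y) → Sol3 p α β γ
sol-int pr α β γ x y z nt q = Zc x , Zc y , Zc z , (λ (a , b , c) → nt (zero-const pr a , zero-const pr b , zero-const pr c)) , λ k → ∣≡ q

sol-scale : ∀ {p} → Prime p → ∀ {α β γ α′ β′ γ′} c₁ c₂ c₃ m → c₁ ≢ + 0 → c₂ ≢ + 0 → c₃ ≢ + 0 →
  α′ * (c₃ * c₃) ≡ m * α → β′ * (c₁ * c₁) ≡ m * β → γ′ * (c₂ * c₂) ≡ m * γ → Sol3 p α β γ → Sol3 p α′ β′ γ′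
sol-scale {p} pr {α} {β} {γ} {α′} {β′} {γ′} c₁ c₂ c₃ m n₁ n₂ n₃ qα qβ qγ (x , y , z , nt , eq) = Z* c₁ x , Z* c₂ y , Z* c₃ z ,
  (λ (a , b , c) → nt (zero-cancel pr n₁ x a , zero-cancel pr n₂ y b , zero-cancel pr n₃ z c)) ,
  λ k → ∣-lc1 (eq k) m (trans (cong₂ _-_ (term α′ c₃ α (seq z k) qα) (cong₂ _+_ (term β′ c₁ β (seq x k) qβ) (term γ′ c₂ γ (seq y k) qγ)))
    (r2 m (α * (seq z k * seq z k)) (β * (seq x k * seq x k)) (γ * (seq y k * seq y k))))
  where
  r : ∀ a c x → a * (c * x * (c * x)) ≡ a * (c * c) * (x * x)
  r = solve-∀
  r2 : ∀ m a b c → m * a - (m * b + m * c) ≡ m * (a - (b + c))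
  r2 = solve-∀
  term : ∀ a c b x → a * (c * c) ≡ m * b → a * (c * x * (c * x)) ≡ m * (b * (x * x))
  term a c b x q = trans (r a c x) (trans (cong (_* (x * x)) q) (*-assoc m b (x * x)))

-- A finite certificate of insolubility: already modulo pᶜ every zero is divisible by `p`.
Aniso : ℕ → ℕ → ℤ → ℤ → Set
Aniso p c A B = ∀ x y z → pk p c ∣ z * z - (A * (x * x) + B * (y * y)) → + p ∣ x × + p ∣ y × + p ∣ z

abstract
  -- Infinite descent at finite precision. Dividing a zero by `p` divides the equation by p², whence
  -- the exponent 2k + c.
  aniso-descent : ∀ {p c A B} → Prime p → Aniso p c A B → ∀ k x y z → pk p (k +ᴺ k +ᴺ c) ∣ z * z - (A * (x * x) + B * (y * y)) →
    pk p k ∣ x × pk p k ∣ y × pk p k ∣ z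
  aniso-descent pr an zero x y z d = divides x (sym (*-identityʳ x)) , divides y (sym (*-identityʳ y)) , divides z (sym (*-identityʳ z))
  aniso-descent {p} {c} {A} {B} pr an (suc k) x y z d = go (an x y z (∣-tr (pk-∣ p (m≤n+m c (suc k +ᴺ suc k))) d))
    where
    up : ∀ {x} q → x ≡ q * + p → pk p k ∣ q → pk p (suc k) ∣ x
    up q e (divides r f) = divides r (trans e (trans (cong (_* + p) f) (trans (*-assoc r (pk p k) (+ p)) (cong (r *_) (trans (*-comm (pk p k) (+ p)) (sym (pk-suc p k)))))))
    sq : ∀ {x} q → x ≡ q * + p → x * x ≡ + p * + p * (q * q)
    sq q refl = re q (+ p)
      where
      re : ∀ q p → q * p * (q * p) ≡ p * p * (q * q)
      re = solve-∀
    re2 : ∀ P a A b B c → P * a - (A * (P * b) + B * (P * c)) ≡ P * (a - (A * b + B * c))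
    re2 = solve-∀
    pk2 : pk p (suc k +ᴺ suc k +ᴺ c) ≡ + p * + p * pk p (k +ᴺ k +ᴺ c)
    pk2 = trans (cong (λ n → pk p (suc n +ᴺ c)) (ℕP.+-suc k k)) (trans (pk-suc p (suc (k +ᴺ k +ᴺ c))) (trans (cong (+ p *_) (pk-suc p (k +ᴺ k +ᴺ c))) (sym (*-assoc (+ p) (+ p) (pk p (k +ᴺ k +ᴺ c))))))
    go : + p ∣ x × + p ∣ y × + p ∣ z → pk p (suc k) ∣ x × pk p (suc k) ∣ y × pk p (suc k) ∣ z
    go (divides x′ ex , divides y′ ey , divides z′ ez) = up x′ ex (proj₁ ih) , up y′ ey (proj₁ (proj₂ ih)) , up z′ ez (proj₂ (proj₂ ih))
      where
      F : z * z - (A * (x * x) + B * (y * y)) ≡ + p * + p * (z′ * z′ - (A * (x′ * x′) + B * (y′ * y′)))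
      F = trans (cong₂ _-_ (sq z′ ez) (cong₂ (λ s t → A * s + B * t) (sq x′ ex) (sq y′ ey))) (re2 (+ p * + p) (z′ * z′) A (x′ * x′) B (y′ * y′))
      ih : pk p k ∣ x′ × pk p k ∣ y′ × pk p k ∣ z′
      ih = aniso-descent {c = c} {A} {B} pr an k x′ y′ z′ (ℤS.*-cancelˡ-∣ (+ p * + p) {{ℤ.≢-nonZero (*-nz (+p≢0 pr) (+p≢0 pr))}} (subst₂ _∣_ pk2 F d))

  aniso-¬sol : ∀ {p c A B} → Prime p → Aniso p c A B → ¬ Sol3 p (+ 1) A B
  aniso-¬sol {p} {c} {A} {B} pr an (x , y , z , nt , eq) = nt ((λ k → back x k (proj₁ (at k))) , (λ k → back y k (proj₁ (proj₂ (at k)))) , (λ k → back z k (proj₂ (proj₂ (at k)))))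
    where
    at : ∀ k → pk p k ∣ seq x (k +ᴺ k +ᴺ c) × pk p k ∣ seq y (k +ᴺ k +ᴺ c) × pk p k ∣ seq z (k +ᴺ k +ᴺ c)
    at k = aniso-descent {c = c} {A} {B} pr an k (seq x (k +ᴺ k +ᴺ c)) (seq y (k +ᴺ k +ᴺ c)) (seq z (k +ᴺ k +ᴺ c))
      (subst (λ t → pk p (k +ᴺ k +ᴺ c) ∣ t - (A * (seq x (k +ᴺ k +ᴺ c) * seq x (k +ᴺ k +ᴺ c)) + B * (seq y (k +ᴺ k +ᴺ c) * seq y (k +ᴺ k +ᴺ c)))) (*-identityˡ (seq z (k +ᴺ k +ᴺ c) * seq z (k +ᴺ k +ᴺ c))) (eq (k +ᴺ k +ᴺ c)))
    re : ∀ a b → b ≡ a - (a - b)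
    re = solve-∀
    back : ∀ (w : Zp p) k → pk p k ∣ seq w (k +ᴺ k +ᴺ c) → pk p k ∣ seq w k
    back w k d = subst (pk p k ∣_) (sym (re (seq w (k +ᴺ k +ᴺ c)) (seq w k))) (∣m∣n⇒∣m-n d (cohere w (≤-trans (m≤m+n k k) (m≤m+n (k +ᴺ k) c))))

Root : ℕ → ℤ → Set
Root p u = Σ (Zp p) λ w → ∀ k → pk p k ∣ seq w k * seq w k - u

abstract
  -- Newton's iteration with the derivative 2x frozen at the starting point: its inverse `b` modulo
  -- `p` is enough to gain one digit per step.
  hensel-odd : ∀ {p} → OddPrime p → ∀ {u} → ¬ (+ p ∣ u) → Sq p u → Root p u
  hensel-odd {p} op {u} nu (x₀ , d₀) = (s , λ k → ∣⇒∣ᵤ (coh k)) , root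
    where
    pr : Prime p
    pr = proj₁ op
    nx : ¬ (+ p ∣ + 2 * x₀)
    nx = ∤-* pr (∤2 op) (Odds.sq-unit op nu d₀)
    b : ℤ
    b = proj₁ (inverse pr nx)
    hb : + p ∣ + 2 * x₀ * b - + 1
    hb = proj₂ (inverse pr nx)
    s : ℕ → ℤ
    -- The term at index k + 1 is a root modulo p to the power k + 1; repeating the start absorbs
    -- the empty condition at index 0.
    s zero = x₀
    s (suc zero) = x₀
    s (suc (suc k)) = s (suc k) - (s (suc k) * s (suc k) - u) * b
    r0 : ∀ x f b x₀ → x - f * b - x₀ ≡ + 1 * (x - x₀) + - b * f
    r0 = solve-∀
    r1 : ∀ x b x₀ → + 1 - + 2 * x * b ≡ - (+ 1) * (+ 2 * x₀ * b - + 1) + - (+ 2 * b) * (x - x₀)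
    r1 = solve-∀
    r2 : ∀ x f b u → (x - f * b) * (x - f * b) - u ≡ x * x - u - + 2 * x * b * f + f * f * (b * b)
    r2 = solve-∀
    r3 : ∀ f x b → f - + 2 * x * b * f + f * f * (b * b) ≡ f * (+ 1 - + 2 * x * b) + b * b * (f * f)
    r3 = solve-∀
    pp : ∀ k {f g} → pk p (suc k) ∣ f → + p ∣ g → pk p (suc (suc k)) ∣ f * g
    pp k (divides q e) (divides r h) = divides (q * r) (trans (cong₂ _*_ e h) (trans (re q (pk p (suc k)) r (+ p)) (cong (q * r *_) (sym (pk-suc p (suc k))))))
      where
      re : ∀ q a r p → q * a * (r * p) ≡ q * r * (p * a)
      re = solve-∀
    base : ∀ k → pk p (suc k) ∣ s (suc k) * s (suc k) - u × + p ∣ s (suc k) - x₀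
    base zero = subst (_∣ x₀ * x₀ - u) (cong +_ (sym (ℕP.*-identityʳ p))) d₀ , ∣≡ {a = x₀} refl
    base (suc k) = step (base k)
      where
      x f : ℤ
      x = s (suc k)
      f = x * x - u
      step : pk p (suc k) ∣ f × + p ∣ x - x₀ → pk p (suc (suc k)) ∣ s (suc (suc k)) * s (suc (suc k)) - u × + p ∣ s (suc (suc k)) - x₀
      step (df , dx) = subst (pk p (suc (suc k)) ∣_) (sym (trans (r2 x f b u) (r3 f x b)))
          (∣m∣n⇒∣m+n (pp k df (∣-lc2 hb dx (- (+ 1)) (- (+ 2 * b)) (r1 x b x₀))) (∣n⇒∣m*n (b * b) (pp k df (∣-tr (p∣pk p k) df))))
        , ∣-lc2 dx (∣-tr (p∣pk p k) df) (+ 1) (- b) (r0 x f b x₀)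
    rc : ∀ x f b → x - f * b - x ≡ - b * f
    rc = solve-∀
    coh : ∀ k → pk p k ∣ s (suc k) - s k
    coh zero = divides (x₀ - x₀) (sym (*-identityʳ (x₀ - x₀)))
    coh (suc k) = ∣-lc1 (proj₁ (base k)) (- b) (rc (s (suc k)) (s (suc k) * s (suc k) - u) b)
    root : ∀ k → pk p k ∣ s k * s k - u
    root zero = divides (x₀ * x₀ - u) (sym (*-identityʳ (x₀ * x₀ - u)))
    root (suc k) = proj₁ (base k)

-- Hilbert symbols

-- Symbols take values in 𝔽₂, with true for −1.
record LocalSymbol (p : ℕ) : Set where
  field
    prime : Prime p
    h     : ℤ → ℤ → Bool
    h-comm : ∀ a b → h a b ≡ h b a
    h-*ˡ  : ∀ {a b} → a ≢ + 0 → b ≢ + 0 → ∀ c → h (a * b) c ≡ h a c xor h b c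
    solve : ∀ {a b} → a ≢ + 0 → b ≢ + 0 → h a b ≡ false → Sol3 p (+ 1) (red p a) (red p b)
    aniso : ∀ {a b} → a ≢ + 0 → b ≢ + 0 → h a b ≡ true → ∃ λ c → Aniso p c (red p a) (red p b)

sgn : Bool → ℤ
sgn false = + 1
sgn true  = - (+ 1)

sgn-xor : ∀ a b → sgn (a xor b) ≡ sgn a * sgn b
sgn-xor false false = refl
sgn-xor false true  = refl
sgn-xor true  false = refl
sgn-xor true  true  = refl

sgn-inj : ∀ {a b} → sgn a ≡ sgn b → a ≡ b
sgn-inj {false} {false} _ = refl
sgn-inj {true} {true} _ = refl

↧≢0 : ∀ a → ↧ a ≢ + 0
↧≢0 a ()

module SymbolProperties {p} (S : LocalSymbol p) where
  open LocalSymbol S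

  h-*ʳ : ∀ {b c} → b ≢ + 0 → c ≢ + 0 → ∀ a → h a (b * c) ≡ h a b xor h a c
  h-*ʳ {b} {c} b0 c0 a = trans (h-comm a (b * c)) (trans (h-*ˡ b0 c0 a) (cong₂ _xor_ (h-comm b a) (h-comm c a)))

  h-sqˡ : ∀ {a c} → a ≢ + 0 → c ≢ + 0 → ∀ b → h (a * (c * c)) b ≡ h a b
  h-sqˡ {a} {c} a0 c0 b = trans (h-*ˡ a0 (*-nz c0 c0) b) (trans (cong (h a b xor_) (trans (h-*ˡ c0 c0 b) (xor-same (h c b)))) (xor-identityʳ (h a b)))

  h-sqʳ : ∀ {b c} → b ≢ + 0 → c ≢ + 0 → ∀ a → h a (b * (c * c)) ≡ h a b
  h-sqʳ {b} {c} b0 c0 a = trans (h-comm a (b * (c * c))) (trans (h-sqˡ b0 c0 a) (h-comm b a))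

  h-sq0 : ∀ {c} → c ≢ + 0 → ∀ b → h (c * c) b ≡ false
  h-sq0 {c} c0 b = trans (h-*ˡ c0 c0 b) (xor-same (h c b))

  abstract
    -- Multiplying αz² = βx² + γy² by α gives (αz)² = αβ·x² + αγ·y², which is why the two products
    -- are the arguments of the symbol.
    h-sol : ∀ {α β γ} → α ≢ + 0 → β ≢ + 0 → γ ≢ + 0 → h (α * β) (α * γ) ≡ false → Sol3 p α β γ
    h-sol {α} {β} {γ} α0 β0 γ0 q = go (red-spec prime (*-nz α0 β0)) (red-spec prime (*-nz α0 γ0))
      where
      r1 : ∀ α P Q → α * (P * Q * (P * Q)) ≡ α * ((P * P) * (Q * Q)) * + 1
      r1 = solve-∀
      r2 : ∀ b α Q → b * (α * Q * (α * Q)) ≡ α * (Q * Q) * (α * b)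
      r2 = solve-∀
      r3 : ∀ α Q P r → α * Q * (P * r) ≡ α * (P * Q) * r
      r3 = solve-∀
      r4 : ∀ α Q P r → α * P * (Q * r) ≡ α * (P * Q) * r
      r4 = solve-∀
      go : (∃ λ i → α * β ≡ (pk p i * pk p i) * red p (α * β)) → (∃ λ j → α * γ ≡ (pk p j * pk p j) * red p (α * γ)) → Sol3 p α β γ
      go (i , ei) (j , ej) = sol-scale prime {+ 1} {red p (α * β)} {red p (α * γ)} {α} {β} {γ} (α * Q) (α * P) (P * Q) (α * ((P * P) * (Q * Q)))
          (*-nz α0 (pk≢0 prime j)) (*-nz α0 (pk≢0 prime i)) (*-nz (pk≢0 prime i) (pk≢0 prime j)) (r1 α P Q)
          (trans (r2 β α Q) (trans (cong (α * (Q * Q) *_) ei) (r3 α (Q * Q) (P * P) (red p (α * β)))))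
          (trans (r2 γ α P) (trans (cong (α * (P * P) *_) ej) (r4 α (Q * Q) (P * P) (red p (α * γ)))))
          (solve (*-nz α0 β0) (*-nz α0 γ0) q)
        where
        P Q : ℤ
        P = pk p i
        Q = pk p j

    h-¬sol : ∀ {α β γ} → α ≢ + 0 → β ≢ + 0 → γ ≢ + 0 → Sol3 p α β γ → h (α * β) (α * γ) ≡ false
    h-¬sol {α} {β} {γ} α0 β0 γ0 s = go (h (α * β) (α * γ)) refl (red-spec prime (*-nz α0 β0)) (red-spec prime (*-nz α0 γ0))
      where
      go : ∀ b → h (α * β) (α * γ) ≡ b → (∃ λ i → α * β ≡ (pk p i * pk p i) * red p (α * β)) → (∃ λ j → α * γ ≡ (pk p j * pk p j) * red p (α * γ)) → b ≡ false
      go false _ _ _ = refl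
      go true q (i , ei) (j , ej) = ⊥-elim (aniso-¬sol {c = proj₁ an} {red p (α * β)} {red p (α * γ)} prime (proj₂ an) (sol-scale prime {α} {β} {γ} {+ 1} {red p (α * β)} {red p (α * γ)} (pk p i) (pk p j) α α (pk≢0 prime i) (pk≢0 prime j) α0
          (*-identityˡ (α * α)) (trans (*-comm (red p (α * β)) (pk p i * pk p i)) (sym ei)) (trans (*-comm (red p (α * γ)) (pk p j * pk p j)) (sym ej)) s))
        where
        an : ∃ λ c → Aniso p c (red p (α * β)) (red p (α * γ))
        an = aniso (*-nz α0 β0) (*-nz α0 γ0) q

  h-iso : ∀ {a b} → a ≢ + 0 → b ≢ + 0 → ∀ x y z → ¬ (x ≡ + 0 × y ≡ + 0 × z ≡ + 0) → z * z ≡ a * (x * x) + b * (y * y) → h a b ≡ false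
  h-iso {a} {b} a0 b0 x y z nt q = subst₂ (λ s t → h s t ≡ false) (*-identityˡ a) (*-identityˡ b)
    (h-¬sol {+ 1} (λ ()) a0 b0 (sol-int prime (+ 1) a b x y z nt (trans (*-identityˡ (z * z)) q)))

  h-neg : ∀ {a} → a ≢ + 0 → h a (- a) ≡ false
  h-neg {a} a0 = h-iso a0 (λ q → a0 (trans (sym (neg-involutive a)) (cong -_ q))) (+ 1) (+ 1) (+ 0) (λ ()) (re a)
    where
    re : ∀ a → + 0 * + 0 ≡ a * (+ 1 * + 1) + - a * (+ 1 * + 1)
    re = solve-∀

  h-self : ∀ {a} → a ≢ + 0 → h a a ≡ h a (- (+ 1))
  h-self {a} a0 = xor-≡ (trans (sym (h-*ʳ a0 (λ ()) a)) (trans (cong (h a) (re a)) (h-neg a0)))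
    where
    re : ∀ a → a * - (+ 1) ≡ - a
    re = solve-∀

  -- n/d and nd lie in the same square class.
  cl : ℚ → ℤ
  cl a = ↥ a * ↧ a

  private
    class : ∀ a b → ↥ a ≢ + 0 → ↥ b ≢ + 0 → h ((↧ a * ↧ b) * (↥ a * ↧ b)) ((↧ a * ↧ b) * (↥ b * ↧ a)) ≡ h (cl a) (cl b)
    class a b a0 b0 = trans (cong₂ h (r1 (↧ a) (↧ b) (↥ a)) (r2 (↧ a) (↧ b) (↥ b)))
        (trans (h-sqˡ (*-nz a0 (↧≢0 a)) (↧≢0 b) _) (h-sqʳ (*-nz b0 (↧≢0 b)) (↧≢0 a) _))
      where
      r1 : ∀ d f n → d * f * (n * f) ≡ n * d * (f * f)
      r1 = solve-∀
      r2 : ∀ d f n → d * f * (n * d) ≡ n * f * (d * d)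
      r2 = solve-∀

  hilbertIs : ∀ a b → ↥ a ≢ + 0 → ↥ b ≢ + 0 → HilbertIs p a b (sgn (h (cl a) (cl b)))
  hilbertIs a b a0 b0 = go (h (cl a) (cl b)) refl
    where
    go : ∀ t → h (cl a) (cl b) ≡ t → HilbertIs p a b (sgn t)
    go false q = inj₁ (refl , sol⇒ {a = a} {b} (h-sol (*-nz (↧≢0 a) (↧≢0 b)) (*-nz a0 (↧≢0 b)) (*-nz b0 (↧≢0 a)) (trans (class a b a0 b0) q)))
    go true q = inj₂ (refl , λ o → case trans (sym q) (trans (sym (class a b a0 b0)) (h-¬sol (*-nz (↧≢0 a) (↧≢0 b)) (*-nz a0 (↧≢0 b)) (*-nz b0 (↧≢0 a)) (sol⇐ {a = a} {b} o))) of λ ())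

  hilbertIs-unique : ∀ {a b s t} → HilbertIs p a b s → HilbertIs p a b t → s ≡ t
  hilbertIs-unique (inj₁ (refl , _)) (inj₁ (refl , _)) = refl
  hilbertIs-unique (inj₂ (refl , _)) (inj₂ (refl , _)) = refl
  hilbertIs-unique (inj₁ (_ , o)) (inj₂ (_ , n)) = ⊥-elim (n o)
  hilbertIs-unique (inj₂ (_ , n)) (inj₁ (_ , o)) = ⊥-elim (n o)

module OddSymbol {p} (op : OddPrime p) where
  open Odds op
  private
    pr : Prime p
    pr = proj₁ op

  ℓ : ℤ → Bool
  ℓ a = leg (unit p a)

  ℓ-* : ∀ {a b} → a ≢ + 0 → b ≢ + 0 → ℓ (a * b) ≡ ℓ a xor ℓ b
  ℓ-* a0 b0 = trans (cong leg (proj₂ (val-* pr a0 b0))) (leg-* (unit-∤ pr a0) (unit-∤ pr b0))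

  -- The tame symbol of pˢu and pᵗv for odd `p`, written additively: the product of (-1/p) to the
  -- power st, (u/p) to the power t and (v/p) to the power s.
  F : Bool → Bool → Bool → Bool → Bool
  F s t l m = ((s ∧ t) ∧ leg (- (+ 1))) xor ((t ∧ l) xor (s ∧ m))

  hodd : ℤ → ℤ → Bool
  hodd a b = F (vp p a) (vp p b) (ℓ a) (ℓ b)

  pp : Bool → ℤ
  pp s = if s then + p else + 1

  ∤neg : ∀ {u} → ¬ (+ p ∣ u) → ¬ (+ p ∣ - u)
  ∤neg {u} nu d = nu (subst (+ p ∣_) (neg-involutive u) (∣m⇒∣-m d))

  leg-neg : ∀ {u} → ¬ (+ p ∣ u) → leg (- u) ≡ leg (- (+ 1)) xor leg u
  leg-neg {u} nu = trans (cong leg (re u)) (leg-* (∤neg (¬p∣1 pr)) nu)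
    where
    re : ∀ u → - u ≡ - (+ 1) * u
    re = solve-∀

  root-unit : ∀ {w} → ¬ (+ p ∣ w) → (r : Root p w) → ¬ Zero (proj₁ r)
  root-unit {w} nw (z , rt) zz = nw (∣-lc2 (at1 rt) (at1 zz) (- (+ 1)) (seq z 1) (re (seq z 1) w))
    where
    at1 : ∀ {f : ℕ → ℤ} → (∀ k → pk p k ∣ f k) → + p ∣ f 1
    at1 {f} g = subst (_∣ f 1) (cong +_ (ℕP.*-identityʳ p)) (g 1)
    re : ∀ z w → w ≡ - (+ 1) * (z * z - w) + z * z
    re = solve-∀

  abstract
    -- Each zero comes from one Hensel root. For two units, `two-squares` makes ux² + vy² congruent
    -- to 1; when only one is a unit, that unit is a square; for pu and pv, -uv is a square and z =
    -- 0.
    solve-core : ∀ s t {u v} → ¬ (+ p ∣ u) → ¬ (+ p ∣ v) → F s t (leg u) (leg v) ≡ false → Sol3 p (+ 1) (pp s * u) (pp t * v)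
    solve-core false false {u} {v} nu nv _ = go (two-squares nu nv (+ 1))
      where
      go : (∃ λ x → ∃ λ y → + p ∣ u * (x * x) + v * (y * y) - + 1) → Sol3 p (+ 1) (+ 1 * u) (+ 1 * v)
      go (x , y , d) = Zc x , Zc y , proj₁ rt , (λ (_ , _ , z) → root-unit nw rt z) , λ k → ∣-lc1 (proj₂ rt k) (+ 1) (re (seq (proj₁ rt) k) u (x * x) v (y * y))
        where
        w : ℤ
        w = u * (x * x) + v * (y * y)
        re1 : ∀ w → + 1 ≡ - (+ 1) * (w - + 1) + + 1 * w
        re1 = solve-∀
        nw : ¬ (+ p ∣ w)
        nw dw = ¬p∣1 pr (∣-lc2 d dw (- (+ 1)) (+ 1) (re1 w))
        rt : Root p w
        rt = hensel-odd op nw (+ 1 , ∣-sym w (+ 1) d)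
        re : ∀ z u X v Y → + 1 * (z * z) - (+ 1 * u * X + + 1 * v * Y) ≡ + 1 * (z * z - (u * X + v * Y))
        re = solve-∀
    solve-core true false {u} {v} nu nv q = Zc (+ 0) , Zc (+ 1) , proj₁ rt , (λ (_ , y , _) → case zero-const pr y of λ ()) ,
        λ k → ∣-lc1 (proj₂ rt k) (+ 1) (re (seq (proj₁ rt) k) (+ p) u v)
      where
      rt : Root p v
      rt = hensel-odd op nv (leg-false q)
      re : ∀ z p u v → + 1 * (z * z) - (p * u * (+ 0 * + 0) + + 1 * v * (+ 1 * + 1)) ≡ + 1 * (z * z - v)
      re = solve-∀
    solve-core false true {u} {v} nu nv q = Zc (+ 1) , Zc (+ 0) , proj₁ rt , (λ (x , _ , _) → case zero-const pr x of λ ()) ,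
        λ k → ∣-lc1 (proj₂ rt k) (+ 1) (re (seq (proj₁ rt) k) (+ p) u v)
      where
      rt : Root p u
      rt = hensel-odd op nu (leg-false (trans (sym (xor-identityʳ (leg u))) q))
      re : ∀ z p u v → + 1 * (z * z) - (+ 1 * u * (+ 1 * + 1) + p * v * (+ 0 * + 0)) ≡ + 1 * (z * z - u)
      re = solve-∀
    solve-core true true {u} {v} nu nv q = proj₁ rt , Zc u , Zc (+ 0) , (λ (_ , y , _) → w≢0 nu (zero-const pr y)) ,
        λ k → ∣-lc1 (proj₂ rt k) (- (+ p * u)) (re (seq (proj₁ rt) k) (+ p) u v)
      where
      rt : Root p (- (u * v))
      rt = hensel-odd op (∤neg (∤-* pr nu nv)) (leg-false (trans (leg-neg (∤-* pr nu nv)) (trans (cong (leg (- (+ 1)) xor_) (leg-* nu nv)) q)))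
      re : ∀ w p u v → + 1 * (+ 0 * + 0) - (p * u * (w * w) + p * v * (u * u)) ≡ - (p * u) * (w * w - - (u * v))
      re = solve-∀

    nonsq-aniso : ∀ {v} → leg v ≡ true → ∀ {y z} → + p ∣ z * z - v * (y * y) → + p ∣ y × + p ∣ z
    nonsq-aniso {v} q {y} {z} d = go (+ p ∣? y)
      where
      re : ∀ z v y → z * z ≡ + 1 * (z * z - v * (y * y)) + v * y * y
      re = solve-∀
      re2 : ∀ z v y → z * z - + 1 * (y * y) * v ≡ z * z - v * (y * y)
      re2 = solve-∀
      go : Dec (+ p ∣ y) → + p ∣ y × + p ∣ z
      go (yes dy) = dy , (case euclid pr z z (∣-lc2 d dy (+ 1) (v * y) (re z v y)) of λ where
        (inj₁ a) → a
        (inj₂ a) → a)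
      go (no ny) = ⊥-elim (leg-true q (subst (Sq p) (*-identityˡ v) (sq-div pr {+ 1} {v} {y} ny z (subst (+ p ∣_) (sym (re2 z v y)) d))))

    p²-cancel : ∀ {x} → + p * + p ∣ + p * x → + p ∣ x
    p²-cancel = ℤS.*-cancelˡ-∣ (+ p) {{ℤ.≢-nonZero (+p≢0 pr)}}

    pp∣ : ∀ {x y} → + p ∣ x → + p ∣ y → + p * + p ∣ x * y
    pp∣ (divides a e) (divides b f) = divides (a * b) (trans (cong₂ _*_ e f) (re a b (+ p)))
      where
      re : ∀ a b p → a * p * (b * p) ≡ a * b * (p * p)
      re = solve-∀

    pk2≡ : pk p 2 ≡ + p * + p
    pk2≡ = trans (pk-suc p 1) (cong (λ n → + p * + n) (ℕP.*-identityʳ p))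

    p-∣-p² : + p ∣ + p * + p
    p-∣-p² = divides (+ p) refl

    unit-x : ∀ {u x} → ¬ (+ p ∣ u) → + p ∣ u * (x * x) → + p ∣ x
    unit-x {u} {x} nu d with euclid pr u (x * x) d
    ... | inj₁ a = ⊥-elim (nu a)
    ... | inj₂ a with euclid pr x x a
    ... | inj₁ b = b
    ... | inj₂ b = b

    -- In the mixed cases a non-residue coefficient forces two variables into pℤ modulo `p`, and the
    -- third follows modulo p². For pu and pv the order is reversed, with `z` settled modulo `p`.
    aniso-core : ∀ s t {u v} → ¬ (+ p ∣ u) → ¬ (+ p ∣ v) → F s t (leg u) (leg v) ≡ true → Aniso p 2 (pp s * u) (pp t * v)
    aniso-core true false {u} {v} nu nv q x y z d′ = unit-x nu (p²-cancel (∣-lc3 d (pp∣ dz dz) (pp∣ dy dy) (- (+ 1)) (+ 1) (- v) (r2 (z * z) (+ p) u (x * x) v (y * y)))) , dy , dz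
      where
      d : + p * + p ∣ z * z - (+ p * u * (x * x) + + 1 * v * (y * y))
      d = subst (_∣ z * z - (+ p * u * (x * x) + + 1 * v * (y * y))) pk2≡ d′
      r1 : ∀ Z p u X v Y → Z - v * Y ≡ + 1 * (Z - (p * u * X + + 1 * v * Y)) + u * X * p
      r1 = solve-∀
      r2 : ∀ Z p u X v Y → p * (u * X) ≡ - (+ 1) * (Z - (p * u * X + + 1 * v * Y)) + + 1 * Z + - v * Y
      r2 = solve-∀
      yz : + p ∣ y × + p ∣ z
      yz = nonsq-aniso q {y} {z} (∣-lc2 (∣-tr p-∣-p² d) ∣-refl (+ 1) (u * (x * x)) (r1 (z * z) (+ p) u (x * x) v (y * y)))
      dy : + p ∣ y
      dy = proj₁ yz
      dz : + p ∣ z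
      dz = proj₂ yz
    aniso-core false true {u} {v} nu nv q x y z d′ = dx , unit-x nv (p²-cancel (∣-lc3 d (pp∣ dz dz) (pp∣ dx dx) (- (+ 1)) (+ 1) (- u) (r2 (z * z) (+ p) v (y * y) u (x * x)))) , dz
      where
      d : + p * + p ∣ z * z - (+ 1 * u * (x * x) + + p * v * (y * y))
      d = subst (_∣ z * z - (+ 1 * u * (x * x) + + p * v * (y * y))) pk2≡ d′
      r1 : ∀ Z p v Y u X → Z - u * X ≡ + 1 * (Z - (+ 1 * u * X + p * v * Y)) + v * Y * p
      r1 = solve-∀
      r2 : ∀ Z p v Y u X → p * (v * Y) ≡ - (+ 1) * (Z - (+ 1 * u * X + p * v * Y)) + + 1 * Z + - u * X
      r2 = solve-∀
      yz : + p ∣ x × + p ∣ z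
      yz = nonsq-aniso (trans (sym (xor-identityʳ (leg u))) q) {x} {z} (∣-lc2 (∣-tr p-∣-p² d) ∣-refl (+ 1) (v * (y * y)) (r1 (z * z) (+ p) v (y * y) u (x * x)))
      dx : + p ∣ x
      dx = proj₁ yz
      dz : + p ∣ z
      dz = proj₂ yz
    aniso-core true true {u} {v} nu nv q x y z d′ = case euclid pr u x (proj₂ yx) of (λ where
        (inj₁ a) → ⊥-elim (nu a)
        (inj₂ a) → a , proj₁ yx , dz)
      where
      d : + p * + p ∣ z * z - (+ p * u * (x * x) + + p * v * (y * y))
      d = subst (_∣ z * z - (+ p * u * (x * x) + + p * v * (y * y))) pk2≡ d′
      r0 : ∀ Z p u X v Y → Z ≡ + 1 * (Z - (p * u * X + p * v * Y)) + (u * X + v * Y) * p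
      r0 = solve-∀
      dz : + p ∣ z
      dz = case euclid pr z z (∣-lc2 (∣-tr p-∣-p² d) ∣-refl (+ 1) (u * (x * x) + v * (y * y)) (r0 (z * z) (+ p) u (x * x) v (y * y))) of λ where
        (inj₁ a) → a
        (inj₂ a) → a
      r1 : ∀ Z p u X v Y → p * (u * X + v * Y) ≡ - (+ 1) * (Z - (p * u * X + p * v * Y)) + + 1 * Z
      r1 = solve-∀
      e1 : + p ∣ u * (x * x) + v * (y * y)
      e1 = p²-cancel (∣-lc2 d (pp∣ dz dz) (- (+ 1)) (+ 1) (r1 (z * z) (+ p) u (x * x) v (y * y)))
      r2 : ∀ u x v y → u * x * (u * x) - - (u * v) * (y * y) ≡ u * (u * (x * x) + v * (y * y))
      r2 = solve-∀
      yx : + p ∣ y × + p ∣ u * x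
      yx = nonsq-aniso {v = - (u * v)} (trans (leg-neg (∤-* pr nu nv)) (trans (cong (leg (- (+ 1)) xor_) (leg-* nu nv)) q)) {y} {u * x} (∣-lc1 e1 u (r2 u x v y))

  oddSymbol : LocalSymbol p
  oddSymbol = record
    { prime = pr ; h = hodd
    ; h-comm = λ a b → taut 5 (λ { (s ∷ t ∷ l ∷ m ∷ w ∷ []) → ((s ∧ t) ∧ w) xor ((t ∧ l) xor (s ∧ m)) }) (λ { (s ∷ t ∷ l ∷ m ∷ w ∷ []) → ((t ∧ s) ∧ w) xor ((s ∧ m) xor (t ∧ l)) }) refl
        (vp p a ∷ vp p b ∷ ℓ a ∷ ℓ b ∷ leg (- (+ 1)) ∷ [])
    ; h-*ˡ = λ {a} {b} a0 b0 c → trans (cong₂ (λ s l → F s (vp p c) l (ℓ c)) (vp-* pr a0 b0) (ℓ-* a0 b0))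
        (taut 7 (λ { (s ∷ s′ ∷ t ∷ l ∷ l′ ∷ m ∷ w ∷ []) → (((s xor s′) ∧ t) ∧ w) xor ((t ∧ (l xor l′)) xor ((s xor s′) ∧ m)) })
          (λ { (s ∷ s′ ∷ t ∷ l ∷ l′ ∷ m ∷ w ∷ []) → (((s ∧ t) ∧ w) xor ((t ∧ l) xor (s ∧ m))) xor (((s′ ∧ t) ∧ w) xor ((t ∧ l′) xor (s′ ∧ m))) }) refl
          (vp p a ∷ vp p b ∷ vp p c ∷ ℓ a ∷ ℓ b ∷ ℓ c ∷ leg (- (+ 1)) ∷ []))
    ; solve = λ {a} {b} a0 b0 q → solve-core (vp p a) (vp p b) (unit-∤ pr a0) (unit-∤ pr b0) q
    ; aniso = λ {a} {b} a0 b0 q → 2 , aniso-core (vp p a) (vp p b) (unit-∤ pr a0) (unit-∤ pr b0) q }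

open OddSymbol using (oddSymbol; hodd) public

-- The dyadic symbol

BZ : Bool → ℤ
BZ false = + 0
BZ true  = + 1

BN : Bool → ℕ
BN false = 0
BN true  = 1

abstract
  bitdec : ∀ x → Σ Bool λ b → Σ ℤ λ q → x ≡ BZ b + + 2 * q
  bitdec x = go (x ℤM.%ℕ 2) (ℤM.n%ℕd<d x 2) (ℤM.a≡a%ℕn+[a/ℕn]*n x 2)
    where
    go : ∀ r → r < 2 → x ≡ + r + (x ℤM./ℕ 2) * + 2 → Σ Bool λ b → Σ ℤ λ q → x ≡ BZ b + + 2 * q
    go zero _ q = false , x ℤM./ℕ 2 , trans q (+ˡ (+ 0) (*-comm (x ℤM./ℕ 2) (+ 2)))
    go (suc zero) _ q = true , x ℤM./ℕ 2 , trans q (+ˡ (+ 1) (*-comm (x ℤM./ℕ 2) (+ 2)))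
    go (suc (suc r)) (s≤s (s≤s ())) _

  bit : ℤ → Bool
  bit x = proj₁ (bitdec x)

  hf : ℤ → ℤ
  hf x = proj₁ (proj₂ (bitdec x))

  bit-spec : ∀ x → x ≡ BZ (bit x) + + 2 * hf x
  bit-spec x = proj₂ (proj₂ (bitdec x))

¬2∣1 : ¬ (+ 2 ∣ + 1)
¬2∣1 = ¬p∣1 prime[2]

¬2∣odd : ∀ q → ¬ (+ 2 ∣ + 1 + + 2 * q)
¬2∣odd q d = ¬2∣1 (∣m+n∣n⇒∣m d (∣m⇒∣m*n q ∣-refl))

+-cancel : ∀ a {b c} → a + b ≡ a + c → b ≡ c
+-cancel a {b} {c} q = trans (re a b) (trans (cong (_- a) q) (sym (re a c)))
  where
  re : ∀ a b → b ≡ a + b - a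
  re = solve-∀

bit-unique : ∀ b c {q r} → BZ b + + 2 * q ≡ BZ c + + 2 * r → b ≡ c × q ≡ r
bit-unique false false {q} {r} e = refl , *-cancelˡ {+ 2} (λ ()) (trans (sym (+-identityˡ (+ 2 * q))) (trans e (+-identityˡ (+ 2 * r))))
bit-unique true true {q} {r} e = refl , *-cancelˡ {+ 2} (λ ()) (+-cancel (+ 1) e)
bit-unique false true {q} {r} e = ⊥-elim (¬2∣odd r (subst (+ 2 ∣_) (trans (sym (+-identityˡ (+ 2 * q))) e) (∣m⇒∣m*n q ∣-refl)))
bit-unique true false {q} {r} e = ⊥-elim (¬2∣odd q (subst (+ 2 ∣_) (trans (sym (+-identityˡ (+ 2 * r))) (sym e)) (∣m⇒∣m*n r ∣-refl)))

bit-of : ∀ {x} b q → x ≡ BZ b + + 2 * q → bit x ≡ b × hf x ≡ q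
bit-of {x} b q e = bit-unique (bit x) b (trans (sym (bit-spec x)) e)

bit-+ : ∀ x y → bit (x + y) ≡ bit x xor bit y
bit-+ x y = proj₁ (bit-of (bit x xor bit y) (BZ (bit x ∧ bit y) + (hf x + hf y)) (trans (cong₂ _+_ (bit-spec x) (bit-spec y)) (go (bit x) (bit y))))
  where
  r0 : ∀ a b → (+ 0 + + 2 * a) + (+ 0 + + 2 * b) ≡ + 0 + + 2 * (+ 0 + (a + b))
  r0 = solve-∀
  r1 : ∀ a b → (+ 0 + + 2 * a) + (+ 1 + + 2 * b) ≡ + 1 + + 2 * (+ 0 + (a + b))
  r1 = solve-∀
  r2 : ∀ a b → (+ 1 + + 2 * a) + (+ 0 + + 2 * b) ≡ + 1 + + 2 * (+ 0 + (a + b))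
  r2 = solve-∀
  r3 : ∀ a b → (+ 1 + + 2 * a) + (+ 1 + + 2 * b) ≡ + 0 + + 2 * (+ 1 + (a + b))
  r3 = solve-∀
  go : ∀ b c → (BZ b + + 2 * hf x) + (BZ c + + 2 * hf y) ≡ BZ (b xor c) + + 2 * (BZ (b ∧ c) + (hf x + hf y))
  go false false = r0 (hf x) (hf y)
  go false true = r1 (hf x) (hf y)
  go true false = r2 (hf x) (hf y)
  go true true = r3 (hf x) (hf y)

bit-* : ∀ x y → bit (x * y) ≡ bit x ∧ bit y
bit-* x y = proj₁ (bit-of (bit x ∧ bit y) (BZ (bit x) * hf y + BZ (bit y) * hf x + + 2 * hf x * hf y)
    (trans (cong₂ _*_ (bit-spec x) (bit-spec y)) (trans (r (BZ (bit x)) (hf x) (BZ (bit y)) (hf y)) (cong (λ z → z + + 2 * (BZ (bit x) * hf y + BZ (bit y) * hf x + + 2 * hf x * hf y)) (go (bit x) (bit y))))))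
  where
  r : ∀ b x c y → (b + + 2 * x) * (c + + 2 * y) ≡ b * c + + 2 * (b * y + c * x + + 2 * x * y)
  r = solve-∀
  go : ∀ b c → BZ b * BZ c ≡ BZ (b ∧ c)
  go false false = refl
  go false true = refl
  go true false = refl
  go true true = refl

bit-BZ : ∀ b → bit (BZ b) ≡ b
bit-BZ b = proj₁ (bit-of b (+ 0) (sym (+-identityʳ (BZ b))))

bit-∣ : ∀ {x} → bit x ≡ false → + 2 ∣ x
bit-∣ {x} q = divides (hf x) (trans (bit-spec x) (trans (cong (λ b → BZ b + + 2 * hf x) q) (trans (+-identityˡ (+ 2 * hf x)) (*-comm (+ 2) (hf x)))))

bit-odd : ∀ {x} → ¬ (+ 2 ∣ x) → bit x ≡ true
bit-odd {x} n = go (bit x) refl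
  where
  go : ∀ b → bit x ≡ b → b ≡ true
  go true _ = refl
  go false q = ⊥-elim (n (bit-∣ q))

odd-spec : ∀ {u} → ¬ (+ 2 ∣ u) → u ≡ + 1 + + 2 * hf u
odd-spec {u} n = trans (bit-spec u) (cong (λ b → BZ b + + 2 * hf u) (bit-odd n))

-- For odd u these are the binary digits of u at 2 and at 4, and their sum; `ε₂` is (u - 1)/2 and
-- `ω₂` is (u² - 1)/8 modulo 2.
ε₂ β₂ ω₂ : ℤ → Bool
ε₂ u = bit (hf u)
β₂ u = bit (hf (hf u))
ω₂ u = ε₂ u xor β₂ u

odd-* : ∀ {u w} → ¬ (+ 2 ∣ u) → ¬ (+ 2 ∣ w) → hf (u * w) ≡ (hf u + hf w) + + 2 * (hf u * hf w)
odd-* {u} {w} nu nw = proj₂ (bit-of true ((hf u + hf w) + + 2 * (hf u * hf w)) (trans (cong₂ _*_ (odd-spec nu) (odd-spec nw)) (re (hf u) (hf w))))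
  where
  re : ∀ a b → (+ 1 + + 2 * a) * (+ 1 + + 2 * b) ≡ + 1 + + 2 * ((a + b) + + 2 * (a * b))
  re = solve-∀

ε₂-* : ∀ {u w} → ¬ (+ 2 ∣ u) → ¬ (+ 2 ∣ w) → ε₂ (u * w) ≡ ε₂ u xor ε₂ w
ε₂-* {u} {w} nu nw = trans (cong bit (odd-* nu nw)) (trans (bit-+ (hf u + hf w) (+ 2 * (hf u * hf w)))
  (trans (cong₂ _xor_ (bit-+ (hf u) (hf w)) (trans (bit-* (+ 2) (hf u * hf w)) (cong (_∧ bit (hf u * hf w)) (proj₁ (bit-of {+ 2} false (+ 1) refl))))) (xor-identityʳ (ε₂ u xor ε₂ w))))

-- `β₂` is a character as well, trivial at 1 and 3 modulo 8: the carry in the sum of the halves and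
-- their product both contribute `ε₂ u ∧ ε₂ w` and cancel.
β₂-* : ∀ {u w} → ¬ (+ 2 ∣ u) → ¬ (+ 2 ∣ w) → β₂ (u * w) ≡ β₂ u xor β₂ w
β₂-* {u} {w} nu nw = trans (cong (λ z → bit (hf z)) (odd-* nu nw)) (trans (cong bit hh) (trans (bit-+ (BZ (ε₂ u ∧ ε₂ w) + (hf U + hf W)) (U * W))
    (trans (cong₂ _xor_ (trans (bit-+ (BZ (ε₂ u ∧ ε₂ w)) (hf U + hf W)) (cong₂ _xor_ (bit-BZ (ε₂ u ∧ ε₂ w)) (bit-+ (hf U) (hf W)))) (bit-* U W))
      (taut 4 (λ { (a ∷ b ∷ c ∷ d ∷ []) → ((a ∧ b) xor (c xor d)) xor (a ∧ b) }) (λ { (a ∷ b ∷ c ∷ d ∷ []) → c xor d }) refl (ε₂ u ∷ ε₂ w ∷ β₂ u ∷ β₂ w ∷ [])))))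
  where
  U W : ℤ
  U = hf u
  W = hf w
  r : ∀ b x c y p → (b + + 2 * x) + (c + + 2 * y) + + 2 * p ≡ (b + c) + + 2 * ((x + y) + p)
  r = solve-∀
  r′ : ∀ d e s p → (d + + 2 * e) + + 2 * (s + p) ≡ d + + 2 * (e + s + p)
  r′ = solve-∀
  go : ∀ b c → BZ b + BZ c ≡ BZ (b xor c) + + 2 * BZ (b ∧ c)
  go false false = refl
  go false true = refl
  go true false = refl
  go true true = refl
  hh : hf ((U + W) + + 2 * (U * W)) ≡ BZ (ε₂ u ∧ ε₂ w) + (hf U + hf W) + U * W
  hh = proj₂ (bit-of (ε₂ u xor ε₂ w) (BZ (ε₂ u ∧ ε₂ w) + (hf U + hf W) + U * W)
    (trans (cong₂ (λ s t → s + t + + 2 * (U * W)) (bit-spec U) (bit-spec W)) (trans (r (BZ (bit U)) (hf U) (BZ (bit W)) (hf W) (U * W))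
      (trans (cong (λ z → z + + 2 * ((hf U + hf W) + U * W)) (go (bit U) (bit W))) (r′ (BZ (bit U xor bit W)) (BZ (bit U ∧ bit W)) (hf U + hf W) (U * W))))))

mod8 : ∀ {u} → ¬ (+ 2 ∣ u) → ∃ λ q → u ≡ + 1 + + 2 * (BZ (ε₂ u) + + 2 * (BZ (β₂ u) + + 2 * q))
mod8 {u} n = hf (hf (hf u)) , trans (odd-spec n) (cong (λ z → + 1 + + 2 * z) (trans (bit-spec (hf u)) (cong (λ z → BZ (ε₂ u) + + 2 * z) (bit-spec (hf (hf u))))))

abstract
  hensel-2 : ∀ {w} → + 8 ∣ w - + 1 → Root 2 w
  hensel-2 {w} (divides c₀ e₀) = ((λ k → x k) , λ k → ∣⇒∣ᵤ (coh k)) , root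
    where
    st : ℕ → ℤ × ℤ
    st zero = + 1 , - c₀
    st (suc m) = proj₁ (st m) - pk 2 (suc (suc m)) * proj₂ (st m) , - (proj₂ (st m) * hf (proj₁ (st m))) + pk 2 m * (proj₂ (st m) * proj₂ (st m))
    x c : ℕ → ℤ
    x m = proj₁ (st m)
    c m = proj₂ (st m)
    r0 : ∀ w c → w - + 1 ≡ c * + 8 → + 1 * + 1 - w ≡ + 8 * - c
    r0 w c e = trans (q1 w) (trans (cong -_ e) (q2 c))
      where
      q1 : ∀ w → + 1 * + 1 - w ≡ - (w - + 1)
      q1 = solve-∀
      q2 : ∀ c → - (c * + 8) ≡ + 8 * - c
      q2 = solve-∀
    r1 : ∀ x P c w → (x - P * c) * (x - P * c) - w ≡ (x * x - w) + (- (+ 2) * P * c * x + P * P * (c * c))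
    r1 = solve-∀
    r2 : ∀ Q c h → + 8 * Q * c + (- (+ 2) * (+ 4 * Q) * c * (+ 1 + + 2 * h) + (+ 4 * Q) * (+ 4 * Q) * (c * c)) ≡ + 16 * Q * (- (c * h) + Q * (c * c))
    r2 = solve-∀
    p4 : ∀ m → pk 2 (suc (suc m)) ≡ + 4 * pk 2 m
    p4 m = trans (pk-suc 2 (suc m)) (trans (cong (+ 2 *_) (pk-suc 2 m)) (sym (*-assoc (+ 2) (+ 2) (pk 2 m))))
    p8 : ∀ m → + 16 * pk 2 m ≡ + 8 * pk 2 (suc m)
    p8 m = trans (*-assoc (+ 8) (+ 2) (pk 2 m)) (cong (+ 8 *_) (sym (pk-suc 2 m)))
    odd : ∀ m → ¬ (+ 2 ∣ x m)
    odd zero = ¬2∣1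
    odd (suc m) d = odd m (∣m+n∣n⇒∣m d (∣m⇒∣-m (∣m⇒∣m*n (c m) (p∣pk 2 (suc m)))))
    inv : ∀ m → x m * x m - w ≡ + 8 * pk 2 m * c m
    inv zero = r0 w c₀ e₀
    inv (suc m) = trans (r1 (x m) (pk 2 (suc (suc m))) (c m) w) (trans (cong₂ _+_ (inv m) (cong₂ (λ P y → - (+ 2) * P * c m * y + P * P * (c m * c m)) (p4 m) (odd-spec (odd m))))
      (trans (r2 (pk 2 m) (c m) (hf (x m))) (cong (_* c (suc m)) (p8 m))))
    rc : ∀ x y → x - y - x ≡ - y
    rc = solve-∀
    coh : ∀ k → pk 2 k ∣ x (suc k) - x k
    coh k = subst (pk 2 k ∣_) (sym (rc (x k) (pk 2 (suc (suc k)) * c k))) (∣m⇒∣-m (∣m⇒∣m*n (c k) (pk-∣ 2 (≤-trans (ℕP.n≤1+n k) (ℕP.n≤1+n (suc k))))))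
    root : ∀ k → pk 2 k ∣ x k * x k - w
    root k = subst (pk 2 k ∣_) (sym (inv k)) (∣m⇒∣m*n (c k) (∣n⇒∣m*n (+ 8) ∣-refl))

form8 : Bool → Bool → ℤ → ℤ
form8 b b′ q = + 1 + + 2 * (BZ b + + 2 * (BZ b′ + + 2 * q))

two : Bool → ℤ
two s = if s then + 2 else + 1

-- The dyadic symbol of 2ˢu and 2ᵗv, with exponent ε(u)ε(v) + sω(v) + tω(u); `b`, `b′` and `c`, `c′`
-- are the digits of u and v at 2 and at 4.
F₂ : Bool → Bool → Bool → Bool → Bool → Bool → Bool
F₂ s t b b′ c c′ = (b ∧ c) xor ((s ∧ (c xor c′)) xor (t ∧ (b xor b′)))

F₂-comm : ∀ s t b b′ c c′ → F₂ s t b b′ c c′ ≡ F₂ t s c c′ b b′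
F₂-comm s t b b′ c c′ = cong₂ _xor_ (BoolP.∧-comm b c) (xor-comm (s ∧ (c xor c′)) (t ∧ (b xor b′)))

root2-unit : ∀ {w} → + 8 ∣ w - + 1 → (r : Root 2 w) → ¬ Zero (proj₁ r)
root2-unit {w} d8 (z , rt) zz = ¬2∣1 (∣-lc3 (rt 1) (zz 1) (∣-tr (divides (+ 4) refl) d8) (- (+ 1)) (seq z 1) (- (+ 1)) (re (seq z 1) w))
  where
  re : ∀ z w → + 1 ≡ - (+ 1) * (z * z - w) + z * z + - (+ 1) * (w - + 1)
  re = solve-∀

abstract
  sol-root : ∀ A B x y → + 8 ∣ A * (x * x) + B * (y * y) - + 1 → Sol3 2 (+ 1) A B
  sol-root A B x y d = Zc x , Zc y , proj₁ rt , (λ (_ , _ , z) → root2-unit d rt z) , λ k → ∣-lc1 (proj₂ rt k) (+ 1) (re (seq (proj₁ rt) k * seq (proj₁ rt) k) (A * (x * x) + B * (y * y)))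
    where
    rt : Root 2 (A * (x * x) + B * (y * y))
    rt = hensel-2 d
    re : ∀ Z w → + 1 * Z - w ≡ + 1 * (Z - w)
    re = solve-∀

  sol-root4 : ∀ A B x y w → A * (x * x) + B * (y * y) ≡ + 4 * w → + 8 ∣ w - + 1 → Sol3 2 (+ 1) A B
  sol-root4 A B x y w e d = Zc x , Zc y , Z* (+ 2) (proj₁ rt) , (λ (_ , _ , z) → root2-unit d rt (zero-cancel prime[2] {+ 2} (λ ()) (proj₁ rt) z)) ,
      λ k → ∣-lc1 (proj₂ rt k) (+ 4) (trans (cong (λ t → + 1 * (+ 2 * seq (proj₁ rt) k * (+ 2 * seq (proj₁ rt) k)) - t) e) (re (seq (proj₁ rt) k) w))
    where
    rt : Root 2 w
    rt = hensel-2 d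
    re : ∀ z w → + 1 * (+ 2 * z * (+ 2 * z)) - + 4 * w ≡ + 4 * (z * z - w)
    re = solve-∀

  sol-hyp : ∀ u v → u ≢ + 0 → + 8 ∣ - (u * v) - + 1 → Sol3 2 (+ 1) (+ 2 * u) (+ 2 * v)
  sol-hyp u v u0 d = proj₁ rt , Zc u , Zc (+ 0) , (λ (_ , y , _) → u0 (zero-const prime[2] y)) , λ k → ∣-lc1 (proj₂ rt k) (- (+ 2 * u)) (re (seq (proj₁ rt) k) u v)
    where
    rt : Root 2 (- (u * v))
    rt = hensel-2 d
    re : ∀ w u v → + 1 * (+ 0 * + 0) - (+ 2 * u * (w * w) + + 2 * v * (u * u)) ≡ - (+ 2 * u) * (w * w - - (u * v))
    re = solve-∀

  sol-swap : ∀ A B → Sol3 2 (+ 1) A B → Sol3 2 (+ 1) B A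
  sol-swap A B (x , y , z , nt , e) = y , x , z , (λ (b , a , c) → nt (a , b , c)) , λ k → subst (λ t → pk 2 k ∣ + 1 * (seq z k * seq z k) - t) (ℤP.+-comm (A * (seq x k * seq x k)) (B * (seq y k * seq y k))) (e k)

  -- A unit u ≡ 1 modulo 4 represents, together with any unit v, a number ≡ 1 modulo 8: u itself, or
  -- u + 4v when u ≡ 5.
  solve-unit : ∀ b′ c c′ q r → Sol3 2 (+ 1) (+ 1 * form8 false b′ q) (+ 1 * form8 c c′ r)
  solve-unit false c c′ q r = sol-root (+ 1 * form8 false false q) (+ 1 * V) (+ 1) (+ 0) (divides q (re q V))
    where
    V : ℤ
    V = form8 c c′ r
    re : ∀ q V → + 1 * (+ 1 + + 2 * (+ 0 + + 2 * (+ 0 + + 2 * q))) * (+ 1 * + 1) + + 1 * V * (+ 0 * + 0) - + 1 ≡ q * + 8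
    re = solve-∀
  solve-unit true c c′ q r = sol-root (+ 1 * form8 false true q) (+ 1 * (+ 1 + + 2 * V)) (+ 1) (+ 2) (divides (+ 1 + q + V) (re q V))
    where
    V : ℤ
    V = BZ c + + 2 * (BZ c′ + + 2 * r)
    re : ∀ q V → + 1 * (+ 1 + + 2 * (+ 0 + + 2 * (+ 1 + + 2 * q))) * (+ 1 * + 1) + + 1 * (+ 1 + + 2 * V) * (+ 2 * + 2) - + 1 ≡ (+ 1 + q + V) * + 8
    re = solve-∀

  -- Either v ≡ 1 modulo 8 or the sum 2u + v is; the remaining residues have symbol -1.
  solve-mixed : ∀ b b′ c c′ q r → F₂ true false b b′ c c′ ≡ false → Sol3 2 (+ 1) (+ 2 * form8 b b′ q) (+ 1 * form8 c c′ r)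
  solve-mixed b b′ false false q r _ = sol-root (+ 2 * U) (+ 1 * form8 false false r) (+ 0) (+ 1) (divides r (re r U))
    where
    U : ℤ
    U = form8 b b′ q
    re : ∀ q V → + 2 * V * (+ 0 * + 0) + + 1 * (+ 1 + + 2 * (+ 0 + + 2 * (+ 0 + + 2 * q))) * (+ 1 * + 1) - + 1 ≡ q * + 8
    re = solve-∀
  solve-mixed false b′ true true q r _ = sol-root (+ 2 * form8 false b′ q) (+ 1 * form8 true true r) (+ 1) (+ 1) (divides (+ 1 + r + (BZ b′ + + 2 * q)) (re r (BZ b′ + + 2 * q)))
    where
    re : ∀ r t → + 2 * (+ 1 + + 2 * (+ 0 + + 2 * t)) * (+ 1 * + 1) + + 1 * (+ 1 + + 2 * (+ 1 + + 2 * (+ 1 + + 2 * r))) * (+ 1 * + 1) - + 1 ≡ (+ 1 + r + t) * + 8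
    re = solve-∀
  solve-mixed true b′ true false q r _ = sol-root (+ 2 * form8 true b′ q) (+ 1 * form8 true false r) (+ 1) (+ 1) (divides (+ 1 + r + (BZ b′ + + 2 * q)) (re r (BZ b′ + + 2 * q)))
    where
    re : ∀ r t → + 2 * (+ 1 + + 2 * (+ 1 + + 2 * t)) * (+ 1 * + 1) + + 1 * (+ 1 + + 2 * (+ 1 + + 2 * (+ 0 + + 2 * r))) * (+ 1 * + 1) - + 1 ≡ (+ 1 + r + t) * + 8
    re = solve-∀
  solve-mixed false b′ false true q r ()
  solve-mixed true b′ false true q r ()
  solve-mixed false b′ true false q r ()
  solve-mixed true b′ true true q r ()

  solve2 : ∀ s t b b′ c c′ q r → F₂ s t b b′ c c′ ≡ false → Sol3 2 (+ 1) (two s * form8 b b′ q) (two t * form8 c c′ r)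
  solve2 false false false b′ c c′ q r _ = solve-unit b′ c c′ q r
  solve2 false false true b′ false c′ q r _ = sol-swap (+ 1 * form8 false c′ r) (+ 1 * form8 true b′ q) (solve-unit c′ true b′ r q)
  solve2 false false true b′ true c′ q r ()
  solve2 true false b b′ c c′ q r h = solve-mixed b b′ c c′ q r h
  solve2 false true b b′ c c′ q r h = sol-swap (+ 2 * form8 c c′ r) (+ 1 * form8 b b′ q) (solve-mixed c c′ b b′ r q (trans (F₂-comm true false c c′ b b′) h))
  solve2 true true b b′ c c′ q r h = tt2 b b′ c c′ h
    where
    hyp : ∀ b b′ c c′ k → - (form8 b b′ q * form8 c c′ r) - + 1 ≡ k * + 8 → Sol3 2 (+ 1) (+ 2 * form8 b b′ q) (+ 2 * form8 c c′ r)
    hyp b b′ c c′ k e = sol-hyp (form8 b b′ q) (form8 c c′ r) (λ z → ¬2∣odd (BZ b + + 2 * (BZ b′ + + 2 * q)) (subst (+ 2 ∣_) (sym z) p∣0)) (divides k e)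
    -- With u + v = 2 + 8k the point (1, 1) has value 4(1 + 4k), which is good for even k; for odd k
    -- the point (1, 3) adds 16v and corrects the residue.
    quad : ∀ u v k → u + v ≡ + 2 + + 8 * k → (∃ λ w → v ≡ + 1 + + 2 * w) → Sol3 2 (+ 1) (+ 2 * u) (+ 2 * v)
    quad u v k e (w , ev) = go (bit k) (hf k) (bit-spec k)
      where
      r1 : ∀ u v → + 2 * u * (+ 1 * + 1) + + 2 * v * (+ 1 * + 1) ≡ + 2 * (u + v)
      r1 = solve-∀
      r2 : ∀ u v → + 2 * u * (+ 1 * + 1) + + 2 * v * (+ 3 * + 3) ≡ + 2 * (u + v) + + 16 * v
      r2 = solve-∀
      r3 : ∀ h → + 2 * (+ 2 + + 8 * (+ 0 + + 2 * h)) ≡ + 4 * (+ 1 + h * + 8)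
      r3 = solve-∀
      r4 : ∀ h w → + 2 * (+ 2 + + 8 * (+ 1 + + 2 * h)) + + 16 * (+ 1 + + 2 * w) ≡ + 4 * (+ 1 + (+ 1 + h + w) * + 8)
      r4 = solve-∀
      r5 : ∀ h → + 1 + h - + 1 ≡ h
      r5 = solve-∀
      go : ∀ b h → k ≡ BZ b + + 2 * h → Sol3 2 (+ 1) (+ 2 * u) (+ 2 * v)
      go false h ek = sol-root4 (+ 2 * u) (+ 2 * v) (+ 1) (+ 1) (+ 1 + h * + 8) (trans (r1 u v) (trans (cong (+ 2 *_) (trans e (cong (λ z → + 2 + + 8 * z) ek))) (r3 h))) (divides h (r5 (h * + 8)))
      go true h ek = sol-root4 (+ 2 * u) (+ 2 * v) (+ 1) (+ 3) (+ 1 + (+ 1 + h + w) * + 8) (trans (r2 u v) (trans (cong₂ (λ s t → + 2 * s + + 16 * t) (trans e (cong (λ z → + 2 + + 8 * z) ek)) ev) (r4 h w))) (divides (+ 1 + h + w) (r5 ((+ 1 + h + w) * + 8)))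
    q00 : ∀ q r → (+ 1 + + 2 * (+ 0 + + 2 * (+ 0 + + 2 * q))) + (+ 1 + + 2 * (+ 0 + + 2 * (+ 0 + + 2 * r))) ≡ + 2 + + 8 * (q + r)
    q00 = solve-∀
    q01 : ∀ q r → (+ 1 + + 2 * (+ 0 + + 2 * (+ 1 + + 2 * q))) + (+ 1 + + 2 * (+ 0 + + 2 * (+ 1 + + 2 * r))) ≡ + 2 + + 8 * (+ 1 + q + r)
    q01 = solve-∀
    q10 : ∀ q r → (+ 1 + + 2 * (+ 1 + + 2 * (+ 0 + + 2 * q))) + (+ 1 + + 2 * (+ 1 + + 2 * (+ 1 + + 2 * r))) ≡ + 2 + + 8 * (+ 1 + q + r)
    q10 = solve-∀
    q11 : ∀ q r → (+ 1 + + 2 * (+ 1 + + 2 * (+ 1 + + 2 * q))) + (+ 1 + + 2 * (+ 1 + + 2 * (+ 0 + + 2 * r))) ≡ + 2 + + 8 * (+ 1 + q + r)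
    q11 = solve-∀
    h1 : ∀ q r → - ((+ 1 + + 2 * (+ 0 + + 2 * (+ 0 + + 2 * q))) * (+ 1 + + 2 * (+ 1 + + 2 * (+ 1 + + 2 * r)))) - + 1 ≡ (- (+ 1) - r - + 7 * q - + 8 * (q * r)) * + 8
    h1 = solve-∀
    h2 : ∀ q r → - ((+ 1 + + 2 * (+ 0 + + 2 * (+ 1 + + 2 * q))) * (+ 1 + + 2 * (+ 1 + + 2 * (+ 0 + + 2 * r)))) - + 1 ≡ (- (+ 2) - + 5 * r - + 3 * q - + 8 * (q * r)) * + 8
    h2 = solve-∀
    h3 : ∀ q r → - ((+ 1 + + 2 * (+ 1 + + 2 * (+ 0 + + 2 * q))) * (+ 1 + + 2 * (+ 0 + + 2 * (+ 1 + + 2 * r)))) - + 1 ≡ (- (+ 2) - + 3 * r - + 5 * q - + 8 * (q * r)) * + 8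
    h3 = solve-∀
    h4 : ∀ q r → - ((+ 1 + + 2 * (+ 1 + + 2 * (+ 1 + + 2 * q))) * (+ 1 + + 2 * (+ 0 + + 2 * (+ 0 + + 2 * r)))) - + 1 ≡ (- (+ 1) - + 7 * r - q - + 8 * (q * r)) * + 8
    h4 = solve-∀
    tt2 : ∀ b b′ c c′ → F₂ true true b b′ c c′ ≡ false → Sol3 2 (+ 1) (+ 2 * form8 b b′ q) (+ 2 * form8 c c′ r)
    tt2 false false false false _ = quad (form8 false false q) (form8 false false r) (q + r) (q00 q r) (BZ false + + 2 * (BZ false + + 2 * r) , refl)
    tt2 false true false true _ = quad (form8 false true q) (form8 false true r) (+ 1 + q + r) (q01 q r) (BZ false + + 2 * (BZ true + + 2 * r) , refl)
    tt2 true false true true _ = quad (form8 true false q) (form8 true true r) (+ 1 + q + r) (q10 q r) (BZ true + + 2 * (BZ true + + 2 * r) , refl)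
    tt2 true true true false _ = quad (form8 true true q) (form8 true false r) (+ 1 + q + r) (q11 q r) (BZ true + + 2 * (BZ false + + 2 * r) , refl)
    tt2 false false true true _ = hyp false false true true (- (+ 1) - r - + 7 * q - + 8 * (q * r)) (h1 q r)
    tt2 false true true false _ = hyp false true true false (- (+ 2) - + 5 * r - + 3 * q - + 8 * (q * r)) (h2 q r)
    tt2 true false false true _ = hyp true false false true (- (+ 2) - + 3 * r - + 5 * q - + 8 * (q * r)) (h3 q r)
    tt2 true true false false _ = hyp true true false false (- (+ 1) - + 7 * r - q - + 8 * (q * r)) (h4 q r)
    tt2 false false false true ()
    tt2 false true false false ()
    tt2 false false true false ()
    tt2 false true true true ()
    tt2 true false false false ()
    tt2 true true false true ()
    tt2 true false true false ()
    tt2 true true true true ()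

-- The squares modulo 16: 0 and 4 for even arguments, 1 and 9 for odd ones.
sqv : Bool → Bool → ℕ
sqv false b = 4 *ᴺ BN b
sqv true  b = 1 +ᴺ 8 *ᴺ BN b

abstract
  sq16 : ∀ x → Σ Bool λ b → + 16 ∣ x * x - + sqv (bit x) b
  sq16 x = go (bit x) refl
    where
    y : ℤ
    y = hf x
    re0 : ∀ b q → (+ 0 + + 2 * (b + + 2 * q)) * (+ 0 + + 2 * (b + + 2 * q)) ≡ + 4 * (b * b) + (b * q + q * q) * + 16
    re0 = solve-∀
    re1 : ∀ s t → s + t - s ≡ t
    re1 = solve-∀
    re2 : ∀ y → (+ 1 + + 2 * y) * (+ 1 + + 2 * y) ≡ + 1 + + 4 * (y * (y + + 1))
    re2 = solve-∀
    re3 : ∀ b h → + 1 + + 4 * ((b + + 2 * h) * + 2) - (+ 1 + + 8 * b) ≡ h * + 16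
    re3 = solve-∀
    bb : ∀ b → + 4 * (BZ b * BZ b) ≡ + (4 *ᴺ BN b)
    bb false = refl
    bb true = refl
    cc : ∀ b → + 1 + + 8 * BZ b ≡ + (1 +ᴺ 8 *ᴺ BN b)
    cc false = refl
    cc true = refl
    ev : + 2 ∣ y * (y + + 1)
    ev = bit-∣ (trans (bit-* y (y + + 1)) (trans (cong (bit y ∧_) (trans (bit-+ y (+ 1)) (cong (bit y xor_) (bit-BZ true)))) (taut 1 (λ { (b ∷ []) → b ∧ (b xor true) }) (λ _ → false) refl (bit y ∷ []))))
    go : ∀ b → bit x ≡ b → Σ Bool λ b′ → + 16 ∣ x * x - + sqv b b′
    go false q = bit y , divides (BZ (bit y) * hf y + hf y * hf y) (trans (cong₂ _-_ (trans (cong (λ z → z * z) (trans (bit-spec x) (cong₂ (λ b t → BZ b + + 2 * t) q (bit-spec y)))) (re0 (BZ (bit y)) (hf y))) (sym (bb (bit y))))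
      (re1 (+ 4 * (BZ (bit y) * BZ (bit y))) ((BZ (bit y) * hf y + hf y * hf y) * + 16)))
    go true q = odd ev
      where
      odd : + 2 ∣ y * (y + + 1) → Σ Bool λ b′ → + 16 ∣ x * x - + sqv true b′
      odd (divides t e) = bit t , divides (hf t) (trans (cong₂ _-_ (trans (cong (λ z → z * z) (trans (bit-spec x) (cong (λ b → BZ b + + 2 * y) q))) (trans (re2 y) (cong (λ z → + 1 + + 4 * z) (trans e (cong (_* + 2) (bit-spec t)))))) (sym (cc (bit t)))) (re3 (BZ (bit t)) (hf t)))

af : Bool → Bool → Bool → Bool → ℕ
af s b b′ b″ = (if s then 2 else 1) *ᴺ (1 +ᴺ 2 *ᴺ (BN b +ᴺ 2 *ᴺ (BN b′ +ᴺ 2 *ᴺ BN b″)))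

-- Anisotropy modulo 16 by exhaustion. Each coefficient enters through a factor 1 or 2 and three
-- binary digits of its odd part, each variable through its parity and its square: 2¹⁴ cases in all.
chk : Vec Bool 14 → Bool
chk (s ∷ t ∷ b ∷ b′ ∷ b″ ∷ c ∷ c′ ∷ c″ ∷ x ∷ x′ ∷ y ∷ y′ ∷ z ∷ z′ ∷ []) =
  if F₂ s t b b′ c c′ ∧ does ((af s b b′ b″ *ᴺ sqv x x′ +ᴺ af t c c′ c″ *ᴺ sqv y y′) ℕ.% 16 ℕ.≟ sqv z z′)
  then not x ∧ (not y ∧ not z) else true

abstract
  chk-all : ∀ v → chk v ≡ true
  chk-all = allB-sound 14 chk refl

sqv<16 : ∀ b c → sqv b c < 16
sqv<16 false false = s≤s z≤n
sqv<16 false true = toWitness {a? = 4 ℕ.<? 16} tt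
sqv<16 true false = toWitness {a? = 1 ℕ.<? 16} tt
sqv<16 true true = toWitness {a? = 9 ℕ.<? 16} tt

abstract
  aniso2 : ∀ s t b b′ c c′ q r → F₂ s t b b′ c c′ ≡ true → Aniso 2 4 (two s * form8 b b′ q) (two t * form8 c c′ r)
  aniso2 s t b b′ c c′ q r h x y z d = ev x (proj₁ fin) , ev y (proj₁ (proj₂ fin)) , ev z (proj₂ (proj₂ fin))
    where
    A B : ℤ
    A = two s * form8 b b′ q
    B = two t * form8 c c′ r
    X Y Z : ℕ
    X = sqv (bit x) (proj₁ (sq16 x))
    Y = sqv (bit y) (proj₁ (sq16 y))
    Z = sqv (bit z) (proj₁ (sq16 z))
    a₀ b₀ : ℕ
    a₀ = af s b b′ (bit q)
    b₀ = af t c c′ (bit r)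
    re1 : ∀ a b c e f → a * (+ 1 + + 2 * (b + + 2 * (c + + 2 * (e + + 2 * f)))) - a * (+ 1 + + 2 * (b + + 2 * (c + + 2 * e))) ≡ a * f * + 16
    re1 = solve-∀
    afZ : ∀ s b b′ e → + af s b b′ e ≡ two s * (+ 1 + + 2 * (BZ b + + 2 * (BZ b′ + + 2 * BZ e)))
    afZ false false false false = refl
    afZ false false false true = refl
    afZ false false true false = refl
    afZ false false true true = refl
    afZ false true false false = refl
    afZ false true false true = refl
    afZ false true true false = refl
    afZ false true true true = refl
    afZ true false false false = refl
    afZ true false false true = refl
    afZ true false true false = refl
    afZ true false true true = refl
    afZ true true false false = refl
    afZ true true false true = refl
    afZ true true true false = refl
    afZ true true true true = refl
    dA : ∀ s b b′ q → + 16 ∣ two s * form8 b b′ q - + af s b b′ (bit q)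
    dA s b b′ q = divides (two s * hf q) (trans (cong₂ _-_ (cong (λ z → two s * (+ 1 + + 2 * (BZ b + + 2 * (BZ b′ + + 2 * z)))) (bit-spec q)) (afZ s b b′ (bit q))) (re1 (two s) (BZ b) (BZ b′) (BZ (bit q)) (hf q)))
    re2 : ∀ A B a b → A * B - a * b ≡ B * (A - a) + a * (B - b)
    re2 = solve-∀
    mulc : ∀ {A B a b} → + 16 ∣ A - a → + 16 ∣ B - b → + 16 ∣ A * B - a * b
    mulc {A} {B} {a} {b} p p′ = ∣-lc2 p p′ B a (re2 A B a b)
    re3 : ∀ zz P Q Z p q → Z - (p + q) ≡ + 1 * (zz - (P + Q)) + - (+ 1) * (zz - Z) + + 1 * ((P - p) + (Q - q))
    re3 = solve-∀
    main : + 16 ∣ + Z - (+ a₀ * + X + + b₀ * + Y)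
    main = ∣-lc3 d (proj₂ (sq16 z)) (∣m∣n⇒∣m+n (mulc {A} {x * x} {+ a₀} {+ X} (dA s b b′ q) (proj₂ (sq16 x))) (mulc {B} {y * y} {+ b₀} {+ Y} (dA t c c′ r) (proj₂ (sq16 y))))
      (+ 1) (- (+ 1)) (+ 1) (re3 (z * z) (A * (x * x)) (B * (y * y)) (+ Z) (+ a₀ * + X) (+ b₀ * + Y))
    W : ℕ
    W = a₀ *ᴺ X +ᴺ b₀ *ᴺ Y
    WZ : + W ≡ + a₀ * + X + + b₀ * + Y
    WZ = trans (pos-+ (a₀ *ᴺ X) (b₀ *ᴺ Y)) (cong₂ _+_ (ℤP.pos-* a₀ X) (ℤP.pos-* b₀ Y))
    dW : + 16 ∣ + W - + (W ℕ.% 16)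
    dW = divides (+ (W ℕ./ 16)) (trans (cong (_- + (W ℕ.% 16)) (trans (cong +_ (ℕM.m≡m%n+[m/n]*n W 16)) (trans (pos-+ (W ℕ.% 16) (W ℕ./ 16 *ᴺ 16)) (+ˡ (+ (W ℕ.% 16)) (ℤP.pos-* (W ℕ./ 16) 16))))) (re4 (+ (W ℕ.% 16)) (+ (W ℕ./ 16) * + 16)))
      where
      re4 : ∀ s t → s + t - s ≡ t
      re4 = solve-∀
    eq : W ℕ.% 16 ≡ Z
    eq = sym (small-≡ (sqv<16 (bit z) (proj₁ (sq16 z))) (ℕM.m%n<n W 16) (∣-trans- (+ Z) (+ W) (+ (W ℕ.% 16)) (subst (λ k → + 16 ∣ + Z - k) (sym WZ) main) dW))
    not-inj : ∀ {b} → not b ≡ true → b ≡ false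
    not-inj {false} _ = refl
    Fin3 : Set
    Fin3 = bit x ≡ false × bit y ≡ false × bit z ≡ false
    conc : not (bit x) ∧ (not (bit y) ∧ not (bit z)) ≡ true → Fin3
    conc e = not-inj (proj₁ (∧-true e)) , not-inj (proj₁ (∧-true (proj₂ (∧-true {not (bit x)} e)))) , not-inj (proj₂ (∧-true {not (bit y)} (proj₂ (∧-true {not (bit x)} e))))
    fin : Fin3
    fin = conc (trans (sym (cong (λ g → if g then not (bit x) ∧ (not (bit y) ∧ not (bit z)) else true) (cong₂ _∧_ h (dec-true (W ℕ.% 16 ℕ.≟ Z) eq))))
      (chk-all (s ∷ t ∷ b ∷ b′ ∷ bit q ∷ c ∷ c′ ∷ bit r ∷ bit x ∷ proj₁ (sq16 x) ∷ bit y ∷ proj₁ (sq16 y) ∷ bit z ∷ proj₁ (sq16 z) ∷ [])))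
    ev : ∀ w → bit w ≡ false → + 2 ∣ w
    ev w = bit-∣

h2 : ℤ → ℤ → Bool
h2 a b = F₂ (vp 2 a) (vp 2 b) (ε₂ (unit 2 a)) (β₂ (unit 2 a)) (ε₂ (unit 2 b)) (β₂ (unit 2 b))

dyadicSymbol : LocalSymbol 2
dyadicSymbol = record
  { prime = prime[2] ; h = h2
  ; h-comm = λ a b → F₂-comm (vp 2 a) (vp 2 b) (ε₂ (unit 2 a)) (β₂ (unit 2 a)) (ε₂ (unit 2 b)) (β₂ (unit 2 b))
  ; h-*ˡ = λ {a} {b} a0 b0 c → trans (cong₂ (λ s u → F₂ s (vp 2 c) (ε₂ u) (β₂ u) (ε₂ (unit 2 c)) (β₂ (unit 2 c))) (vp-* prime[2] a0 b0) (proj₂ (val-* prime[2] a0 b0)))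
      (trans (cong₂ (λ x y → F₂ (vp 2 a xor vp 2 b) (vp 2 c) x y (ε₂ (unit 2 c)) (β₂ (unit 2 c))) (ε₂-* (unit-∤ prime[2] a0) (unit-∤ prime[2] b0)) (β₂-* (unit-∤ prime[2] a0) (unit-∤ prime[2] b0)))
       (taut 9 (λ { (s ∷ s₁ ∷ t ∷ b ∷ b₁ ∷ b′ ∷ b₁′ ∷ c ∷ c′ ∷ []) → ((b xor b₁) ∧ c) xor (((s xor s₁) ∧ (c xor c′)) xor (t ∧ ((b xor b₁) xor (b′ xor b₁′)))) })
         (λ { (s ∷ s₁ ∷ t ∷ b ∷ b₁ ∷ b′ ∷ b₁′ ∷ c ∷ c′ ∷ []) → ((b ∧ c) xor ((s ∧ (c xor c′)) xor (t ∧ (b xor b′)))) xor ((b₁ ∧ c) xor ((s₁ ∧ (c xor c′)) xor (t ∧ (b₁ xor b₁′)))) }) refl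
         (vp 2 a ∷ vp 2 b ∷ vp 2 c ∷ ε₂ (unit 2 a) ∷ ε₂ (unit 2 b) ∷ β₂ (unit 2 a) ∷ β₂ (unit 2 b) ∷ ε₂ (unit 2 c) ∷ β₂ (unit 2 c) ∷ [])))
  ; solve = λ {a} {b} a0 b0 q → subst₂ (Sol3 2 (+ 1)) (sym (rd a a0)) (sym (rd b b0)) (solve2 (vp 2 a) (vp 2 b) (ε₂ (unit 2 a)) (β₂ (unit 2 a)) (ε₂ (unit 2 b)) (β₂ (unit 2 b)) (proj₁ (mod8 (unit-∤ prime[2] a0))) (proj₁ (mod8 (unit-∤ prime[2] b0))) q)
  ; aniso = λ {a} {b} a0 b0 q → 4 , subst₂ (Aniso 2 4) (sym (rd a a0)) (sym (rd b b0)) (aniso2 (vp 2 a) (vp 2 b) (ε₂ (unit 2 a)) (β₂ (unit 2 a)) (ε₂ (unit 2 b)) (β₂ (unit 2 b)) (proj₁ (mod8 (unit-∤ prime[2] a0))) (proj₁ (mod8 (unit-∤ prime[2] b0))) q) }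
  where
  rd : ∀ a (a0 : a ≢ + 0) → red 2 a ≡ two (vp 2 a) * form8 (ε₂ (unit 2 a)) (β₂ (unit 2 a)) (proj₁ (mod8 (unit-∤ prime[2] a0)))
  rd a a0 = cong (two (vp 2 a) *_) (proj₂ (mod8 (unit-∤ prime[2] a0)))

-- Invariance of the Hasse symbol

-- ∏_{i<j} (aᵢ,aⱼ) = ∏ᵢ (aᵢ, ∏_{j>i} aⱼ) by bilinearity.
hs : ∀ {p} → LocalSymbol p → ∀ {n} → Vc n → Bool
hs S {zero}  a = false
hs S {suc n} a = LocalSymbol.h S (a zero) (prodℤ (a ∘ suc)) xor hs S (a ∘ suc)

prod-nz : ∀ {n} {a : Vc n} → (∀ i → a i ≢ + 0) → prodℤ a ≢ + 0
prod-nz {zero} nz ()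
prod-nz {suc n} nz = *-nz (nz zero) (prod-nz (nz ∘ suc))

-- Equality in ℚ*/ℚ*² for nonzero arguments, without fractions.
record SqEq (x y : ℤ) : Set where
  constructor sqeq
  field
    s t : ℤ
    s0  : s ≢ + 0
    t0  : t ≢ + 0
    eq  : x * (s * s) ≡ y * (t * t)

sqEq-refl : ∀ {x} → SqEq x x
sqEq-refl = sqeq (+ 1) (+ 1) (λ ()) (λ ()) refl

sqEq-trans : ∀ {x y z} → SqEq x y → SqEq y z → SqEq x z
sqEq-trans {x} {y} {z} (sqeq s t s0 t0 q) (sqeq s′ t′ s0′ t0′ q′) = sqeq (s * s′) (t′ * t) (*-nz s0 s0′) (*-nz t0′ t0)
  (trans (re x s s′) (trans (cong (_* (s′ * s′)) q) (trans (re2 y t s′) (trans (cong (_* (t * t)) q′) (sym (re z t′ t))))))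
  where
  re : ∀ x s s′ → x * (s * s′ * (s * s′)) ≡ x * (s * s) * (s′ * s′)
  re = solve-∀
  re2 : ∀ y t s → y * (t * t) * (s * s) ≡ y * (s * s) * (t * t)
  re2 = solve-∀

sqEq-* : ∀ {x y x′ y′} → SqEq x y → SqEq x′ y′ → SqEq (x * x′) (y * y′)
sqEq-* {x} {y} {x′} {y′} (sqeq s t s0 t0 q) (sqeq s′ t′ s0′ t0′ q′) = sqeq (s * s′) (t * t′) (*-nz s0 s0′) (*-nz t0 t0′)
  (trans (re x x′ s s′) (trans (cong₂ _*_ q q′) (sym (re y y′ t t′))))
  where
  re : ∀ x x′ s s′ → x * x′ * (s * s′ * (s * s′)) ≡ x * (s * s) * (x′ * (s′ * s′))
  re = solve-∀

sqEq-h : ∀ {p} (S : LocalSymbol p) {x y} → x ≢ + 0 → y ≢ + 0 → SqEq x y → ∀ z → LocalSymbol.h S x z ≡ LocalSymbol.h S y z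
sqEq-h S {x} {y} x0 y0 (sqeq s t s0 t0 q) z = trans (sym (h-sqˡ x0 s0 z)) (trans (cong (λ w → LocalSymbol.h S w z) q) (h-sqˡ y0 t0 z))
  where open SymbolProperties S

sqEq-vp : ∀ {p} → Prime p → ∀ {x y} → x ≢ + 0 → y ≢ + 0 → SqEq x y → vp p x ≡ vp p y
sqEq-vp {p} pr {x} {y} x0 y0 (sqeq s t s0 t0 q) = trans (sym (ev x0 s0)) (trans (cong (vp p) q) (ev y0 t0))
  where
  ev : ∀ {x s} → x ≢ + 0 → s ≢ + 0 → vp p (x * (s * s)) ≡ vp p x
  ev {x} {s} x0 s0 = trans (vp-* pr x0 (*-nz s0 s0)) (trans (cong (vp p x xor_) (trans (vp-* pr s0 s0) (xor-same (vp p s)))) (xor-identityʳ (vp p x)))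

-- Quantified over all local symbols: the moves that relate two orthogonal bases are global, so one
-- chain of moves serves every prime.
record Equ {n} (a b : Vc n) : Set where
  field
    heq : ∀ {p} (S : LocalSymbol p) → hs S a ≡ hs S b
    peq : SqEq (prodℤ a) (prodℤ b)
open Equ public

equ-trans : ∀ {n} {a b c : Vc n} → Equ a b → Equ b c → Equ a c
equ-trans E F = record { heq = λ S → trans (heq E S) (heq F S) ; peq = sqEq-trans (peq E) (peq F) }

equ-cons : ∀ {n} {a b : Vc (suc n)} → (∀ i → a i ≢ + 0) → (∀ i → b i ≢ + 0) → SqEq (a zero) (b zero) → Equ (a ∘ suc) (b ∘ suc) → Equ a b
equ-cons {n} {a} {b} na nb e ih = record
  { heq = λ S → cong₂ _xor_ (trans (sqEq-h S (na zero) (nb zero) e (prodℤ (a ∘ suc)))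
       (trans (LocalSymbol.h-comm S (b zero) (prodℤ (a ∘ suc))) (trans (sqEq-h S (prod-nz (na ∘ suc)) (prod-nz (nb ∘ suc)) (peq ih) (b zero)) (LocalSymbol.h-comm S (prodℤ (b ∘ suc)) (b zero))))) (heq ih S)
  ; peq = sqEq-* e (peq ih) }

equ-sq : ∀ {n} {a b : Vc n} → (∀ i → a i ≢ + 0) → (∀ i → b i ≢ + 0) → (∀ i → SqEq (a i) (b i)) → Equ a b
equ-sq {zero} na nb e = record { heq = λ S → refl ; peq = sqEq-refl }
equ-sq {suc n} {a} {b} na nb e = equ-cons {a = a} {b} na nb (e zero) (equ-sq (na ∘ suc) (nb ∘ suc) (e ∘ suc))

rot : ∀ {n} → Vc (suc (suc n)) → ℤ → Vc (suc (suc n))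
rot a a′ zero = a′
rot a a′ (suc zero) = a′ * (a zero * a (suc zero))
rot a a′ (suc (suc i)) = a (suc (suc i))

-- Witt's binary move from ⟨x, y⟩ to ⟨a′, a′xy⟩ for a value a′ = xc² + yd². The two Hasse symbols
-- differ by (xa′, ya′), which is trivial because (c, d, a′) solves its equation.
equ-rot : ∀ {n} (a : Vc (suc (suc n))) → (∀ i → a i ≢ + 0) → ∀ c d a′ → a′ ≢ + 0 → a′ ≡ a zero * (c * c) + a (suc zero) * (d * d) → Equ a (rot a a′)
equ-rot {n} a na c d a′ a0 q = record { heq = he ; peq = sqeq a′ (+ 1) a0 (λ ()) (re (a zero) (a (suc zero)) a′ (prodℤ (λ i → a (suc (suc i))))) }
  where
  re : ∀ x y z R → x * (y * R) * (z * z) ≡ z * (z * (x * y) * R) * (+ 1 * + 1)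
  re = solve-∀
  x y R : ℤ
  x = a zero
  y = a (suc zero)
  R = prodℤ (λ i → a (suc (suc i)))
  x0 : x ≢ + 0
  x0 = na zero
  y0 : y ≢ + 0
  y0 = na (suc zero)
  R0 : R ≢ + 0
  R0 = prod-nz (λ i → na (suc (suc i)))
  r1 : ∀ x y z C D → z * (x * C + y * D) ≡ x * z * C + y * z * D
  r1 = solve-∀
  he : ∀ {p} (S : LocalSymbol p) → hs S a ≡ hs S (rot a a′)
  he S = trans (cong (_xor (h y R xor hs S {n} (λ i → a (suc (suc i))))) (h-*ʳ y0 R0 x))
      (trans (taut 8 (λ { (xy ∷ xR ∷ yR ∷ r ∷ xz ∷ zy ∷ zz ∷ zR ∷ []) → (xy xor xR) xor (yR xor r) }) (λ { (xy ∷ xR ∷ yR ∷ r ∷ xz ∷ zy ∷ zz ∷ zR ∷ []) → ((xy xor xz) xor (zy xor zz)) xor (((zz xor (xz xor zy)) xor zR) xor ((zR xor (xR xor yR)) xor r)) }) refl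
         (h x y ∷ h x R ∷ h y R ∷ hs S (λ i → a (suc (suc i))) ∷ h x a′ ∷ h a′ y ∷ h a′ a′ ∷ h a′ R ∷ []))
      (trans (cong (_xor (((h a′ a′ xor (h x a′ xor h a′ y)) xor h a′ R) xor ((h a′ R xor (h x R xor h y R)) xor hs S (λ i → a (suc (suc i)))))) zero′)
        (sym (cong₂ (λ s t → s xor (t xor hs S (λ i → a (suc (suc i))))) e1 e2))))
    where
    open LocalSymbol S using (h; h-*ˡ; h-comm)
    open SymbolProperties S
    zero′ : (h x y xor h x a′) xor (h a′ y xor h a′ a′) ≡ false
    zero′ = trans (sym (trans (h-*ˡ x0 a0 (y * a′)) (cong₂ _xor_ (h-*ʳ y0 a0 x) (h-*ʳ y0 a0 a′))))
      (h-iso (*-nz x0 a0) (*-nz y0 a0) c d a′ (λ (_ , _ , z) → a0 z) (trans (cong (a′ *_) q) (r1 x y a′ (c * c) (d * d))))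
    e1 : h a′ (a′ * (x * y) * R) ≡ (h a′ a′ xor (h x a′ xor h a′ y)) xor h a′ R
    e1 = trans (h-*ʳ (*-nz a0 (*-nz x0 y0)) R0 a′) (cong (_xor h a′ R) (trans (h-*ʳ a0 (*-nz x0 y0) a′) (cong (h a′ a′ xor_) (trans (h-*ʳ x0 y0 a′) (cong (_xor h a′ y) (h-comm a′ x))))))
    e2 : h (a′ * (x * y)) R ≡ h a′ R xor (h x R xor h y R)
    e2 = trans (h-*ˡ a0 (*-nz x0 y0) R) (cong (h a′ R xor_) (h-*ˡ x0 y0 R))

form : ∀ {n m} → Vc n → (Fin n → Fin m → ℤ) → Fin m → Fin m → ℤ
form a V j l = sumℤ (λ r → a r * (V r j * V r l))

Pos : ∀ {n} → Vc n → Set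
Pos a = ∀ i → + 0 <ℤ a i

pos-nz : ∀ {x} → + 0 <ℤ x → x ≢ + 0
pos-nz (ℤ.+<+ ()) refl

pos-* : ∀ {x y} → + 0 <ℤ x → + 0 <ℤ y → + 0 <ℤ x * y
pos-* {+ suc m} {+ suc k} _ _ = ℤ.+<+ (s≤s z≤n)
pos-* {+ zero} (ℤ.+<+ ()) _
pos-* {+ suc m} {+ zero} _ (ℤ.+<+ ())

sq-nonneg : ∀ x → + 0 ≤ℤ x * x
sq-nonneg (+ n) = subst (+ 0 ≤ℤ_) (ℤP.pos-* n n) (ℤ.+≤+ z≤n)
sq-nonneg (-[1+ n ]) = ℤ.+≤+ z≤n

sq-pos : ∀ {x} → x ≢ + 0 → + 0 <ℤ x * x
sq-pos {x} x0 = ℤP.≤∧≢⇒< (sq-nonneg x) (λ q → *-nz x0 x0 (sym q))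

record Conc {n m} (a : Vc (suc n)) (V : Fin (suc n) → Fin (suc m) → ℤ) : Set where
  field
    a′ : Vc (suc n)
    V′ : Fin (suc n) → Fin (suc m) → ℤ
    k : ℤ
    k0 : k ≢ + 0
    pos : Pos a′
    equ : Equ a a′
    frm : ∀ j l → form a′ V′ j l ≡ k * k * form a V j l
    z : ∀ r → V′ (suc r) zero ≡ + 0

abstract
  -- Plane rotations, from the last coordinate upwards, carry column zero of `V` onto the first
  -- axis. They are used without their normalising factor, so the Gram matrix gets multiplied by a
  -- square `k * k`.
  conc : ∀ n {m} (a : Vc (suc n)) (V : Fin (suc n) → Fin (suc m) → ℤ) → Pos a → Conc a V
  conc zero a V pa = record { a′ = a ; V′ = V ; k = + 1 ; k0 = λ () ; pos = pa ; equ = equ-sq (λ i → pos-nz (pa i)) (λ i → pos-nz (pa i)) (λ i → sqEq-refl)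
    ; frm = λ j l → sym (*-identityˡ (form a V j l)) ; z = λ () }
  conc (suc n) {m} a V pa = go (conc n (a ∘ suc) (V ∘ suc) (pa ∘ suc))
    where
    go : Conc (a ∘ suc) (V ∘ suc) → Conc a V
    go C = fin (c ℤ.≟ + 0) (d ℤ.≟ + 0)
      where
      open Conc C
      a₁ : Vc (suc (suc n))
      a₁ = cons (a zero) a′
      V₁ : Fin (suc (suc n)) → Fin (suc m) → ℤ
      V₁ zero j = k * V zero j
      V₁ (suc r) j = V′ r j
      p₁ : Pos a₁
      p₁ zero = pa zero
      p₁ (suc r) = pos r
      c d : ℤ
      c = V₁ zero zero
      d = V₁ (suc zero) zero
      re : ∀ k x u v s → x * (k * u * (k * v)) + k * k * s ≡ k * k * (x * (u * v) + s)
      re = solve-∀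
      f₁ : ∀ j l → form a₁ V₁ j l ≡ k * k * form a V j l
      f₁ j l = trans (+ˡ (a zero * (k * V zero j * (k * V zero l))) (frm j l)) (re k (a zero) (V zero j) (V zero l) (form (a ∘ suc) (V ∘ suc) j l))
      E₁ : Equ a a₁
      E₁ = equ-cons {a = a} {b = a₁} (λ i → pos-nz (pa i)) (λ i → pos-nz (p₁ i)) sqEq-refl equ
      rotate : + 0 <ℤ a zero * (c * c) + a′ zero * (d * d) → Conc a V
      rotate pb = record { a′ = rot a₁ b ; V′ = W ; k = b * k ; k0 = *-nz (pos-nz pb) k0 ; pos = pw′ ; equ = equ-trans E₁ (equ-rot a₁ (λ i → pos-nz (p₁ i)) c d b (pos-nz pb) refl)
          ; frm = λ j l → trans (fW j l) (trans (cong (b * b *_) (f₁ j l)) (re4 b k (form a V j l))) ; z = zW }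
        where
        b x y : ℤ
        b = a zero * (c * c) + a′ zero * (d * d)
        x = a zero
        y = a′ zero
        -- Coordinates along (c, d) and along its orthogonal complement in the plane ⟨x, y⟩; the
        -- identity `bin` makes this an isometry up to the factor b².
        W : Fin (suc (suc n)) → Fin (suc m) → ℤ
        W zero j = x * c * V₁ zero j + y * d * V₁ (suc zero) j
        W (suc zero) j = c * V₁ (suc zero) j - d * V₁ zero j
        W (suc (suc r)) j = b * V₁ (suc (suc r)) j
        pw′ : Pos (rot a₁ b)
        pw′ zero = pb
        pw′ (suc zero) = pos-* pb (pos-* (p₁ zero) (p₁ (suc zero)))
        pw′ (suc (suc r)) = p₁ (suc (suc r))
        re3 : ∀ b A u v → A * (b * u * (b * v)) ≡ b * b * (A * (u * v))
        re3 = solve-∀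
        re4 : ∀ b k f → b * b * (k * k * f) ≡ b * k * (b * k) * f
        re4 = solve-∀
        c1 : ∀ X Y u v u′ v′ → (X * u + Y * v) * (X * u′ + Y * v′) ≡ X * X * (u * u′) + X * Y * (u * v′ + v * u′) + Y * Y * (v * v′)
        c1 = solve-∀
        c2 : ∀ c d u v u′ v′ → (c * v - d * u) * (c * v′ - d * u′) ≡ c * c * (v * v′) + d * d * (u * u′) - c * d * (u * v′ + v * u′)
        c2 = solve-∀
        c3 : ∀ x y c d A B M → (x * c * (x * c) * A + x * c * (y * d) * M + y * d * (y * d) * B) + x * y * (c * c * B + d * d * A - c * d * M) ≡ (x * (c * c) + y * (d * d)) * (x * A + y * B)
        c3 = solve-∀
        c4 : ∀ b P q Q → b * P + (b * q * Q) ≡ b * (P + q * Q)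
        c4 = solve-∀
        bin : ∀ u v u′ v′ → b * ((x * c * u + y * d * v) * (x * c * u′ + y * d * v′)) + b * (x * y) * ((c * v - d * u) * (c * v′ - d * u′)) ≡ b * b * (x * (u * u′) + y * (v * v′))
        bin u v u′ v′ = trans (c4 b ((x * c * u + y * d * v) * (x * c * u′ + y * d * v′)) (x * y) ((c * v - d * u) * (c * v′ - d * u′)))
          (trans (cong (b *_) (trans (cong₂ (λ s t → s + x * y * t) (c1 (x * c) (y * d) u v u′ v′) (c2 c d u v u′ v′)) (c3 x y c d (u * u′) (v * v′) (u * v′ + v * u′))))
            (sym (*-assoc b b (x * (u * u′) + y * (v * v′)))))
        re5 : ∀ P Q s → P + (Q + s) ≡ (P + Q) + s
        re5 = solve-∀
        re6 : ∀ b P Q s → b * (P + Q) + b * s ≡ b * (P + (Q + s))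
        re6 = solve-∀
        fW : ∀ j l → form (rot a₁ b) W j l ≡ b * b * form a₁ V₁ j l
        fW j l = trans (re5 (b * (W zero j * W zero l)) (b * (x * y) * (W (suc zero) j * W (suc zero) l)) tl′)
          (trans (cong₂ _+_ (bin (V₁ zero j) (V₁ (suc zero) j) (V₁ zero l) (V₁ (suc zero) l)) tle)
            (re6 (b * b) (x * (V₁ zero j * V₁ zero l)) (y * (V₁ (suc zero) j * V₁ (suc zero) l)) tl))
          where
          tl tl′ : ℤ
          tl = sumℤ (λ r → a₁ (suc (suc r)) * (V₁ (suc (suc r)) j * V₁ (suc (suc r)) l))
          tl′ = sumℤ (λ r → a₁ (suc (suc r)) * (b * V₁ (suc (suc r)) j * (b * V₁ (suc (suc r)) l)))
          tle : tl′ ≡ b * b * tl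
          tle = trans (sum-cong (λ r → re3 b (a₁ (suc (suc r))) (V₁ (suc (suc r)) j) (V₁ (suc (suc r)) l))) (sum-*ˡ (b * b) (λ r → a₁ (suc (suc r)) * (V₁ (suc (suc r)) j * V₁ (suc (suc r)) l)))
        re7 : ∀ c d → c * d - d * c ≡ + 0
        re7 = solve-∀
        zW : ∀ r → W (suc r) zero ≡ + 0
        zW zero = re7 c d
        zW (suc r) = trans (cong (b *_) (z r)) (*-zeroʳ b)
      nonneg : ∀ x y → + 0 <ℤ x → + 0 ≤ℤ x * (y * y)
      nonneg (+ suc k) y px = subst (_≤ℤ + suc k * (y * y)) (*-zeroʳ (+ suc k)) (ℤP.*-monoˡ-≤-nonNeg (+ suc k) (sq-nonneg y))
      nonneg (+ zero) y (ℤ.+<+ ())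
      fin : Dec (c ≡ + 0) → Dec (d ≡ + 0) → Conc a V
      fin (yes c0) (yes d0) = record { a′ = a₁ ; V′ = V₁ ; k = k ; k0 = k0 ; pos = p₁ ; equ = E₁ ; frm = f₁ ; z = λ { zero → d0 ; (suc r) → z r } }
      fin (no c0) _ = rotate (ℤP.+-mono-<-≤ (pos-* (pa zero) (sq-pos c0)) (nonneg (a′ zero) d (pos zero)))
      fin (yes _) (no d0) = rotate (ℤP.+-mono-≤-< (nonneg (a zero) c (pa zero)) (pos-* (pos zero) (sq-pos d0)))

  -- Once column zero has a single nonzero entry, orthogonality of the columns kills the rest of row
  -- zero, and the complementary block relates the two shorter diagonals. This is Witt cancellation
  -- made explicit.
  invariance : ∀ n (a b : Vc n) (V : Mat n) → Pos a → Pos b → (∀ j l → form a V j l ≡ diag b j l) → Equ a b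
  invariance zero a b V pa pb f = record { heq = λ S → refl ; peq = sqEq-refl }
  invariance (suc n) a b V pa pb f = go (conc n a V pa)
    where
    go : Conc a V → Equ a b
    go C = equ-trans equ (equ-trans (equ-cons {a = a′} {b = kb} nza nzkb e0 ih) (equ-sq nzkb (λ i → pos-nz (pb i)) (λ i → sqeq (+ 1) k (λ ()) k0 (re0 k (b i)))))
      where
      open Conc C
      kb : Vc (suc n)
      kb i = k * k * b i
      re0 : ∀ k b → k * k * b * (+ 1 * + 1) ≡ b * (k * k)
      re0 = solve-∀
      nza : ∀ i → a′ i ≢ + 0
      nza i = pos-nz (pos i)
      pkb : Pos kb
      pkb i = pos-* (sq-pos k0) (pb i)
      nzkb : ∀ i → kb i ≢ + 0
      nzkb i = pos-nz (pkb i)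
      fr : ∀ j l → form a′ V′ j l ≡ kb j * δ j l
      fr j l = trans (frm j l) (trans (cong (k * k *_) (f j l)) (sym (*-assoc (k * k) (b j) (δ j l))))
      w : ℤ
      w = V′ zero zero
      row0 : ∀ l → a′ zero * (w * V′ zero l) ≡ kb zero * δ zero l
      row0 l = trans (sym (+z (sum-0 (λ r → trans (cong (λ t → a′ (suc r) * (t * V′ (suc r) l)) (z r)) (*-zeroʳ (a′ (suc r))))))) (fr zero l)
      w0 : w ≢ + 0
      w0 q = nzkb zero (trans (sym (*-identityʳ (kb zero))) (trans (sym (row0 zero)) (trans (cong (λ t → a′ zero * (t * t)) q) (*-zeroʳ (a′ zero)))))
      e0 : SqEq (a′ zero) (kb zero)
      e0 = sqeq w (+ 1) w0 (λ ()) (row0 zero)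
      z0 : ∀ l → V′ zero (suc l) ≡ + 0
      z0 l = case V′ zero (suc l) ℤ.≟ + 0 of λ where
        (yes q) → q
        (no q) → ⊥-elim (*-nz (nza zero) (*-nz w0 q) (trans (row0 (suc l)) (*-zeroʳ (kb zero))))
      ih : Equ (a′ ∘ suc) (kb ∘ suc)
      ih = invariance n (a′ ∘ suc) (kb ∘ suc) (λ r j → V′ (suc r) (suc j)) (pos ∘ suc) (pkb ∘ suc)
        (λ j l → trans (sym (z+ (trans (cong (λ t → a′ zero * (t * V′ zero (suc l))) (z0 j)) (*-zeroʳ (a′ zero))))) (fr (suc j) (suc l)))

bil-diag : ∀ {n} (c : Vc n) x y → bil (diag c) x y ≡ sumℤ (λ r → c r * (x r * y r))
bil-diag c x y = trans (bil≡dot (diag c) x y) (sum-cong (λ r → trans (cong (x r *_) (trans (sum-cong (λ j → *-assoc (c r) (δ r j) (y j))) (trans (sum-*ˡ (c r) (λ j → δ r j * y j)) (cong (c r *_) (sum-δˡ r y))))) (re (x r) (c r) (y r))))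
  where
  re : ∀ x c y → x * (c * y) ≡ c * (x * y)
  re = solve-∀

frame-inv : ∀ {p n} {M : Mat n} (fr : Frame p M) → Inv p (Frame.F fr)
frame-inv fr = record { Ei = Fi ; w = u ; p∤w = p∤u ; right = right ; left = left }
  where open Frame fr

diag-ii : ∀ {n} (c : Vc n) i → diag c i i ≡ c i
diag-ii c i = trans (cong (c i *_) (δ-refl i)) (*-identityʳ (c i))

frame-pos : ∀ {p n} {M : Mat n} → PosDef M → (fr : Frame p M) → Pos (Frame.c fr)
frame-pos {M = M} pd fr i = subst (+ 0 <ℤ_) (trans (gram i i) (diag-ii c i)) (pos-entry {M = cgr F M} (posdef-cgr {M = M} (frame-inv fr) pd) i)
  where open Frame fr

abstract
  -- `Fi ⊗ U` expresses the basis `U`, scaled by `u`, in the frame; so any integral orthogonal basis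
  -- may replace the frame in computing symbols.
  orth-equ : ∀ {p n} {M : Mat n} → PosDef M → (fr : Frame p M) → (U : Mat n) (b : Vc n) → Pos b → (∀ j l → cgr U M j l ≡ diag b j l) → Equ (Frame.c fr) b
  orth-equ {p} {n} {M} pd fr U b pb g = equ-trans (invariance n c ub (Fi ⊗ U) (frame-pos {M = M} pd fr) pub f)
      (equ-sq (λ i → pos-nz (pub i)) (λ i → pos-nz (pb i)) (λ i → sqeq (+ 1) u (λ ()) u0 (re0 u (b i))))
    where
    open Frame fr
    u0 : u ≢ + 0
    u0 = w≢0 p∤u
    ub : Vc n
    ub i = u * u * b i
    pub : Pos ub
    pub i = pos-* (sq-pos u0) (pb i)
    re0 : ∀ k b → k * k * b * (+ 1 * + 1) ≡ b * (k * k)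
    re0 = solve-∀
    FFU : ∀ j r → act F (λ k → (Fi ⊗ U) k j) r ≡ u * U r j
    FFU j r = trans (act-act F Fi (λ k → U k j) r) (scal-act u right (λ k → U k j) r)
    f : ∀ j l → form c (Fi ⊗ U) j l ≡ diag ub j l
    f j l = trans (sym (bil-diag c (λ r → (Fi ⊗ U) r j) (λ r → (Fi ⊗ U) r l)))
      (trans (bil-cong {x′ = λ r → (Fi ⊗ U) r j} {y′ = λ r → (Fi ⊗ U) r l} (λ r s → sym (gram r s)) (λ _ → refl) (λ _ → refl))
      (trans (bil-act F M (λ r → (Fi ⊗ U) r j) (λ r → (Fi ⊗ U) r l))
      (trans (bil-cong {M = M} {M} {x′ = λ r → u * U r j} {y′ = λ r → u * U r l} (λ _ _ → refl) (FFU j) (FFU l))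
      (trans (bil-scale M u u (λ r → U r j) (λ r → U r l))
      (trans (cong (u * u *_) (g j l)) (sym (*-assoc (u * u) (b j) (δ j l))))))))

-- Overlattices

record Step (p : ℕ) {n} (M : Mat n) : Set where
  field
    x   : Vc n
    i   : Fin n
    x∤  : ¬ (+ p ∣ x i)
    Mx  : ∀ r → + p ∣ act M x r
    qx  : + p * + p ∣ bil M x x

Emb : ∀ {n} → Mat n → Mat n → Set
Emb {n} M M′ = Σ (Mat n) λ A → ∀ i j → cgr A M′ i j ≡ M i j

-- `diag (pik i p)` embeds the lattice in the one obtained by dividing its i-th basis vector by `p`;
-- `qik` is `p` times the inverse.
pik qik : ∀ {n} → Fin n → ℤ → Vc n
pik zero    p zero    = p
pik zero    p (suc j) = + 1
pik (suc i) p zero    = + 1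
pik (suc i) p (suc j) = pik i p j
qik zero    p zero    = + 1
qik zero    p (suc j) = p
qik (suc i) p zero    = p
qik (suc i) p (suc j) = qik i p j

pik*qik : ∀ {n} (i : Fin n) p j → pik i p j * qik i p j ≡ p
pik*qik zero p zero = *-identityʳ p
pik*qik zero p (suc j) = *-identityˡ p
pik*qik (suc i) p zero = *-identityˡ p
pik*qik (suc i) p (suc j) = pik*qik i p j

pik-≡ : ∀ {n} (i : Fin n) p → pik i p i ≡ p
pik-≡ zero p = refl
pik-≡ (suc i) p = pik-≡ i p

pik-≢ : ∀ {n} {i j : Fin n} → j ≢ i → ∀ p → pik i p j ≡ + 1
pik-≢ {i = zero} {zero} ne p = ⊥-elim (ne refl)
pik-≢ {i = zero} {suc j} ne p = refl
pik-≢ {i = suc i} {zero} ne p = refl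
pik-≢ {i = suc i} {suc j} ne p = pik-≢ (λ q → ne (cong suc q)) p

qik-≢ : ∀ {n} {i j : Fin n} → j ≢ i → ∀ p → qik i p j ≡ p
qik-≢ {i = zero} {zero} ne p = ⊥-elim (ne refl)
qik-≢ {i = zero} {suc j} ne p = refl
qik-≢ {i = suc i} {zero} ne p = refl
qik-≢ {i = suc i} {suc j} ne p = qik-≢ (λ q → ne (cong suc q)) p

qik-≡ : ∀ {n} (i : Fin n) p → qik i p i ≡ + 1
qik-≡ zero p = refl
qik-≡ (suc i) p = qik-≡ i p

pik-prod : ∀ {n} (i : Fin n) p → prodℤ (pik i p) ≡ p
pik-prod {suc n} zero p = trans (cong (p *_) (prod-1 n)) (*-identityʳ p)
pik-prod (suc i) p = trans (*-identityˡ (prodℤ (pik i p))) (pik-prod i p)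

-- The rank one perturbation 1 + z·wᵀ; for w orthogonal to z it is unimodular, with inverse 1 -
-- z·wᵀ.
shear : ∀ {n} → Vc n → Vc n → Mat n
shear z w i j = δ i j + z i * w j

shear-⊗ : ∀ {n} (z z′ w : Vc n) → dot w z ≡ + 0 → dot w z′ ≡ + 0 → (∀ i → z i + z′ i ≡ + 0) → Scal (+ 1) (shear z w ⊗ shear z′ w)
shear-⊗ {n} z z′ w wz wz′ zz i j = begin
  sumℤ (λ k → (δ i k + z i * w k) * (δ k j + z′ k * w j))
    ≡⟨ sum-cong (λ k → r1 (δ i k) (z i) (w k) (δ k j) (z′ k) (w j)) ⟩
  sumℤ (λ k → δ i k * (δ k j + z′ k * w j) + (z i * (w k * δ k j) + z i * w j * (w k * z′ k)))
    ≡⟨ trans (sum-+ (λ k → δ i k * (δ k j + z′ k * w j)) (λ k → z i * (w k * δ k j) + z i * w j * (w k * z′ k)))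
        (cong₂ _+_ (sum-δˡ i (λ k → δ k j + z′ k * w j)) (trans (sum-+ (λ k → z i * (w k * δ k j)) (λ k → z i * w j * (w k * z′ k)))
          (cong₂ _+_ (trans (sum-*ˡ (z i) (λ k → w k * δ k j)) (cong (z i *_) (sum-δʳ j w))) (trans (sum-*ˡ (z i * w j) (λ k → w k * z′ k)) (cong (z i * w j *_) wz′))))) ⟩
  (δ i j + z′ i * w j) + (z i * w j + z i * w j * + 0)
    ≡⟨ r2 (δ i j) (z′ i) (w j) (z i) ⟩
  + 1 * δ i j + (z i + z′ i) * w j
    ≡⟨ +z (trans (cong (_* w j) (zz i)) (*-zeroˡ (w j))) ⟩
  + 1 * δ i j ∎
  where
  open ≡-Reasoning
  r1 : ∀ a z w d z′ v → (a + z * w) * (d + z′ * v) ≡ a * (d + z′ * v) + (z * (w * d) + z * v * (w * z′))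
  r1 = solve-∀
  r2 : ∀ a z′ w z → (a + z′ * w) + (z * w + z * w * + 0) ≡ + 1 * a + (z + z′) * w
  r2 = solve-∀

dot-neg : ∀ {n} (w z : Vc n) → dot w z ≡ + 0 → dot w (λ i → - z i) ≡ + 0
dot-neg w z q = trans (sum-cong (λ i → re (w i) (z i))) (trans (sum-*ˡ (- (+ 1)) (λ i → w i * z i)) (cong (- (+ 1) *_) q))
  where
  re : ∀ a b → a * - b ≡ - (+ 1) * (a * b)
  re = solve-∀

shear-inv : ∀ {p} → Prime p → ∀ {n} (z w : Vc n) → dot w z ≡ + 0 → Inv p (shear z w)
shear-inv pr z w q = record { Ei = shear (λ i → - z i) w ; w = + 1 ; p∤w = ¬p∣1 pr
  ; right = shear-⊗ z (λ i → - z i) w q (dot-neg w z q) (λ i → ℤP.+-inverseʳ (z i))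
  ; left = shear-⊗ (λ i → - z i) z w (dot-neg w z q) q (λ i → ℤP.+-inverseˡ (z i)) }

scal1-det : ∀ {n} {A : Mat n} → Scal (+ 1) A → det A ≡ + 1
scal1-det {n} {A} s = trans (det-cong {n} {A} {δ} (λ i j → trans (s i j) (*-identityˡ (δ i j)))) (det-δ {n})

unit-sq : ∀ x y → x * y ≡ + 1 → y * y ≡ + 1
unit-sq x y q with ℕP.m*n≡1⇒n≡1 (abs x) (abs y) (trans (sym (abs-* x y)) (cong abs q))
... | r = go y r
  where
  go : ∀ y → abs y ≡ 1 → y * y ≡ + 1
  go (+ .1) refl = refl
  go (-[1+ zero ]) refl = refl

Scal-det-sq : ∀ {n} (A B : Mat n) → Scal (+ 1) (A ⊗ B) → det B * det B ≡ + 1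
Scal-det-sq A B s = unit-sq (det A) (det B) (trans (sym (det-⊗ A B)) (scal1-det s))

cgr-diag : ∀ {n} (c : Vc n) (M : Mat n) i j → cgr (diag c) M i j ≡ c i * c j * M i j
cgr-diag c M i j = trans (bil-cong {M = M} {M} {x′ = λ r → c i * ê i r} {y′ = λ r → c j * ê j r} (λ _ _ → refl) (col i) (col j))
  (trans (bil-scale M (c i) (c j) (ê i) (ê j)) (cong (c i * c j *_) (bil-e M i j)))
  where
  col : ∀ i r → diag c r i ≡ c i * δ r i
  col i r with r FinP.≟ i
  ... | yes refl = refl
  ... | no ne = trans (cong (c r *_) (δ-≢ ne)) (trans (*-zeroʳ (c r)) (sym (trans (cong (c i *_) (δ-≢ ne)) (*-zeroʳ (c i)))))

cgr-cong : ∀ {n} {E E′ M M′ : Mat n} → (∀ i j → E i j ≡ E′ i j) → (∀ i j → M i j ≡ M′ i j) → ∀ i j → cgr E M i j ≡ cgr E′ M′ i j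
cgr-cong {E = E} {E′} {M} {M′} e m i j = bil-cong {M = M} {M′} {λ r → E r i} {λ r → E′ r i} {λ r → E r j} {λ r → E′ r j} m (λ r → e r i) (λ r → e r j)

cgr-δ : ∀ {n} {E : Mat n} (M : Mat n) → Scal (+ 1) E → ∀ i j → cgr E M i j ≡ M i j
cgr-δ {E = E} M s i j = trans (bil-cong {M = M} {M} {λ r → E r i} {ê i} {λ r → E r j} {ê j} (λ _ _ → refl) (λ r → trans (s r i) (*-identityˡ (δ r i))) (λ r → trans (s r j) (*-identityˡ (δ r j)))) (bil-e M i j)

record Overlattice (p : ℕ) {n} (M : Mat n) : Set where
  field
    M′   : Mat n
    lat  : IsLattice M′
    emb  : Emb M M′
    dt   : det M ≡ + p * + p * det M′

abstract
  -- The vector x is replaced by kx + s·eᵢ with i-th coordinate 1. Since p divides s, all the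
  -- divisibilities survive; a shear makes the new vector the i-th basis vector, and row and column
  -- `i` of the Gram matrix are divided by `p`.
  overlattice : ∀ {p} → Prime p → ∀ {n} (M : Mat n) → IsLattice M → Step p M → Overlattice p M
  overlattice {p} pr {n} M (sy , pd) st = norm (inverse pr x∤)
    where
    open Step st
    norm : (∃ λ k → + p ∣ x i * k - + 1) → Overlattice p M
    norm (k , dk) = res
      where
      s : ℤ
      s = + 1 - k * x i
      ds : + p ∣ s
      ds = ∣-lc1 dk (- (+ 1)) (re (x i) k)
        where
        re : ∀ a k → + 1 - k * a ≡ - (+ 1) * (a * k - + 1)
        re = solve-∀
      y : Vc n
      y r = k * x r + s * ê i r
      yi : y i ≡ + 1
      yi = trans (cong (λ d → k * x i + s * d) (δ-refl i)) (re k (x i))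
        where
        re : ∀ k a → k * a + (+ 1 - k * a) * + 1 ≡ + 1
        re = solve-∀
      My : ∀ r → + p ∣ act M y r
      My r = subst (+ p ∣_) (sym (trans (sum-cong (λ j → re (M r j) k (x j) s (δ j i))) (trans (sum-lin k s (λ j → M r j * x j) (λ j → M r j * δ j i)) refl)))
          (∣m∣n⇒∣m+n (∣n⇒∣m*n k (Mx r)) (∣m⇒∣m*n (sumℤ (λ j → M r j * δ j i)) ds))
        where
        re : ∀ m k x s d → m * (k * x + s * d) ≡ k * (m * x) + s * (m * d)
        re = solve-∀
      qy : + p * + p ∣ bil M y y
      qy = subst (+ p * + p ∣_) (sym (trans (bil-quad sy (λ r → k * x r) (ê i) s) (cong₂ (λ a b → a + + 2 * s * b + s * s * bil M (ê i) (ê i)) (bil-scale M k k x x) (trans (bil-comm sy (λ r → k * x r) (ê i)) (trans (bil-eˡ M i (λ r → k * x r)) (trans (sum-cong (λ j → re (M i j) k (x j))) (sum-*ˡ k (λ j → M i j * x j))))))))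
          (∣m∣n⇒∣m+n (∣m∣n⇒∣m+n (∣n⇒∣m*n (k * k) qx) (two* s (k * act M x i) ds (∣n⇒∣m*n k (Mx i)))) (∣m⇒∣m*n (bil M (ê i) (ê i)) (sq2 s s ds ds)))
        where
        re : ∀ m k x → m * (k * x) ≡ k * (m * x)
        re = solve-∀
        sq2 : ∀ a b → + p ∣ a → + p ∣ b → + p * + p ∣ a * b
        sq2 a b (divides a′ ea) (divides b′ eb) = divides (a′ * b′) (trans (cong₂ _*_ ea eb) (re2 a′ b′ (+ p)))
          where
          re2 : ∀ a b p → a * p * (b * p) ≡ a * b * (p * p)
          re2 = solve-∀
        two* : ∀ a b → + p ∣ a → + p ∣ b → + p * + p ∣ + 2 * a * b
        two* a b da db = sq2 (+ 2 * a) b (∣n⇒∣m*n (+ 2) da) db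
      z w : Vc n
      z r = y r - ê i r
      w j = δ i j
      wz : dot w z ≡ + 0
      wz = trans (sum-δˡ i z) (trans (cong₂ _-_ yi (δ-refl i)) refl)
      E Ei : Mat n
      E = shear z w
      IE : Inv p E
      IE = shear-inv pr z w wz
      Ei = Inv.Ei IE
      coli : ∀ r → E r i ≡ y r
      coli r = trans (cong (λ d → δ r i + (y r - δ r i) * d) (δ-refl i)) (re (δ r i) (y r))
        where
        re : ∀ d y → d + (y - d) * + 1 ≡ y
        re = solve-∀
      M₁ : Mat n
      M₁ = cgr E M
      s₁ : Symmetric M₁
      s₁ = cgr-sym E sy
      π κ : Vc n
      π = pik i (+ p)
      κ = qik i (+ p)
      rowi : ∀ j → + p ∣ M₁ j i
      rowi j = subst (+ p ∣_) (sym (trans (bil-cong {M = M} {M} {λ r → E r j} {λ r → E r j} {λ r → E r i} {y} (λ _ _ → refl) (λ _ → refl) coli) (bil≡dot M (λ r → E r j) y)))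
        (sum-∣ (+ p) (λ r → E r j * act M y r) (λ r → ∣n⇒∣m*n (E r j) (My r)))
      dM : ∀ j l → π j * π l ∣ M₁ j l
      dM j l = go (j FinP.≟ i) (l FinP.≟ i)
        where
        go : Dec (j ≡ i) → Dec (l ≡ i) → π j * π l ∣ M₁ j l
        go (yes refl) (yes refl) = subst₂ (λ a b → a ∣ b) (sym (cong₂ _*_ (pik-≡ i (+ p)) (pik-≡ i (+ p)))) (sym (bil-cong {M = M} {M} {λ r → E r i} {y} {λ r → E r i} {y} (λ _ _ → refl) coli coli)) qy
        go (yes refl) (no nl) = subst (_∣ M₁ i l) (sym (trans (cong₂ _*_ (pik-≡ i (+ p)) (pik-≢ nl (+ p))) (*-identityʳ (+ p)))) (subst (+ p ∣_) (s₁ l i) (rowi l))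
        go (no nj) (yes refl) = subst (_∣ M₁ j i) (sym (trans (cong₂ _*_ (pik-≢ nj (+ p)) (pik-≡ i (+ p))) (*-identityˡ (+ p)))) (rowi j)
        go (no nj) (no nl) = subst (_∣ M₁ j l) (sym (cong₂ _*_ (pik-≢ nj (+ p)) (pik-≢ nl (+ p)))) (divides (M₁ j l) (sym (*-identityʳ (M₁ j l))))
      M₂ : Mat n
      M₂ j l = _∣_.quotient (dM j l)
      P′ : Mat n
      P′ = diag π
      M₁₂ : ∀ j l → cgr P′ M₂ j l ≡ M₁ j l
      M₁₂ j l = trans (cgr-diag π M₂ j l) (trans (*-comm (π j * π l) (M₂ j l)) (sym (_∣_.equality (dM j l))))
      p0 : + p ≢ + 0
      p0 = +p≢0 pr
      π0 : ∀ j → π j ≢ + 0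
      π0 j q = p0 (trans (sym (pik*qik i (+ p) j)) (trans (cong (_* κ j) q) (*-zeroˡ (κ j))))
      κ0 : ∀ j → κ j ≢ + 0
      κ0 j q = p0 (trans (sym (pik*qik i (+ p) j)) (trans (cong (π j *_) q) (*-zeroʳ (π j))))
      s₂ : Symmetric M₂
      s₂ j l = *-cancelˡ (*-nz (π0 j) (π0 l)) (trans (sym (cgr-diag π M₂ j l)) (trans (M₁₂ j l) (trans (s₁ j l) (trans (sym (M₁₂ l j)) (trans (cgr-diag π M₂ l j) (cong (_* M₂ l j) (*-comm (π l) (π j))))))))
      actP : ∀ (v : Vc n) r → act P′ (λ j → κ j * v j) r ≡ + p * v r
      actP v r = trans (sum-cong (λ j → re (π r) (δ r j) (κ j * v j))) (trans (sum-*ˡ (π r) (λ j → δ r j * (κ j * v j))) (trans (cong (π r *_) (sum-δˡ r (λ j → κ j * v j))) (trans (sym (*-assoc (π r) (κ r) (v r))) (cong (_* v r) (pik*qik i (+ p) r)))))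
        where
        re : ∀ a d t → a * d * t ≡ a * (d * t)
        re = solve-∀
      pd₂ : PosDef M₂
      pd₂ v (j , vj) = ℤP.*-cancelˡ-<-nonNeg (+ (p *ᴺ p)) (subst₂ _<ℤ_ (sym (*-zeroʳ (+ (p *ᴺ p)))) eqn pos₁)
        where
        κv : Vc n
        κv j = κ j * v j
        pos₁ : + 0 <ℤ bil M₁ κv κv
        pos₁ = posdef-cgr {M = M} IE pd κv (j , *-nz (κ0 j) vj)
        eqn : bil M₁ κv κv ≡ + (p *ᴺ p) * bil M₂ v v
        eqn = trans (bil-cong {M = M₁} {cgr P′ M₂} {κv} {κv} {κv} {κv} (λ j l → sym (M₁₂ j l)) (λ _ → refl) (λ _ → refl))
          (trans (bil-act P′ M₂ κv κv) (trans (bil-cong {M = M₂} {M₂} (λ _ _ → refl) (actP v) (actP v)) (trans (bil-scale M₂ (+ p) (+ p) v v) (cong (_* bil M₂ v v) (sym (ℤP.pos-* p p))))))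
      A : Mat n
      A = P′ ⊗ Ei
      cg : ∀ j l → cgr A M₂ j l ≡ M j l
      cg j l = trans (sym (cgr-cgr P′ Ei M₂ j l)) (trans (cgr-cong {E = Ei} {Ei} {cgr P′ M₂} {cgr E M} (λ _ _ → refl) M₁₂ j l) (trans (cgr-cgr E Ei M j l) (cgr-δ M (Inv.right IE) j l)))
      detA : det A ≡ + p * det Ei
      detA = trans (det-⊗ P′ Ei) (cong (_* det Ei) (trans (det-diag π) (pik-prod i (+ p))))
      res : Overlattice p M
      res = record { M′ = M₂ ; lat = s₂ , pd₂ ; emb = A , cg
        ; dt = trans (sym (det-cong cg)) (trans (det-cgr A M₂) (trans (cong (λ d → d * (det M₂ * d)) detA) (trans (re (+ p) (det Ei) (det M₂)) (trans (cong (λ t → + p * + p * det M₂ * t) (Scal-det-sq E Ei (Inv.right IE))) (*-identityʳ (+ p * + p * det M₂)))))) }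
        where
        re : ∀ p e m → p * e * (m * (p * e)) ≡ p * p * m * (e * e)
        re = solve-∀

frame-det : ∀ {p n} {M : Mat n} (fr : Frame p M) → det M * (det (Frame.F fr) * det (Frame.F fr)) ≡ prodℤ (Frame.c fr)
frame-det {M = M} fr = trans (re (det M) (det F)) (trans (sym (det-cgr F M)) (trans (det-cong gram) (det-diag c)))
  where
  open Frame fr
  re : ∀ m f → m * (f * f) ≡ f * (m * f)
  re = solve-∀

pow : ℤ → ℕ → ℤ
pow a zero = + 1
pow a (suc n) = a * pow a n

prod-const : ∀ n a → prodℤ {n} (λ _ → a) ≡ pow a n
prod-const zero a = refl
prod-const (suc n) a = cong (a *_) (prod-const n a)

scal-det : ∀ {n} w {A : Mat n} → Scal w A → det A ≡ pow w n
scal-det {n} w {A} s = trans (det-cong {n} {A} {diag (λ _ → w)} s) (trans (det-diag {n} (λ _ → w)) (prod-const n w))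

pow-∤ : ∀ {p} → Prime p → ∀ {a} → ¬ (+ p ∣ a) → ∀ n → ¬ (+ p ∣ pow a n)
pow-∤ pr na zero = ¬p∣1 pr
pow-∤ pr na (suc n) = ∤-* pr na (pow-∤ pr na n)

frame-det∤ : ∀ {p} → Prime p → ∀ {n} {M : Mat n} (fr : Frame p M) → ¬ (+ p ∣ det (Frame.F fr))
frame-det∤ {p} pr {n} fr d = pow-∤ pr p∤u n (subst (+ p ∣_) (trans (sym (det-⊗ F Fi)) (scal-det u {F ⊗ Fi} right)) (∣m⇒∣m*n (det Fi) d))
  where open Frame fr

frame-sqEq : ∀ {p} → Prime p → ∀ {n} {M : Mat n} (fr : Frame p M) → SqEq (det M) (prodℤ (Frame.c fr))
frame-sqEq pr {M = M} fr = sqeq (det (Frame.F fr)) (+ 1) (w≢0 (frame-det∤ pr {M = M} fr)) (λ ()) (trans (frame-det {M = M} fr) (sym (*-identityʳ _)))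

abstract
  -- Frame coordinates that are not all divisible by `p` give a vector outside pL, since `Fi` undoes
  -- `F` up to the unit `u`; the divisibility of (x, L) is transferred back in the same way.
  frame-step : ∀ {p} → Prime p → ∀ {n} {M : Mat n} → Symmetric M → (fr : Frame p M) → (α : Vc n) → (∀ i → + p ∣ α i * Frame.c fr i) →
    (∃ λ i → ¬ (+ p ∣ α i)) → + p * + p ∣ sumℤ (λ i → Frame.c fr i * (α i * α i)) → Step p M
  frame-step {p} pr {n} {M} sy fr α dα (k , nk) dq = go (any? (λ r → ¬? (+ p ∣? act F α r)))
    where
    open Frame fr
    x : Vc n
    x = act F α
    go : Dec (∃ λ r → ¬ (+ p ∣ x r)) → Step p M
    go (no h) = ⊥-elim (∤-* pr p∤u nk (subst (+ p ∣_) (trans (act-act Fi F α k) (scal-act u {Fi ⊗ F} left α k)) (sum-∣ (+ p) (λ r → Fi k r * x r) (λ r → ∣n⇒∣m*n (Fi k r) (all r)))))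
      where
      all : ∀ r → + p ∣ x r
      all r with + p ∣? x r
      ... | yes q = q
      ... | no q = ⊥-elim (h (r , q))
    go (yes (r , nr)) = record { x = x ; i = r ; x∤ = nr ; Mx = mx ; qx = subst (+ p * + p ∣_) (sym qeq) dq }
      where
      qeq : bil M x x ≡ sumℤ (λ i → c i * (α i * α i))
      qeq = trans (sym (bil-act F M α α)) (trans (bil-cong {x′ = α} {y′ = α} gram (λ _ → refl) (λ _ → refl)) (bil-diag c α α))
      FMx : ∀ i → + p ∣ act (F ᵀ) (act M x) i
      FMx i = subst (+ p ∣_) (sym eqn) (dα i)
        where
        eqn : act (F ᵀ) (act M x) i ≡ α i * c i
        eqn = trans (sum-cong (λ r → cong (F r i *_) (act-act M F α r))) (trans (act-act (F ᵀ) (M ⊗ F) α i)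
          (trans (act-cong {A = (F ᵀ) ⊗ (M ⊗ F)} {diag c} {α} {α} (λ a b → trans (sym (cgr-⊗ F M a b)) (gram a b)) (λ _ → refl) i)
            (trans (sum-cong (λ j → *-assoc (c i) (δ i j) (α j))) (trans (sum-*ˡ (c i) (λ j → δ i j * α j)) (trans (cong (c i *_) (sum-δˡ i α)) (*-comm (c i) (α i)))))))
      mx : ∀ r → + p ∣ act M x r
      mx r = case euclid pr u (act M x r) (subst (+ p ∣_) (trans (act-act (Fi ᵀ) (F ᵀ) (act M x) r) (scal-act u {(Fi ᵀ) ⊗ (F ᵀ)} tr (act M x) r)) (sum-∣ (+ p) (λ i → Fi i r * act (F ᵀ) (act M x) i) (λ i → ∣n⇒∣m*n (Fi i r) (FMx i)))) of λ where
          (inj₁ a) → ⊥-elim (p∤u a)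
          (inj₂ a) → a
        where
        tr : Scal u ((Fi ᵀ) ⊗ (F ᵀ))
        tr i j = trans (sum-cong (λ k → *-comm (Fi k i) (F j k))) (trans (right j i) (cong (u *_) (δ-sym j i)))

-- Enlargement at odd primes.

module OddStep {p} (op : OddPrime p) where
  open Odds op using (leg; leg-*; leg-false; two-squares)
  open OddSymbol op hiding (oddSymbol; hodd)
  private
    pr : Prime p
    pr = proj₁ op
    S : LocalSymbol p
    S = oddSymbol op

  -- The outcome of the local analysis. `sf` carries an enlarging vector. Otherwise the entries are
  -- units except for at most two of valuation one, and such a pair is anisotropic: `s2`, with even
  -- valuation of the determinant and symbol -1.
  data St {n} (c : Vc n) : Set where
    sf : (α : Vc n) → (∀ i → + p ∣ α i * c i) → (∃ λ i → ¬ (+ p ∣ α i)) → + p * + p ∣ sumℤ (λ i → c i * (α i * α i)) → St c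
    s0 : ¬ (+ p ∣ prodℤ c) → vp p (prodℤ c) ≡ false → hs S c ≡ false → St c
    s1 : ∀ i u → c i ≡ + p * u → ¬ (+ p ∣ u) → vp p (prodℤ c) ≡ true → hs S c ≡ ℓ (prodℤ c) xor leg u → St c
    s2 : ∀ i j u w → i ≢ j → c i ≡ + p * u → c j ≡ + p * w → ¬ (+ p ∣ u) → ¬ (+ p ∣ w) → vp p (prodℤ c) ≡ false → hs S c ≡ true → St c

  unit-class : ∀ {a} → ¬ (+ p ∣ a) → vp p a ≡ false × ℓ a ≡ leg a
  unit-class {a} na = cong par (proj₁ v) , cong leg (proj₂ v)
    where
    v : val p a ≡ 0 × unit p a ≡ a
    v = val-of pr 0 a (sym (*-identityˡ a)) na

  p-class : ∀ {a u} → a ≡ + p * u → ¬ (+ p ∣ u) → vp p a ≡ true × ℓ a ≡ leg u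
  p-class {a} {u} e nu = cong par (proj₁ v) , cong leg (proj₂ v)
    where
    v : val p a ≡ 1 × unit p a ≡ u
    v = val-of pr 1 u (trans e (cong (λ k → + k * u) (sym (ℕP.*-identityʳ p)))) nu

  private
    p-δ : ∀ {n} (c : Vc n) i {u} → c i ≡ + p * u → ∀ k → + p ∣ δ i k * c k
    p-δ c i {u} e k with i FinP.≟ k
    ... | yes refl = ∣n⇒∣m*n (δ i i) (divides u (trans e (*-comm (+ p) u)))
    ... | no ne = subst (+ p ∣_) (sym (trans (cong (_* c k) (δ-≢ ne)) (*-zeroˡ (c k)))) p∣0

    hcons : ∀ {n} (c : Vc (suc n)) {s t l m} → vp p (c zero) ≡ s → vp p (prodℤ (c ∘ suc)) ≡ t → ℓ (c zero) ≡ l → ℓ (prodℤ (c ∘ suc)) ≡ m → ∀ {g} → hs S (c ∘ suc) ≡ g → hs S c ≡ F s t l m xor g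
    hcons c refl refl refl refl refl = refl

  abstract
    -- Entries are added one at a time. An entry divisible by p² gives a vector at once; two entries
    -- of valuation one do so when minus the product of their units is a square; three always do, by
    -- `two-squares`.
    build : ∀ n (c : Vc n) → (∀ i → c i ≢ + 0) → St c
    build zero c nz = s0 (¬p∣1 pr) (proj₁ (unit-class (¬p∣1 pr))) refl
    build (suc n) c nz = go (build n (c ∘ suc) (nz ∘ suc)) (+ p ∣? c zero)
      where
      c′ : Vc n
      c′ = c ∘ suc
      Π : ℤ
      Π = prodℤ c′
      Π0 : Π ≢ + 0
      Π0 = prod-nz (nz ∘ suc)
      vΠ : vp p (prodℤ c) ≡ vp p (c zero) xor vp p Π
      vΠ = vp-* pr (nz zero) Π0
      ℓΠ : ℓ (prodℤ c) ≡ ℓ (c zero) xor ℓ Π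
      ℓΠ = ℓ-* (nz zero) Π0
      goU : St c′ → ¬ (+ p ∣ c zero) → St c
      goU (sf α a b q) nc = sf (cons (+ 0) α) (λ { zero → subst (+ p ∣_) (sym (*-zeroˡ (c zero))) p∣0 ; (suc i) → a i }) (suc (proj₁ b) , proj₂ b)
        (subst (+ p * + p ∣_) (sym (z+ (*-zeroʳ (c zero)))) q)
      goU (s0 d v h) nc = s0 (∤-* pr nc d) (trans vΠ (cong₂ _xor_ (proj₁ (unit-class nc)) v)) (trans (hcons c (proj₁ (unit-class nc)) v refl refl h) refl)
      goU (s1 i u e nu v h) nc = s1 (suc i) u e nu (trans vΠ (cong₂ _xor_ (proj₁ (unit-class nc)) v))
        (trans (hcons c (proj₁ (unit-class nc)) v refl refl h) (trans (taut 3 (λ { (a ∷ b ∷ d ∷ []) → (a xor false) xor (b xor d) }) (λ { (a ∷ b ∷ d ∷ []) → (a xor b) xor d }) refl (ℓ (c zero) ∷ ℓ Π ∷ leg u ∷ [])) (cong (_xor leg u) (sym ℓΠ))))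
      goU (s2 i j u w ne e f nu nw v h) nc = s2 (suc i) (suc j) u w (λ q → ne (FinP.suc-injective q)) e f nu nw (trans vΠ (cong₂ _xor_ (proj₁ (unit-class nc)) v))
        (trans (hcons c (proj₁ (unit-class nc)) v refl refl h) refl)
      goP : St c′ → ∀ q → c zero ≡ + p * q → ¬ (+ p ∣ q) → St c
      goP (sf α a b g) q e nq = goU′
        where
        goU′ : St c
        goU′ = sf (cons (+ 0) α) (λ { zero → subst (+ p ∣_) (sym (*-zeroˡ (c zero))) p∣0 ; (suc i) → a i }) (suc (proj₁ b) , proj₂ b) (subst (+ p * + p ∣_) (sym (z+ (*-zeroʳ (c zero)))) g)
      goP (s0 d v h) q e nq = s1 zero q e nq (trans vΠ (cong₂ _xor_ (proj₁ (p-class e nq)) v))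
        (trans (hcons c (proj₁ (p-class e nq)) v refl refl h) (trans (taut 2 (λ { (a ∷ b ∷ []) → b xor false }) (λ { (a ∷ b ∷ []) → (a xor b) xor a }) refl (leg q ∷ ℓ Π ∷ [])) (cong (_xor leg q) (sym (trans ℓΠ (cong (_xor ℓ Π) (proj₂ (p-class e nq))))))))
      goP (s1 i u f nu v h) q e nq = dec (leg (- (q * u))) refl
        where
        lg : leg (- (q * u)) ≡ leg (- (+ 1)) xor (leg q xor leg u)
        lg = trans (leg-neg (∤-* pr nq nu)) (cong (leg (- (+ 1)) xor_) (leg-* nq nu))
        dec : ∀ b → leg (- (q * u)) ≡ b → St c
        dec true r = s2 zero (suc i) q u (λ ()) e f nq nu (trans vΠ (cong₂ _xor_ (proj₁ (p-class e nq)) v))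
          (trans (hcons c (proj₁ (p-class e nq)) v (proj₂ (p-class e nq)) refl h) (trans (taut 4 (λ { (w ∷ a ∷ b ∷ d ∷ []) → (w xor (a xor b)) xor (b xor d) }) (λ { (w ∷ a ∷ b ∷ d ∷ []) → w xor (a xor d) }) refl (leg (- (+ 1)) ∷ leg q ∷ ℓ Π ∷ leg u ∷ [])) (trans (sym lg) r)))
        dec false r = root (leg-false r)
          where
          re1 : ∀ p q w u → p * q * (w * w) + p * u * (q * q) ≡ p * (q * (w * w - - (q * u)))
          re1 = solve-∀
          re2 : ∀ a b → a * b ≡ b * a
          re2 = *-comm
          root : Sq p (- (q * u)) → St c
          root (w , dw) = sf (cons w (λ k → q * δ i k)) (λ { zero → ∣n⇒∣m*n w (divides q (trans e (*-comm (+ p) q))) ; (suc k) → subst (+ p ∣_) (sym (*-assoc q (δ i k) (c (suc k)))) (∣n⇒∣m*n q (p-δ c′ i f k)) })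
              (suc i , (λ d → nq (subst (+ p ∣_) (trans (cong (q *_) (δ-refl i)) (*-identityʳ q)) d)))
              (subst (+ p * + p ∣_) (sym eqn) (dd dw))
            where
            dd : + p ∣ w * w - - (q * u) → + p * + p ∣ + p * (q * (w * w - - (q * u)))
            dd (divides k′ ek) = divides (q * k′) (trans (cong (λ z → + p * (q * z)) ek) (re3 (+ p) q k′))
              where
              re3 : ∀ p q k → p * (q * (k * p)) ≡ q * k * (p * p)
              re3 = solve-∀
            eqn : c zero * (w * w) + sumℤ (λ k → c′ k * (q * δ i k * (q * δ i k))) ≡ + p * (q * (w * w - - (q * u)))
            eqn = trans (cong₂ _+_ (cong (_* (w * w)) e) (trans (sum-single i (λ k → c′ k * (q * δ i k * (q * δ i k))) (λ k ne → trans (cong (λ z → c′ k * (q * z * (q * z))) (δ-≢ (λ s → ne (sym s)))) (re4 (c′ k) q))) (trans (cong (λ z → c′ i * (q * z * (q * z))) (δ-refl i)) (trans (cong (c′ i *_) (re5 q)) (cong (_* (q * q)) f))))) (re1 (+ p) q w u)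
              where
              re4 : ∀ a q → a * (q * + 0 * (q * + 0)) ≡ + 0
              re4 = solve-∀
              re5 : ∀ q → q * + 1 * (q * + 1) ≡ q * q
              re5 = solve-∀
      goP (s2 i j u w ne f g nu nw v h) q e nq = ts (two-squares nu nw (- q))
        where
        ts : (∃ λ x → ∃ λ y → + p ∣ u * (x * x) + w * (y * y) - - q) → St c
        ts (x , y , d) = sf (cons (+ 1) α′) (λ { zero → ∣n⇒∣m*n (+ 1) (divides q (trans e (*-comm (+ p) q))) ; (suc k) → ∣-lc2 (p-δ c′ i f k) (p-δ c′ j g k) x y (re1 x (δ i k) y (δ j k) (c′ k)) })
            (zero , ¬p∣1 pr) (subst (+ p * + p ∣_) (sym eqn) (dd d))
          where
          α′ : Vc n
          α′ k = x * δ i k + y * δ j k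
          re1 : ∀ x d y e c → (x * d + y * e) * c ≡ x * (d * c) + y * (e * c)
          re1 = solve-∀
          dd : + p ∣ u * (x * x) + w * (y * y) - - q → + p * + p ∣ + p * (u * (x * x) + w * (y * y) - - q)
          dd (divides k′ ek) = divides k′ (trans (cong (+ p *_) ek) (re3 (+ p) k′))
            where
            re3 : ∀ p k → p * (k * p) ≡ k * (p * p)
            re3 = solve-∀
          re4 : ∀ c x y → c * ((x * + 1 + y * + 0) * (x * + 1 + y * + 0)) ≡ + 1 * (c * (x * x)) + + 0 * (c * (y * y))
          re4 = solve-∀
          re5 : ∀ c x y → c * ((x * + 0 + y * + 1) * (x * + 0 + y * + 1)) ≡ + 0 * (c * (x * x)) + + 1 * (c * (y * y))
          re5 = solve-∀
          re6 : ∀ c x y → c * ((x * + 0 + y * + 0) * (x * + 0 + y * + 0)) ≡ + 0 * (c * (x * x)) + + 0 * (c * (y * y))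
          re6 = solve-∀
          tm : ∀ k → c′ k * (α′ k * α′ k) ≡ δ i k * (c′ k * (x * x)) + δ j k * (c′ k * (y * y))
          tm k with i FinP.≟ k | j FinP.≟ k
          ... | yes refl | yes r = ⊥-elim (ne (sym r))
          ... | yes refl | no nj = subst₂ (λ a b → c′ k * ((x * a + y * b) * (x * a + y * b)) ≡ a * (c′ k * (x * x)) + b * (c′ k * (y * y))) (sym (δ-refl i)) (sym (δ-≢ nj)) (re4 (c′ k) x y)
          ... | no ni | yes refl = subst₂ (λ a b → c′ k * ((x * a + y * b) * (x * a + y * b)) ≡ a * (c′ k * (x * x)) + b * (c′ k * (y * y))) (sym (δ-≢ ni)) (sym (δ-refl j)) (re5 (c′ k) x y)
          ... | no ni | no nj = subst₂ (λ a b → c′ k * ((x * a + y * b) * (x * a + y * b)) ≡ a * (c′ k * (x * x)) + b * (c′ k * (y * y))) (sym (δ-≢ ni)) (sym (δ-≢ nj)) (re6 (c′ k) x y)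
          re7 : ∀ p q u X w Y → p * q * (+ 1 * + 1) + (p * u * X + p * w * Y) ≡ p * (u * X + w * Y - - q)
          re7 = solve-∀
          eqn : c zero * (+ 1 * + 1) + sumℤ (λ k → c′ k * (α′ k * α′ k)) ≡ + p * (u * (x * x) + w * (y * y) - - q)
          eqn = trans (cong₂ _+_ (cong (_* (+ 1 * + 1)) e) (trans (sum-cong tm) (trans (sum-+ (λ k → δ i k * (c′ k * (x * x))) (λ k → δ j k * (c′ k * (y * y)))) (cong₂ _+_ (trans (sum-δˡ i (λ k → c′ k * (x * x))) (cong (_* (x * x)) f)) (trans (sum-δˡ j (λ k → c′ k * (y * y))) (cong (_* (y * y)) g)))))) (re7 (+ p) q u (x * x) w (y * y))
      go : St c′ → Dec (+ p ∣ c zero) → St c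
      go s (no nc) = goU s nc
      go s (yes (divides q e)) = sub (+ p ∣? q)
        where
        sub : Dec (+ p ∣ q) → St c
        sub (no nq) = goP s q (trans e (*-comm q (+ p))) nq
        sub (yes (divides r f)) = sf (cons (+ 1) (λ _ → + 0)) (λ { zero → ∣n⇒∣m*n (+ 1) (divides q e) ; (suc k) → subst (+ p ∣_) (sym (*-zeroˡ (c (suc k)))) p∣0 }) (zero , ¬p∣1 pr)
          (subst (+ p * + p ∣_) (sym (+z (sum-0 (λ k → *-zeroʳ (c (suc k)))))) (divides r (trans (*-identityʳ (c zero)) (trans e (trans (cong (_* + p) f) (*-assoc r (+ p) (+ p)))))))

    -- Each hypothesis removes one shape: `p ∣ det M` the unit one, even valuation the one with a
    -- single `p`, trivial symbol the anisotropic plane.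
    odd-step : ∀ {n} {M : Mat n} → IsLattice M → (fr : Frame p M) → + p ∣ det M → vp p (det M) ≡ false → hs S (Frame.c fr) ≡ false → Step p M
    odd-step {n} {M} (sy , pd) fr dp v h = go (build n c (λ i → pos-nz (pc i)))
      where
      open Frame fr using (c) renaming (F to FF)
      pc : Pos c
      pc = frame-pos {M = M} pd fr
      nzΠ : prodℤ c ≢ + 0
      nzΠ = prod-nz (λ i → pos-nz (pc i))
      nzd : det M ≢ + 0
      nzd z = nzΠ (trans (sym (frame-det {M = M} fr)) (trans (cong (_* (det FF * det FF)) z) (*-zeroˡ (det FF * det FF))))
      vc : vp p (prodℤ c) ≡ false
      vc = trans (sym (sqEq-vp pr nzd nzΠ (frame-sqEq pr {M = M} fr))) v
      go : St c → Step p M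
      go (sf α a b q) = frame-step pr {M = M} sy fr α a b q
      go (s0 d _ _) = ⊥-elim (d (subst (+ p ∣_) (frame-det {M = M} fr) (∣m⇒∣m*n (det FF * det FF) dp)))
      go (s1 _ _ _ _ t _) = case trans (sym t) vc of λ ()
      go (s2 _ _ _ _ _ _ _ _ _ _ t) = case trans (sym t) h of λ ()

-- Enlargement at 2.

prod-quot : ∀ {n} (c : Vc n) k → ∃ λ q → c k * q ≡ prodℤ c
prod-quot c zero = prodℤ (c ∘ suc) , refl
prod-quot c (suc k) with prod-quot (c ∘ suc) k
... | q , e = c zero * q , trans (re (c (suc k)) (c zero) q) (cong (c zero *_) e)
  where
  re : ∀ a b q → a * (b * q) ≡ b * (a * q)
  re = solve-∀

-- An integral multiple of the inverse Gram matrix: column j of `N` pairs to `C` with eⱼ and to 0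
-- with the other basis vectors, so its norm is C·N j j.
record Dual {n} (M : Mat n) : Set where
  field
    N  : Mat n
    C  : ℤ
    C0 : C ≢ + 0
    NS : Symmetric N
    MN : Scal C (M ⊗ N)

-- The inverse read off a diagonalisation, F·diag(C/c)·Fᵀ with C the product of the diagonal; the
-- unit `u` is cancelled at the end.
dual : ∀ {p n} {M : Mat n} → Symmetric M → PosDef M → Frame p M → Dual M
dual {n = n} {M} sy pd fr = record { N = N ; C = C ; C0 = C0 ; NS = NS ; MN = λ i j → *-cancelˡ (w≢0 p∤u) (eqn i j) }
  where
  open Frame fr
  C : ℤ
  C = prodℤ c
  C0 : C ≢ + 0
  C0 = prod-nz (λ i → pos-nz (frame-pos {M = M} pd fr i))
  Q : Vc n
  Q k = proj₁ (prod-quot c k)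
  N : Mat n
  N r s = sumℤ (λ k → F r k * (Q k * F s k))
  NS : Symmetric N
  NS r s = sum-cong (λ k → re (F r k) (Q k) (F s k))
    where
    re : ∀ a q b → a * (q * b) ≡ b * (q * a)
    re = solve-∀
  tr : Scal u ((Fi ᵀ) ⊗ (F ᵀ))
  tr i j = trans (sum-cong (λ k → *-comm (Fi k i) (F j k))) (trans (right j i) (cong (u *_) (δ-sym j i)))
  uMF : ∀ i k → u * (M ⊗ F) i k ≡ Fi k i * c k
  uMF i k = trans (sym (scal-act u {(Fi ᵀ) ⊗ (F ᵀ)} tr (λ r → (M ⊗ F) r k) i)) (trans (sym (act-act (Fi ᵀ) (F ᵀ) (λ r → (M ⊗ F) r k) i))
    (trans (sum-cong (λ m → cong (Fi m i *_) (trans (sym (cgr-⊗ F M m k)) (gram m k)))) (trans (sum-cong (λ m → re (Fi m i) (c m) (δ m k))) (sum-δʳ k (λ m → Fi m i * c m)))))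
    where
    re : ∀ a b d → a * (b * d) ≡ a * b * d
    re = solve-∀
  eqn : ∀ i j → u * (M ⊗ N) i j ≡ u * (C * δ i j)
  eqn i j = begin
    u * (M ⊗ N) i j
      ≡⟨ cong (u *_) (sum-cong (λ r → cong (M i r *_) (sum-cong (λ k → cong (F r k *_) (*-comm (Q k) (F j k)))))) ⟩
    u * sumℤ (λ r → M i r * act F (λ k → F j k * Q k) r)
      ≡⟨ cong (u *_) (act-act M F (λ k → F j k * Q k) i) ⟩
    u * sumℤ (λ k → (M ⊗ F) i k * (F j k * Q k))
      ≡⟨ sym (sum-*ˡ u (λ k → (M ⊗ F) i k * (F j k * Q k))) ⟩
    sumℤ (λ k → u * ((M ⊗ F) i k * (F j k * Q k)))
      ≡⟨ sum-cong (λ k → trans (sym (*-assoc u ((M ⊗ F) i k) (F j k * Q k))) (trans (cong (_* (F j k * Q k)) (uMF i k)) (trans (re (Fi k i) (c k) (F j k) (Q k)) (cong (_* (F j k * Fi k i)) (proj₂ (prod-quot c k)))))) ⟩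
    sumℤ (λ k → C * (F j k * Fi k i))
      ≡⟨ sum-*ˡ C (λ k → F j k * Fi k i) ⟩
    C * (F ⊗ Fi) j i
      ≡⟨ cong (C *_) (trans (right j i) (cong (u *_) (δ-sym j i))) ⟩
    C * (u * δ i j)
      ≡⟨ re2 C u (δ i j) ⟩
    u * (C * δ i j) ∎
    where
    open ≡-Reasoning
    re : ∀ a c f q → a * c * (f * q) ≡ c * q * (f * a)
    re = solve-∀
    re2 : ∀ c u d → c * (u * d) ≡ u * (c * d)
    re2 = solve-∀

record Dual2 {n} (M : Mat n) : Set where
  field
    dl : Dual M
    a b : Fin n
    odd : ¬ (+ 2 ∣ Dual.N dl a b)

abstract
  -- While `N` is divisible by 2, so is `C`, a diagonal entry of `M ⊗ N`; halving both shrinks `C`.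
  strip : ∀ {n} {M : Mat (suc n)} (D : Dual M) → Acc _<_ (abs (Dual.C D)) → Dual2 M
  strip {n} {M} D (acc rs) = go (any? (λ i → any? (λ j → ¬? (+ 2 ∣? N i j))))
    where
    open Dual D
    go : Dec (∃ λ i → ∃ λ j → ¬ (+ 2 ∣ N i j)) → Dual2 M
    go (yes (i , j , h)) = record { dl = D ; a = i ; b = j ; odd = h }
    go (no none) = strip D′ (rs smaller)
      where
      ev : ∀ i j → + 2 ∣ N i j
      ev i j with + 2 ∣? N i j
      ... | yes q = q
      ... | no q = ⊥-elim (none (i , j , q))
      N′ : Mat (suc n)
      N′ i j = _∣_.quotient (ev i j)
      Ne : ∀ i j → N i j ≡ N′ i j * + 2
      Ne i j = _∣_.equality (ev i j)
      MN′ : ∀ i j → (M ⊗ N) i j ≡ (M ⊗ N′) i j * + 2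
      MN′ i j = trans (sum-cong (λ k → trans (cong (M i k *_) (Ne k j)) (sym (*-assoc (M i k) (N′ k j) (+ 2))))) (sum-*ʳ (+ 2) (λ k → M i k * N′ k j))
      dC : + 2 ∣ C
      dC = divides ((M ⊗ N′) zero zero) (trans (sym (*-identityʳ C)) (trans (sym (MN zero zero)) (MN′ zero zero)))
      C′ : ℤ
      C′ = _∣_.quotient dC
      Ce : C ≡ C′ * + 2
      Ce = _∣_.equality dC
      C0′ : C′ ≢ + 0
      C0′ q = C0 (trans Ce (cong (_* + 2) q))
      re : ∀ c d → c * + 2 * d ≡ + 2 * (c * d)
      re = solve-∀
      D′ : Dual M
      D′ = record { N = N′ ; C = C′ ; C0 = C0′ ; NS = λ i j → ℤP.*-cancelʳ-≡ (N′ i j) (N′ j i) (+ 2) (trans (sym (Ne i j)) (trans (NS i j) (Ne j i)))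
        ; MN = λ i j → *-cancelˡ {+ 2} (λ ()) (trans (*-comm (+ 2) ((M ⊗ N′) i j)) (trans (sym (MN′ i j)) (trans (MN i j) (trans (cong (_* δ i j) Ce) (re C′ (δ i j)))))) }
      smaller : abs C′ < abs C
      smaller = subst (abs C′ <_) (trans (sym (abs-* C′ (+ 2))) (cong abs (sym Ce))) (m<m*n (abs C′) 2 {{ℕ.≢-nonZero λ q → C0′ (ℤP.∣i∣≡0⇒i≡0 q)}} (s≤s (s≤s z≤n)))

  -- A column of `N` with an odd entry works if C·N j j is divisible by 4, and so does a sum of two
  -- columns with odd diagonal entries if it is odd somewhere. If neither occurs, `C` is 2 modulo 4
  -- and `N` has rank one modulo 2, which leaves too few factors 2 for `det M`.
  two-step : ∀ {n} {M : Mat (suc n)} → Symmetric M → Dual2 M → + 2 * + 2 ∣ det M → Step 2 M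
  two-step {n} {M} sy D d4 = caseC (+ 2 ∣? C)
    where
    open Dual2 D
    open Dual dl
    col : Fin (suc n) → Vc (suc n)
    col j r = N r j
    Mcol : ∀ j r → act M (col j) r ≡ C * δ r j
    Mcol j r = MN r j
    bcol : ∀ i j → bil M (col i) (col j) ≡ C * N i j
    bcol i j = trans (bil≡dot M (col i) (col j)) (trans (sum-cong (λ r → trans (cong (N r i *_) (Mcol j r)) (re (N r i) C (δ r j)))) (trans (sum-*ˡ C (λ r → N r i * δ r j)) (cong (C *_) (trans (sum-δʳ j (λ r → N r i)) (NS j i)))))
      where
      re : ∀ a c d → a * (c * d) ≡ c * (a * d)
      re = solve-∀
    detMN : det M * det N ≡ pow C (suc n)
    detMN = trans (sym (det-⊗ M N)) (scal-det C {M ⊗ N} MN)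
    caseC : Dec (+ 2 ∣ C) → Step 2 M
    caseC (no nC) = ⊥-elim (pow-∤ prime[2] nC (suc n) (subst (+ 2 ∣_) detMN (∣m⇒∣m*n (det N) (∣-tr (divides (+ 2) refl) d4))))
    caseC (yes (divides C′ eC)) = case4 (+ 2 ∣? C′)
      where
      dC : + 2 ∣ C
      dC = divides C′ eC
      mx1 : ∀ j r → + 2 ∣ act M (col j) r
      mx1 j r = subst (+ 2 ∣_) (sym (Mcol j r)) (∣m⇒∣m*n (δ r j) dC)
      qd : ∀ {t} → + 2 ∣ t → + 2 * + 2 ∣ C * t
      qd (divides t′ et) = divides (C′ * t′) (trans (cong₂ _*_ eC et) (re C′ t′))
        where
        re : ∀ c t → c * + 2 * (t * + 2) ≡ c * t * (+ 2 * + 2)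
        re = solve-∀
      case4 : Dec (+ 2 ∣ C′) → Step 2 M
      case4 (yes (divides C″ e″)) = record { x = col b ; i = a ; x∤ = odd ; Mx = mx1 b ; qx = subst (+ 2 * + 2 ∣_) (sym (bcol b b)) (∣m⇒∣m*n (N b b) (divides C″ (trans eC (trans (cong (_* + 2) e″) (*-assoc C″ (+ 2) (+ 2)))))) }
      case4 (no nC′) = search1 (any? (λ j → (+ 2 ∣? N j j) ×-dec any? (λ i → ¬? (+ 2 ∣? N i j))))
        where
        search1 : Dec (∃ λ j → + 2 ∣ N j j × ∃ λ i → ¬ (+ 2 ∣ N i j)) → Step 2 M
        search1 (yes (j , ev , i , od)) = record { x = col j ; i = i ; x∤ = od ; Mx = mx1 j ; qx = subst (+ 2 * + 2 ∣_) (sym (bcol j j)) (qd ev) }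
        search1 (no no1) = search2 (any? (λ j → ¬? (+ 2 ∣? N j j) ×-dec any? (λ r → ¬? (+ 2 ∣? (N r j + + 1 * N r b)))))
          where
          evcol : ∀ j → + 2 ∣ N j j → ∀ r → + 2 ∣ N r j
          evcol j ev r with + 2 ∣? N r j
          ... | yes q = q
          ... | no q = ⊥-elim (no1 (j , ev , r , q))
          bb : ¬ (+ 2 ∣ N b b)
          bb ev = odd (evcol b ev a)
          oddsum : ∀ {x y} → ¬ (+ 2 ∣ x) → ¬ (+ 2 ∣ y) → + 2 ∣ x + y
          oddsum {x} {y} nx ny = bit-∣ (trans (bit-+ x y) (cong₂ _xor_ (bit-odd nx) (bit-odd ny)))
          search2 : Dec (∃ λ j → ¬ (+ 2 ∣ N j j) × ∃ λ r → ¬ (+ 2 ∣ N r j + + 1 * N r b)) → Step 2 M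
          search2 (yes (j , oj , r , nr)) = record { x = λ r → col j r + + 1 * col b r ; i = r ; x∤ = nr
              ; Mx = λ s → subst (+ 2 ∣_) (sym (trans (sum-cong (λ k → re (M s k) (N k j) (N k b))) (sum-+ (λ k → M s k * N k j) (λ k → M s k * N k b)))) (∣m∣n⇒∣m+n (mx1 j s) (mx1 b s))
              ; qx = subst (+ 2 * + 2 ∣_) (sym (trans (bil-quad sy (col j) (col b) (+ 1)) (trans (cong₂ _+_ (cong₂ (λ s t → s + + 2 * + 1 * t) (bcol j j) (bcol j b)) (cong (+ 1 * + 1 *_) (bcol b b))) (re2 C (N j j) (N j b) (N b b))))) (qd (∣m∣n⇒∣m+n (oddsum oj bb) (∣m⇒∣m*n (N j b) ∣-refl))) }
            where
            re : ∀ m x y → m * (x + + 1 * y) ≡ m * x + m * y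
            re = solve-∀
            re2 : ∀ c x y z → c * x + + 2 * + 1 * (c * y) + + 1 * + 1 * (c * z) ≡ c * ((x + z) + + 2 * y)
            re2 = solve-∀
          search2 (no no2) = ⊥-elim (nC′n final)
            where
            -- Modulo 2 every column of `N` is now zero or equal to column `b`; the coefficient -1
            -- is used exactly for the latter, `b` itself excepted.
            t : Vc (suc n)
            t j with j FinP.≟ b | + 2 ∣? N j j
            ... | yes _ | _ = + 0
            ... | no _ | yes _ = + 0
            ... | no _ | no _ = - (+ 1)
            tb : dot t (ê b) ≡ + 0
            tb = trans (sum-δʳ b t) tb′
              where
              tb′ : t b ≡ + 0
              tb′ with b FinP.≟ b | + 2 ∣? N b b
              ... | yes _ | _ = refl
              ... | no ne | _ = ⊥-elim (ne refl)
            E : Mat (suc n)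
            E = shear (ê b) t
            IE : Inv 2 E
            IE = shear-inv prime[2] (ê b) t tb
            NE : ∀ r j → (N ⊗ E) r j ≡ N r j + t j * N r b
            NE r j = trans (sum-cong (λ k → re (N r k) (δ k j) (δ k b) (t j))) (trans (sum-+ (λ k → N r k * δ k j) (λ k → t j * (N r k * δ k b))) (cong₂ _+_ (sum-δʳ j (N r)) (trans (sum-*ˡ (t j) (λ k → N r k * δ k b)) (cong (t j *_) (sum-δʳ b (N r))))))
              where
              re : ∀ a d e t → a * (d + e * t) ≡ a * d + t * (a * e)
              re = solve-∀
            evNE : ∀ r j → j ≢ b → + 2 ∣ N r j + t j * N r b
            evNE r j ne with j FinP.≟ b | + 2 ∣? N j j
            ... | yes q | _ = ⊥-elim (ne q)
            ... | no _ | yes ev = ∣m∣n⇒∣m+n (evcol j ev r) (divides (+ 0) (*-zeroˡ (N r b)))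
            ... | no _ | no od = ∣-lc2 sm ∣-refl (+ 1) (- N r b) (re (N r j) (N r b))
              where
              re : ∀ x y → x + - (+ 1) * y ≡ + 1 * (x + + 1 * y) + - y * + 2
              re = solve-∀
              sm : + 2 ∣ N r j + + 1 * N r b
              sm with + 2 ∣? (N r j + + 1 * N r b)
              ... | yes q = q
              ... | no q = ⊥-elim (no2 (j , od , r , q))
            κ : Vc (suc n)
            κ = qik b (+ 2)
            dv : ∀ r j → κ j ∣ N r j + t j * N r b
            dv r j = dv′ (j FinP.≟ b)
              where
              dv′ : Dec (j ≡ b) → κ j ∣ N r j + t j * N r b
              dv′ (yes q) = subst (_∣ N r j + t j * N r b) (sym (trans (cong κ q) (qik-≡ b (+ 2)))) (divides (N r j + t j * N r b) (sym (*-identityʳ (N r j + t j * N r b))))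
              dv′ (no ne) = subst (_∣ N r j + t j * N r b) (sym (qik-≢ ne (+ 2))) (evNE r j ne)
            N″ : Mat (suc n)
            N″ r j = _∣_.quotient (dv r j)
            fac : ∀ r j → (N ⊗ E) r j ≡ (N″ ⊗ diag κ) r j
            fac r j = trans (NE r j) (trans (_∣_.equality (dv r j)) (sym (trans (sum-cong (λ k → re (N″ r k) (κ k) (δ k j))) (sum-δʳ j (λ k → N″ r k * κ k)))))
              where
              re : ∀ a b d → a * (b * d) ≡ a * b * d
              re = solve-∀
            pκ : ∀ {m} (i : Fin (suc m)) → prodℤ (qik i (+ 2)) ≡ pow (+ 2) m
            pκ {m} zero = trans (*-identityˡ (prodℤ {m} (λ _ → + 2))) (prod-const m (+ 2))
            pκ {suc m} (suc i) = cong (+ 2 *_) (pκ i)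
            detN : det N * det E ≡ det N″ * pow (+ 2) n
            detN = trans (sym (det-⊗ N E)) (trans (det-cong fac) (trans (det-⊗ N″ (diag κ)) (cong (det N″ *_) (trans (det-diag κ) (pκ b)))))
            powM : ∀ a m → pow (a * + 2) m ≡ pow a m * pow (+ 2) m
            powM a zero = refl
            powM a (suc m) = trans (cong (a * + 2 *_) (powM a m)) (re a (pow a m) (pow (+ 2) m))
              where
              re : ∀ a x y → a * + 2 * (x * y) ≡ a * x * (+ 2 * y)
              re = solve-∀
            p20 : ∀ m → pow (+ 2) m ≢ + 0
            p20 zero ()
            p20 (suc m) = *-nz {+ 2} (λ ()) (p20 m)
            -- `det N` accounts for 2ⁿ and `C` to the power n + 1 for one factor 2 more, so a single
            -- 2 is left over for `det M`.
            main : det M * det N″ ≡ + 2 * (pow C′ (suc n) * det E)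
            main = *-cancelˡ (p20 n) (trans (re1 (pow (+ 2) n) (det M) (det N″)) (trans (cong (det M *_) (sym detN)) (trans (sym (*-assoc (det M) (det N) (det E))) (trans (cong (_* det E) (trans detMN (trans (cong (λ z → pow z (suc n)) eC) (powM C′ (suc n))))) (re2 (pow C′ (suc n)) (pow (+ 2) n) (det E))))))
              where
              re1 : ∀ p a b → p * (a * b) ≡ a * (b * p)
              re1 = solve-∀
              re2 : ∀ c p e → c * (+ 2 * p) * e ≡ p * (+ 2 * (c * e))
              re2 = solve-∀
            final : + 2 ∣ pow C′ (suc n)
            final = subst (+ 2 ∣_) (trans (*-assoc (pow C′ (suc n)) (det E) (det E)) (trans (cong (pow C′ (suc n) *_) (unit-sq (det (Inv.Ei IE)) (det E) (trans (sym (det-⊗ (Inv.Ei IE) E)) (scal1-det (Inv.left IE))))) (*-identityʳ (pow C′ (suc n)))))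
              (∣m⇒∣m*n (det E) (ℤS.*-cancelˡ-∣ (+ 2) (subst (+ 2 * + 2 ∣_) main (∣m⇒∣m*n (det N″) d4))))
            nC′n : ¬ (+ 2 ∣ pow C′ (suc n))
            nC′n = pow-∤ prime[2] nC′ (suc n)

-- Ascent to a unimodular lattice.

vp-even-sq : ∀ {p} → Prime p → ∀ {d} → d ≢ + 0 → vp p d ≡ false → + p ∣ d → + p * + p ∣ d
vp-even-sq {p} pr {d} d0 v dp = go (val p d) refl
  where
  go : ∀ k → val p d ≡ k → + p * + p ∣ d
  go zero q = ⊥-elim (unit-∤ pr d0 (subst (+ p ∣_) (trans (val-spec pr d0) (trans (cong (λ k → pk p k * unit p d) q) (*-identityˡ (unit p d)))) dp))
  go (suc zero) q = case trans (sym v) (cong par q) of λ ()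
  go (suc (suc k)) q = divides (pk p k * unit p d) (trans (val-spec pr d0) (trans (cong (λ k → pk p k * unit p d) q) (trans (cong (_* unit p d) (trans (pk-suc p (suc k)) (cong (+ p *_) (pk-suc p k)))) (re (+ p) (pk p k) (unit p d)))))
    where
    re : ∀ p k u → p * (p * k) * u ≡ k * u * (p * p)
    re = solve-∀

prime-factor : ∀ n → 1 < n → ∃ λ p → Prime p × p ℕD.∣ n
prime-factor n h = go (PrimeFactorisation.factors f) (PrimeFactorisation.isFactorisation f) (PrimeFactorisation.factorsPrime f)
  where
  f = factorise n {{ℕ.>-nonZero (<-trans (s≤s z≤n) h)}}
  go : ∀ l → n ≡ Data.Nat.ListAction.product l → All Prime l → ∃ λ p → Prime p × p ℕD.∣ n
  go [] e _ = ⊥-elim (<-irrefl (sym e) h)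
  go (p ∷ l) e (pp ∷ _) = p , pp , ℕD.divides (Data.Nat.ListAction.product l) (trans e (ℕP.*-comm p (Data.Nat.ListAction.product l)))

-- A frame at 3 is also a diagonalisation over ℚ and serves as the global one wherever the choice of
-- prime is immaterial.
prime3 : OddPrime 3
prime3 = toWitness {a? = prime? 3} tt , (λ ())

prod-pos : ∀ {n} (c : Vc n) → Pos c → + 0 <ℤ prodℤ c
prod-pos {zero} c pc = ℤ.+<+ (s≤s z≤n)
prod-pos {suc n} c pc = pos-* (pc zero) (prod-pos (c ∘ suc) (pc ∘ suc))

pos-det : ∀ {n} {M : Mat n} → IsLattice M → + 0 <ℤ det M
pos-det {n} {M} lat = ℤP.*-cancelʳ-<-nonNeg (det F * det F) {{nn}} (subst₂ _<ℤ_ (sym (*-zeroˡ (det F * det F))) (sym (frame-det {M = M} fr)) (prod-pos c (frame-pos {M = M} (proj₂ lat) fr)))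
  where
  fr : Frame 3 M
  fr = frame prime3 n M lat
  open Frame fr
  nn : ℤ.NonNegative (det F * det F)
  nn = ℤ.nonNegative (sq-nonneg (det F))

-- The orthogonal basis is existential and may vary with `p`, so the property passes to an
-- overlattice by carrying the same vectors along the embedding.
OrthS : ∀ {n} → Mat n → Set
OrthS {n} M = ∀ {p} (op : OddPrime p) → Σ (Mat n) λ U → Σ (Vc n) λ b → Pos b × (∀ j l → cgr U M j l ≡ diag b j l) × hs (oddSymbol op) b ≡ false

emb-trans : ∀ {n} {M M′ M″ : Mat n} → Emb M M′ → Emb M′ M″ → Emb M M″
emb-trans {M = M} {M′} {M″} (A , a) (B , b) = B ⊗ A , λ i j → trans (sym (cgr-cgr B A M″ i j)) (trans (cgr-cong {E = A} {A} {cgr B M″} {M′} (λ _ _ → refl) b i j) (a i j))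

emb-odd : ∀ {n} {M M′ : Mat n} → Emb M M′ → Odd M → Odd M′
emb-odd {M = M} {M′} (A , a) (x , nx) = act A x , λ d → nx (subst (+ 2 ℤU.∣_) (trans (sym (bil-act A M′ x x)) (bil-cong {M = cgr A M′} {M} {x} {x} {x} {x} a (λ _ → refl) (λ _ → refl))) d)

emb-orth : ∀ {n} {M M′ : Mat n} → Emb M M′ → OrthS M → OrthS M′
emb-orth {M = M} {M′} (A , a) o op with o op
... | U , b , pb , g , h = A ⊗ U , b , pb , (λ j l → trans (sym (cgr-cgr A U M′ j l)) (trans (cgr-cong {E = U} {U} {cgr A M′} {M} (λ _ _ → refl) a j l) (g j l))) , h

Envelope : ∀ {n} → Mat n → Set
Envelope {n} M = Σ (Mat n) λ U → IsLattice U × det U ≡ + 1 × Emb M U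

abstract
  -- Descent on the determinant: each enlargement divides it by p², which preserves the parity of
  -- every valuation, and an integer greater than 1 always offers a next prime.
  unimodular : ∀ {n} (M : Mat n) → Acc _<_ (abs (det M)) → IsLattice M → (∀ {p} → Prime p → vp p (det M) ≡ false) → OrthS M →
    Envelope M
  unimodular {zero} M _ lat _ _ = M , lat , refl , δ , λ ()
  unimodular {suc n} M (acc rs) lat ev os = go (det M) refl (pos-det lat)
    where
    recur : ∀ {p} → Prime p → Step p M → Envelope M
    recur {p} pr st = fin (unimodular M′ (rs smaller) lat′ ev′ (emb-orth {M = M} {M′} emb os))
      where
      ov : Overlattice p M
      ov = overlattice pr M lat st
      open Overlattice ov renaming (lat to lat′)
      d0 : det M′ ≢ + 0
      d0 = pos-nz (pos-det lat′)
      smaller : abs (det M′) < abs (det M)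
      smaller = subst (abs (det M′) <_) (trans (ℕP.*-comm (abs (det M′)) (p *ᴺ p)) (sym (trans (cong abs dt) (trans (abs-* (+ p * + p) (det M′)) (cong (_*ᴺ abs (det M′)) (abs-* (+ p) (+ p)))))))
        (m<m*n (abs (det M′)) (p *ᴺ p) {{ℕ.≢-nonZero λ q → d0 (ℤP.∣i∣≡0⇒i≡0 q)}} (<-≤-trans 1<p (ℕP.m≤m*n p p {{prime-nz pr}})))
        where
        1<p : 1 < p
        1<p = prime>1 pr
      ev′ : ∀ {q} → Prime q → vp q (det M′) ≡ false
      ev′ {q} qr = trans (sym (trans (cong (vp q) (trans dt (*-comm (+ p * + p) (det M′)))) (trans (vp-* qr d0 (*-nz (+p≢0 pr) (+p≢0 pr))) (trans (cong (vp q (det M′) xor_) (trans (vp-* qr (+p≢0 pr) (+p≢0 pr)) (xor-same (vp q (+ p))))) (xor-identityʳ (vp q (det M′))))))) (ev qr)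
      fin : Envelope M′ → Envelope M
      fin (U , l , d , e) = U , l , d , emb-trans {M = M} {M′} {U} emb e
    go : ∀ d → det M ≡ d → + 0 <ℤ d → Envelope M
    go (+ zero) _ (ℤ.+<+ ())
    go (+ suc zero) e _ = M , lat , e , δ , λ i j → cgr-δ M (λ i j → sym (*-identityˡ (δ i j))) i j
    go (+ suc (suc k)) e _ = prm (prime-factor (suc (suc k)) (s≤s (s≤s z≤n)))
      where
      prm : (∃ λ p → Prime p × p ℕD.∣ suc (suc k)) → Envelope M
      prm (p , pr , dp) = two? (p ℕ.≟ 2)
        where
        dpM : + p ∣ det M
        dpM = subst (+ p ∣_) (sym e) (∣ᵤ⇒∣ dp)
        d4 : + p * + p ∣ det M
        d4 = vp-even-sq pr (pos-nz (pos-det lat)) (ev pr) dpM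
        two? : Dec (p ≡ 2) → Envelope M
        two? (yes refl) = recur pr (two-step (proj₁ lat) (strip (dual (proj₁ lat) (proj₂ lat) (frame prime3 (suc n) M lat)) (ℕI.<-wellFounded _)) d4)
        two? (no ne) = recur pr (OddStep.odd-step op lat fr dpM (ev pr) (ds (os op)))
          where
          op : OddPrime p
          op = pr , ne
          fr : Frame p M
          fr = frame op (suc n) M lat
          ds : (Σ (Mat (suc n)) λ U → Σ (Vc (suc n)) λ b → Pos b × (∀ j l → cgr U M j l ≡ diag b j l) × hs (oddSymbol op) b ≡ false) → hs (oddSymbol op) (Frame.c fr) ≡ false
          ds (U , b , pb , g , h) = trans (heq (orth-equ {M = M} (proj₂ lat) fr U b pb g) (oddSymbol op)) h

embeds-same : ∀ {n} (M : Mat n) → IsLattice M → Odd M → (∀ {p} → Prime p → vp p (det M) ≡ false) → OrthS M → EmbedsInOddUnimodular n M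
embeds-same {n} M lat od ev os = fin (unimodular M (ℕI.<-wellFounded _) lat ev os)
  where
  fin : Envelope M → EmbedsInOddUnimodular n M
  fin (U , l , d , A , a) = U , l , d , emb-odd {M = M} {U} (A , a) od , A , a , inj
    where
    -- A nonzero kernel vector would have norm zero.
    inj : ∀ (x : Vc n) → (∀ r → act A x r ≡ + 0) → ∀ i → x i ≡ + 0
    inj x z i = case x i ℤ.≟ + 0 of λ where
        (yes q) → q
        (no q) → ⊥-elim (pos-nz (proj₂ lat x (i , q)) (trans (bil-cong {M = M} {cgr A U} {x} {x} {x} {x} (λ j l → sym (a j l)) (λ _ → refl) (λ _ → refl)) (trans (bil-act A U x x) zz)))
      where
      zz : bil U (act A x) (act A x) ≡ + 0
      zz = sum-0 (λ r → sum-0 (λ s → trans (cong (_* (U r s * act A x s)) (z r)) (*-zeroˡ (U r s * act A x s))))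

-- Hasse symbols of rational bases

ι : ℤ → ℚ
ι z = ℚ.mkℚ z 0 (ℕC.sym (ℕC.1-coprimeTo (abs z)))

toℚ≡ι : ∀ z → toℚ z ≡ ι z
toℚ≡ι z = ℚP.↥p/↧p≡p (ι z)

↥toℚ : ∀ z → ↥ (toℚ z) ≡ z
↥toℚ z = cong ↥_ (toℚ≡ι z)

↧toℚ : ∀ z → ↧ (toℚ z) ≡ + 1
↧toℚ z = cong ↧_ (toℚ≡ι z)

toℚ-inj : ∀ {a b} → toℚ a ≡ toℚ b → a ≡ b
toℚ-inj {a} {b} q = trans (sym (↥toℚ a)) (trans (cong ↥_ q) (↥toℚ b))

toℚ-+ : ∀ a b → toℚ (a + b) ≡ toℚ a ℚ.+ toℚ b
toℚ-+ a b = sym (trans (cong₂ ℚ._+_ (toℚ≡ι a) (toℚ≡ι b)) (cong toℚ (cong₂ _+_ (*-identityʳ a) (*-identityʳ b))))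

toℚ-* : ∀ a b → toℚ (a * b) ≡ toℚ a ℚ.* toℚ b
toℚ-* a b = sym (cong₂ ℚ._*_ (toℚ≡ι a) (toℚ≡ι b))

numer : ∀ q → toℚ (↥ q) ≡ toℚ (↧ q) ℚ.* q
numer q@(ℚ.mkℚ _ _ _) = trans (toℚ≡ι (↥ q)) (trans (ℚP.toℚᵘ-injective (ℚᵘP.≃-trans (ℚᵘ.*≡* (re (↥ q) (↧ q))) (ℚᵘP.≃-sym (ℚP.toℚᵘ-homo-* (ι (↧ q)) q)))) (cong (ℚ._* q) (sym (toℚ≡ι (↧ q)))))
  where
  re : ∀ n d → n * (+ 1 * d) ≡ d * n * + 1
  re = solve-∀

sumℚ-cong : ∀ {n} {f g : Fin n → ℚ} → (∀ i → f i ≡ g i) → sumℚ f ≡ sumℚ g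
sumℚ-cong {zero} e = refl
sumℚ-cong {suc n} e = cong₂ ℚ._+_ (e zero) (sumℚ-cong (e ∘ suc))

toℚ-sum : ∀ {n} (f : Vc n) → toℚ (sumℤ f) ≡ sumℚ (λ i → toℚ (f i))
toℚ-sum {zero} f = refl
toℚ-sum {suc n} f = trans (toℚ-+ (f zero) (sumℤ (f ∘ suc))) (cong (toℚ (f zero) ℚ.+_) (toℚ-sum (f ∘ suc)))

sumℚ-*ˡ : ∀ {n} c (f : Fin n → ℚ) → sumℚ (λ i → c ℚ.* f i) ≡ c ℚ.* sumℚ f
sumℚ-*ˡ {zero} c f = sym (ℚP.*-zeroʳ c)
sumℚ-*ˡ {suc n} c f = trans (cong (c ℚ.* f zero ℚ.+_) (sumℚ-*ˡ c (f ∘ suc))) (sym (ℚP.*-distribˡ-+ c (f zero) (sumℚ (f ∘ suc))))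

sumℚ-0 : ∀ {n} {f : Fin n → ℚ} → (∀ i → f i ≡ ℚ.0ℚ) → sumℚ f ≡ ℚ.0ℚ
sumℚ-0 {zero} e = refl
sumℚ-0 {suc n} e = trans (cong₂ ℚ._+_ (e zero) (sumℚ-0 (e ∘ suc))) (ℚP.+-identityˡ ℚ.0ℚ)

private
  open ℚSol.+-*-Solver using (solve; _:+_; _:*_; _:=_)

  ℚ4 : ∀ a b c d → (a ℚ.+ b) ℚ.+ (c ℚ.+ d) ≡ (a ℚ.+ c) ℚ.+ (b ℚ.+ d)
  ℚ4 = solve 4 (λ a b c d → (a :+ b) :+ (c :+ d) := (a :+ c) :+ (b :+ d)) refl

  ℚ5 : ∀ N u g K v → (N ℚ.* u) ℚ.* (g ℚ.* (K ℚ.* v)) ≡ (N ℚ.* K) ℚ.* (u ℚ.* (g ℚ.* v))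
  ℚ5 = solve 5 (λ N u g K v → (N :* u) :* (g :* (K :* v)) := (N :* K) :* (u :* (g :* v))) refl

  ℚ3 : ∀ a b c → a ℚ.* (b ℚ.* c) ≡ b ℚ.* (a ℚ.* c)
  ℚ3 = solve 3 (λ a b c → a :* (b :* c) := b :* (a :* c)) refl

sumℚ-+ : ∀ {n} (f g : Fin n → ℚ) → sumℚ (λ i → f i ℚ.+ g i) ≡ sumℚ f ℚ.+ sumℚ g
sumℚ-+ {zero} f g = sym (ℚP.+-identityˡ ℚ.0ℚ)
sumℚ-+ {suc n} f g = trans (cong (f zero ℚ.+ g zero ℚ.+_) (sumℚ-+ (f ∘ suc) (g ∘ suc))) (ℚ4 (f zero) (g zero) (sumℚ (f ∘ suc)) (sumℚ (g ∘ suc)))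

sumℚ-swap : ∀ {m n} (f : Fin m → Fin n → ℚ) → sumℚ (λ i → sumℚ (f i)) ≡ sumℚ (λ j → sumℚ (λ i → f i j))
sumℚ-swap {zero} {n} f = sym (sumℚ-0 {n} (λ _ → refl))
sumℚ-swap {suc m} f = trans (cong (sumℚ (f zero) ℚ.+_) (sumℚ-swap (f ∘ suc))) (sym (sumℚ-+ (f zero) (λ j → sumℚ (λ i → f (suc i) j))))

sumℚ-single : ∀ {n} (k : Fin n) (f : Fin n → ℚ) → (∀ i → i ≢ k → f i ≡ ℚ.0ℚ) → sumℚ f ≡ f k
sumℚ-single zero f z = trans (cong (f zero ℚ.+_) (sumℚ-0 (λ i → z (suc i) (λ ())))) (ℚP.+-identityʳ (f zero))
sumℚ-single (suc k) f z = trans (cong₂ ℚ._+_ (z zero (λ ())) (sumℚ-single k (f ∘ suc) (λ i ne → z (suc i) (λ q → ne (FinP.suc-injective q))))) (ℚP.+-identityˡ (f (suc k)))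

toℚ-bil : ∀ {n} (G : Mat n) {x y : Fin n → ℚ} (X Y : Vc n) N K → (∀ i → toℚ (X i) ≡ toℚ N ℚ.* x i) → (∀ i → toℚ (Y i) ≡ toℚ K ℚ.* y i) →
  toℚ (bil G X Y) ≡ (toℚ N ℚ.* toℚ K) ℚ.* bilℚ G x y
toℚ-bil G {x} {y} X Y N K ex ey = trans (toℚ-sum (λ i → sumℤ (λ j → X i * (G i j * Y j)))) (trans (sumℚ-cong (λ i → trans (toℚ-sum (λ j → X i * (G i j * Y j)))
    (trans (sumℚ-cong (λ j → trans (toℚ-* (X i) (G i j * Y j)) (trans (cong₂ ℚ._*_ (ex i) (trans (toℚ-* (G i j) (Y j)) (cong (toℚ (G i j) ℚ.*_) (ey j)))) (ℚ5 (toℚ N) (x i) (toℚ (G i j)) (toℚ K) (y j)))))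
      (sumℚ-*ˡ (toℚ N ℚ.* toℚ K) (λ j → x i ℚ.* (toℚ (G i j) ℚ.* y j)))))) (sumℚ-*ˡ (toℚ N ℚ.* toℚ K) (λ i → sumℚ (λ j → x i ℚ.* (toℚ (G i j) ℚ.* y j)))))

abstract
  clear-denominators : ∀ {n} (x : Fin n → ℚ) → Σ ℤ λ N → N ≢ + 0 × Σ (Vc n) λ X → ∀ i → toℚ (X i) ≡ toℚ N ℚ.* x i
  clear-denominators {zero} x = + 1 , (λ ()) , (λ ()) , λ ()
  clear-denominators {suc n} x = go (clear-denominators (x ∘ suc))
    where
    d : ℤ
    d = ↧ (x zero)
    go : (Σ ℤ λ N → N ≢ + 0 × Σ (Vc n) λ X → ∀ i → toℚ (X i) ≡ toℚ N ℚ.* x (suc i)) → Σ ℤ λ N → N ≢ + 0 × Σ (Vc (suc n)) λ X → ∀ i → toℚ (X i) ≡ toℚ N ℚ.* x i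
    go (N , N0 , X , e) = N * d , *-nz N0 (↧≢0 (x zero)) , cons (N * ↥ (x zero)) (λ i → d * X i) , λ where
      zero → trans (toℚ-* N (↥ (x zero))) (trans (cong (toℚ N ℚ.*_) (numer (x zero))) (trans (sym (ℚP.*-assoc (toℚ N) (toℚ d) (x zero))) (cong (ℚ._* x zero) (sym (toℚ-* N d)))))
      (suc i) → trans (toℚ-* d (X i)) (trans (cong (toℚ d ℚ.*_) (e i)) (trans (ℚ3 (toℚ d) (toℚ N) (x (suc i))) (trans (sym (ℚP.*-assoc (toℚ N) (toℚ d) (x (suc i)))) (cong (ℚ._* x (suc i)) (sym (toℚ-* N d))))))

ℚ-cancelˡ : ∀ r .{{_ : ℚ.NonZero r}} {p q} → r ℚ.* p ≡ r ℚ.* q → p ≡ q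
ℚ-cancelˡ r {p} {q} e = trans (sym (inv p)) (trans (cong (ℚ.1/ r ℚ.*_) e) (inv q))
  where
  inv : ∀ p → ℚ.1/ r ℚ.* (r ℚ.* p) ≡ p
  inv p = trans (sym (ℚP.*-assoc (ℚ.1/ r) r p)) (trans (cong (ℚ._* p) (ℚP.*-inverseˡ r)) (ℚP.*-identityˡ p))

toℚ-clear : ∀ b M q → toℚ b ≡ toℚ M ℚ.* q → b * ↧ q ≡ M * ↥ q
toℚ-clear b M q e = toℚ-inj (trans (toℚ-* b (↧ q)) (trans (cong (ℚ._* toℚ (↧ q)) e) (trans (ℚP.*-assoc (toℚ M) q (toℚ (↧ q))) (trans (cong (toℚ M ℚ.*_) (trans (ℚP.*-comm q (toℚ (↧ q))) (sym (numer q)))) (sym (toℚ-* M (↥ q)))))))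

pairs-hs : ∀ {p} (S : LocalSymbol p) n (b : Vc n) → (∀ i → b i ≢ + 0) → (f : Fin n → Fin n → ℤ) →
  (∀ i j → toℕ i < toℕ j → f i j ≡ sgn (LocalSymbol.h S (b i) (b j))) → prodPairs f ≡ sgn (hs S b)
pairs-hs S zero b nz f e = refl
pairs-hs S (suc n) b nz f e = trans (cong₂ _*_ (trans (*-identityˡ (prodℤ (λ j → f zero (suc j)))) (row n (b ∘ suc) (nz ∘ suc) (λ j → f zero (suc j)) (λ j → e zero (suc j) (s≤s z≤n))))
    (trans (prod-cong (λ i → *-identityˡ (prodℤ (λ j → if toℕ i ℕ.<ᵇ toℕ j then f (suc i) (suc j) else + 1)))) (pairs-hs S n (b ∘ suc) (nz ∘ suc) (λ i j → f (suc i) (suc j)) (λ i j lt → e (suc i) (suc j) (s≤s lt)))))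
  (sym (sgn-xor (h (b zero) (prodℤ (b ∘ suc))) (hs S (b ∘ suc))))
  where
  open LocalSymbol S using (h)
  open SymbolProperties S
  prod-cong : ∀ {n} {f g : Vc n} → (∀ i → f i ≡ g i) → prodℤ f ≡ prodℤ g
  prod-cong {zero} e = refl
  prod-cong {suc n} e = cong₂ _*_ (e zero) (prod-cong (e ∘ suc))
  h1 : ∀ a → h a (+ 1) ≡ false
  h1 a = trans (LocalSymbol.h-comm S a (+ 1)) (h-sq0 {+ 1} (λ ()) a)
  row : ∀ m (c : Vc m) → (∀ i → c i ≢ + 0) → (g : Vc m) → (∀ j → g j ≡ sgn (h (b zero) (c j))) → prodℤ g ≡ sgn (h (b zero) (prodℤ c))
  row zero c nzc g eg = cong sgn (sym (h1 (b zero)))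
  row (suc m) c nzc g eg = trans (cong₂ _*_ (eg zero) (row m (c ∘ suc) (nzc ∘ suc) (g ∘ suc) (eg ∘ suc))) (trans (sym (sgn-xor (h (b zero) (c zero)) (h (b zero) (prodℤ (c ∘ suc))))) (cong sgn (sym (h-*ʳ (nzc zero) (prod-nz (nzc ∘ suc)) (b zero)))))

abstract
  -- Clearing denominators vector by vector turns the rational basis into an integral orthogonal one
  -- whose norms differ from the old by squares; invariance then compares it with the frame.
  hasse⇒ : ∀ {p} (S : LocalSymbol p) {n} {G : Mat n} → IsLattice G → ∀ {s} → HasseIs G p s → (fr : Frame 3 G) → s ≡ sgn (hs S (Frame.c fr))
  hasse⇒ {p} S {n} {G} (sy , pd) {s} (u , ((ind , _) , orth) , hh , hil , pp) fr =
      trans (sym pp) (trans (pairs-hs S n b (λ i → pos-nz (pb i)) hh hval) (cong sgn (sym (heq (orth-equ {M = G} pd fr U b pb gm) S))))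
    where
    open LocalSymbol S using (h)
    open SymbolProperties S
    N : Fin n → ℤ
    N i = proj₁ (clear-denominators (u i))
    N0 : ∀ i → N i ≢ + 0
    N0 i = proj₁ (proj₂ (clear-denominators (u i)))
    X : Fin n → Vc n
    X i = proj₁ (proj₂ (proj₂ (clear-denominators (u i))))
    eX : ∀ i r → toℚ (X i r) ≡ toℚ (N i) ℚ.* u i r
    eX i = proj₂ (proj₂ (proj₂ (clear-denominators (u i))))
    U : Mat n
    U r i = X i r
    b : Vc n
    b i = bil G (X i) (X i)
    rel : ∀ i j → toℚ (bil G (X i) (X j)) ≡ (toℚ (N i) ℚ.* toℚ (N j)) ℚ.* bilℚ G (u i) (u j)
    rel i j = toℚ-bil G (X i) (X j) (N i) (N j) (eX i) (eX j)
    gm : ∀ i j → cgr U G i j ≡ diag b i j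
    gm i j with i FinP.≟ j
    ... | yes refl = sym (diag-ii b i)
    ... | no ne = trans (toℚ-inj (trans (rel i j) (trans (cong ((toℚ (N i) ℚ.* toℚ (N j)) ℚ.*_) (orth i j ne)) (ℚP.*-zeroʳ (toℚ (N i) ℚ.* toℚ (N j)))))) (sym (trans (cong (b i *_) (δ-≢ ne)) (*-zeroʳ (b i))))
    tN0 : ∀ i → ℚ.NonZero (toℚ (N i))
    tN0 i = ℚ.≢-nonZero (λ q → N0 i (toℚ-inj q))
    Xnz : ∀ i → Nonzero (X i)
    Xnz i with nonzero? (X i)
    ... | yes q = q
    ... | no q = ⊥-elim (one≢0 (trans (sym c1) (ind c lc i)))
      where
      c : Fin n → ℚ
      c j = toℚ (δ i j)
      c1 : c i ≡ ℚ.1ℚ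
      c1 = cong toℚ (δ-refl i)
      one≢0 : ℚ.1ℚ ≢ ℚ.0ℚ
      one≢0 ()
      ui0 : ∀ r → u i r ≡ ℚ.0ℚ
      ui0 r = ℚ-cancelˡ (toℚ (N i)) {{tN0 i}} (trans (sym (eX i r)) (trans (cong toℚ (¬nonzero q r)) (sym (ℚP.*-zeroʳ (toℚ (N i))))))
      lc : ∀ r → lincomb u c r ≡ ℚ.0ℚ
      lc r = sumℚ-0 λ j → case i FinP.≟ j of λ where
        (yes refl) → trans (cong (c j ℚ.*_) (ui0 r)) (ℚP.*-zeroʳ (c j))
        (no ne) → trans (cong (ℚ._* u j r) (cong toℚ (δ-≢ ne))) (ℚP.*-zeroˡ (u j r))
    pb : Pos b
    pb i = pd (X i) (Xnz i)
    qi : Fin n → ℚ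
    qi i = qℚ G (u i)
    cl-eq : ∀ i → b i * ↧ (qi i) ≡ N i * N i * ↥ (qi i)
    cl-eq i = toℚ-clear (b i) (N i * N i) (qi i) (trans (rel i i) (cong (ℚ._* qi i) (sym (toℚ-* (N i) (N i)))))
    ↥nz : ∀ i → ↥ (qi i) ≢ + 0
    ↥nz i q = *-nz (pos-nz (pb i)) (↧≢0 (qi i)) (trans (cl-eq i) (trans (cong (N i * N i *_) q) (*-zeroʳ (N i * N i))))
    sq : ∀ i → SqEq (cl (qi i)) (b i)
    sq i = sqeq (N i) (↧ (qi i)) (N0 i) (↧≢0 (qi i)) (trans (re (↥ (qi i)) (↧ (qi i)) (N i)) (trans (cong (_* ↧ (qi i)) (sym (cl-eq i))) (*-assoc (b i) (↧ (qi i)) (↧ (qi i)))))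
      where
      re : ∀ a d n → a * d * (n * n) ≡ n * n * a * d
      re = solve-∀
    clnz : ∀ i → cl (qi i) ≢ + 0
    clnz i = *-nz (↥nz i) (↧≢0 (qi i))
    hval : ∀ i j → toℕ i < toℕ j → hh i j ≡ sgn (h (b i) (b j))
    hval i j lt = trans (hilbertIs-unique {qi i} {qi j} (hil i j lt) (hilbertIs (qi i) (qi j) (↥nz i) (↥nz j)))
      (cong sgn (trans (sqEq-h S (clnz i) (pos-nz (pb i)) (sq i) (cl (qi j))) (trans (LocalSymbol.h-comm S (b i) (cl (qi j))) (trans (sqEq-h S (clnz j) (pos-nz (pb j)) (sq j) (b i)) (LocalSymbol.h-comm S (b j) (b i))))))

  -- The columns of the frame are themselves a rational orthogonal basis. This direction is what
  -- allows the excluded pair at 2 to be contradicted.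
  hasse⇐ : ∀ {p} (S : LocalSymbol p) {n} {G : Mat n} → IsLattice G → (fr : Frame 3 G) → HasseIs G p (sgn (hs S (Frame.c fr)))
  hasse⇐ {p} S {n} {G} (sy , pd) fr = u , ((ind , span) , orth) , hh , (λ i j _ → hilbertIs (qi i) (qi j) (↥nz i) (↥nz j)) , pairs-hs S n c (λ i → pos-nz (pc i)) hh (λ i j _ → cong sgn (cong₂ h (clq i) (clq j)))
    where
    open LocalSymbol S using (h)
    open SymbolProperties S
    open Frame fr renaming (u to uu)
    pc : Pos c
    pc = frame-pos {M = G} pd fr
    u : Fin n → Fin n → ℚ
    u i r = toℚ (F r i)
    bq : ∀ i j → bilℚ G (u i) (u j) ≡ toℚ (diag c i j)
    bq i j = sym (trans (cong toℚ (sym (gram i j))) (trans (toℚ-bil G {u i} {u j} (λ r → F r i) (λ r → F r j) (+ 1) (+ 1) (λ r → sym (ℚP.*-identityˡ (u i r))) (λ r → sym (ℚP.*-identityˡ (u j r)))) (trans (cong (ℚ._* bilℚ G (u i) (u j)) (ℚP.*-identityˡ (toℚ (+ 1)))) (ℚP.*-identityˡ (bilℚ G (u i) (u j))))))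
    orth : ∀ i j → i ≢ j → bilℚ G (u i) (u j) ≡ ℚ.0ℚ
    orth i j ne = trans (bq i j) (cong toℚ (trans (cong (c i *_) (δ-≢ ne)) (*-zeroʳ (c i))))
    qi : Fin n → ℚ
    qi i = qℚ G (u i)
    qc : ∀ i → qi i ≡ toℚ (c i)
    qc i = trans (bq i i) (cong toℚ (diag-ii c i))
    ↥q : ∀ i → ↥ (qi i) ≡ c i
    ↥q i = trans (cong ↥_ (qc i)) (↥toℚ (c i))
    ↥nz : ∀ i → ↥ (qi i) ≢ + 0
    ↥nz i q = pos-nz (pc i) (trans (sym (↥q i)) q)
    clq : ∀ i → cl (qi i) ≡ c i
    clq i = trans (cong₂ _*_ (↥q i) (trans (cong ↧_ (qc i)) (↧toℚ (c i)))) (*-identityʳ (c i))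
    hh : Fin n → Fin n → ℤ
    hh i j = sgn (h (cl (qi i)) (cl (qi j)))
    tu : ℚ
    tu = toℚ uu
    instance
      tunz : ℚ.NonZero tu
      tunz = ℚ.≢-nonZero (λ q → w≢0 p∤u (toℚ-inj q))
    comp : ∀ (A B : Mat n) (v : Fin n → ℚ) k → Scal uu (A ⊗ B) → sumℚ (λ r → toℚ (A k r) ℚ.* sumℚ (λ i → v i ℚ.* toℚ (B r i))) ≡ v k ℚ.* tu
    comp A B v k sc = trans (sumℚ-cong (λ r → trans (sym (sumℚ-*ˡ (toℚ (A k r)) (λ i → v i ℚ.* toℚ (B r i)))) (sumℚ-cong (λ i → trans (ℚ3 (toℚ (A k r)) (v i) (toℚ (B r i))) (cong (v i ℚ.*_) (sym (toℚ-* (A k r) (B r i))))))))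
      (trans (sumℚ-swap (λ r i → v i ℚ.* toℚ (A k r * B r i))) (trans (sumℚ-cong (λ i → trans (sumℚ-*ˡ (v i) (λ r → toℚ (A k r * B r i))) (cong (v i ℚ.*_) (trans (sym (toℚ-sum (λ r → A k r * B r i))) (cong toℚ (sc k i))))))
        (trans (sumℚ-single k (λ i → v i ℚ.* toℚ (uu * δ k i)) (λ i ne → trans (cong (λ z → v i ℚ.* toℚ z) (trans (cong (uu *_) (δ-≢ (λ q → ne (sym q)))) (*-zeroʳ uu))) (ℚP.*-zeroʳ (v i)))) (cong (λ z → v k ℚ.* toℚ z) (trans (cong (uu *_) (δ-refl k)) (*-identityʳ uu))))))
    ind : ∀ a → (∀ r → lincomb u a r ≡ ℚ.0ℚ) → ∀ i → a i ≡ ℚ.0ℚ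
    ind a z k = ℚ-cancelˡ tu (trans (ℚP.*-comm tu (a k)) (trans (sym (comp Fi F a k left)) (trans (sumℚ-0 (λ r → trans (cong (toℚ (Fi k r) ℚ.*_) (z r)) (ℚP.*-zeroʳ (toℚ (Fi k r))))) (sym (ℚP.*-zeroʳ tu)))))
    span : ∀ (v : Fin n → ℚ) → ∃ λ a → ∀ r → lincomb u a r ≡ v r
    span v = a , λ r → trans (sumℚ-cong (λ i → ℚP.*-comm (a i) (toℚ (F r i)))) (trans (comp F Fi (λ s → ℚ.1/ tu ℚ.* v s) r right) (trans (ℚP.*-comm (ℚ.1/ tu ℚ.* v r) tu) (trans (sym (ℚP.*-assoc tu (ℚ.1/ tu) (v r))) (trans (cong (ℚ._* v r) (ℚP.*-inverseʳ tu)) (ℚP.*-identityˡ (v r))))))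
      where
      a : Fin n → ℚ
      a i = sumℚ (λ s → (ℚ.1/ tu ℚ.* v s) ℚ.* toℚ (Fi i s))

-- Quadratic reciprocity

module Fold {A : Set} (_∙_ : A → A → A) (ε : A) (assoc : ∀ x y z → (x ∙ y) ∙ z ≡ x ∙ (y ∙ z)) (comm : ∀ x y → x ∙ y ≡ y ∙ x) where
  fold : ∀ {n} → (Fin n → A) → A
  fold {zero}  f = ε
  fold {suc n} f = f zero ∙ fold (f ∘ suc)

  fold-cong : ∀ {n} {f g : Fin n → A} → (∀ i → f i ≡ g i) → fold f ≡ fold g
  fold-cong {zero}  e = refl
  fold-cong {suc n} e = cong₂ _∙_ (e zero) (fold-cong (e ∘ suc))

  fold-remove : ∀ {n} (k : Fin (suc n)) (g : Fin (suc n) → A) → fold g ≡ g k ∙ fold (λ i → g (punchIn k i))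
  fold-remove zero g = refl
  fold-remove {suc n} (suc k) g = trans (cong (g zero ∙_) (fold-remove k (g ∘ suc)))
    (trans (sym (assoc _ _ _)) (trans (cong (_∙ fold (λ i → g (suc (punchIn k i)))) (comm (g zero) (g (suc k)))) (assoc _ _ _)))

  fold-inj : ∀ {n} (π : Fin n → Fin n) → (∀ {i j} → π i ≡ π j → i ≡ j) → (g : Fin n → A) → fold (λ i → g (π i)) ≡ fold g
  fold-inj {zero} π inj g = refl
  fold-inj {suc n} π inj g = trans (cong (g (π zero) ∙_) (trans (fold-cong (λ i → cong g (sym (FinP.punchIn-punchOut (ne i))))) (fold-inj π′ inj′ (λ i → g (punchIn (π zero) i))))) (sym (fold-remove (π zero) g))
    where
    ne : ∀ i → π zero ≢ π (suc i)
    ne i q = case inj q of λ ()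
    π′ : Fin n → Fin n
    π′ i = punchOut (ne i)
    inj′ : ∀ {i j} → π′ i ≡ π′ j → i ≡ j
    inj′ {i} {j} q = FinP.suc-injective (inj (FinP.punchOut-injective (ne i) (ne j) q))

module X = Fold _xor_ false xor-assoc xor-comm
module Pr = Fold _*_ (+ 1) *-assoc *-comm

xsum : ∀ {n} → (Fin n → Bool) → Bool
xsum = X.fold

xsum-xor : ∀ {n} (f g : Fin n → Bool) → xsum (λ i → f i xor g i) ≡ xsum f xor xsum g
xsum-xor {zero} f g = refl
xsum-xor {suc n} f g = trans (cong ((f zero xor g zero) xor_) (xsum-xor (f ∘ suc) (g ∘ suc)))
  (taut 4 (λ { (a ∷ b ∷ c ∷ d ∷ []) → (a xor b) xor (c xor d) }) (λ { (a ∷ b ∷ c ∷ d ∷ []) → (a xor c) xor (b xor d) }) refl (f zero ∷ g zero ∷ xsum (f ∘ suc) ∷ xsum (g ∘ suc) ∷ []))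

xsum-∧ : ∀ {n} b (f : Fin n → Bool) → xsum (λ i → b ∧ f i) ≡ b ∧ xsum f
xsum-∧ {n} false f = go n where
  go : ∀ n → xsum {n} (λ _ → false) ≡ false
  go zero = refl
  go (suc n) = go n
xsum-∧ true f = refl

xsum-swap : ∀ {m n} (f : Fin m → Fin n → Bool) → xsum (λ i → xsum (f i)) ≡ xsum (λ j → xsum (λ i → f i j))
xsum-swap {zero} {n} f = sym (xsum-∧ {n} false (λ _ → false))
xsum-swap {suc m} f = trans (cong (xsum (f zero) xor_) (xsum-swap (f ∘ suc))) (sym (xsum-xor (f zero) (λ j → xsum (λ i → f (suc i) j))))

xsum-const : ∀ n → xsum {n} (λ _ → true) ≡ par n
xsum-const zero = refl
xsum-const (suc n) = cong not (xsum-const n)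

par-* : ∀ m n → par (m *ᴺ n) ≡ par m ∧ par n
par-* zero n = refl
par-* (suc m) n = trans (par-+ n (m *ᴺ n)) (trans (cong (par n xor_) (par-* m n)) (taut 2 (λ { (a ∷ b ∷ []) → b xor (a ∧ b) }) (λ { (a ∷ b ∷ []) → not a ∧ b }) refl (par m ∷ par n ∷ [])))

idx : ∀ {n} → Fin n → ℕ
idx i = suc (toℕ i)

ev : ∀ {m} → Vec ℤ m → ℤ → ℤ
ev []       x = + 0
ev (c ∷ cs) x = c + x * ev cs x

-- Synthetic division by X - r, with coefficients listed from the constant term upwards.
quo : ∀ {m} → ℤ → Vec ℤ (suc m) → Vec ℤ m
quo {zero}  r _        = []
quo {suc m} r (c ∷ cs) = ev cs r ∷ quo r cs

ev-quo : ∀ {m} r (f : Vec ℤ (suc m)) x → ev f x ≡ ev f r + (x - r) * ev (quo r f) x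
ev-quo {zero} r (c ∷ []) x = re c x r
  where
  re : ∀ c x r → c + x * + 0 ≡ c + r * + 0 + (x - r) * + 0
  re = solve-∀
ev-quo {suc m} r (c ∷ cs) x = trans (cong (λ z → c + x * z) (ev-quo r cs x)) (re c x r (ev cs r) (ev (quo r cs) x))
  where
  re : ∀ c x r e q → c + x * (e + (x - r) * q) ≡ c + r * e + (x - r) * (e + x * q)
  re = solve-∀

abstract
  -- Lagrange's bound on the number of roots, for the points 1, ..., m and `m` coefficients. It is
  -- applied to Xʰ - 1 to exhibit a non-residue.
  roots-vanish : ∀ {p} → Prime p → ∀ m → m < p → (f : Vec ℤ m) → (∀ j → 0 < j → j ≤ m → + p ∣ ev f (+ j)) → ∀ x → + p ∣ ev f x
  roots-vanish pr zero _ [] _ x = p∣0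
  roots-vanish {p} pr (suc m) mp f z x = subst (+ p ∣_) (sym (ev-quo (+ suc m) f x)) (∣m∣n⇒∣m+n (z (suc m) (s≤s z≤n) ≤-refl) (∣n⇒∣m*n (x - + suc m) (roots-vanish pr m (<⇒≤ mp) (quo (+ suc m) f) zq x)))
    where
    zq : ∀ j → 0 < j → j ≤ m → + p ∣ ev (quo (+ suc m) f) (+ j)
    zq j j0 jm = case euclid pr (+ j - + suc m) (ev (quo (+ suc m) f) (+ j)) (∣m+n∣m⇒∣n (subst (+ p ∣_) (ev-quo (+ suc m) f (+ j)) (z j j0 (ℕP.m≤n⇒m≤1+n jm))) (z (suc m) (s≤s z≤n) ≤-refl)) of λ where
      (inj₁ d) → ⊥-elim (<⇒≢ (s≤s jm) (small-≡ (<-trans (s≤s jm) mp) mp d))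
      (inj₂ d) → d

mono : ∀ k → Vec ℤ (suc k)
mono zero = + 1 ∷ []
mono (suc k) = + 0 ∷ mono k

ev-mono : ∀ k x → ev (mono k) x ≡ pow x k
ev-mono zero x = re x where
  re : ∀ x → + 1 + x * + 0 ≡ + 1
  re = solve-∀
ev-mono (suc k) x = trans (+-identityˡ (x * ev (mono k) x)) (cong (x *_) (ev-mono k x))

pow-* : ∀ x y k → pow (x * y) k ≡ pow x k * pow y k
pow-* x y zero = refl
pow-* x y (suc k) = trans (cong (x * y *_) (pow-* x y k)) (re x y (pow x k) (pow y k))
  where
  re : ∀ x y a b → x * y * (a * b) ≡ x * a * (y * b)
  re = solve-∀

pow-cong : ∀ {d} x y k → d ∣ x - y → d ∣ pow x k - pow y k
pow-cong x y zero d = p∣0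
pow-cong x y (suc k) d = ∣-lc2 d (pow-cong x y k d) (pow x k) y (re x (pow x k) y (pow y k))
  where
  re : ∀ x a y b → x * a - y * b ≡ a * (x - y) + y * (a - b)
  re = solve-∀

module Gauss {p} (op : OddPrime p) (pr : Prime p) .{{_ : ℕ.NonZero p}} (h : ℕ) (ph : p ≡ suc (h +ᴺ h)) where
  h<p : h < p
  h<p = subst (h <_) (sym ph) (s≤s (m≤m+n h h))

  idx∤ : (i : Fin h) → ¬ (+ p ∣ + idx i)
  idx∤ i d = case small-∣ (≤-<-trans (toℕ<n i) h<p) d of λ ()

  parp : par p ≡ true
  parp = trans (cong par ph) (cong not (par-double h))

  module At (a : ℕ) (na : ¬ (+ p ∣ + a)) where
    r q : Fin h → ℕ
    r i = (a *ᴺ idx i) ℕ.% p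
    q i = (a *ᴺ idx i) ℕ./ p

    rq : ∀ i → a *ᴺ idx i ≡ r i +ᴺ q i *ᴺ p
    rq i = ℕM.m≡m%n+[m/n]*n (a *ᴺ idx i) p

    r<p : ∀ i → r i < p
    r<p i = ℕM.m%n<n (a *ᴺ idx i) p

    r-cong : ∀ i → + p ∣ + a * + idx i - + r i
    r-cong i = divides (+ q i) (trans (cong (_- + r i) (trans (sym (ℤP.pos-* a (idx i))) (trans (cong +_ (rq i)) (trans (pos-+ (r i) (q i *ᴺ p)) (+ˡ (+ r i) (ℤP.pos-* (q i) p)))))) (re (+ r i) (+ q i * + p)))
      where
      re : ∀ r t → r + t - r ≡ t
      re = solve-∀

    r≢0 : ∀ i → r i ≢ 0
    r≢0 i z = ∤-* pr na (idx∤ i) (subst (+ p ∣_) (trans (cong (λ t → + a * + idx i - + t) z) (+-identityʳ (+ a * + idx i))) (r-cong i))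

    s : Fin h → Bool
    s i = not (does (r i ℕ.≤? h))

    π : Fin h → ℕ
    π i = if s i then p ∸ r i else r i

    -- `π i` is the absolute least residue of a·i, and `s i` its sign. The parity clause holds
    -- because `p` is odd: r and p - r have opposite parities.
    record Spec (i : Fin h) : Set where
      field
        lo : 1 ≤ π i
        hi : π i ≤ h
        cg : + p ∣ + a * + idx i - sgn (s i) * + π i
        pa : par (r i) ≡ par (π i) xor s i

    abstract
      spec : ∀ i → Spec i
      spec i = go (r i ℕ.≤? h)
        where
        R : ℕ
        R = r i
        Spec′ : Bool → Set
        Spec′ b = let P = if b then p ∸ R else R in 1 ≤ P × P ≤ h × + p ∣ + a * + idx i - sgn b * + P × par R ≡ par P xor b
        pack : Spec′ (s i) → Spec i
        pack (x , y , z , w) = record { lo = x ; hi = y ; cg = z ; pa = w }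
        go : Dec (R ≤ h) → Spec i
        go (yes le) = pack (subst Spec′ (sym (cong not (dec-true (r i ℕ.≤? h) le))) (ℕP.n≢0⇒n>0 (r≢0 i) , le , subst (λ t → + p ∣ + a * + idx i - t) (sym (*-identityˡ (+ R))) (r-cong i) , sym (xor-identityʳ (par R))))
        go (no nle) = pack (subst Spec′ (sym (cong not (dec-false (r i ℕ.≤? h) nle))) (ℕP.m<n⇒0<n∸m (r<p i) , up , cgn , pn))
          where
          up : p ∸ R ≤ h
          up = ≤-trans (ℕP.∸-monoʳ-≤ p (ℕP.≰⇒> nle)) (≤-reflexive (trans (cong (_∸ suc h) ph) (ℕP.m+n∸m≡n h h)))
          PR : + (p ∸ R) ≡ + p - + R
          PR = sym (pos-∸ (<⇒≤ (r<p i)))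
          re : ∀ A p R → A - - (+ 1) * (p - R) ≡ + 1 * (A - R) + + 1 * p
          re = solve-∀
          cgn : + p ∣ + a * + idx i - - (+ 1) * + (p ∸ R)
          cgn = subst (λ t → + p ∣ + a * + idx i - - (+ 1) * t) (sym PR) (∣-lc2 (r-cong i) ∣-refl (+ 1) (+ 1) (re (+ a * + idx i) (+ p) (+ R)))
          pn : par R ≡ par (p ∸ R) xor true
          pn = trans (taut 2 (λ { (x ∷ y ∷ []) → y }) (λ { (x ∷ y ∷ []) → (x xor (x xor y)) }) refl (par (p ∸ R) ∷ par R ∷ []))
            (cong (par (p ∸ R) xor_) (trans (sym (par-+ (p ∸ R) R)) (trans (cong par (m∸n+n≡m (<⇒≤ (r<p i)))) parp)))

    πF : Fin h → Fin h
    πF i = fromℕ< {π i ∸ 1} (<-≤-trans (≤-reflexive (trans (sym (ℕP.+-∸-assoc 1 (Spec.lo (spec i)))) refl)) (Spec.hi (spec i)))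

    πF-idx : ∀ i → idx (πF i) ≡ π i
    πF-idx i = trans (cong suc (FinP.toℕ-fromℕ< _)) (trans (sym (ℕP.+-∸-assoc 1 (Spec.lo (spec i)))) refl)

    abstract
      -- Equal absolute residues at i and j give a(i - j) ≡ 0 or a(i + j) ≡ 0 modulo `p`, and i + j
      -- stays below `p`.
      πF-inj : ∀ {i j} → πF i ≡ πF j → i ≡ j
      πF-inj {i} {j} e = go (s i) (s j) refl refl
        where
        πe : π i ≡ π j
        πe = trans (sym (πF-idx i)) (trans (cong idx e) (πF-idx j))
        I J A Π : ℤ
        I = + idx i
        J = + idx j
        A = + a
        Π = + π j
        ci : + p ∣ A * I - sgn (s i) * Π
        ci = subst (λ t → + p ∣ A * I - sgn (s i) * + t) πe (Spec.cg (spec i))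
        cj : + p ∣ A * J - sgn (s j) * Π
        cj = Spec.cg (spec j)
        same : ∀ {b} → + p ∣ A * I - b → + p ∣ A * J - b → i ≡ j
        same {b} d d′ = case euclid pr A (I - J) (∣-lc2 d d′ (+ 1) (- (+ 1)) (re A I J b)) of λ where
            (inj₁ x) → ⊥-elim (na x)
            (inj₂ x) → toℕ-injective (ℕP.suc-injective (small-≡ (≤-<-trans (toℕ<n i) h<p) (≤-<-trans (toℕ<n j) h<p) x))
          where
          re : ∀ A I J b → A * (I - J) ≡ + 1 * (A * I - b) + - (+ 1) * (A * J - b)
          re = solve-∀
        opp : + p ∣ (A * I - Π) + (A * J - - Π) → ⊥
        opp d = case euclid pr A (I + J) (subst (+ p ∣_) (re A I J Π) d) of λ where
            (inj₁ x) → na x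
            (inj₂ x) → case small-∣ (subst (idx i +ᴺ idx j <_) (sym ph) (s≤s (ℕP.+-mono-≤ (toℕ<n i) (toℕ<n j)))) (subst (+ p ∣_) (sym (pos-+ (idx i) (idx j))) x) of λ ()
          where
          re : ∀ A I J b → (A * I - b) + (A * J - - b) ≡ A * (I + J)
          re = solve-∀
        pos1 : ∀ X → X - sgn false * Π ≡ X - Π
        pos1 X = cong (λ z → X - z) (*-identityˡ Π)
        neg1 : ∀ X → X - sgn true * Π ≡ X - - Π
        neg1 X = cong (λ z → X - z) (ℤP.-1*i≡-i Π)
        go : ∀ b c → s i ≡ b → s j ≡ c → i ≡ j
        go false false ei ej = same {Π} (subst (+ p ∣_) (trans (cong (λ z → A * I - sgn z * Π) ei) (pos1 (A * I))) ci) (subst (+ p ∣_) (trans (cong (λ z → A * J - sgn z * Π) ej) (pos1 (A * J))) cj)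
        go true true ei ej = same { - Π} (subst (+ p ∣_) (trans (cong (λ z → A * I - sgn z * Π) ei) (neg1 (A * I))) ci) (subst (+ p ∣_) (trans (cong (λ z → A * J - sgn z * Π) ej) (neg1 (A * J))) cj)
        go false true ei ej = ⊥-elim (opp (∣m∣n⇒∣m+n (subst (+ p ∣_) (trans (cong (λ z → A * I - sgn z * Π) ei) (pos1 (A * I))) ci) (subst (+ p ∣_) (trans (cong (λ z → A * J - sgn z * Π) ej) (neg1 (A * J))) cj)))
        go true false ei ej = ⊥-elim (opp′ (∣m∣n⇒∣m+n (subst (+ p ∣_) (trans (cong (λ z → A * I - sgn z * Π) ei) (neg1 (A * I))) ci) (subst (+ p ∣_) (trans (cong (λ z → A * J - sgn z * Π) ej) (pos1 (A * J))) cj)))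
          where
          re : ∀ A I J b → (A * I - - b) + (A * J - b) ≡ (A * I - b) + (A * J - - b)
          re = solve-∀
          opp′ : + p ∣ (A * I - - Π) + (A * J - Π) → ⊥
          opp′ d = opp (subst (+ p ∣_) (re A I J Π) d)

    μ : Bool
    μ = xsum s

    -- Eisenstein's form of Gauss's lemma: add up a·i = r + q·p modulo 2, where `p` is odd and the
    -- numbers `π i` are a permutation of 1, ..., h.
    parity : μ ≡ ((par a ∧ xsum {h} (par ∘ idx)) xor xsum {h} (par ∘ idx)) xor xsum (par ∘ q)
    parity = taut′ {par a} {xsum {h} (par ∘ idx)} {μ} {xsum (par ∘ q)} (trans (sym (xsum-∧ {h} (par a) (par ∘ idx))) (trans (X.fold-cong each) (trans (xsum-xor (λ i → par (π i) xor s i) (par ∘ q)) (cong (_xor xsum (par ∘ q)) (trans (xsum-xor (par ∘ π) s) (cong (_xor μ) perm))))))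
      where
      each : ∀ i → par a ∧ par (idx i) ≡ (par (π i) xor s i) xor par (q i)
      each i = trans (sym (par-* a (idx i))) (trans (cong par (rq i)) (trans (par-+ (r i) (q i *ᴺ p)) (cong₂ _xor_ (Spec.pa (spec i)) (trans (par-* (q i) p) (trans (cong (par (q i) ∧_) parp) (∧-identityʳ (par (q i))))))))
      perm : xsum (par ∘ π) ≡ xsum {h} (par ∘ idx)
      perm = trans (X.fold-cong (λ i → cong par (sym (πF-idx i)))) (X.fold-inj πF πF-inj (par ∘ idx))
      taut′ : ∀ {A P M Q} → A ∧ P ≡ (P xor M) xor Q → M ≡ ((A ∧ P) xor P) xor Q
      taut′ {A} {P} {M} {Q} e = trans (taut 3 (λ { (P ∷ M ∷ Q ∷ []) → M }) (λ { (P ∷ M ∷ Q ∷ []) → (((P xor M) xor Q) xor P) xor Q }) refl (P ∷ M ∷ Q ∷ [])) (cong (λ z → (z xor P) xor Q) (sym e))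

    abstract
      -- Gauss's lemma: multiply the congruences a·i ≡ ±π(i) and cancel the factorial of h.
      euler : + p ∣ pow (+ a) h - sgn μ
      euler = case euclid pr (Pr.fold {h} (λ i → + idx i)) (pow (+ a) h - sgn μ) (subst (+ p ∣_) fin (prodc {h} (λ i → + a * + idx i) (λ i → sgn (s i) * + π i) (λ i → Spec.cg (spec i)))) of λ where
          (inj₁ d) → ⊥-elim (fact∤ (λ i → + idx i) idx∤ d)
          (inj₂ d) → d
        where
        re : ∀ x a y b → x * a - y * b ≡ a * (x - y) + y * (a - b)
        re = solve-∀
        prodc : ∀ {n} (f g : Fin n → ℤ) → (∀ i → + p ∣ f i - g i) → + p ∣ Pr.fold f - Pr.fold g
        prodc {zero} f g e = p∣0
        prodc {suc n} f g e = ∣-lc2 (e zero) (prodc (f ∘ suc) (g ∘ suc) (e ∘ suc)) (Pr.fold (f ∘ suc)) (g zero) (re (f zero) (Pr.fold (f ∘ suc)) (g zero) (Pr.fold (g ∘ suc)))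
        fact∤ : ∀ {n} (f : Fin n → ℤ) → (∀ i → ¬ (+ p ∣ f i)) → ¬ (+ p ∣ Pr.fold f)
        fact∤ {zero} f e = ¬p∣1 pr
        fact∤ {suc n} f e = ∤-* pr (e zero) (fact∤ (f ∘ suc) (e ∘ suc))
        re2 : ∀ a x b y → a * x * (b * y) ≡ a * b * (x * y)
        re2 = solve-∀
        lhs : ∀ {n} (f : Fin n → ℤ) → Pr.fold (λ i → + a * f i) ≡ pow (+ a) n * Pr.fold f
        lhs {zero} f = refl
        lhs {suc n} f = trans (cong (+ a * f zero *_) (lhs (f ∘ suc))) (re2 (+ a) (f zero) (pow (+ a) n) (Pr.fold (f ∘ suc)))
        rhs : ∀ {n} (t : Fin n → Bool) (f : Fin n → ℤ) → Pr.fold (λ i → sgn (t i) * f i) ≡ sgn (xsum t) * Pr.fold f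
        rhs {zero} t f = refl
        rhs {suc n} t f = trans (cong (sgn (t zero) * f zero *_) (rhs (t ∘ suc) (f ∘ suc))) (trans (re2 (sgn (t zero)) (f zero) (sgn (xsum (t ∘ suc))) (Pr.fold (f ∘ suc))) (cong (_* (f zero * Pr.fold (f ∘ suc))) (sym (sgn-xor (t zero) (xsum (t ∘ suc))))))
        re3 : ∀ x y f → x * f - y * f ≡ f * (x - y)
        re3 = solve-∀
        fin : Pr.fold {h} (λ i → + a * + idx i) - Pr.fold (λ i → sgn (s i) * + π i) ≡ Pr.fold {h} (λ i → + idx i) * (pow (+ a) h - sgn μ)
        fin = trans (cong₂ _-_ (lhs {h} (λ i → + idx i)) (trans (rhs s (λ i → + π i)) (cong (sgn μ *_) (trans (Pr.fold-cong (λ i → cong +_ (sym (πF-idx i)))) (Pr.fold-inj πF πF-inj (λ i → + idx i))))))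
          (re3 (pow (+ a) h) (sgn μ) (Pr.fold {h} (λ i → + idx i)))

sgn-sq : ∀ b → sgn b * sgn b ≡ + 1
sgn-sq false = refl
sgn-sq true = refl

module Legendre {p} (op : OddPrime p) where
  private
    pr : Prime p
    pr = proj₁ op
    instance
      nzp : ℕ.NonZero p
      nzp = prime-nz pr
  h : ℕ
  h = proj₁ (half-prime op)
  ph : p ≡ suc (h +ᴺ h)
  ph = proj₂ (half-prime op)
  open Odds op using (leg; leg-sq; leg-nsq; leg-true; leg-false; leg-cong; nr-rep; sq-unit)
  open Gauss op pr h ph using (module At; h<p; parp)

  sgn-cong : ∀ b c → + p ∣ sgn b - sgn c → b ≡ c
  sgn-cong false false _ = refl
  sgn-cong true true _ = refl
  sgn-cong false true d = ⊥-elim (∤2 op d)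
  sgn-cong true false d = ⊥-elim (∤2 op (∣m⇒∣-m d))

  h≢0 : h ≢ 0
  h≢0 z = ℕ.nonTrivial⇒≢1 {{prime⇒nonTrivial pr}} (trans ph (cong (λ k → suc (k +ᴺ k)) z))

  nat∤ : ∀ {x} → ¬ (+ p ∣ x) → ¬ (+ p ∣ + toℕ (rem p x))
  nat∤ {x} nx d = nx (∣-lc2 (rem-spec p x) d (+ 1) (+ 1) (re x (+ toℕ (rem p x))))
    where
    re : ∀ x r → x ≡ + 1 * (x - r) + + 1 * r
    re = solve-∀

  -- Fermat's little theorem, obtained by squaring the ±1 of `At.euler`.
  pow-sq : ∀ {x} → ¬ (+ p ∣ x) → + p ∣ pow (x * x) h - + 1
  pow-sq {x} nx = ∣-lc2 e₁ (At.euler a na) (+ 1) (pow (+ a) h + sgn m) (trans (cong (λ z → pow (x * x) h - z) (sym (sgn-sq m))) (trans (re (pow (x * x) h) (pow (+ a) h) (sgn m)) (cong (λ z → + 1 * (pow (x * x) h - z) + (pow (+ a) h + sgn m) * (pow (+ a) h - sgn m)) (sym (pow-* (+ a) (+ a) h)))))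
    where
    a : ℕ
    a = toℕ (rem p x)
    na : ¬ (+ p ∣ + a)
    na = nat∤ nx
    m : Bool
    m = At.μ a na
    e₁ : + p ∣ pow (x * x) h - pow (+ a * + a) h
    e₁ = pow-cong (x * x) (+ a * + a) h (∣-sym (+ a * + a) (x * x) (sq-rem p x))
    re : ∀ X A s → X - s * s ≡ + 1 * (X - A * A) + (A + s) * (A - s)
    re = solve-∀

  sq-μ : ∀ a na → Sq p (+ a) → At.μ a na ≡ false
  sq-μ a na (x , d) = sgn-cong (At.μ a na) false (∣-lc3 (At.euler a na) (pow-cong (x * x) (+ a) h d) (pow-sq {x} (sq-unit na d)) (- (+ 1)) (- (+ 1)) (+ 1) (re (sgn (At.μ a na)) (pow (+ a) h) (pow (x * x) h)))
    where
    re : ∀ s A X → s - + 1 ≡ - (+ 1) * (A - s) + - (+ 1) * (X - A) + + 1 * (X - + 1)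
    re = solve-∀

  dec1 : ∀ {k} → Vec ℤ (suc k) → Vec ℤ (suc k)
  dec1 (c ∷ cs) = c - + 1 ∷ cs

  ev-dec1 : ∀ {k} (f : Vec ℤ (suc k)) x → ev (dec1 f) x ≡ ev f x - + 1
  ev-dec1 (c ∷ cs) x = re c (x * ev cs x)
    where
    re : ∀ c y → c - + 1 + y ≡ c + y - + 1
    re = solve-∀

  abstract
    -- Otherwise Xʰ - 1 would vanish at 1, ..., h + 1 and hence everywhere modulo `p`, but its value
    -- at 0 is -1.
    nonresidue : ∃ λ g → Σ (¬ (+ p ∣ + g)) λ ng → At.μ g ng ≡ true
    nonresidue = go (any? {suc h} (λ k → ¬? (+ p ∣? (pow (+ idx k) h - + 1))))
      where
      sh<p : suc h < p
      sh<p = subst (suc h <_) (sym ph) (s≤s (ℕP.+-monoˡ-< h (ℕP.n≢0⇒n>0 h≢0)))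
      go : Dec (∃ λ (k : Fin (suc h)) → ¬ (+ p ∣ pow (+ idx k) h - + 1)) → ∃ λ g → Σ (¬ (+ p ∣ + g)) λ ng → At.μ g ng ≡ true
      go (yes (k , nk)) = idx k , nx , lem (At.μ (idx k) nx) refl
        where
        nx : ¬ (+ p ∣ + idx k)
        nx d = case small-∣ (≤-<-trans (toℕ<n k) sh<p) d of λ ()
        lem : ∀ b → At.μ (idx k) nx ≡ b → b ≡ true
        lem true _ = refl
        lem false q = ⊥-elim (nk (subst (λ z → + p ∣ pow (+ idx k) h - sgn z) q (At.euler (idx k) nx)))
      go (no none) = ⊥-elim (¬p∣1 pr (∣m⇒∣-m (subst (+ p ∣_) (trans (ev-dec1 (mono h) (+ 0)) (cong (_- + 1) (trans (ev-mono h (+ 0)) (p0 h h≢0)))) (roots-vanish pr (suc h) sh<p (dec1 (mono h)) vz (+ 0)))))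
        where
        p0 : ∀ k → k ≢ 0 → pow (+ 0) k ≡ + 0
        p0 zero nz = ⊥-elim (nz refl)
        p0 (suc k) nz = *-zeroˡ (pow (+ 0) k)
        all : ∀ (k : Fin (suc h)) → + p ∣ pow (+ idx k) h - + 1
        all k with + p ∣? (pow (+ idx k) h - + 1)
        ... | yes q = q
        ... | no q = ⊥-elim (none (k , q))
        vz : ∀ j → 0 < j → j ≤ suc h → + p ∣ ev (dec1 (mono h)) (+ j)
        vz (suc j) _ jh = subst (+ p ∣_) (sym (trans (ev-dec1 (mono h) (+ suc j)) (cong (_- + 1) (ev-mono h (+ suc j))))) (subst (λ t → + p ∣ pow (+ suc t) h - + 1) (FinP.toℕ-fromℕ< jh) (all (fromℕ< jh)))

    -- Squares are covered by `sq-μ`. A non-square `a` differs from the known non-residue by a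
    -- square factor and so has the same sign.
    leg-μ : ∀ a na → leg (+ a) ≡ At.μ a na
    leg-μ a na = go (sq? p (+ a))
      where
      go : Dec (Sq p (+ a)) → leg (+ a) ≡ At.μ a na
      go (yes s) = trans (leg-sq s) (sym (sq-μ a na s))
      go (no ns) = trans (leg-nsq ns) (sym (fin nonresidue))
        where
        fin : (∃ λ g → Σ (¬ (+ p ∣ + g)) λ ng → At.μ g ng ≡ true) → At.μ a na ≡ true
        fin (g , ng , mg) = pick (nr-rep na ns (+ g))
          where
          rel : ∀ j → + p ∣ + a * (j * j) - + g → At.μ a na ≡ true
          rel j d = trans (sgn-cong (At.μ a na) (At.μ g ng) (∣-lc3 (At.euler a na) (At.euler g ng) (∣-lc2 powd (pow-sq {j} nj) (+ 1) (- pow (+ a) h) (re2 (pow (+ a) h) (pow (j * j) h) (pow (+ g) h))) (- (+ 1)) (+ 1) (+ 1) (re (sgn (At.μ a na)) (sgn (At.μ g ng)) (pow (+ a) h) (pow (+ g) h)))) mg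
            where
            nj : ¬ (+ p ∣ j)
            nj dj = ng (∣-lc2 d dj (- (+ 1)) (+ a * j) (re0 (+ a) j (+ g)))
              where
              re0 : ∀ a j g → g ≡ - (+ 1) * (a * (j * j) - g) + a * j * j
              re0 = solve-∀
            powd : + p ∣ pow (+ a) h * pow (j * j) h - pow (+ g) h
            powd = subst (λ z → + p ∣ z - pow (+ g) h) (pow-* (+ a) (j * j) h) (pow-cong (+ a * (j * j)) (+ g) h d)
            re2 : ∀ A J G → A - G ≡ + 1 * (A * J - G) + - A * (J - + 1)
            re2 = solve-∀
            re : ∀ s t A G → s - t ≡ - (+ 1) * (A - s) + + 1 * (G - t) + + 1 * (A - G)
            re = solve-∀
          pick : (Sq p (+ g) ⊎ ∃ λ j → + p ∣ + a * (j * j) - + g) → At.μ a na ≡ true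
          pick (inj₁ s) = case trans (sym mg) (sq-μ g ng s) of λ ()
          pick (inj₂ (j , d)) = rel j d

  abstract
    exists-nonresidue : ∃ λ g → ¬ (+ p ∣ + g) × leg (+ g) ≡ true
    exists-nonresidue = proj₁ nonresidue , proj₁ (proj₂ nonresidue) , trans (leg-μ (proj₁ nonresidue) (proj₁ (proj₂ nonresidue))) (proj₂ (proj₂ nonresidue))

  P : Bool
  P = xsum {h} (par ∘ idx)

  abstract
    -- Represent -1 by p - 1: from (p - 1)i = (p - i) + (i - 1)p the quotients are 0, ..., h - 1.
    leg-minus-one : leg (- (+ 1)) ≡ par h
    leg-minus-one = trans (leg-cong (divides (- (+ 1)) e₀)) (trans (leg-μ a na) (trans (At.parity a na) (trans (cong₂ (λ s t → ((s ∧ P) xor P) xor t) (trans (cong par (cong (_∸ 1) ph)) (par-double h)) (trans (X.fold-cong qi) (trans (xsum-xor {h} (λ _ → true) (par ∘ idx)) (cong (_xor P) (xsum-const h)))))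
        (taut 2 (λ { (x ∷ y ∷ []) → y xor (x xor y) }) (λ { (x ∷ y ∷ []) → x }) refl (par h ∷ P ∷ [])))))
      where
      a : ℕ
      a = p ∸ 1
      ap : + a ≡ + p - + 1
      ap = sym (pos-∸ (≤-trans (s≤s z≤n) h<p))
      re : ∀ p → - (+ 1) - (p - + 1) ≡ - (+ 1) * p
      re = solve-∀
      e₀ : - (+ 1) - + a ≡ - (+ 1) * + p
      e₀ = trans (cong (λ z → - (+ 1) - z) ap) (re (+ p))
      na : ¬ (+ p ∣ + a)
      na d = ¬p∣1 pr (∣-lc2 d ∣-refl (- (+ 1)) (+ 1) (trans (re′ (+ p)) (cong (λ z → - (+ 1) * z + + 1 * + p) (sym ap))))
        where
        re′ : ∀ p → + 1 ≡ - (+ 1) * (p - + 1) + + 1 * p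
        re′ = solve-∀
      qi : ∀ i → par (At.q a na i) ≡ true xor par (idx i)
      qi i = trans (cong par qv) (sym (BoolP.not-involutive (par (toℕ i))))
        where
        i<p : idx i < p
        i<p = ≤-<-trans (toℕ<n i) h<p
        num : a *ᴺ idx i ≡ (p ∸ idx i) +ᴺ toℕ i *ᴺ p
        num = ℤP.+-injective (trans (ℤP.pos-* a (idx i)) (trans (cong₂ _*_ ap (pos-+ 1 (toℕ i))) (trans (re″ (+ p) (+ toℕ i)) (sym (trans (pos-+ (p ∸ idx i) (toℕ i *ᴺ p)) (cong₂ _+_ (trans (sym (pos-∸ (<⇒≤ i<p))) (cong (λ z → + p - z) (pos-+ 1 (toℕ i)))) (ℤP.pos-* (toℕ i) p)))))))
          where
          re″ : ∀ p t → (p - + 1) * (+ 1 + t) ≡ p - (+ 1 + t) + t * p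
          re″ = solve-∀
        qv : At.q a na i ≡ toℕ i
        qv = trans (cong (ℕ._/ p) num) (trans (ℕM.+-distrib-/-∣ʳ (p ∸ idx i) {toℕ i *ᴺ p} {p} (ℕD.divides (toℕ i) refl)) (cong₂ _+ᴺ_ (ℕM.m<n⇒m/n≡0 (ℕP.∸-monoʳ-< (s≤s z≤n) (<⇒≤ i<p))) (ℕM.m*n/n≡m (toℕ i) p)))

    -- For i ≤ h the number 2i stays below `p`, so all quotients vanish and only the triangular sum
    -- `P` remains.
    leg-two : leg (+ 2) ≡ P
    leg-two = trans (leg-μ 2 (∤2 op)) (trans (At.parity 2 (∤2 op)) (trans (cong (P xor_) (trans (X.fold-cong qi) (xsum-∧ {h} false (λ _ → true)))) (xor-identityʳ P)))
      where
      qi : ∀ i → par (At.q 2 (∤2 op) i) ≡ false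
      qi i = cong par (ℕM.m<n⇒m/n≡0 (subst (2 *ᴺ idx i <_) (sym ph) (s≤s (subst (2 *ᴺ idx i ≤_) (cong (h +ᴺ_) (ℕP.+-identityʳ h)) (ℕP.*-monoʳ-≤ 2 (toℕ<n i))))))

    leg-odd : ∀ a (na : ¬ (+ p ∣ + a)) → par a ≡ true → leg (+ a) ≡ xsum {h} (λ i → par ((a *ᴺ idx i) ℕ./ p))
    leg-odd a na pa = trans (leg-μ a na) (trans (At.parity a na) (trans (cong (λ s → ((s ∧ P) xor P) xor xsum (par ∘ At.q a na)) pa) (cong (_xor xsum (par ∘ At.q a na)) (xor-same P))))

le : ℕ → ℕ → Bool
le m n = does (m ℕ.≤? n)

par-count : ∀ k n → n ≤ k → par n ≡ xsum {k} (λ j → le (idx j) n)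
par-count zero .zero z≤n = refl
par-count (suc k) zero _ = sym (trans (X.fold-cong {suc k} (λ j → dec-false (idx j ℕ.≤? 0) (λ ()))) (xsum-∧ {suc k} false (λ _ → true)))
par-count (suc k) (suc n) (s≤s h) = cong not (trans (par-count k n h) (X.fold-cong {k} (λ j → sh (idx j) n)))
  where
  sh : ∀ a b → le a b ≡ le (suc a) (suc b)
  sh a b = case a ℕ.≤? b of λ where
    (yes q) → trans (dec-true (a ℕ.≤? b) q) (sym (dec-true (suc a ℕ.≤? suc b) (s≤s q)))
    (no q) → trans (dec-false (a ℕ.≤? b) q) (sym (dec-false (suc a ℕ.≤? suc b) (λ { (s≤s r) → q r })))

module _ {p q} (op : OddPrime p) (oq : OddPrime q) (p≢q : p ≢ q) where
  private
    module L = Legendre op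
    module M = Legendre oq
    instance
      nzp : ℕ.NonZero p
      nzp = prime-nz (proj₁ op)
      nzq : ℕ.NonZero q
      nzq = prime-nz (proj₁ oq)

    prime∤ : ∀ {p q} → Prime p → Prime q → p ≢ q → ¬ (+ p ∣ + q)
    prime∤ pr qr ne d = case Data.Nat.Primality.prime⇒irreducible qr (∣⇒∣ᵤ d) of λ where
      (inj₁ z) → ℕ.nonTrivial⇒≢1 {{prime⇒nonTrivial pr}} z
      (inj₂ z) → ne z

    count : ∀ {p q} .{{_ : ℕ.NonZero p}} h k → p ≡ suc (h +ᴺ h) → q ≡ suc (k +ᴺ k) → (i : Fin h) → par ((q *ᴺ idx i) ℕ./ p) ≡ xsum {k} (λ j → le (p *ᴺ idx j) (q *ᴺ idx i))
    count {p} {q} h k ph qk i = trans (par-count k N N≤k) (X.fold-cong {k} (λ j → eqv (idx j)))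
      where
      A N : ℕ
      A = q *ᴺ idx i
      N = A ℕ./ p
      2A : A *ᴺ 2 < suc q *ᴺ p
      2A = ≤-<-trans (≤-trans (≤-reflexive (re q (idx i))) (ℕP.*-monoʳ-≤ q (≤-trans (ℕP.*-monoʳ-≤ 2 (toℕ<n i)) (≤-trans (≤-reflexive (cong (h +ᴺ_) (ℕP.+-identityʳ h))) (≤-trans (ℕP.n≤1+n (h +ᴺ h)) (≤-reflexive (sym ph))))))) (ℕP.*-monoˡ-< p (ℕP.n<1+n q))
        where
        re : ∀ q i → q *ᴺ i *ᴺ 2 ≡ q *ᴺ (2 *ᴺ i)
        re = ℕR.solve-∀
      N≤k : N ≤ k
      N≤k = ≤-pred (ℕP.*-cancelʳ-< (p *ᴺ 2) N (suc k) (≤-<-trans (≤-trans (≤-reflexive (sym (ℕP.*-assoc N p 2))) (ℕP.*-monoˡ-≤ 2 (ℕM.m/n*n≤m A p))) (subst (A *ᴺ 2 <_) (trans (cong (λ z → suc z *ᴺ p) qk) (re k p)) 2A)))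
        where
        re : ∀ k p → suc (suc (k +ᴺ k)) *ᴺ p ≡ suc k *ᴺ (p *ᴺ 2)
        re = ℕR.solve-∀
      eqv : ∀ j → le j N ≡ le (p *ᴺ j) A
      eqv j = case j ℕ.≤? N of λ where
        (yes h′) → trans (dec-true (j ℕ.≤? N) h′) (sym (dec-true (p *ᴺ j ℕ.≤? A) (≤-trans (≤-reflexive (ℕP.*-comm p j)) (≤-trans (ℕP.*-monoˡ-≤ p h′) (ℕM.m/n*n≤m A p)))))
        (no h′) → trans (dec-false (j ℕ.≤? N) h′) (sym (dec-false (p *ᴺ j ℕ.≤? A) (λ g → h′ (≤-trans (≤-reflexive (sym (ℕM.m*n/n≡m j p))) (ℕM./-monoˡ-≤ p (≤-trans (≤-reflexive (ℕP.*-comm j p)) g))))))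

  abstract
    -- Eisenstein's lattice points: the quotient at i counts the j with pj ≤ qi, the other symbol
    -- counts the opposite inequality, and no point lies on the diagonal.
    reciprocity : Odds.leg op (+ q) xor Odds.leg oq (+ p) ≡ par L.h ∧ par M.h
    reciprocity = trans (cong₂ _xor_ (trans (L.leg-odd q (prime∤ (proj₁ op) (proj₁ oq) p≢q) (trans (cong par M.ph) (cong not (par-double M.h)))) (X.fold-cong {L.h} (λ i → count L.h M.h L.ph M.ph i)))
        (trans (M.leg-odd p (prime∤ (proj₁ oq) (proj₁ op) (λ z → p≢q (sym z))) (trans (cong par L.ph) (cong not (par-double L.h)))) (trans (X.fold-cong {M.h} (λ j → count M.h L.h M.ph L.ph j)) (xsum-swap {M.h} {L.h} (λ j i → le (q *ᴺ idx i) (p *ᴺ idx j))))))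
      (trans (sym (xsum-xor {L.h} (λ i → xsum {M.h} (λ j → le (p *ᴺ idx j) (q *ᴺ idx i))) (λ i → xsum {M.h} (λ j → le (q *ᴺ idx i) (p *ᴺ idx j)))))
      (trans (X.fold-cong {L.h} (λ i → trans (sym (xsum-xor {M.h} (λ j → le (p *ᴺ idx j) (q *ᴺ idx i)) (λ j → le (q *ᴺ idx i) (p *ᴺ idx j)))) (trans (X.fold-cong {M.h} (λ j → tri (p *ᴺ idx j) (q *ᴺ idx i) (neq i j))) (trans (xsum-const M.h) (sym (∧-identityʳ (par M.h)))))))
        (trans (xsum-∧ {L.h} (par M.h) (λ _ → true)) (trans (cong (par M.h ∧_) (xsum-const L.h)) (BoolP.∧-comm (par M.h) (par L.h))))))
      where
      neq : ∀ (i : Fin L.h) (j : Fin M.h) → p *ᴺ idx j ≢ q *ᴺ idx i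
      neq i j e = case euclidsLemma q (idx i) (proj₁ op) (ℕD.divides (idx j) (trans (sym e) (ℕP.*-comm p (idx j)))) of λ where
        (inj₁ d) → prime∤ (proj₁ op) (proj₁ oq) p≢q (∣ᵤ⇒∣ d)
        (inj₂ d) → <⇒≱ (≤-<-trans (toℕ<n i) (subst (L.h <_) (sym L.ph) (s≤s (m≤m+n L.h L.h)))) (ℕD.∣⇒≤ d)
      tri : ∀ a b → a ≢ b → le a b xor le b a ≡ true
      tri a b ne with ℕP.<-cmp a b
      ... | tri< lt _ _ = cong₂ _xor_ (dec-true (a ℕ.≤? b) (<⇒≤ lt)) (dec-false (b ℕ.≤? a) (<⇒≱ lt))
      ... | tri≈ _ q _ = ⊥-elim (ne q)
      ... | tri> _ _ gt = cong₂ _xor_ (dec-false (a ℕ.≤? b) (<⇒≱ gt)) (dec-true (b ℕ.≤? a) (<⇒≤ gt))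

-- The product formula

SyD : ∀ {p} → Prime p → Dec (p ≡ 2) → LocalSymbol p
SyD pr (yes refl) = dyadicSymbol
SyD pr (no ne)    = oddSymbol (pr , ne)

Sy : ∀ {p} → Prime p → LocalSymbol p
Sy {p} pr = SyD pr (p ℕ.≟ 2)

HD : ∀ p → Dec (Prime p) → ℤ → ℤ → Bool
HD p (yes pr) a b = LocalSymbol.h (Sy pr) a b
HD p (no _)   a b = false

-- `false` off the primes, so that a product over places becomes a sum over all p < B.
H : ℕ → ℤ → ℤ → Bool
H p = HD p (prime? p)

abstract
  H-Sy : ∀ {p} (pr : Prime p) a b → H p a b ≡ LocalSymbol.h (Sy pr) a b
  H-Sy {p} pr a b = go (prime? p)
    where
    go : (d : Dec (Prime p)) → HD p d a b ≡ LocalSymbol.h (Sy pr) a b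
    go (no n) = ⊥-elim (n pr)
    go (yes pr′) = go′ (p ℕ.≟ 2)
      where
      go′ : (d : Dec (p ≡ 2)) → LocalSymbol.h (SyD pr′ d) a b ≡ LocalSymbol.h (SyD pr d) a b
      go′ (yes refl) = refl
      go′ (no ne) = refl

  H-odd : ∀ {p} (op : OddPrime p) a b → H p a b ≡ hodd op a b
  H-odd {p} op@(pr , ne) a b = trans (H-Sy pr a b) (go (p ℕ.≟ 2))
    where
    go : (d : Dec (p ≡ 2)) → LocalSymbol.h (SyD pr d) a b ≡ hodd op a b
    go (yes q) = ⊥-elim (ne q)
    go (no _) = refl

  H-2 : ∀ a b → H 2 a b ≡ h2 a b
  H-2 a b = H-Sy prime[2] a b

  H-np : ∀ {p} → ¬ Prime p → ∀ a b → H p a b ≡ false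
  H-np {p} np a b = go (prime? p)
    where
    go : (d : Dec (Prime p)) → HD p d a b ≡ false
    go (yes pr) = ⊥-elim (np pr)
    go (no _) = refl

  H-*ˡ : ∀ p {a b} → a ≢ + 0 → b ≢ + 0 → ∀ c → H p (a * b) c ≡ H p a c xor H p b c
  H-*ˡ p {a} {b} a0 b0 c = go (prime? p)
    where
    go : (d : Dec (Prime p)) → HD p d (a * b) c ≡ HD p d a c xor HD p d b c
    go (yes pr) = LocalSymbol.h-*ˡ (Sy pr) a0 b0 c
    go (no _) = refl

  H-comm : ∀ p a b → H p a b ≡ H p b a
  H-comm p a b = go (prime? p)
    where
    go : (d : Dec (Prime p)) → HD p d a b ≡ HD p d b a
    go (yes pr) = LocalSymbol.h-comm (Sy pr) a b
    go (no _) = refl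

  H-self : ∀ p {a} → a ≢ + 0 → H p a a ≡ H p a (- (+ 1))
  H-self p {a} a0 = go (prime? p)
    where
    go : (d : Dec (Prime p)) → HD p d a a ≡ HD p d a (- (+ 1))
    go (yes pr) = SymbolProperties.h-self (Sy pr) a0
    go (no _) = refl

H-1 : ∀ p b → H p (+ 1) b ≡ false
H-1 p b = trans (H-*ˡ p {+ 1} {+ 1} (λ ()) (λ ()) b) (xor-same (H p (+ 1) b))

sumB : ℕ → (ℕ → Bool) → Bool
sumB zero    f = false
sumB (suc n) f = f n xor sumB n f

sumB-cong : ∀ n {f g} → (∀ p → p < n → f p ≡ g p) → sumB n f ≡ sumB n g
sumB-cong zero e = refl
sumB-cong (suc n) e = cong₂ _xor_ (e n ≤-refl) (sumB-cong n (λ p h → e p (m<n⇒m<1+n h)))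

sumB-xor : ∀ n f g → sumB n (λ p → f p xor g p) ≡ sumB n f xor sumB n g
sumB-xor zero f g = refl
sumB-xor (suc n) f g = trans (cong ((f n xor g n) xor_) (sumB-xor n f g))
  (taut 4 (λ { (a ∷ b ∷ c ∷ d ∷ []) → (a xor b) xor (c xor d) }) (λ { (a ∷ b ∷ c ∷ d ∷ []) → (a xor c) xor (b xor d) }) refl (f n ∷ g n ∷ sumB n f ∷ sumB n g ∷ []))

sumB-0 : ∀ n {f} → (∀ p → p < n → f p ≡ false) → sumB n f ≡ false
sumB-0 zero e = refl
sumB-0 (suc n) e = cong₂ _xor_ (e n ≤-refl) (sumB-0 n (λ p h → e p (m<n⇒m<1+n h)))

sumB-single : ∀ n k f → k < n → (∀ p → p < n → p ≢ k → f p ≡ false) → sumB n f ≡ f k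
sumB-single (suc n) k f k<n z = go (k ℕ.≟ n)
  where
  go : Dec (k ≡ n) → f n xor sumB n f ≡ f k
  go (yes refl) = trans (cong (f k xor_) (sumB-0 k (λ p h → z p (m<n⇒m<1+n h) (<⇒≢ h)))) (xor-identityʳ (f k))
  go (no ne) = cong₂ _xor_ (z n ≤-refl (λ q → ne (sym q))) (sumB-single n k f (≤∧≢⇒< (≤-pred k<n) ne) (λ p h → z p (m<n⇒m<1+n h)))

sumB-split : ∀ n k f → k < n → sumB n f ≡ f k xor sumB n (λ p → not (does (p ℕ.≟ k)) ∧ f p)
sumB-split n k f k<n = trans (sumB-cong n (λ p _ → spl p)) (trans (sumB-xor n (λ p → at p ∧ f p) (λ p → not (at p) ∧ f p)) (cong (_xor sumB n (λ p → not (at p) ∧ f p)) (trans (sumB-single n k (λ p → at p ∧ f p) k<n (λ p _ np → cong (_∧ f p) (dec-false (p ℕ.≟ k) np))) (cong (_∧ f k) (dec-true (k ℕ.≟ k) refl)))))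
  where
  at : ℕ → Bool
  at p = does (p ℕ.≟ k)
  spl : ∀ p → f p ≡ (at p ∧ f p) xor (not (at p) ∧ f p)
  spl p = taut 2 (λ { (a ∷ b ∷ []) → b }) (λ { (a ∷ b ∷ []) → (a ∧ b) xor (not a ∧ b) }) refl (at p ∷ f p ∷ [])

off-≢ : ∀ {p k} → p ≢ k → ∀ c → not (does (p ℕ.≟ k)) ∧ c ≡ c
off-≢ {p} {k} ne c = cong (λ b → not b ∧ c) (dec-false (p ℕ.≟ k) ne)

off-≡ : ∀ {p k} → p ≡ k → ∀ c → not (does (p ℕ.≟ k)) ∧ c ≡ false
off-≡ {p} {k} q c = cong (λ b → not b ∧ c) (dec-true (p ℕ.≟ k) q)

off : ℕ → (ℕ → Bool) → ℕ → Bool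
off k f p = not (does (p ℕ.≟ k)) ∧ f p

off-0 : ∀ n k f (Q : ℕ → Set) → (∀ p → p < n → p ≢ k → Q p → f p ≡ false) → ∀ p → p < n → Q p → off k f p ≡ false
off-0 n k f Q z p h q = go (p ℕ.≟ k)
  where
  go : Dec (p ≡ k) → off k f p ≡ false
  go (yes e) = off-≡ e (f p)
  go (no e) = trans (off-≢ e (f p)) (z p h e q)

sumB-double : ∀ n k l f → k < n → l < n → k ≢ l → (∀ p → p < n → p ≢ k → p ≢ l → f p ≡ false) → sumB n f ≡ f k xor f l
sumB-double n k l f kn ln ne z = trans (sumB-split n k f kn) (cong (f k xor_) (trans (sumB-single n l (off k f) ln (off-0 n k f (λ p → p ≢ l) z)) (off-≢ (λ q → ne (sym q)) (f l))))

sumB-triple : ∀ n k l m f → k < n → l < n → m < n → k ≢ l → k ≢ m → l ≢ m → (∀ p → p < n → p ≢ k → p ≢ l → p ≢ m → f p ≡ false) → sumB n f ≡ f k xor (f l xor f m)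
sumB-triple n k l m f kn ln mn kl km lm z = trans (sumB-split n k f kn) (cong (f k xor_) (trans (sumB-double n l m (off k f) ln mn lm (λ p h nl nm → off-0 n k f (λ p → p ≢ l × p ≢ m) (λ p h nk (a , b) → z p h nk a b) p h (nl , nm)))
  (cong₂ _xor_ (off-≢ (λ q → kl (sym q)) (f l)) (off-≢ (λ q → km (sym q)) (f m)))))

unit-cls : ∀ {p} → Prime p → ∀ {a} → ¬ (+ p ∣ a) → vp p a ≡ false × unit p a ≡ a
unit-cls {p} pr {a} na = cong par (proj₁ v) , proj₂ v
  where
  v : val p a ≡ 0 × unit p a ≡ a
  v = val-of pr 0 a (sym (*-identityˡ a)) na

p-cls : ∀ {p} → Prime p → vp p (+ p) ≡ true × unit p (+ p) ≡ + 1
p-cls {p} pr = cong par (proj₁ v) , proj₂ v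
  where
  v : val p (+ p) ≡ 1 × unit p (+ p) ≡ + 1
  v = val-of pr 1 (+ 1) (trans (cong +_ (sym (ℕP.*-identityʳ p))) (sym (*-identityʳ (pk p 1)))) (¬p∣1 pr)

prime-∤ : ∀ {p q} → Prime p → Prime q → p ≢ q → ¬ (+ p ∣ + q)
prime-∤ pr qr ne d = case Data.Nat.Primality.prime⇒irreducible qr (∣⇒∣ᵤ d) of λ where
  (inj₁ z) → ℕ.nonTrivial⇒≢1 {{prime⇒nonTrivial pr}} z
  (inj₂ z) → ne z

-1∤ : ∀ {p} → Prime p → ¬ (+ p ∣ - (+ 1))
-1∤ pr d = ¬p∣1 pr (∣m⇒∣-m d)

hodd-units : ∀ {p} (op : OddPrime p) {a b} → ¬ (+ p ∣ a) → ¬ (+ p ∣ b) → hodd op a b ≡ false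
hodd-units {p} op@(pr , _) {a} {b} na nb = cong₂ (λ s t → OddSymbol.F op s t (OddSymbol.ℓ op a) (OddSymbol.ℓ op b)) (proj₁ (unit-cls pr na)) (proj₁ (unit-cls pr nb))

hodd-p : ∀ {p} (op : OddPrime p) {b} → ¬ (+ p ∣ b) → hodd op (+ p) b ≡ Odds.leg op b
hodd-p {p} op@(pr , _) {b} nb = trans (cong₂ (λ s t → OddSymbol.F op s t (OddSymbol.ℓ op (+ p)) (OddSymbol.ℓ op b)) (proj₁ (p-cls pr)) (proj₁ (unit-cls pr nb))) (cong (Odds.leg op) (proj₂ (unit-cls pr nb)))

h2-units : ∀ {a b} → ¬ (+ 2 ∣ a) → ¬ (+ 2 ∣ b) → h2 a b ≡ ε₂ a ∧ ε₂ b
h2-units {a} {b} na nb = trans (cong₂ (λ s t → F₂ s t (ε₂ (unit 2 a)) (β₂ (unit 2 a)) (ε₂ (unit 2 b)) (β₂ (unit 2 b))) (proj₁ (unit-cls prime[2] na)) (proj₁ (unit-cls prime[2] nb)))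
  (trans (xor-identityʳ (ε₂ (unit 2 a) ∧ ε₂ (unit 2 b))) (cong₂ (λ x y → ε₂ x ∧ ε₂ y) (proj₂ (unit-cls prime[2] na)) (proj₂ (unit-cls prime[2] nb))))

h2-two : ∀ {b} → ¬ (+ 2 ∣ b) → h2 (+ 2) b ≡ ω₂ b
h2-two {b} nb = trans (cong₂ (λ s t → F₂ s t (ε₂ (unit 2 (+ 2))) (β₂ (unit 2 (+ 2))) (ε₂ (unit 2 b)) (β₂ (unit 2 b))) (proj₁ (p-cls prime[2])) (proj₁ (unit-cls prime[2] nb)))
  (trans (cong (λ u → (ε₂ u ∧ ε₂ (unit 2 b)) xor ((ε₂ (unit 2 b) xor β₂ (unit 2 b)) xor false)) (proj₂ (p-cls prime[2]))) (trans (cong (λ e → (e ∧ ε₂ (unit 2 b)) xor ((ε₂ (unit 2 b) xor β₂ (unit 2 b)) xor false)) e1) (trans (xor-identityʳ (ω₂ (unit 2 b))) (cong ω₂ (proj₂ (unit-cls prime[2] nb))))))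
  where
  e1 : ε₂ (+ 1) ≡ false
  e1 = trans (cong bit (proj₂ (bit-of {+ 1} true (+ 0) refl))) (bit-BZ false)

hf-neg1 : hf (- (+ 1)) ≡ - (+ 1)
hf-neg1 = proj₂ (bit-of { - (+ 1)} true (- (+ 1)) refl)

ε₂-neg1 : ε₂ (- (+ 1)) ≡ true
ε₂-neg1 = trans (cong bit hf-neg1) (proj₁ (bit-of { - (+ 1)} true (- (+ 1)) refl))

ω₂-neg1 : ω₂ (- (+ 1)) ≡ false
ω₂-neg1 = cong₂ _xor_ ε₂-neg1 (trans (cong (λ z → bit (hf z)) hf-neg1) ε₂-neg1)

bit-par : ∀ n → bit (+ n) ≡ par n
bit-par zero = bit-BZ false
bit-par (suc n) = trans (cong bit (pos-+ 1 n)) (trans (bit-+ (+ 1) (+ n)) (cong₂ _xor_ (bit-BZ true) (bit-par n)))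

hf-suc-even : ∀ {x} → bit x ≡ false → hf (+ 1 + x) ≡ hf x
hf-suc-even {x} q = proj₂ (bit-of true (hf x) (+ˡ (+ 1) (trans (bit-spec x) (trans (cong (λ b → BZ b + + 2 * hf x) q) (+-identityˡ (+ 2 * hf x))))))

hf-suc-odd : ∀ {x} → bit x ≡ true → hf (+ 1 + x) ≡ + 1 + hf x
hf-suc-odd {x} q = proj₂ (bit-of false (+ 1 + hf x) (trans (+ˡ (+ 1) (trans (bit-spec x) (cong (λ b → BZ b + + 2 * hf x) q))) (re (hf x))))
  where
  re : ∀ h → + 1 + (+ 1 + + 2 * h) ≡ + 0 + + 2 * (+ 1 + h)
  re = solve-∀

xsum-last : ∀ n (f : ℕ → Bool) → xsum {suc n} (f ∘ toℕ) ≡ xsum {n} (f ∘ toℕ) xor f n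
xsum-last zero f = xor-identityʳ (f 0)
xsum-last (suc n) f = trans (cong (f 0 xor_) (xsum-last n (f ∘ suc))) (sym (xor-assoc (f 0) (xsum {n} (λ i → f (suc (toℕ i)))) (f (suc n))))

-- The parity of 1 + ... + h is the sum of the two lowest binary digits of h. This identifies the
-- sum `P` that Gauss's lemma attaches to 2 with `ω₂ (+ p)`.
par-tri : ∀ h → xsum {h} (par ∘ idx) ≡ bit (+ h) xor bit (hf (+ h))
par-tri zero = sym (cong₂ _xor_ (bit-BZ false) (trans (cong bit (proj₂ (bit-of {+ 0} false (+ 0) refl))) (bit-BZ false)))
par-tri (suc h) = trans (xsum-last h (λ k → par (suc k))) (trans (cong (_xor not (par h)) (par-tri h)) (go (bit (+ h)) refl))
  where
  sb : bit (+ suc h) ≡ not (bit (+ h))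
  sb = trans (bit-par (suc h)) (cong not (sym (bit-par h)))
  go : ∀ b → bit (+ h) ≡ b → (bit (+ h) xor bit (hf (+ h))) xor not (par h) ≡ bit (+ suc h) xor bit (hf (+ suc h))
  go false q = trans (cong₂ (λ a c → (a xor bit (hf (+ h))) xor not c) q (trans (sym (bit-par h)) q)) (trans (xor-comm (bit (hf (+ h))) true)
    (sym (cong₂ _xor_ (trans sb (cong not q)) (cong bit (trans (cong hf (pos-+ 1 h)) (hf-suc-even q))))))
  go true q = trans (cong₂ (λ a c → (a xor bit (hf (+ h))) xor not c) q (trans (sym (bit-par h)) q)) (trans (xor-identityʳ (not (bit (hf (+ h)))))
    (sym (cong₂ _xor_ (trans sb (cong not q)) (trans (cong bit (trans (cong hf (pos-+ 1 h)) (hf-suc-odd q))) (trans (bit-+ (+ 1) (hf (+ h))) (cong (_xor bit (hf (+ h))) (bit-BZ true)))))))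

module _ {p} (op : OddPrime p) where
  private
    module L = Legendre op
  hf-p : hf (+ p) ≡ + L.h
  hf-p = proj₂ (bit-of true (+ L.h) (trans (cong +_ L.ph) (trans (pos-+ 1 (L.h +ᴺ L.h)) (+ˡ (+ 1) (trans (pos-+ L.h L.h) (re (+ L.h)))))))
    where
    re : ∀ h → h + h ≡ + 2 * h
    re = solve-∀
  ε₂-p : ε₂ (+ p) ≡ par L.h
  ε₂-p = trans (cong bit hf-p) (bit-par L.h)
  ω₂-p : ω₂ (+ p) ≡ L.P
  ω₂-p = trans (cong₂ _xor_ (cong bit hf-p) (cong (λ z → bit (hf z)) hf-p)) (sym (par-tri L.h))
  2∤p : ¬ (+ 2 ∣ + p)
  2∤p = prime-∤ prime[2] (proj₁ op) (λ q → proj₂ op (sym q))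

-- The finite places only. It is shown to vanish for positive first argument, where the real symbol
-- is trivial.
T : ℕ → ℤ → ℤ → Bool
T B a b = sumB B (λ p → H p a b)

T-*ˡ : ∀ B {a b} → a ≢ + 0 → b ≢ + 0 → ∀ c → T B (a * b) c ≡ T B a c xor T B b c
T-*ˡ B a0 b0 c = trans (sumB-cong B (λ p _ → H-*ˡ p a0 b0 c)) (sumB-xor B _ _)

T-comm : ∀ B a b → T B a b ≡ T B b a
T-comm B a b = sumB-cong B (λ p _ → H-comm p a b)

H-units : ∀ {p} → p ≢ 2 → ∀ {a b} → (Prime p → ¬ (+ p ∣ a)) → (Prime p → ¬ (+ p ∣ b)) → H p a b ≡ false
H-units {p} ne {a} {b} na nb = case prime? p of λ where
  (yes pr) → trans (H-odd (pr , ne) a b) (hodd-units (pr , ne) (na pr) (nb pr))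
  (no np) → H-np np a b

abstract
  T-odd-neg : ∀ B {q} → OddPrime q → q < B → 2 < B → T B (+ q) (- (+ 1)) ≡ false
  T-odd-neg B {q} oq qB 2B = trans (sumB-double B q 2 (λ p → H p (+ q) (- (+ 1))) qB 2B (proj₂ oq) (λ p _ n1 n2 → H-units n2 (λ pr → prime-∤ pr (proj₁ oq) n1) (λ pr → -1∤ pr)))
    (trans (cong₂ _xor_ (trans (H-odd oq (+ q) (- (+ 1))) (trans (hodd-p oq (-1∤ (proj₁ oq))) (Legendre.leg-minus-one oq))) (trans (H-2 (+ q) (- (+ 1))) (trans (h2-units (2∤p oq) (-1∤ prime[2])) (cong₂ _∧_ (ε₂-p oq) ε₂-neg1))))
      (taut 1 (λ { (x ∷ []) → x xor (x ∧ true) }) (λ _ → false) refl (par (Legendre.h oq) ∷ [])))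

  T-2-neg : ∀ B → 2 < B → T B (+ 2) (- (+ 1)) ≡ false
  T-2-neg B 2B = trans (sumB-single B 2 (λ p → H p (+ 2) (- (+ 1))) 2B (λ p _ n2 → H-units n2 (λ pr → prime-∤ pr prime[2] n2) (λ pr → -1∤ pr))) (trans (H-2 (+ 2) (- (+ 1))) (trans (h2-two (-1∤ prime[2])) ω₂-neg1))

  T-odd-2 : ∀ B {q} → OddPrime q → q < B → 2 < B → T B (+ q) (+ 2) ≡ false
  T-odd-2 B {q} oq qB 2B = trans (sumB-double B q 2 (λ p → H p (+ q) (+ 2)) qB 2B (proj₂ oq) (λ p _ n1 n2 → H-units n2 (λ pr → prime-∤ pr (proj₁ oq) n1) (λ pr → prime-∤ pr prime[2] n2)))
    (trans (cong₂ _xor_ (trans (H-odd oq (+ q) (+ 2)) (trans (hodd-p oq (∤2 oq)) (Legendre.leg-two oq))) (trans (H-comm 2 (+ q) (+ 2)) (trans (H-2 (+ 2) (+ q)) (trans (h2-two (2∤p oq)) (ω₂-p oq))))) (xor-same (Legendre.P oq)))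

  -- The places q, r and 2 contribute the three terms of the reciprocity law, and every other place
  -- sees two units.
  T-odd-odd : ∀ B {q r} → OddPrime q → OddPrime r → q ≢ r → q < B → r < B → 2 < B → T B (+ q) (+ r) ≡ false
  T-odd-odd B {q} {r} oq or ne qB rB 2B = trans (sumB-triple B q r 2 (λ p → H p (+ q) (+ r)) qB rB 2B ne (proj₂ oq) (proj₂ or) (λ p _ n1 n2 n3 → H-units n3 (λ pr → prime-∤ pr (proj₁ oq) n1) (λ pr → prime-∤ pr (proj₁ or) n2)))
    (trans (cong₂ _xor_ (trans (H-odd oq (+ q) (+ r)) (hodd-p oq (prime-∤ (proj₁ oq) (proj₁ or) ne))) (cong₂ _xor_ (trans (H-comm r (+ q) (+ r)) (trans (H-odd or (+ r) (+ q)) (hodd-p or (prime-∤ (proj₁ or) (proj₁ oq) (λ z → ne (sym z)))))) (trans (H-2 (+ q) (+ r)) (trans (h2-units (2∤p oq) (2∤p or)) (cong₂ _∧_ (ε₂-p oq) (ε₂-p or))))))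
      (trans (sym (xor-assoc (Odds.leg oq (+ r)) (Odds.leg or (+ q)) (par (Legendre.h oq) ∧ par (Legendre.h or)))) (trans (cong (_xor (par (Legendre.h oq) ∧ par (Legendre.h or))) (reciprocity oq or ne)) (xor-same (par (Legendre.h oq) ∧ par (Legendre.h or))))))

2<B : ∀ {q B} → Prime q → q < B → 2 < B
2<B {q} pr qB = ≤-<-trans (prime>1 pr) qB

T-prime-neg : ∀ B {q} → Prime q → q < B → T B (+ q) (- (+ 1)) ≡ false
T-prime-neg B {q} pr qB = case q ℕ.≟ 2 of λ where
  (yes refl) → T-2-neg B qB
  (no ne) → T-odd-neg B (pr , ne) qB (2<B pr qB)

T-prime-prime : ∀ B {q r} → Prime q → Prime r → q < B → r < B → T B (+ q) (+ r) ≡ false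
T-prime-prime B {q} {r} qr rr qB rB = go (q ℕ.≟ r) (q ℕ.≟ 2) (r ℕ.≟ 2)
  where
  go : Dec (q ≡ r) → Dec (q ≡ 2) → Dec (r ≡ 2) → T B (+ q) (+ r) ≡ false
  go (yes refl) _ _ = trans (sumB-cong B (λ p _ → H-self p (+p≢0 qr))) (T-prime-neg B qr qB)
  go (no ne) (yes refl) (yes refl) = ⊥-elim (ne refl)
  go (no ne) (yes refl) (no r2) = trans (T-comm B (+ 2) (+ r)) (T-odd-2 B (rr , r2) rB qB)
  go (no ne) (no q2) (yes refl) = T-odd-2 B (qr , q2) qB rB
  go (no ne) (no q2) (no r2) = T-odd-odd B (qr , q2) (rr , r2) ne qB rB (2<B qr qB)

pos≢0 : ∀ {n} → 0 < n → + n ≢ + 0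
pos≢0 (s≤s _) ()

neg≡ : ∀ b → - b ≡ b * - (+ 1)
neg≡ = solve-∀

module _ (B : ℕ) where
  private
    prod : List ℕ → ℕ
    prod = Data.Nat.ListAction.product

    prod>0 : ∀ {l} → All Prime l → 0 < prod l
    prod>0 [] = s≤s z≤n
    prod>0 (pr ∷ ps) = *-mono-≤ (<⇒≤ (prime>1 pr)) (prod>0 ps)

    T-list : ∀ l → All Prime l → All (_< B) l → ∀ c → (∀ {q} → Prime q → q < B → T B (+ q) c ≡ false) → T B (+ prod l) c ≡ false
    T-list [] _ _ c g = sumB-0 B (λ p _ → H-1 p c)
    T-list (q ∷ l) (qr ∷ ps) (qB ∷ bs) c g = trans (cong (λ z → T B z c) (ℤP.pos-* q (prod l))) (trans (T-*ˡ B (+p≢0 qr) (pos≢0 (prod>0 ps)) c) (cong₂ _xor_ (g qr qB) (T-list l ps bs c g)))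

    small : ∀ l → All Prime l → prod l < B → All (_< B) l
    small [] _ _ = []
    small (q ∷ l) (qr ∷ ps) h = ≤-<-trans (ℕP.m≤m*n q (prod l) {{ℕ.>-nonZero (prod>0 ps)}}) h ∷ small l ps (≤-<-trans (ℕP.m≤n*m (prod l) q {{prime-nz qr}}) h)

    T-nat : ∀ a → 0 < a → a < B → ∀ c → (∀ {q} → Prime q → q < B → T B (+ q) c ≡ false) → T B (+ a) c ≡ false
    T-nat a a0 aB c g = go (factorise a {{ℕ.>-nonZero a0}})
      where
      go : PrimeFactorisation a → T B (+ a) c ≡ false
      go record { factors = l ; isFactorisation = e ; factorsPrime = ps } = subst (λ n → T B (+ n) c ≡ false) (sym e) (T-list l ps (small l ps (subst (_< B) e aB)) c g)

  abstract
    -- Bimultiplicativity reduces to prime arguments. `B` exceeds both numbers, so every place with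
    -- a nontrivial symbol is counted.
    product-formula : ∀ {a b} → 0 < a → 0 < b → a < B → b < B → T B (+ a) (+ b) ≡ false
    product-formula {a} {b} a0 b0 aB bB = T-nat a a0 aB (+ b) (λ {q} qr qB → trans (T-comm B (+ q) (+ b)) (T-nat b b0 bB (+ q) (λ {r} rr rB → T-prime-prime B rr qr rB qB)))

    product-formula⁻ : ∀ {a b} → 0 < a → 0 < b → a < B → b < B → T B (+ a) (- + b) ≡ false
    product-formula⁻ {a} {b} a0 b0 aB bB = trans (cong (T B (+ a)) (neg≡ (+ b))) (trans (T-comm B (+ a) (+ b * - (+ 1))) (trans (T-*ˡ B {+ b} { - (+ 1)} (pos≢0 b0) (λ ()) (+ a)) (cong₂ _xor_ (trans (T-comm B (+ b) (+ a)) (product-formula a0 b0 aB bB)) (trans (T-comm B (- (+ 1)) (+ a)) (T-nat a a0 aB (- (+ 1)) (T-prime-neg B))))))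

-- Dirichlet's hyperbola method

sN : ℕ → (ℕ → ℤ) → ℤ
sN zero    f = + 0
sN (suc n) f = f 0 + sN n (f ∘ suc)

sN-cong : ∀ n {f g} → (∀ i → i < n → f i ≡ g i) → sN n f ≡ sN n g
sN-cong zero e = refl
sN-cong (suc n) e = cong₂ _+_ (e 0 (s≤s z≤n)) (sN-cong n (λ i h → e (suc i) (s≤s h)))

sN-0 : ∀ n {f} → (∀ i → i < n → f i ≡ + 0) → sN n f ≡ + 0
sN-0 zero e = refl
sN-0 (suc n) e = cong₂ _+_ (e 0 (s≤s z≤n)) (sN-0 n (λ i h → e (suc i) (s≤s h)))

sN-+ : ∀ n f g → sN n (λ i → f i + g i) ≡ sN n f + sN n g
sN-+ zero f g = refl
sN-+ (suc n) f g = trans (+ˡ (f 0 + g 0) (sN-+ n (f ∘ suc) (g ∘ suc))) (+-interchange (f 0) (g 0) (sN n (f ∘ suc)) (sN n (g ∘ suc)))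

sN-* : ∀ n c f → sN n (λ i → c * f i) ≡ c * sN n f
sN-* zero c f = sym (*-zeroʳ c)
sN-* (suc n) c f = trans (+ˡ (c * f 0) (sN-* n c (f ∘ suc))) (sym (ℤP.*-distribˡ-+ c (f 0) (sN n (f ∘ suc))))

sN-split : ∀ m n f → sN (m +ᴺ n) f ≡ sN m f + sN n (λ i → f (m +ᴺ i))
sN-split zero n f = sym (+-identityˡ (sN n f))
sN-split (suc m) n f = trans (+ˡ (f 0) (sN-split m n (f ∘ suc))) (sym (ℤP.+-assoc (f 0) (sN m (f ∘ suc)) (sN n (λ i → f (suc m +ᴺ i)))))

sN-last : ∀ n f → sN (suc n) f ≡ sN n f + f n
sN-last n f = trans (cong (λ k → sN k f) (ℕP.+-comm 1 n)) (trans (sN-split n 1 f) (+ˡ (sN n f) (trans (+-identityʳ (f (n +ᴺ 0))) (cong f (ℕP.+-identityʳ n)))))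

sN-swap : ∀ m n (f : ℕ → ℕ → ℤ) → sN m (λ i → sN n (λ j → f i j)) ≡ sN n (λ j → sN m (λ i → f i j))
sN-swap zero n f = sym (sN-0 n (λ _ _ → refl))
sN-swap (suc m) n f = trans (+ˡ (sN n (f 0)) (sN-swap m n (f ∘ suc))) (sym (sN-+ n (f 0) (λ j → sN m (λ i → f (suc i) j))))

sN-trunc : ∀ {m n} f → m ≤ n → (∀ i → m ≤ i → f i ≡ + 0) → sN n f ≡ sN m f
sN-trunc {m} {n} f h z = trans (cong (λ k → sN k f) (sym (ℕP.m+[n∸m]≡n h))) (trans (sN-split m (n ∸ m) f) (+z (sN-0 (n ∸ m) (λ i _ → z (m +ᴺ i) (m≤m+n m i)))))

abs-sN : ∀ n D M f → (∀ i → i < D → abs (f i) ≤ M) → (∀ i → D ≤ i → f i ≡ + 0) → abs (sN n f) ≤ D *ᴺ M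
abs-sN zero D M f b z = z≤n
abs-sN (suc n) zero M f b z = ≤-reflexive (cong abs (sN-0 (suc n) (λ i _ → z i z≤n)))
abs-sN (suc n) (suc D) M f b z = ≤-trans (ℤP.∣i+j∣≤∣i∣+∣j∣ (f 0) (sN n (f ∘ suc))) (ℕP.+-mono-≤ (b 0 (s≤s z≤n)) (abs-sN n D M (f ∘ suc) (λ i h → b (suc i) (s≤s h)) (λ i h → z (suc i) (s≤s h))))

abs-sN′ : ∀ n M f → (∀ i → i < n → abs (f i) ≤ M) → abs (sN n f) ≤ n *ᴺ M
abs-sN′ zero M f b = z≤n
abs-sN′ (suc n) M f b = ≤-trans (ℤP.∣i+j∣≤∣i∣+∣j∣ (f 0) (sN n (f ∘ suc))) (ℕP.+-mono-≤ (b 0 (s≤s z≤n)) (abs-sN′ n M (f ∘ suc) (λ i h → b (suc i) (s≤s h))))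

record Chr (D : ℕ) (f : ℕ → ℤ) : Set where
  field
    f≤1 : ∀ n → abs (f n) ≤ 1
    per : ∀ n → f (D +ᴺ n) ≡ f n
    f0  : f 0 ≡ + 0

record ZeroSum (D : ℕ) (f : ℕ → ℤ) : Set where
  field
    chr : Chr D f
    zs  : sN D f ≡ + 0
  open Chr chr public

abs-≤ : ∀ {x y M N} → abs x ≤ M → abs y ≤ N → abs (x * y) ≤ M *ᴺ N
abs-≤ {x} {y} h g = ≤-trans (≤-reflexive (abs-* x y)) (*-mono-≤ h g)

chr-* : ∀ (f : ℕ → ℤ) {M} n (y : ℤ) → (∀ n → abs (f n) ≤ 1) → abs y ≤ M → abs (f n * y) ≤ M
chr-* f {M} n y b h = ≤-trans (abs-≤ {f n} {y} (b n) h) (≤-reflexive (ℕP.*-identityˡ M))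

module Block {D θ} (Z : ZeroSum D θ) where
  open ZeroSum Z

  Tθ : ℤ
  Tθ = sN D (λ r → θ r * + r)

  T≤ : abs Tθ ≤ D *ᴺ D
  T≤ = abs-sN′ D D (λ r → θ r * + r) (λ r h → chr-* θ r (+ r) f≤1 (<⇒≤ h))

  periods : ∀ k → sN (k *ᴺ D) θ ≡ + 0
  periods zero = refl
  periods (suc k) = trans (sN-split D (k *ᴺ D) θ) (trans (cong₂ _+_ zs (trans (sN-cong (k *ᴺ D) (λ i _ → per i)) (periods k))) refl)

  moments : ∀ k → sN (k *ᴺ D) (λ r → θ r * + r) ≡ + k * Tθ
  moments zero = sym (*-zeroˡ Tθ)
  moments (suc k) = trans (sN-split D (k *ᴺ D) (λ r → θ r * + r)) (trans (+ˡ Tθ (trans (sN-cong (k *ᴺ D) (λ i _ → trans (cong₂ _*_ (per i) (pos-+ D i)) (re1 (θ i) (+ D) (+ i)))) (trans (sN-+ (k *ᴺ D) (λ i → + D * θ i) (λ i → θ i * + i)) (cong₂ _+_ (trans (sN-* (k *ᴺ D) (+ D) θ) (cong (+ D *_) (periods k))) (moments k))))) (trans (re2 Tθ (+ D) (+ k * Tθ)) (re3 (+ k) Tθ)))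
    where
    re1 : ∀ t d i → t * (d + i) ≡ d * t + t * i
    re1 = solve-∀
    re2 : ∀ t d s → t + (d * + 0 + s) ≡ t + s
    re2 = solve-∀
    re3 : ∀ k t → t + k * t ≡ (+ 1 + k) * t
    re3 = solve-∀

  module _ (a : ℕ) where
    -- The sum of θ(b)·max(Y - ab, 0), the maximum being truncated subtraction.
    s : ℕ → ℕ → ℤ
    s N Y = sN N (λ b → θ b * + (Y ∸ a *ᴺ b))

    -- `D` times the error of the linear approximation -(Tθ/D)·Y to `s`; the slope is the value L(0,
    -- θ).
    e : ℕ → ℕ → ℤ
    e N Y = + D * s N Y + Tθ * + Y

    s-step : ∀ N Y → s (D +ᴺ N) (a *ᴺ D +ᴺ Y) ≡ - (+ a) * Tθ + s N Y
    s-step N Y = trans (sN-split D N (λ b → θ b * + ((a *ᴺ D +ᴺ Y) ∸ a *ᴺ b))) (cong₂ _+_ first rest)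
      where
      rest : sN N (λ b → θ (D +ᴺ b) * + ((a *ᴺ D +ᴺ Y) ∸ a *ᴺ (D +ᴺ b))) ≡ s N Y
      rest = sN-cong N (λ b _ → cong₂ (λ u v → u * + v) (per b) (trans (cong ((a *ᴺ D +ᴺ Y) ∸_) (ℕP.*-distribˡ-+ a D b)) (ℕP.[m+n]∸[m+o]≡n∸o (a *ᴺ D) Y (a *ᴺ b))))
      re1 : ∀ t W a r → t * (W - a * r) ≡ W * t + - a * (t * r)
      re1 = solve-∀
      W : ℕ
      W = a *ᴺ D +ᴺ Y
      first : sN D (λ b → θ b * + (W ∸ a *ᴺ b)) ≡ - (+ a) * Tθ
      first = trans (sN-cong D (λ b h → trans (cong (θ b *_) (trans (sym (pos-∸ (≤-trans (ℕP.*-monoʳ-≤ a (<⇒≤ h)) (m≤m+n (a *ᴺ D) Y)))) (cong (λ z → + W - z) (ℤP.pos-* a b)))) (re1 (θ b) (+ W) (+ a) (+ b))))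
        (trans (sN-+ D (λ b → + W * θ b) (λ b → - (+ a) * (θ b * + b))) (trans (cong₂ _+_ (trans (sN-* D (+ W) θ) (trans (cong (+ W *_) zs) (*-zeroʳ (+ W)))) (sN-* D (- (+ a)) (λ b → θ b * + b))) (+-identityˡ (- (+ a) * Tθ))))

    -- A whole period adds -a·Tθ to `s` while `Y` grows by aD, so the error is periodic and only its
    -- first period needs an estimate.
    e-step : ∀ N Y → e (D +ᴺ N) (a *ᴺ D +ᴺ Y) ≡ e N Y
    e-step N Y = trans (cong₂ (λ u v → + D * u + Tθ * v) (s-step N Y) (trans (pos-+ (a *ᴺ D) Y) (cong (_+ + Y) (ℤP.pos-* a D)))) (re (+ D) (+ a) Tθ (s N Y) (+ Y))
      where
      re : ∀ D a T s Y → D * (- a * T + s) + T * (a * D + Y) ≡ D * s + T * Y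
      re = solve-∀

    E : ℕ
    E = D *ᴺ (D *ᴺ (a *ᴺ D)) +ᴺ (D *ᴺ D) *ᴺ (a *ᴺ D)

    abstract
      -- `J` counts the periods to be peeled off. The condition `Y ≤ N *ᴺ a` guarantees that the cut
      -- at `N` removes only zero terms.
      e-bound : ∀ J N Y → Y < J *ᴺ (a *ᴺ D) → Y ≤ N *ᴺ a → abs (e N Y) ≤ E
      e-bound zero N Y () _
      e-bound (suc J) N Y lt le = go (Y ℕ.<? a *ᴺ D)
        where
        go : Dec (Y < a *ᴺ D) → abs (e N Y) ≤ E
        go (yes small) = ≤-trans (ℤP.∣i+j∣≤∣i∣+∣j∣ (+ D * s N Y) (Tθ * + Y)) (ℕP.+-mono-≤ (abs-≤ {+ D} {s N Y} ≤-refl bs) (abs-≤ {Tθ} {+ Y} T≤ (<⇒≤ small)))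
          where
          bs : abs (s N Y) ≤ D *ᴺ (a *ᴺ D)
          bs = abs-sN N D (a *ᴺ D) (λ b → θ b * + (Y ∸ a *ᴺ b)) (λ b _ → chr-* θ b (+ (Y ∸ a *ᴺ b)) f≤1 (≤-trans (ℕP.m∸n≤m Y (a *ᴺ b)) (<⇒≤ small)))
            (λ b h → trans (cong (λ z → θ b * + z) (ℕP.m≤n⇒m∸n≡0 (≤-trans (<⇒≤ small) (ℕP.*-monoʳ-≤ a h)))) (*-zeroʳ (θ b)))
        go (no big) = subst₂ (λ n y → abs (e n y) ≤ E) (ℕP.m+[n∸m]≡n D≤N) (ℕP.m+[n∸m]≡n aD≤Y) (≤-trans (≤-reflexive (cong abs (e-step (N ∸ D) (Y ∸ a *ᴺ D)))) (e-bound J (N ∸ D) (Y ∸ a *ᴺ D) lt′ le′))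
          where
          aD≤Y : a *ᴺ D ≤ Y
          aD≤Y = ≮⇒≥ big
          lt′ : Y ∸ a *ᴺ D < J *ᴺ (a *ᴺ D)
          lt′ = subst (Y ∸ a *ᴺ D <_) (ℕP.m+n∸m≡n (a *ᴺ D) (J *ᴺ (a *ᴺ D))) (ℕP.∸-monoˡ-< lt aD≤Y)
          aD>0 : 0 < a *ᴺ D
          aD>0 = ℕP.n≢0⇒n>0 λ z → case subst (Y <_) (trans (cong (suc J *ᴺ_) z) (ℕP.*-zeroʳ (suc J))) lt of λ ()
          a≢0 : ℕ.NonZero a
          a≢0 = ℕ.≢-nonZero λ z → <⇒≢ aD>0 (sym (cong (_*ᴺ D) z))
          D≤N : D ≤ N
          D≤N = ℕP.*-cancelʳ-≤ D N a {{a≢0}} (≤-trans (≤-reflexive (ℕP.*-comm D a)) (≤-trans aD≤Y le))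
          le′ : Y ∸ a *ᴺ D ≤ (N ∸ D) *ᴺ a
          le′ = ≤-trans (ℕP.∸-monoˡ-≤ (a *ᴺ D) le) (≤-reflexive (trans (cong (N *ᴺ a ∸_) (ℕP.*-comm a D)) (sym (ℕP.*-distribʳ-∸ a N D))))

module Hyperbola {D φ θ} (Zφ : ZeroSum D φ) (Zθ : ZeroSum D θ) (D>0 : 0 < D) (k : ℕ) where
  private
    module Bφ = Block Zφ
    module Bθ = Block Zθ
    module Cφ = ZeroSum Zφ
    module Cθ = ZeroSum Zθ
  -- The region ab < X is cut at a = y = √X; y is a multiple of `D` so that character sums up to y
  -- vanish.
  y X : ℕ
  y = k *ᴺ D
  X = y *ᴺ y

  Fsum : ℤ
  Fsum = sN X (λ a → sN X (λ b → φ a * θ b * + (X ∸ a *ᴺ b)))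

  y≤X : y ≤ X
  y≤X = go y
    where
    go : ∀ y → y ≤ y *ᴺ y
    go zero = z≤n
    go (suc y) = m≤m+n (suc y) (y *ᴺ suc y)

  private
    D³ : ℕ
    D³ = D *ᴺ (D *ᴺ D)

    E≤ : ∀ a → a ≤ y → D *ᴺ (D *ᴺ (a *ᴺ D)) +ᴺ (D *ᴺ D) *ᴺ (a *ᴺ D) ≤ 2 *ᴺ D³ *ᴺ y
    E≤ a h = ≤-trans (≤-reflexive (re D a)) (ℕP.*-monoʳ-≤ (2 *ᴺ D³) h)
      where
      re : ∀ D a → D *ᴺ (D *ᴺ (a *ᴺ D)) +ᴺ (D *ᴺ D) *ᴺ (a *ᴺ D) ≡ 2 *ᴺ (D *ᴺ (D *ᴺ D)) *ᴺ a
      re = ℕR.solve-∀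

    bnd : ∀ {θ} (Z : ZeroSum D θ) a N Y → 1 ≤ a → a ≤ y → Y ≤ N *ᴺ a → abs (Block.e Z a N Y) ≤ 2 *ᴺ D³ *ᴺ y
    bnd Z (suc a) N Y _ h le = ≤-trans (Block.e-bound Z (suc a) (suc Y) N Y (≤-trans (≤-reflexive (sym (ℕP.*-identityʳ (suc Y)))) (ℕP.*-monoʳ-≤ (suc Y) (*-mono-≤ {1} {suc a} (s≤s z≤n) D>0))) le) (E≤ (suc a) h)

    weighted : ∀ {φ θ} (Cφ : ZeroSum D φ) (Z : ZeroSum D θ) (N : ℕ) (Yf : ℕ → ℕ) → (∀ a → 1 ≤ a → a < y → Yf a ≤ N *ᴺ a) → abs (sN y (λ a → φ a * Block.e Z a N (Yf a))) ≤ y *ᴺ (2 *ᴺ D³ *ᴺ y)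
    weighted {φ} C Z N Yf g = abs-sN′ y (2 *ᴺ D³ *ᴺ y) (λ a → φ a * Block.e Z a N (Yf a)) term
      where
      term : ∀ a → a < y → abs (φ a * Block.e Z a N (Yf a)) ≤ 2 *ᴺ D³ *ᴺ y
      term zero _ = ≤-trans (≤-reflexive (cong abs (trans (cong (_* Block.e Z 0 N (Yf 0)) (ZeroSum.f0 C)) (*-zeroˡ (Block.e Z 0 N (Yf 0)))))) z≤n
      term (suc a) h = chr-* φ (suc a) (Block.e Z (suc a) N (Yf (suc a))) (ZeroSum.f≤1 C) (bnd Z (suc a) N (Yf (suc a)) (s≤s z≤n) (<⇒≤ h) (g (suc a) (s≤s z≤n) h))

    F1 F2 : ℤ
    F1 = sN y (λ a → sN X (λ b → φ a * θ b * + (X ∸ a *ᴺ b)))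
    F2 = sN (X ∸ y) (λ a → sN X (λ b → φ (y +ᴺ a) * θ b * + (X ∸ (y +ᴺ a) *ᴺ b)))

    Fsplit : Fsum ≡ F1 + F2
    Fsplit = trans (cong (λ n → sN n (λ a → sN X (λ b → φ a * θ b * + (X ∸ a *ᴺ b)))) (sym (ℕP.m+[n∸m]≡n y≤X))) (sN-split y (X ∸ y) (λ a → sN X (λ b → φ a * θ b * + (X ∸ a *ᴺ b))))

    -- The range a < y. The main term is proportional to the sum of φ over complete periods and
    -- drops out, leaving only the bounded errors.
    DF1 : + D * F1 ≡ sN y (λ a → φ a * Bθ.e a X X)
    DF1 = trans (cong (+ D *_) (sN-cong y (λ a _ → trans (sN-cong X (λ b _ → *-assoc (φ a) (θ b) (+ (X ∸ a *ᴺ b)))) (sN-* X (φ a) (λ b → θ b * + (X ∸ a *ᴺ b))))))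
      (trans (sym (+z (trans (cong (λ z → Bθ.Tθ * + X * z) (Bφ.periods k)) (*-zeroʳ (Bθ.Tθ * + X))))) (trans (cong₂ _+_ (sym (sN-* y (+ D) (λ a → φ a * Bθ.s a X X))) (sym (sN-* y (Bθ.Tθ * + X) φ)))
        (trans (sym (sN-+ y (λ a → + D * (φ a * Bθ.s a X X)) (λ a → Bθ.Tθ * + X * φ a))) (sN-cong y (λ a _ → re (+ D) (φ a) (Bθ.s a X X) Bθ.Tθ (+ X))))))
      where
      re : ∀ D f s T X → D * (f * s) + T * X * f ≡ f * (D * s + T * X)
      re = solve-∀

    -- The range a ≥ y. There ab < X forces b < y, so b becomes the outer variable, and periodicity
    -- lets the inner sum start afresh at y.
    F2′ : F2 ≡ sN y (λ b → θ b * Bφ.s b (X ∸ y) (X ∸ y *ᴺ b))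
    F2′ = trans (sN-swap (X ∸ y) X (λ a b → φ (y +ᴺ a) * θ b * + (X ∸ (y +ᴺ a) *ᴺ b))) (trans (sN-cong X (λ b _ → trans (sN-cong (X ∸ y) (λ a _ → trans (cong₂ (λ u v → u * θ b * + v) (perk a) (trans (cong (X ∸_) (trans (ℕP.*-distribʳ-+ b y a) (cong (y *ᴺ b +ᴺ_) (ℕP.*-comm a b)))) (sym (ℕP.∸-+-assoc X (y *ᴺ b) (b *ᴺ a))))) (re (φ a) (θ b) (+ (X ∸ y *ᴺ b ∸ b *ᴺ a))))) (sN-* (X ∸ y) (θ b) (λ a → φ a * + (X ∸ y *ᴺ b ∸ b *ᴺ a)))))
      (sN-trunc (λ b → θ b * Bφ.s b (X ∸ y) (X ∸ y *ᴺ b)) y≤X (λ b h → trans (cong (θ b *_) (sN-0 (X ∸ y) (λ a _ → trans (cong (λ z → φ a * + z) (trans (cong (_∸ b *ᴺ a) (ℕP.m≤n⇒m∸n≡0 (ℕP.*-monoʳ-≤ y h))) (ℕP.0∸n≡0 (b *ᴺ a)))) (*-zeroʳ (φ a))))) (*-zeroʳ (θ b)))))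
      where
      re : ∀ f t z → f * t * z ≡ t * (f * z)
      re = solve-∀
      perk : ∀ a → φ (y +ᴺ a) ≡ φ a
      perk a = go k
        where
        go : ∀ k → φ (k *ᴺ D +ᴺ a) ≡ φ a
        go zero = refl
        go (suc k) = trans (cong φ (ℕP.+-assoc D (k *ᴺ D) a)) (trans (Cφ.per (k *ᴺ D +ᴺ a)) (go k))

    -- Here the main term -Tφ·(X - yb), summed against θ, keeps only its part in b; what survives is
    -- of the order y² = X.
    DF2 : + D * F2 ≡ sN y (λ b → θ b * Bφ.e b (X ∸ y) (X ∸ y *ᴺ b)) + Bφ.Tθ * + y * (+ k * Bθ.Tθ)
    DF2 = trans (cong (+ D *_) F2′) (trans (sym (sN-* y (+ D) (λ b → θ b * Bφ.s b (X ∸ y) (X ∸ y *ᴺ b)))) (trans (sN-cong y each) (trans (sN-+ y (λ b → θ b * Bφ.e b (X ∸ y) (X ∸ y *ᴺ b)) (λ b → - (Bφ.Tθ * + X) * θ b + Bφ.Tθ * + y * (θ b * + b)))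
      (+ˡ (sN y (λ b → θ b * Bφ.e b (X ∸ y) (X ∸ y *ᴺ b))) (trans (sN-+ y (λ b → - (Bφ.Tθ * + X) * θ b) (λ b → Bφ.Tθ * + y * (θ b * + b))) (trans (cong₂ _+_ (trans (sN-* y (- (Bφ.Tθ * + X)) θ) (trans (cong (- (Bφ.Tθ * + X) *_) (Bθ.periods k)) (*-zeroʳ (- (Bφ.Tθ * + X))))) (trans (sN-* y (Bφ.Tθ * + y) (λ b → θ b * + b)) (cong (Bφ.Tθ * + y *_) (Bθ.moments k)))) (+-identityˡ (Bφ.Tθ * + y * (+ k * Bθ.Tθ)))))))))
      where
      re : ∀ D t s T X y b → D * (t * s) ≡ t * (D * s + T * (X - y * b)) + (- (T * X) * t + T * y * (t * b))
      re = solve-∀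
      each : ∀ b → b < y → + D * (θ b * Bφ.s b (X ∸ y) (X ∸ y *ᴺ b)) ≡ θ b * Bφ.e b (X ∸ y) (X ∸ y *ᴺ b) + (- (Bφ.Tθ * + X) * θ b + Bφ.Tθ * + y * (θ b * + b))
      each b h = trans (re (+ D) (θ b) (Bφ.s b (X ∸ y) (X ∸ y *ᴺ b)) Bφ.Tθ (+ X) (+ y) (+ b)) (cong (λ z → θ b * (+ D * Bφ.s b (X ∸ y) (X ∸ y *ᴺ b) + Bφ.Tθ * z) + (- (Bφ.Tθ * + X) * θ b + Bφ.Tθ * + y * (θ b * + b))) (trans (cong (λ z → + X - z) (sym (ℤP.pos-* y b))) (pos-∸ (ℕP.*-monoʳ-≤ y (<⇒≤ h)))))

  abstract
    -- Two error sums of size at most 2D³y² each, and the surviving main term of size at most D³y².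
    upper : abs (+ D * Fsum) ≤ 5 *ᴺ D³ *ᴺ X
    upper = ≤-trans (≤-reflexive (cong abs (trans (cong (+ D *_) Fsplit) (trans (ℤP.*-distribˡ-+ (+ D) F1 F2) (cong₂ _+_ DF1 DF2)))))
      (≤-trans (ℤP.∣i+j∣≤∣i∣+∣j∣ A (C + G)) (≤-trans (ℕP.+-mono-≤ bA (≤-trans (ℤP.∣i+j∣≤∣i∣+∣j∣ C G) (ℕP.+-mono-≤ bC bG))) (≤-reflexive (re D³ y))))
      where
      A C G : ℤ
      A = sN y (λ a → φ a * Bθ.e a X X)
      C = sN y (λ b → θ b * Bφ.e b (X ∸ y) (X ∸ y *ᴺ b))
      G = Bφ.Tθ * + y * (+ k * Bθ.Tθ)
      bA : abs A ≤ y *ᴺ (2 *ᴺ D³ *ᴺ y)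
      bA = weighted Zφ Zθ X (λ _ → X) (λ { (suc a) _ _ → ℕP.m≤m*n X (suc a) })
      bC : abs C ≤ y *ᴺ (2 *ᴺ D³ *ᴺ y)
      bC = weighted Zθ Zφ (X ∸ y) (λ b → X ∸ y *ᴺ b) (λ { (suc b) _ _ → ≤-trans (ℕP.∸-monoˡ-≤ (y *ᴺ suc b) (ℕP.m≤m*n X (suc b))) (≤-reflexive (sym (ℕP.*-distribʳ-∸ (suc b) X y))) })
      bG : abs G ≤ y *ᴺ (D³ *ᴺ y)
      bG = ≤-trans (abs-≤ {Bφ.Tθ * + y} {+ k * Bθ.Tθ} (abs-≤ {Bφ.Tθ} {+ y} Bφ.T≤ ≤-refl) (abs-≤ {+ k} {Bθ.Tθ} ≤-refl Bθ.T≤)) (≤-reflexive (re2 D k))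
        where
        re2 : ∀ D k → (D *ᴺ D *ᴺ (k *ᴺ D)) *ᴺ (k *ᴺ (D *ᴺ D)) ≡ k *ᴺ D *ᴺ (D *ᴺ (D *ᴺ D) *ᴺ (k *ᴺ D))
        re2 = ℕR.solve-∀
      re : ∀ d y → y *ᴺ (2 *ᴺ d *ᴺ y) +ᴺ (y *ᴺ (2 *ᴺ d *ᴺ y) +ᴺ y *ᴺ (d *ᴺ y)) ≡ 5 *ᴺ d *ᴺ (y *ᴺ y)
      re = ℕR.solve-∀

-- Divisor sums of a real character.

ind : ℕ → ℕ → ℤ
ind b n = BZ (does (b ℕD.∣? n))

ind-1 : ∀ {b n} → b ℕD.∣ n → ind b n ≡ + 1
ind-1 {b} {n} d = cong BZ (dec-true (b ℕD.∣? n) d)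

ind-0 : ∀ {b n} → ¬ (b ℕD.∣ n) → ind b n ≡ + 0
ind-0 {b} {n} d = cong BZ (dec-false (b ℕD.∣? n) d)

ind-⇔ : ∀ {a b c d} → (a ℕD.∣ b → c ℕD.∣ d) → (c ℕD.∣ d → a ℕD.∣ b) → ind a b ≡ ind c d
ind-⇔ {a} {b} f g = case a ℕD.∣? b of λ where
  (yes h) → trans (ind-1 h) (sym (ind-1 (f h)))
  (no h) → trans (ind-0 h) (sym (ind-0 (λ z → h (g z))))

sN-single : ∀ n k f → k < n → (∀ i → i < n → i ≢ k → f i ≡ + 0) → sN n f ≡ f k
sN-single (suc n) zero f _ z = +z (sN-0 n (λ i h → z (suc i) (s≤s h) (λ ())))
sN-single (suc n) (suc k) f (s≤s h) z = trans (z+ (z 0 (s≤s z≤n) (λ ()))) (sN-single n k (f ∘ suc) h (λ i g ne → z (suc i) (s≤s g) (λ q → ne (ℕP.suc-injective q))))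

sN-blocks : ∀ N c g → sN (N *ᴺ c) g ≡ sN N (λ a → sN c (λ r → g (a *ᴺ c +ᴺ r)))
sN-blocks zero c g = refl
sN-blocks (suc N) c g = trans (sN-split c (N *ᴺ c) g) (+ˡ (sN c g) (trans (sN-blocks N c (λ i → g (c +ᴺ i))) (sN-cong N (λ a _ → sN-cong c (λ r _ → cong g (sym (ℕP.+-assoc c (a *ᴺ c) r)))))))

-- Cut the range into blocks of length `c`: each holds exactly one multiple of `c`, and beyond `N`
-- the function vanishes.
multiples : ∀ N c (f : ℕ → ℤ) → 0 < c → (∀ n → N ≤ n → f n ≡ + 0) → sN N (λ a → f (c *ᴺ a)) ≡ sN N (λ n → ind c n * f n)
multiples N c@(suc c′) f _ z = trans (sN-cong N (λ a _ → block a)) (trans (sym (sN-blocks N c (λ n → ind c n * f n))) (sN-trunc (λ n → ind c n * f n) (ℕP.m≤m*n N c) (λ n h → trans (cong (ind c n *_) (z n h)) (*-zeroʳ (ind c n)))))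
  where
  block : ∀ a → f (c *ᴺ a) ≡ sN c (λ r → ind c (a *ᴺ c +ᴺ r) * f (a *ᴺ c +ᴺ r))
  block a = sym (trans (sN-single c 0 (λ r → ind c (a *ᴺ c +ᴺ r) * f (a *ᴺ c +ᴺ r)) (s≤s z≤n) (λ r h ne → trans (cong (_* f (a *ᴺ c +ᴺ r)) (ind-0 (λ d → ne (nodiv r h (ℕD.∣m+n∣m⇒∣n d (ℕD.divides a refl)))))) (*-zeroˡ (f (a *ᴺ c +ᴺ r)))))
    (trans (cong₂ _*_ (ind-1 (ℕD.divides a (ℕP.+-identityʳ (a *ᴺ c)))) (cong f (trans (ℕP.+-identityʳ (a *ᴺ c)) (ℕP.*-comm a c)))) (*-identityˡ (f (c *ᴺ a)))))
    where
    nodiv : ∀ r → r < c → c ℕD.∣ r → r ≡ 0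
    nodiv zero _ _ = refl
    nodiv (suc r) h d = ⊥-elim (ℕP.≤⇒≯ (ℕD.∣⇒≤ d) h)

Trit : ℤ → Set
Trit x = x ≡ + 0 ⊎ x ≡ + 1 ⊎ x ≡ - (+ 1)

trit : ∀ x → abs x ≤ 1 → Trit x
trit (+ 0) _ = inj₁ refl
trit (+ 1) _ = inj₂ (inj₁ refl)
trit (+ suc (suc n)) (s≤s ())
trit (-[1+ 0 ]) _ = inj₂ (inj₂ refl)
trit (-[1+ suc n ]) (s≤s ())

record Mul (f : ℕ → ℤ) : Set where
  field
    mul : ∀ m n → f (m *ᴺ n) ≡ f m * f n
    f1  : f 1 ≡ + 1

prime-coprime : ∀ {q b} → Prime q → ¬ (q ℕD.∣ b) → ℕC.Coprime b q
prime-coprime pr nb (d , d′) = case Data.Nat.Primality.prime⇒irreducible pr d′ of λ where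
  (inj₁ z) → z
  (inj₂ refl) → ⊥-elim (nb d)

Factor : ℕ → ℕ → Set
Factor q n = Σ ℕ λ e → Σ ℕ λ m → n ≡ q ^ᴺ e *ᴺ m × ¬ (q ℕD.∣ m) × val q (+ n) ≡ e

factor-out : ∀ {q} → Prime q → ∀ n → 0 < n → Factor q n
factor-out {q} pr n n0 = val q (+ n) , abs (unit q (+ n)) , trans (cong abs (val-spec pr (pos≢0 n0))) (abs-* (pk q (val q (+ n))) (unit q (+ n))) , (λ d → unit-∤ pr (pos≢0 n0) (∣ᵤ⇒∣ d)) , refl

module Divisors {D χ} (C : Chr D χ) (Mχ : Mul χ) where
  open Chr C
  open Mul Mχ

  -- For 0 < n < N this is r(n), the sum of χ over the divisors of n. The range of b does not depend
  -- on n, so that sums over b and n can be exchanged.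
  R : ℕ → ℕ → ℤ
  R N n = sN N (λ b → χ b * ind b n)

  χ-pow : ∀ q e → χ (q ^ᴺ e) ≡ pow (χ q) e
  χ-pow q zero = f1
  χ-pow q (suc e) = trans (mul q (q ^ᴺ e)) (cong (χ q *_) (χ-pow q e))

  -- The local factor of r at qᵉ, with x = χ(q).
  G : ℤ → ℕ → ℤ
  G x zero = + 1
  G x (suc e) = G x e + pow x (suc e)

  q^>0 : ∀ {q} → Prime q → ∀ e → 0 < q ^ᴺ e
  q^>0 pr e = ≤-<-trans z≤n (k<pk pr e)

  abstract
    -- The divisors of qᵉ⁺¹m that do not divide qᵉm are the multiples of qᵉ⁺¹ among them, and their
    -- cofactors are the divisors of m.
    R-step : ∀ {q} → Prime q → ∀ m e N → ¬ (q ℕD.∣ m) → 0 < m → q ^ᴺ suc e *ᴺ m < N → R N (q ^ᴺ suc e *ᴺ m) ≡ R N (q ^ᴺ e *ᴺ m) + pow (χ q) (suc e) * R N m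
    R-step {q} pr m e N nm m0 lt = trans (sN-cong N (λ b _ → trans (cong (χ b *_) (pt b)) (re (χ b) (ind b (q ^ᴺ e *ᴺ m)) (ind c b) (ind b n))))
        (trans (sN-+ N (λ b → χ b * ind b (q ^ᴺ e *ᴺ m)) (λ b → ind c b * (χ b * ind b n))) (+ˡ (R N (q ^ᴺ e *ᴺ m)) (trans (sym (multiples N c (λ b → χ b * ind b n) c0 (λ b h → trans (cong (χ b *_) (ind-0 (λ d → <⇒≱ (<-≤-trans lt h) (ℕD.∣⇒≤ {{ℕ.>-nonZero n0}} d)))) (*-zeroʳ (χ b)))))
          (trans (sN-cong N (λ b _ → trans (cong₂ _*_ (trans (mul c b) (cong (_* χ b) (χ-pow q (suc e)))) (ind-⇔ {c *ᴺ b} {c *ᴺ m} {b} {m} (ℕD.*-cancelˡ-∣ c {{ℕ.>-nonZero c0}}) (ℕD.*-monoʳ-∣ c))) (*-assoc (pow (χ q) (suc e)) (χ b) (ind b m)))) (sN-* N (pow (χ q) (suc e)) (λ b → χ b * ind b m))))))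
      where
      c n : ℕ
      c = q ^ᴺ suc e
      n = c *ᴺ m
      c0 : 0 < c
      c0 = q^>0 pr (suc e)
      n0 : 0 < n
      n0 = *-mono-≤ c0 m0
      re : ∀ x i j k → x * (i + j * k) ≡ x * i + j * (x * k)
      re = solve-∀
      q0 : ℕ.NonZero q
      q0 = prime-nz pr
      caseA : ∀ b → c ℕD.∣ b → ¬ (b ℕD.∣ q ^ᴺ e *ᴺ m)
      caseA b cb d = nm (ℕD.*-cancelˡ-∣ (q ^ᴺ e) {{ℕ.>-nonZero (q^>0 pr e)}} (subst (ℕD._∣ q ^ᴺ e *ᴺ m) (ℕP.*-comm q (q ^ᴺ e)) (ℕD.∣-trans cb d)))
      caseB : ∀ e b → ¬ (q ^ᴺ suc e ℕD.∣ b) → b ℕD.∣ q ^ᴺ suc e *ᴺ m → b ℕD.∣ q ^ᴺ e *ᴺ m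
      caseB e b nc d = go (q ℕD.∣? b)
        where
        assoc : q ^ᴺ suc e *ᴺ m ≡ q *ᴺ (q ^ᴺ e *ᴺ m)
        assoc = ℕP.*-assoc q (q ^ᴺ e) m
        go : Dec (q ℕD.∣ b) → b ℕD.∣ q ^ᴺ e *ᴺ m
        go (no nq) = ℕC.coprime-divisor (prime-coprime pr nq) (subst (b ℕD.∣_) assoc d)
        go (yes (ℕD.divides b₁ refl)) = go′ e nc (ℕD.*-cancelˡ-∣ q {{q0}} (subst₂ ℕD._∣_ (ℕP.*-comm b₁ q) assoc d))
          where
          go′ : ∀ e → ¬ (q ^ᴺ suc e ℕD.∣ b₁ *ᴺ q) → b₁ ℕD.∣ q ^ᴺ e *ᴺ m → b₁ *ᴺ q ℕD.∣ q ^ᴺ e *ᴺ m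
          go′ zero nc _ = ⊥-elim (nc (ℕD.divides b₁ (cong (b₁ *ᴺ_) (sym (ℕP.*-identityʳ q)))))
          go′ (suc e) nc d₁ = subst₂ ℕD._∣_ (ℕP.*-comm q b₁) (sym (ℕP.*-assoc q (q ^ᴺ e) m)) (ℕD.*-monoʳ-∣ q (caseB e b₁ (λ z → nc (subst (q ^ᴺ suc (suc e) ℕD.∣_) (ℕP.*-comm q b₁) (ℕD.*-monoʳ-∣ q z))) d₁))
      pt : ∀ b → ind b n ≡ ind b (q ^ᴺ e *ᴺ m) + ind c b * ind b n
      pt b = case c ℕD.∣? b of λ where
        (yes cb) → sym (trans (cong₂ (λ u v → u + v * ind b n) (ind-0 (caseA b cb)) (ind-1 cb)) (trans (+-identityˡ (+ 1 * ind b n)) (*-identityˡ (ind b n))))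
        (no cb) → trans (ind-⇔ (caseB e b cb) (λ d → ℕD.∣-trans d (ℕD.divides q (ℕP.*-assoc q (q ^ᴺ e) m)))) (sym (+z (trans (cong (_* ind b n) (ind-0 cb)) (*-zeroˡ (ind b n)))))

    R-mult : ∀ {q} → Prime q → ∀ m e N → ¬ (q ℕD.∣ m) → 0 < m → q ^ᴺ e *ᴺ m < N → R N (q ^ᴺ e *ᴺ m) ≡ G (χ q) e * R N m
    R-mult pr m zero N nm m0 lt = trans (cong (R N) (ℕP.*-identityˡ m)) (sym (*-identityˡ (R N m)))
    R-mult {q} pr m (suc e) N nm m0 lt = trans (R-step pr m e N nm m0 lt) (trans (cong (_+ pow (χ q) (suc e) * R N m) (R-mult pr m e N nm m0 (≤-<-trans (ℕP.*-monoˡ-≤ m (ℕP.m≤n*m (q ^ᴺ e) q {{prime-nz pr}})) lt))) (sym (ℤP.*-distribʳ-+ (R N m) (G (χ q) e) (pow (χ q) (suc e)))))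

    R-one : ∀ N → 1 < N → R N 1 ≡ + 1
    R-one N lt = trans (sN-single N 1 (λ b → χ b * ind b 1) lt (λ b _ ne → trans (cong (χ b *_) (ind-0 (λ d → ne (ℕD.∣1⇒≡1 d)))) (*-zeroʳ (χ b)))) (cong₂ _*_ f1 (ind-1 {1} {1} ℕD.∣-refl))

  G-1 : ∀ e → G (+ 1) e ≡ + suc e
  G-1 zero = refl
  G-1 (suc e) = trans (cong₂ _+_ (G-1 e) (trans (*-identityˡ (pow (+ 1) e)) (p1 e))) (trans (sym (pos-+ (suc e) 1)) (cong +_ (ℕP.+-comm (suc e) 1)))
    where
    p1 : ∀ e → pow (+ 1) e ≡ + 1
    p1 zero = refl
    p1 (suc e) = trans (*-identityˡ (pow (+ 1) e)) (p1 e)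

  G-0 : ∀ e → G (+ 0) e ≡ + 1
  G-0 zero = refl
  G-0 (suc e) = trans (+z (*-zeroˡ (pow (+ 0) e))) (G-0 e)

  G-neg : ∀ e → G (- (+ 1)) e ≡ BZ (not (par e))
  G-neg zero = refl
  G-neg (suc e) = trans (cong₂ _+_ (G-neg e) (pn (suc e))) (go (par e))
    where
    pn : ∀ e → pow (- (+ 1)) e ≡ sgn (par e)
    pn zero = refl
    pn (suc e) = trans (cong (- (+ 1) *_) (pn e)) (ng (par e))
      where
      ng : ∀ b → - (+ 1) * sgn b ≡ sgn (not b)
      ng false = refl
      ng true = refl
    go : ∀ b → BZ (not b) + sgn (not b) ≡ BZ (not (not b))
    go false = refl
    go true = refl

  G≥0 : ∀ {x} e → Trit x → + 0 ≤ℤ G x e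
  G≥0 e (inj₁ refl) = subst (+ 0 ≤ℤ_) (sym (G-0 e)) (ℤ.+≤+ z≤n)
  G≥0 e (inj₂ (inj₁ refl)) = subst (+ 0 ≤ℤ_) (sym (G-1 e)) (ℤ.+≤+ z≤n)
  G≥0 e (inj₂ (inj₂ refl)) = subst (+ 0 ≤ℤ_) (sym (G-neg e)) (go (not (par e)))
    where
    go : ∀ b → + 0 ≤ℤ BZ b
    go false = ℤ.+≤+ z≤n
    go true = ℤ.+≤+ z≤n

  G≥1 : ∀ {x} e → Trit x → par e ≡ false → + 1 ≤ℤ G x e
  G≥1 e (inj₁ refl) _ = subst (+ 1 ≤ℤ_) (sym (G-0 e)) ℤP.≤-refl
  G≥1 e (inj₂ (inj₁ refl)) _ = subst (+ 1 ≤ℤ_) (sym (G-1 e)) (ℤ.+≤+ (s≤s z≤n))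
  G≥1 e (inj₂ (inj₂ refl)) q = subst (+ 1 ≤ℤ_) (sym (trans (G-neg e) (cong (λ b → BZ (not b)) q))) ℤP.≤-refl

  *≥0 : ∀ {x y} → + 0 ≤ℤ x → + 0 ≤ℤ y → + 0 ≤ℤ x * y
  *≥0 {+ m} {+ n} _ _ = subst (+ 0 ≤ℤ_) (ℤP.pos-* m n) (ℤ.+≤+ z≤n)

  *≥1 : ∀ {x y} → + 1 ≤ℤ x → + 1 ≤ℤ y → + 1 ≤ℤ x * y
  *≥1 {+ suc m} {+ suc n} _ _ = ℤ.+≤+ (s≤s z≤n)
  *≥1 {+ zero} (ℤ.+≤+ ())
  *≥1 {+ suc m} {+ zero} _ (ℤ.+≤+ ())

  abstract
    -- For χ(q) equal to 0, 1 or -1 the local factor is 1, e + 1, or 1 and 0 according to the parity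
    -- of e; it is never negative.
    R≥0 : ∀ n → Acc _<_ n → 0 < n → ∀ N → n < N → + 0 ≤ℤ R N n
    R≥0 n (acc rs) n0 N lt = go (n ℕ.≟ 1)
      where
      go : Dec (n ≡ 1) → + 0 ≤ℤ R N n
      go (yes refl) = subst (+ 0 ≤ℤ_) (sym (R-one N lt)) (ℤ.+≤+ z≤n)
      go (no ne) = pf (prime-factor n (≤∧≢⇒< n0 (λ q → ne (sym q))))
        where
        pf : (∃ λ q → Prime q × q ℕD.∣ n) → + 0 ≤ℤ R N n
        pf (q , pr , qn) = fo (factor-out pr n n0)
          where
          fo : Factor q n → + 0 ≤ℤ R N n
          fo (zero , m , en , nm , _) = ⊥-elim (nm (subst (q ℕD.∣_) (trans en (ℕP.*-identityˡ m)) qn))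
          fo (suc e , m , en , nm , _) = subst (+ 0 ≤ℤ_) (sym (trans (cong (R N) en) (R-mult pr m (suc e) N nm m0 (subst (_< N) en lt)))) (*≥0 (G≥0 (suc e) (trit (χ q) (f≤1 q))) (R≥0 m (rs m<n) m0 N (<-trans m<n lt)))
            where
            m0 : 0 < m
            m0 = ℕP.n≢0⇒n>0 λ z → nm (subst (q ℕD.∣_) (sym z) (q ℕD.∣0))
            m<n : m < n
            m<n = subst (m <_) (trans (ℕP.*-comm m (q ^ᴺ suc e)) (sym en)) (m<m*n m (q ^ᴺ suc e) {{ℕ.>-nonZero m0}} (≤-<-trans (s≤s z≤n) (k<pk pr (suc e))))

    -- In a square all exponents are even, so the factor at a prime with χ(q) = -1 is 1 and not 0.
    R-sq≥1 : ∀ m → Acc _<_ m → 0 < m → ∀ N → m *ᴺ m < N → + 1 ≤ℤ R N (m *ᴺ m)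
    R-sq≥1 n (acc rs) n0 N lt = go (n ℕ.≟ 1)
      where
      go : Dec (n ≡ 1) → + 1 ≤ℤ R N (n *ᴺ n)
      go (yes refl) = subst (+ 1 ≤ℤ_) (sym (R-one N lt)) ℤP.≤-refl
      go (no ne) = pf (prime-factor n (≤∧≢⇒< n0 (λ q → ne (sym q))))
        where
        pf : (∃ λ q → Prime q × q ℕD.∣ n) → + 1 ≤ℤ R N (n *ᴺ n)
        pf (q , pr , qn) = fo (factor-out pr n n0)
          where
          fo : Factor q n → + 1 ≤ℤ R N (n *ᴺ n)
          fo (zero , m , en , nm , _) = ⊥-elim (nm (subst (q ℕD.∣_) (trans en (ℕP.*-identityˡ m)) qn))
          fo (suc e , m , en , nm , _) = subst (+ 1 ≤ℤ_) (sym (trans (cong (R N) nn) (R-mult pr (m *ᴺ m) (suc e +ᴺ suc e) N nmm (*-mono-≤ m0 m0) (subst (_< N) nn lt)))) (*≥1 (G≥1 (suc e +ᴺ suc e) (trit (χ q) (f≤1 q)) (par-double (suc e))) (R-sq≥1 m (rs m<n) m0 N (≤-<-trans (*-mono-≤ (<⇒≤ m<n) (<⇒≤ m<n)) lt)))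
            where
            m0 : 0 < m
            m0 = ℕP.n≢0⇒n>0 λ z → nm (subst (q ℕD.∣_) (sym z) (q ℕD.∣0))
            m<n : m < n
            m<n = subst (m <_) (trans (ℕP.*-comm m (q ^ᴺ suc e)) (sym en)) (m<m*n m (q ^ᴺ suc e) {{ℕ.>-nonZero m0}} (≤-<-trans (s≤s z≤n) (k<pk pr (suc e))))
            nmm : ¬ (q ℕD.∣ m *ᴺ m)
            nmm d = case euclidsLemma m m pr d of λ where
              (inj₁ z) → nm z
              (inj₂ z) → nm z
            re : ∀ a m → a *ᴺ m *ᴺ (a *ᴺ m) ≡ a *ᴺ a *ᴺ (m *ᴺ m)
            re = ℕR.solve-∀
            nn : n *ᴺ n ≡ q ^ᴺ (suc e +ᴺ suc e) *ᴺ (m *ᴺ m)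
            nn = trans (cong₂ _*ᴺ_ en en) (trans (re (q ^ᴺ suc e) m) (cong (_*ᴺ (m *ᴺ m)) (sym (ℕP.^-distribˡ-+-* q (suc e) (suc e)))))

    -- An odd exponent at a prime with χ(q) = -1 would make the local factor 0.
    R-good : ∀ n → 0 < n → ∀ N → n < N → R N n ≢ + 0 → ∀ {q} → Prime q → χ q ≡ - (+ 1) → vp q (+ n) ≡ false
    R-good n n0 N lt nz {q} pr χq = fo (factor-out pr n n0)
      where
      fo : Factor q n → vp q (+ n) ≡ false
      fo (e , m , en , nm , ev) = go (par e) refl
        where
        m0 : 0 < m
        m0 = ℕP.n≢0⇒n>0 λ z → nm (subst (q ℕD.∣_) (sym z) (q ℕD.∣0))
        go : ∀ b → par e ≡ b → vp q (+ n) ≡ false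
        go false q′ = trans (cong par ev) q′
        go true q′ = ⊥-elim (nz (trans (cong (R N) en) (trans (R-mult pr m e N nm m0 (subst (_< N) en lt)) (trans (cong (_* R N m) (trans (cong (λ x → G x e) χq) (trans (G-neg e) (cong (λ b → BZ (not b)) q′)))) (*-zeroˡ (R N m))))))

-- Existence of norm values with a prescribed character.

sN-mono : ∀ m n f → m ≤ n → (∀ i → i < n → + 0 ≤ℤ f i) → sN m f ≤ℤ sN n f
sN-mono zero zero f _ _ = ℤP.≤-refl
sN-mono zero (suc n) f _ p = subst (_≤ℤ f 0 + sN n (f ∘ suc)) refl (ℤP.+-mono-≤ (p 0 (s≤s z≤n)) (sN-mono 0 n (f ∘ suc) z≤n (λ i h → p (suc i) (s≤s h))))
sN-mono (suc m) (suc n) f (s≤s h) p = ℤP.+-mono-≤ (ℤP.≤-refl {f 0}) (sN-mono m n (f ∘ suc) h (λ i g → p (suc i) (s≤s g)))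

-- The indices `s j` increase, so their terms can be picked out of a sum of nonnegative terms
-- without repetition.
sub-sum : ∀ K N (s : ℕ → ℕ) f c → (∀ j → s j < s (suc j)) → (∀ j → j < K → s j < N) → (∀ i → i < N → + 0 ≤ℤ f i) → (∀ j → j < K → c ≤ℤ f (s j)) → + K * c ≤ℤ sN N f
sub-sum zero N s f c mo lt p b = subst (_≤ℤ sN N f) (sym (*-zeroˡ c)) (sN-mono 0 N f z≤n p)
sub-sum (suc K) N s f c mo lt p b = subst (_≤ℤ sN N f) (re (+ K) c) (ℤP.≤-trans (ℤP.+-mono-≤ (sub-sum K (s K) s f c mo (λ j h → inc j K h) (λ i h → p i (<-trans h sK)) (λ j h → b j (m<n⇒m<1+n h))) (b K ≤-refl))
    (ℤP.≤-trans (ℤP.≤-reflexive (sym (sN-last (s K) f))) (sN-mono (suc (s K)) N f sK p)))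
  where
  sK : s K < N
  sK = lt K ≤-refl
  inc : ∀ j k → j < k → s j < s k
  inc j (suc k) (s≤s h) = case ℕP.m≤n⇒m<n∨m≡n h of λ where
    (inj₁ g) → <-trans (inc j k g) (mo k)
    (inj₂ refl) → mo j
  re : ∀ K c → K * c + c ≡ (+ 1 + K) * c
  re = solve-∀

module GenusLemma {D χ ψ} (D>0 : 0 < D) (Cχ : Chr D χ) (Mχ : Mul χ) (Mψ : Mul ψ) (Zψ : ZeroSum D ψ) (Zχψ : ZeroSum D (λ n → χ n * ψ n)) where
  private
    -- The squares m² with m = 1 + jD and j < K satisfy m ≤ DK, while X = 4(DK)²; so `D` times the
    -- sum is at least 3DK·(DK)². This beats the upper bound 20D³·(DK)² once 3K > 20D², for which
    -- 7D² + 1 suffices.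
    K : ℕ
    K = 7 *ᴺ (D *ᴺ D) +ᴺ 1
    module Hy = Hyperbola Zψ Zχψ D>0 (2 *ᴺ K)
    module Dv = Divisors Cχ Mχ
    open Hy using (X; y)
    open ZeroSum Zψ using () renaming (f≤1 to ψ≤1; per to ψper; f0 to ψ0)
    open Chr Cχ using () renaming (f0 to χ0)

    g : ℕ → ℤ
    g n = ψ n * + (X ∸ n)

    -- With θ = χψ the pair (a, b) contributes ψ(ab)χ(b), so collecting n = ab leaves ψ(n)(X -
    -- n)r(n).
    regroup : Hy.Fsum ≡ sN X (λ n → g n * Dv.R X n)
    regroup = trans (sN-swap X X (λ a b → ψ a * (χ b * ψ b) * + (X ∸ a *ᴺ b))) (trans (sN-cong X (λ b _ → trans (sN-cong X (λ a _ → trans (re (ψ a) (χ b) (ψ b) (+ (X ∸ a *ᴺ b))) (cong₂ (λ u v → χ b * (u * + (X ∸ v))) (sym (Mul.mul Mψ b a)) (ℕP.*-comm a b)))) (trans (sN-* X (χ b) (λ a → g (b *ᴺ a))) (inner b))))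
      (trans (sN-swap X X (λ b n → χ b * (ind b n * g n))) (sN-cong X (λ n _ → trans (sN-cong X (λ b _ → re2 (χ b) (ind b n) (g n))) (sN-* X (g n) (λ b → χ b * ind b n))))))
      where
      re : ∀ a c b z → a * (c * b) * z ≡ c * (b * a * z)
      re = solve-∀
      re2 : ∀ c i g → c * (i * g) ≡ g * (c * i)
      re2 = solve-∀
      inner : ∀ b → χ b * sN X (λ a → g (b *ᴺ a)) ≡ sN X (λ n → χ b * (ind b n * g n))
      inner zero = trans (trans (cong (_* sN X (λ a → g 0)) χ0) (*-zeroˡ (sN X (λ a → g 0)))) (sym (sN-0 X (λ n _ → trans (cong (_* (ind 0 n * g n)) χ0) (*-zeroˡ (ind 0 n * g n)))))
      inner (suc b) = trans (cong (χ (suc b) *_) (multiples X (suc b) g (s≤s z≤n) (λ n h → trans (cong (λ z → ψ n * + z) (ℕP.m≤n⇒m∸n≡0 h)) (*-zeroʳ (ψ n))))) (sym (sN-* X (χ (suc b)) (λ n → ind (suc b) n * g n)))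

    DK : ℕ
    DK = D *ᴺ K

    m : ℕ → ℕ
    m j = suc (j *ᴺ D)

    m≤ : ∀ j → j < K → m j ≤ DK
    m≤ j h = ≤-trans (ℕP.+-monoˡ-≤ (j *ᴺ D) D>0) (≤-trans (ℕP.*-monoˡ-≤ D h) (≤-reflexive (ℕP.*-comm K D)))

    X≡ : X ≡ 3 *ᴺ (DK *ᴺ DK) +ᴺ DK *ᴺ DK
    X≡ = re K D
      where
      re : ∀ K D → 2 *ᴺ K *ᴺ D *ᴺ (2 *ᴺ K *ᴺ D) ≡ 3 *ᴺ (D *ᴺ K *ᴺ (D *ᴺ K)) +ᴺ D *ᴺ K *ᴺ (D *ᴺ K)
      re = ℕR.solve-∀

    DK>0 : 0 < DK *ᴺ DK
    DK>0 = *-mono-≤ dk dk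
      where
      dk : 0 < DK
      dk = *-mono-≤ D>0 (m≤n+m 1 (7 *ᴺ (D *ᴺ D)))

    msq<X : ∀ j → j < K → m j *ᴺ m j < X
    msq<X j h = ≤-<-trans (*-mono-≤ (m≤ j h) (m≤ j h)) (subst (DK *ᴺ DK <_) (sym X≡) (ℕP.m<n+m (DK *ᴺ DK) (*-mono-≤ {1} {3} (s≤s z≤n) DK>0)))

    rest : ∀ j → j < K → 3 *ᴺ (DK *ᴺ DK) ≤ X ∸ m j *ᴺ m j
    rest j h = ≤-trans (≤-reflexive (sym (trans (cong (_∸ DK *ᴺ DK) X≡) (ℕP.m+n∸n≡m (3 *ᴺ (DK *ᴺ DK)) (DK *ᴺ DK))))) (ℕP.∸-monoʳ-≤ X (*-mono-≤ (m≤ j h) (m≤ j h)))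

    ψm : ∀ j → ψ (m j) ≡ + 1
    ψm zero = Mul.f1 Mψ
    ψm (suc j) = trans (cong ψ (sym (ℕP.+-suc D (j *ᴺ D)))) (trans (ψper (m j)) (ψm j))

    Good : ℕ → Set
    Good n = ψ n ≡ - (+ 1) × Dv.R X n ≢ + 0

    good? : ∀ n → Dec (Good n)
    good? n = (ψ n ℤ.≟ - (+ 1)) ×-dec ¬? (Dv.R X n ℤ.≟ + 0)

    -- Without such an n every term is nonnegative, and the squares of numbers congruent to 1 modulo
    -- `D` alone exceed the hyperbola bound.
    contra : (∀ n → n < X → ¬ Good n) → ⊥
    contra none = <⇒≱ final (ℤP.drop‿+≤+ chain)
      where
      t : ℕ → ℤ
      t n = g n * Dv.R X n
      R0 : ∀ n → 0 < n → n < X → + 0 ≤ℤ Dv.R X n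
      R0 n h lt = Dv.R≥0 n (ℕI.<-wellFounded n) h X lt
      t≥0 : ∀ n → n < X → + 0 ≤ℤ t n
      t≥0 zero lt = ℤP.≤-reflexive (sym (trans (cong (λ z → z * + (X ∸ 0) * Dv.R X 0) ψ0) (trans (cong (_* Dv.R X 0) (*-zeroˡ (+ (X ∸ 0)))) (*-zeroˡ (Dv.R X 0)))))
      t≥0 n@(suc n′) lt = tr (trit (ψ n) (ψ≤1 n))
        where
        tr : Trit (ψ n) → + 0 ≤ℤ t n
        tr (inj₁ e) = ℤP.≤-reflexive (sym (trans (cong (λ z → z * + (X ∸ n) * Dv.R X n) e) (trans (cong (_* Dv.R X n) (*-zeroˡ (+ (X ∸ n)))) (*-zeroˡ (Dv.R X n)))))
        tr (inj₂ (inj₁ e)) = Dv.*≥0 (subst (+ 0 ≤ℤ_) (sym (trans (cong (_* + (X ∸ n)) e) (*-identityˡ (+ (X ∸ n))))) (ℤ.+≤+ z≤n)) (R0 n (s≤s z≤n) lt)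
        tr (inj₂ (inj₂ e)) = case Dv.R X n ℤ.≟ + 0 of λ where
          (yes z) → ℤP.≤-reflexive (sym (trans (cong (g n *_) z) (*-zeroʳ (g n))))
          (no nz) → ⊥-elim (none n lt (e , nz))
      c : ℤ
      c = + (3 *ᴺ (DK *ᴺ DK))
      tb : ∀ j → j < K → c ≤ℤ t (m j *ᴺ m j)
      tb j h = ℤP.≤-trans (ℤ.+≤+ (rest j h)) (ℤP.≤-trans (ℤP.≤-reflexive (trans (sym (*-identityʳ (+ (X ∸ m j *ᴺ m j)))) (cong (_* + 1) (sym (trans (cong (_* + (X ∸ m j *ᴺ m j)) (trans (Mul.mul Mψ (m j) (m j)) (cong₂ _*_ (ψm j) (ψm j)))) (*-identityˡ (+ (X ∸ m j *ᴺ m j))))))))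
        (mono≤ (g (m j *ᴺ m j)) gnn (Dv.R-sq≥1 (m j) (ℕI.<-wellFounded (m j)) (s≤s z≤n) X (msq<X j h))))
        where
        gnn : + 0 ≤ℤ g (m j *ᴺ m j)
        gnn = subst (+ 0 ≤ℤ_) (sym (trans (cong (_* + (X ∸ m j *ᴺ m j)) (trans (Mul.mul Mψ (m j) (m j)) (cong₂ _*_ (ψm j) (ψm j)))) (*-identityˡ (+ (X ∸ m j *ᴺ m j))))) (ℤ.+≤+ z≤n)
        mono≤ : ∀ a → + 0 ≤ℤ a → ∀ {x y} → x ≤ℤ y → a * x ≤ℤ a * y
        mono≤ (+ a) _ h = ℤP.*-monoˡ-≤-nonNeg (+ a) h
      lower : + K * c ≤ℤ Hy.Fsum
      lower = subst (+ K * c ≤ℤ_) (sym regroup) (sub-sum K X (λ j → m j *ᴺ m j) t c (λ j → ℕP.*-mono-< (inc j) (inc j)) msq<X t≥0 tb)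
        where
        inc : ∀ j → m j < m (suc j)
        inc j = s≤s (ℕP.m<n+m (j *ᴺ D) D>0)
      chain : + (D *ᴺ (K *ᴺ (3 *ᴺ (DK *ᴺ DK)))) ≤ℤ + (5 *ᴺ (D *ᴺ (D *ᴺ D)) *ᴺ X)
      chain = ℤP.≤-trans (ℤP.≤-reflexive (trans (ℤP.pos-* D (K *ᴺ (3 *ᴺ (DK *ᴺ DK)))) (cong (+ D *_) (ℤP.pos-* K (3 *ᴺ (DK *ᴺ DK)))))) (ℤP.≤-trans (ℤP.*-monoˡ-≤-nonNeg (+ D) lower) (ℤP.≤-trans (le-abs (+ D * Hy.Fsum)) (ℤ.+≤+ Hy.upper)))
        where
        le-abs : ∀ x → x ≤ℤ + abs x
        le-abs (+ n) = ℤP.≤-refl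
        le-abs (-[1+ n ]) = ℤ.-≤+
      final : 5 *ᴺ (D *ᴺ (D *ᴺ D)) *ᴺ X < D *ᴺ (K *ᴺ (3 *ᴺ (DK *ᴺ DK)))
      final = subst₂ _<_ (sym (trans (cong (5 *ᴺ (D *ᴺ (D *ᴺ D)) *ᴺ_) X≡) (r1 D (DK *ᴺ DK)))) (sym (r2 D (DK *ᴺ DK))) (ℕP.m<m+n (20 *ᴺ (D *ᴺ (D *ᴺ D)) *ᴺ (DK *ᴺ DK)) (<-≤-trans (*-mono-≤ D>0 DK>0) (≤-trans (ℕP.m≤n*m (D *ᴺ (DK *ᴺ DK)) 3) (m≤n+m (3 *ᴺ (D *ᴺ (DK *ᴺ DK))) ((D *ᴺ (D *ᴺ D)) *ᴺ (DK *ᴺ DK))))))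
        where
        r1 : ∀ D q → 5 *ᴺ (D *ᴺ (D *ᴺ D)) *ᴺ (3 *ᴺ q +ᴺ q) ≡ 20 *ᴺ (D *ᴺ (D *ᴺ D)) *ᴺ q
        r1 = ℕR.solve-∀
        r2 : ∀ D q → D *ᴺ ((7 *ᴺ (D *ᴺ D) +ᴺ 1) *ᴺ (3 *ᴺ q)) ≡ 20 *ᴺ (D *ᴺ (D *ᴺ D)) *ᴺ q +ᴺ ((D *ᴺ (D *ᴺ D)) *ᴺ q +ᴺ 3 *ᴺ (D *ᴺ q))
        r2 = ℕR.solve-∀

  abstract
    -- The search below `X` is finite and decidable, so the contradiction yields an actual witness;
    -- r(n) ≠ 0 is then read as even valuation at the primes with χ(q) = -1.
    genus-lemma : ∃ λ n → 0 < n × ψ n ≡ - (+ 1) × (∀ {q} → Prime q → χ q ≡ - (+ 1) → vp q (+ n) ≡ false)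
    genus-lemma = go (ℕP.anyUpTo? good? X)
      where
      go : Dec (∃ λ n → n < X × Good n) → ∃ λ n → 0 < n × ψ n ≡ - (+ 1) × (∀ {q} → Prime q → χ q ≡ - (+ 1) → vp q (+ n) ≡ false)
      go (no h) = ⊥-elim (contra (λ n lt gd → h (n , lt , gd)))
      go (yes (zero , lt , e , _)) = case trans (sym ψ0) e of λ ()
      go (yes (n@(suc _) , lt , e , nz)) = n , s≤s z≤n , e , Dv.R-good n (s≤s z≤n) X lt nz

-- Genus characters

record Char (D : ℕ) (f : ℕ → ℤ) : Set where
  field
    bd  : ∀ n → abs (f n) ≤ 1
    prd : ∀ n → f (D +ᴺ n) ≡ f n
    mlt : Mul f

char-* : ∀ {D f g} → Char D f → Char D g → Char D (λ n → f n * g n)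
char-* {D} {f} {g} F G = record
  { bd = λ n → abs-≤ {f n} {g n} (Char.bd F n) (Char.bd G n)
  ; prd = λ n → cong₂ _*_ (Char.prd F n) (Char.prd G n)
  ; mlt = record { mul = λ m n → trans (cong₂ _*_ (Mul.mul (Char.mlt F) m n) (Mul.mul (Char.mlt G) m n)) (re (f m) (f n) (g m) (g n)) ; f1 = cong₂ _*_ (Mul.f1 (Char.mlt F)) (Mul.f1 (Char.mlt G)) } }
  where
  re : ∀ a b c d → a * b * (c * d) ≡ a * c * (b * d)
  re = solve-∀

char-prd : ∀ {D f} → Char D f → ∀ k n → f (k *ᴺ D +ᴺ n) ≡ f n
char-prd F zero n = refl
char-prd {D} {f} F (suc k) n = trans (cong f (ℕP.+-assoc D (k *ᴺ D) n)) (trans (Char.prd F (k *ᴺ D +ᴺ n)) (char-prd F k n))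

char-ext : ∀ {D f} k → Char D f → Char (k *ᴺ D) f
char-ext k F = record { bd = Char.bd F ; prd = char-prd F k ; mlt = Char.mlt F }

char-cong : ∀ {D f} → Char D f → ∀ m n → + D ∣ + m - + n → f m ≡ f n
char-cong {D} {f} F m n d = case ℕP.≤-total n m of λ where
    (inj₁ h) → go m n h d
    (inj₂ h) → sym (go n m h (∣-sym (+ m) (+ n) d))
  where
  go : ∀ m n → n ≤ m → + D ∣ + m - + n → f m ≡ f n
  go m n h d with ∣⇒∣ᵤ (subst (+ D ∣_) (pos-∸ h) d)
  ... | ℕD.divides k e = trans (cong f (trans (sym (m∸n+n≡m h)) (cong (_+ᴺ n) e))) (char-prd F k n)

module Sm = Fold _+_ (+ 0) ℤP.+-assoc ℤP.+-comm

sN-fold : ∀ n f → sN n f ≡ Sm.fold {n} (λ i → f (toℕ i))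
sN-fold zero f = refl
sN-fold (suc n) f = +ˡ (f 0) (sN-fold n (f ∘ suc))

fold-neg : ∀ {n} (f : Fin n → ℤ) → Sm.fold (λ i → - (+ 1) * f i) ≡ - (+ 1) * Sm.fold f
fold-neg {zero} f = refl
fold-neg {suc n} f = trans (+ˡ (- (+ 1) * f zero) (fold-neg (f ∘ suc))) (sym (ℤP.*-distribˡ-+ (- (+ 1)) (f zero) (Sm.fold (f ∘ suc))))

abstract
  -- Multiplication by `r` permutes the residues and negates the values, so the sum equals its own
  -- negative.
  char-zero-sum : ∀ {D f} → 0 < D → Char D f → ∀ r → f r ≡ - (+ 1) → (∀ x → + D ∣ + r * x → + D ∣ x) → sN D f ≡ + 0
  char-zero-sum {D} {f} D0 F r fr cancel = fin (trans (sN-fold D f) (trans (sym (Sm.fold-inj π inj (λ i → f (toℕ i)))) (trans (Sm.fold-cong {D} fπ) (trans (fold-neg {D} (λ i → f (toℕ i))) (cong (- (+ 1) *_) (sym (sN-fold D f)))))))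
    where
    instance
      nz : ℕ.NonZero D
      nz = ℕ.>-nonZero D0
    π : Fin D → Fin D
    π i = rem D (+ r * + toℕ i)
    sp : ∀ i → + D ∣ + r * + toℕ i - + toℕ (π i)
    sp i = rem-spec D (+ r * + toℕ i)
    fπ : ∀ i → f (toℕ (π i)) ≡ - (+ 1) * f (toℕ i)
    fπ i = trans (sym (char-cong F (r *ᴺ toℕ i) (toℕ (π i)) (subst (λ z → + D ∣ z - + toℕ (π i)) (sym (ℤP.pos-* r (toℕ i))) (sp i)))) (trans (Mul.mul (Char.mlt F) r (toℕ i)) (cong (_* f (toℕ i)) fr))
    re : ∀ r a b → r * a - r * b ≡ r * (a - b)
    re = solve-∀
    inj : ∀ {i j} → π i ≡ π j → i ≡ j
    inj {i} {j} q = toℕ-injective (small-≡ (toℕ<n i) (toℕ<n j) (cancel (+ toℕ i - + toℕ j) (subst (+ D ∣_) (re (+ r) (+ toℕ i) (+ toℕ j)) (rem-≡ D (+ r * + toℕ i) (+ r * + toℕ j) q))))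
    fin : ∀ {x} → x ≡ - (+ 1) * x → x ≡ + 0
    fin {x} e = *-cancelˡ {+ 2} {x} {+ 0} (λ ()) (trans (re2 x) (trans (+ˡ x e) (re3 x)))
      where
      re2 : ∀ x → + 2 * x ≡ x + x
      re2 = solve-∀
      re3 : ∀ x → x + - (+ 1) * x ≡ + 2 * + 0
      re3 = solve-∀

Decr : List ℕ → Set
Decr []      = ⊤
Decr (p ∷ l) = All (λ q → q < p) l × Decr l

module Genera (d : ℕ) (d>0 : 0 < d) where
  -d : ℤ
  -d = - + d

  -d≢0 : -d ≢ + 0
  -d≢0 q = pos≢0 d>0 (trans (sym (neg-involutive (+ d))) (cong -_ q))

  Hd : ℕ → ℕ → Bool
  Hd p n = H p (+ n) -d

  -- The odd primes that ramify in ℚ(√-d).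
  InR : ℕ → Set
  InR p = OddPrime p × vp p -d ≡ true

  pcD : (ℕ → Bool) → ∀ p n → Dec (+ p ∣ + n) → ℤ
  pcD J p n (yes _) = + 0
  pcD J p n (no _) = sgn (J p ∧ Hd p n)

  -- The genus character at `p`, switched on by `J`. It vanishes at multiples of `p` even when
  -- switched off, so that all the products `chi l J` share one modulus and one support.
  pc : (ℕ → Bool) → ℕ → ℕ → ℤ
  pc J p n = pcD J p n (+ p ∣? + n)

  pc-yes : ∀ J {p n} → + p ∣ + n → pc J p n ≡ + 0
  pc-yes J {p} {n} h = go (+ p ∣? + n)
    where
    go : ∀ x → pcD J p n x ≡ + 0
    go (yes _) = refl
    go (no g) = ⊥-elim (g h)

  pc-no : ∀ J {p n} → ¬ (+ p ∣ + n) → pc J p n ≡ sgn (J p ∧ Hd p n)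
  pc-no J {p} {n} h = go (+ p ∣? + n)
    where
    go : ∀ x → pcD J p n x ≡ sgn (J p ∧ Hd p n)
    go (yes g) = ⊥-elim (h g)
    go (no _) = refl

  sgn≤1 : ∀ b → abs (sgn b) ≤ 1
  sgn≤1 false = ≤-refl
  sgn≤1 true = ≤-refl

  -- The value `true` need not occur at an odd number: it does not when ℚ₂(√-d) is unramified.
  Odd₂ : Bool → Set
  Odd₂ b = ∃ λ g → ¬ (+ 2 ∣ + g) × Hd 2 g ≡ b

  Hd-* : ∀ p {m n} → 0 < m → 0 < n → Hd p (m *ᴺ n) ≡ Hd p m xor Hd p n
  Hd-* p {m} {n} m0 n0 = trans (cong (λ z → H p z -d) (ℤP.pos-* m n)) (H-*ˡ p (pos≢0 m0) (pos≢0 n0) -d)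

  Hd-odd : ∀ {p} (op : OddPrime p) n → ¬ (+ p ∣ + n) → Hd p n ≡ vp p -d ∧ Odds.leg op (+ n)
  Hd-odd {p} op n nn = trans (H-odd op (+ n) -d) (trans (cong (λ s → OddSymbol.F op s (vp p -d) (OddSymbol.ℓ op (+ n)) (OddSymbol.ℓ op -d)) (proj₁ (unit-cls (proj₁ op) nn))) (trans (xor-identityʳ (vp p -d ∧ OddSymbol.ℓ op (+ n))) (cong (λ u → vp p -d ∧ Odds.leg op u) (proj₂ (unit-cls (proj₁ op) nn)))))

  Hd-2 : ∀ n → ¬ (+ 2 ∣ + n) → Hd 2 n ≡ (ε₂ (+ n) ∧ ε₂ (unit 2 -d)) xor (vp 2 -d ∧ ω₂ (+ n))
  Hd-2 n nn = trans (H-2 (+ n) -d) (trans (cong₂ (λ s u → F₂ s (vp 2 -d) (ε₂ u) (β₂ u) (ε₂ (unit 2 -d)) (β₂ (unit 2 -d))) (proj₁ (unit-cls prime[2] nn)) (proj₂ (unit-cls prime[2] nn))) refl)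

  bits8 : ∀ n → ¬ (+ 2 ∣ + n) → ε₂ (+ (8 +ᴺ n)) ≡ ε₂ (+ n) × ω₂ (+ (8 +ᴺ n)) ≡ ω₂ (+ n)
  bits8 n nn = e1 , cong₂ _xor_ e1 e2
    where
    x : ℤ
    x = + n
    re1 : ∀ h → + 8 + (+ 1 + + 2 * h) ≡ + 1 + + 2 * (+ 4 + h)
    re1 = solve-∀
    h1 : hf (+ (8 +ᴺ n)) ≡ + 4 + hf x
    h1 = proj₂ (bit-of true (+ 4 + hf x) (trans (pos-+ 8 n) (trans (+ˡ (+ 8) (odd-spec nn)) (re1 (hf x)))))
    re2 : ∀ b h → + 4 + (b + + 2 * h) ≡ b + + 2 * (+ 2 + h)
    re2 = solve-∀
    s4 : ∀ y → bit (+ 4 + y) ≡ bit y × hf (+ 4 + y) ≡ + 2 + hf y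
    s4 y = bit-of (bit y) (+ 2 + hf y) (trans (+ˡ (+ 4) (bit-spec y)) (re2 (BZ (bit y)) (hf y)))
    re3 : ∀ b h → + 2 + (b + + 2 * h) ≡ b + + 2 * (+ 1 + h)
    re3 = solve-∀
    s2 : ∀ y → bit (+ 2 + y) ≡ bit y
    s2 y = proj₁ (bit-of (bit y) (+ 1 + hf y) (trans (+ˡ (+ 2) (bit-spec y)) (re3 (BZ (bit y)) (hf y))))
    e1 : ε₂ (+ (8 +ᴺ n)) ≡ ε₂ x
    e1 = trans (cong bit h1) (proj₁ (s4 (hf x)))
    e2 : β₂ (+ (8 +ᴺ n)) ≡ β₂ x
    e2 = trans (cong (λ z → bit (hf z)) h1) (trans (cong bit (proj₂ (s4 (hf x)))) (s2 (hf (hf x))))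

  pc-char : ∀ J {p} → Prime p → (D : ℕ) → + p ∣ + D → (∀ n → ¬ (+ p ∣ + n) → Hd p (D +ᴺ n) ≡ Hd p n) → Char D (pc J p)
  pc-char J {p} pr D pD per = record
    { bd = λ n → go (+ p ∣? + n)
    ; prd = λ n → prd n (+ p ∣? + n)
    ; mlt = record { mul = λ m n → mul m n (+ p ∣? + m) (+ p ∣? + n) ; f1 = trans (pc-no J (¬p∣1 pr)) (cong (λ b → sgn b) (trans (cong (J p ∧_) (H-1 p -d)) (∧-zeroʳ (J p)))) } }
    where
    go : ∀ {n} (x : Dec (+ p ∣ + n)) → abs (pcD J p n x) ≤ 1
    go (yes _) = z≤n
    go {n} (no _) = sgn≤1 (J p ∧ Hd p n)
    dn : ∀ n → ¬ (+ p ∣ + n) → ¬ (+ p ∣ + (D +ᴺ n))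
    dn n nn z = nn (∣m+n∣m⇒∣n (subst (+ p ∣_) (pos-+ D n) z) pD)
    prd : ∀ n → Dec (+ p ∣ + n) → pc J p (D +ᴺ n) ≡ pc J p n
    prd n (yes h) = trans (pc-yes J (subst (+ p ∣_) (sym (pos-+ D n)) (∣m∣n⇒∣m+n pD h))) (sym (pc-yes J h))
    prd n (no h) = trans (pc-no J (dn n h)) (trans (cong (λ b → sgn (J p ∧ b)) (per n h)) (sym (pc-no J h)))
    mul : ∀ m n → Dec (+ p ∣ + m) → Dec (+ p ∣ + n) → pc J p (m *ᴺ n) ≡ pc J p m * pc J p n
    mul m n (yes h) _ = trans (pc-yes J (subst (+ p ∣_) (sym (ℤP.pos-* m n)) (∣m⇒∣m*n (+ n) h))) (sym (trans (cong (_* pc J p n) (pc-yes J h)) (*-zeroˡ (pc J p n))))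
    mul m n (no _) (yes h) = trans (pc-yes J (subst (+ p ∣_) (sym (ℤP.pos-* m n)) (∣n⇒∣m*n (+ m) h))) (sym (trans (cong (pc J p m *_) (pc-yes J h)) (*-zeroʳ (pc J p m))))
    mul m n (no h) (no g) = trans (pc-no J (λ z → ∤-* pr h g (subst (+ p ∣_) (ℤP.pos-* m n) z))) (trans (cong (λ b → sgn (J p ∧ b)) (trans (cong (λ z → H p z -d) (ℤP.pos-* m n)) (H-*ˡ p (w≢0 h) (w≢0 g) -d)))
      (trans (cong sgn (BoolP.∧-distribˡ-xor (J p) (Hd p m) (Hd p n))) (trans (sgn-xor (J p ∧ Hd p m) (J p ∧ Hd p n)) (sym (cong₂ _*_ (pc-no J h) (pc-no J g))))))

  pc-odd : ∀ J {p} → OddPrime p → Char p (pc J p)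
  pc-odd J {p} op = pc-char J (proj₁ op) p ∣-refl λ n nn → trans (Hd-odd op (p +ᴺ n) (λ z → nn (∣m+n∣m⇒∣n (subst (+ p ∣_) (pos-+ p n) z) ∣-refl)))
      (trans (cong (vp p -d ∧_) (Odds.leg-cong op (divides (+ 1) (trans (cong (_- + n) (pos-+ p n)) (re (+ p) (+ n)))))) (sym (Hd-odd op n nn)))
    where
    re : ∀ p n → p + n - n ≡ + 1 * p
    re = solve-∀

  pc-2 : ∀ J → Char 8 (pc J 2)
  pc-2 J = pc-char J prime[2] 8 (divides (+ 4) refl) λ n nn → trans (Hd-2 (8 +ᴺ n) (λ z → nn (∣m+n∣m⇒∣n (subst (+ 2 ∣_) (pos-+ 8 n) z) (divides (+ 4) refl))))
    (trans (cong₂ (λ a b → (a ∧ ε₂ (unit 2 -d)) xor (vp 2 -d ∧ b)) (proj₁ (bits8 n nn)) (proj₂ (bits8 n nn))) (sym (Hd-2 n nn)))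

  -- With all switches on and `l` complete, reciprocity makes this the quadratic character of
  -- ℚ(√-d), restricted to numbers prime to 2 and to `l`.
  chi : List ℕ → (ℕ → Bool) → ℕ → ℤ
  chi []      J n = pc J 2 n
  chi (p ∷ l) J n = pc J p n * chi l J n

  Dl : List ℕ → ℕ
  Dl []      = 8
  Dl (p ∷ l) = p *ᴺ Dl l

  Dl>0 : ∀ {l} → All OddPrime l → 0 < Dl l
  Dl>0 [] = s≤s z≤n
  Dl>0 (op ∷ os) = *-mono-≤ (<⇒≤ (prime>1 (proj₁ op))) (Dl>0 os)

  chi-char : ∀ {l} → All OddPrime l → ∀ J → Char (Dl l) (chi l J)
  chi-char [] J = pc-2 J
  chi-char {p ∷ l} (op ∷ os) J = char-* (subst (λ n → Char n (pc J p)) (ℕP.*-comm (Dl l) p) (char-ext (Dl l) (pc-odd J op))) (char-ext p (chi-char os J))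

  chi-0 : ∀ l J → chi l J 0 ≡ + 0
  chi-0 [] J = pc-yes J {2} {0} p∣0
  chi-0 (p ∷ l) J = trans (cong (pc J p 0 *_) (chi-0 l J)) (*-zeroʳ (pc J p 0))

  lsum : List ℕ → (ℕ → Bool) → (ℕ → Bool) → Bool
  lsum []      J v = J 2 ∧ v 2
  lsum (p ∷ l) J v = (J p ∧ v p) xor lsum l J v

  p∤Dl : ∀ {p l} → OddPrime p → All OddPrime l → All (λ q → q < p) l → ¬ (+ p ∣ + Dl l)
  p∤Dl op [] [] d = ∤-* (proj₁ op) (∤-* (proj₁ op) (∤2 op) (∤2 op)) (∤2 op) d
  p∤Dl {p} {q ∷ l} op (oq ∷ os) (lt ∷ lts) d = ∤-* (proj₁ op) (prime-∤ (proj₁ op) (proj₁ oq) (λ e → <⇒≢ lt (sym e))) (p∤Dl op os lts) (subst (+ p ∣_) (ℤP.pos-* q (Dl l)) d)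

  chi-unit : ∀ J {p n} → pc J p n ≢ + 0 → ¬ (+ p ∣ + n)
  chi-unit J h d = h (pc-yes J d)

  -- A nonzero value means that `r` is prime to 2 and to every prime of `l`, hence invertible for
  -- the modulus.
  Dl-cancel : ∀ {l} → All OddPrime l → Decr l → ∀ J r → chi l J r ≢ + 0 → ∀ x → + Dl l ∣ + r * x → + Dl l ∣ x
  Dl-cancel [] _ J r nz x d = unit-cancel prime[2] 3 (chi-unit J {2} {r} nz) d
  Dl-cancel {p ∷ l} (op ∷ os) (lts , ds) J r nz x d = go (Dl-cancel os ds J r (λ z → nz (trans (cong (pc J p r *_) z) (*-zeroʳ (pc J p r)))) x (∣-tr (divides (+ p) (ℤP.pos-* p (Dl l))) d))
    where
    np : ¬ (+ p ∣ + r)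
    np = chi-unit J {p} {r} (λ z → nz (trans (cong (_* chi l J r) z) (*-zeroˡ (chi l J r))))
    px : + p ∣ x
    px = case euclid (proj₁ op) (+ r) x (∣-tr (divides (+ Dl l) (trans (ℤP.pos-* p (Dl l)) (*-comm (+ p) (+ Dl l)))) d) of λ where
      (inj₁ z) → ⊥-elim (np z)
      (inj₂ z) → z
    go : + Dl l ∣ x → + Dl (p ∷ l) ∣ x
    go (divides k e) = case euclid (proj₁ op) k (+ Dl l) (subst (+ p ∣_) e px) of λ where
      (inj₁ (divides k′ e′)) → divides k′ (trans e (trans (cong (_* + Dl l) e′) (trans (*-assoc k′ (+ p) (+ Dl l)) (cong (k′ *_) (sym (ℤP.pos-* p (Dl l)))))))
      (inj₂ z) → ⊥-elim (p∤Dl op os lts z)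

  abstract
    local-witness : ∀ {p} → InR p → ∀ b → ∃ λ g → ¬ (+ p ∣ + g) × Hd p g ≡ b
    local-witness {p} (op , v) false = 1 , ¬p∣1 (proj₁ op) , H-1 p -d
    local-witness {p} (op , v) true = case Legendre.exists-nonresidue op of λ (g , ng , mg) → g , ng , trans (Hd-odd op g ng) (trans (cong (_∧ Odds.leg op (+ g)) v) mg)

    -- One residue realises the prescribed local signs `τ`, hence the value of every product of
    -- characters at once. The sign at 2 has to be attainable by an odd number.
    crt : ∀ {l} → All InR l → Decr l → ∀ (τ : ℕ → Bool) → Odd₂ (τ 2) → ∃ λ r → ∀ J → chi l J r ≡ sgn (lsum l J τ)
    crt [] _ τ (g , ng , e) = g , λ J → trans (pc-no J ng) (cong (λ b → sgn (J 2 ∧ b)) e)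
    crt {p ∷ l} (ip ∷ is) (lts , ds) τ w = go (crt is ds τ w) (local-witness ip (τ p))
      where
      op : OddPrime p
      op = proj₁ ip
      os : All OddPrime l
      os = All.map proj₁ is
      instance
        nzp : ℕ.NonZero p
        nzp = prime-nz (proj₁ op)
      go : (∃ λ r → ∀ J → chi l J r ≡ sgn (lsum l J τ)) → (∃ λ g → ¬ (+ p ∣ + g) × Hd p g ≡ τ p) → ∃ λ r → ∀ J → chi (p ∷ l) J r ≡ sgn (lsum (p ∷ l) J τ)
      go (r′ , hr) (g , ng , eg) = inv (inverse (proj₁ op) (p∤Dl op os lts))
        where
        inv : (∃ λ b → + p ∣ + Dl l * b - + 1) → ∃ λ r → ∀ J → chi (p ∷ l) J r ≡ sgn (lsum (p ∷ l) J τ)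
        inv (b , db) = r , λ J → trans (cong₂ _*_ (trans (char-cong (pc-odd J op) r g dg) (trans (pc-no J ng) (cong (λ z → sgn (J p ∧ z)) eg))) (trans (char-prd (chi-char os J) t r′) (hr J))) (sym (sgn-xor (J p ∧ τ p) (lsum l J τ)))
          where
          z : ℤ
          z = (+ g - + r′) * b
          t r : ℕ
          t = toℕ (rem p z)
          r = t *ᴺ Dl l +ᴺ r′
          re : ∀ t D r g b → t * D + r - g ≡ - D * ((g - r) * b - t) + (g - r) * (D * b - + 1)
          re = solve-∀
          dg : + p ∣ + r - + g
          dg = ∣-lc2 (rem-spec p z) db (- + Dl l) (+ g - + r′) (trans (cong (_- + g) (trans (pos-+ (t *ᴺ Dl l) r′) (cong (_+ + r′) (ℤP.pos-* t (Dl l))))) (re (+ t) (+ Dl l) (+ r′) (+ g) b))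

  -- Units at 2 and at `l` whose symbol against -d is trivial at every odd unramified prime.
  record Adm (l : List ℕ) (n : ℕ) : Set where
    field
      pos  : 0 < n
      odd  : ¬ (+ 2 ∣ + n)
      cop  : All (λ p → ¬ (+ p ∣ + n)) l
      good : ∀ {q} → OddPrime q → vp q -d ≡ false → H q (+ q) -d ≡ true → vp q (+ n) ≡ false

  Adm-1 : ∀ {l} → All OddPrime l → Adm l 1
  Adm-1 os = record { pos = s≤s z≤n ; odd = ¬2∣1 ; cop = All.map (λ op → ¬p∣1 (proj₁ op)) os ; good = λ oq _ _ → proj₁ (unit-cls (proj₁ oq) (¬p∣1 (proj₁ oq))) }

  Adm-* : ∀ {l} → All OddPrime l → ∀ {m n} → Adm l m → Adm l n → Adm l (m *ᴺ n)
  Adm-* os {m} {n} x y = record { pos = *-mono-≤ (Adm.pos x) (Adm.pos y) ; odd = λ d → ∤-* prime[2] (Adm.odd x) (Adm.odd y) (subst (+ 2 ∣_) (ℤP.pos-* m n) d)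
    ; cop = go os (Adm.cop x) (Adm.cop y)
    ; good = λ {q} oq v h → trans (cong (vp q) (ℤP.pos-* m n)) (trans (vp-* (proj₁ oq) (pos≢0 (Adm.pos x)) (pos≢0 (Adm.pos y))) (cong₂ _xor_ (Adm.good x oq v h) (Adm.good y oq v h))) }
    where
    go : ∀ {l} → All OddPrime l → All (λ p → ¬ (+ p ∣ + m)) l → All (λ p → ¬ (+ p ∣ + n)) l → All (λ p → ¬ (+ p ∣ + (m *ᴺ n))) l
    go [] [] [] = []
    go (op ∷ os) (a ∷ as) (b ∷ bs) = (λ d → ∤-* (proj₁ op) a b (subst (+ _ ∣_) (ℤP.pos-* m n) d)) ∷ go os as bs

  chi-cop : ∀ l J n → chi l J n ≢ + 0 → ¬ (+ 2 ∣ + n) × All (λ p → ¬ (+ p ∣ + n)) l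
  chi-cop [] J n nz = chi-unit J {2} {n} nz , []
  chi-cop (p ∷ l) J n nz = proj₁ ih , chi-unit J {p} {n} (λ z → nz (trans (cong (_* chi l J n) z) (*-zeroˡ (chi l J n)))) ∷ proj₂ ih
    where
    ih : ¬ (+ 2 ∣ + n) × All (λ p → ¬ (+ p ∣ + n)) l
    ih = chi-cop l J n (λ z → nz (trans (cong (pc J p n *_) z) (*-zeroʳ (pc J p n))))

  chi-val : ∀ l J n → ¬ (+ 2 ∣ + n) → All (λ p → ¬ (+ p ∣ + n)) l → chi l J n ≡ sgn (lsum l J (λ p → Hd p n))
  chi-val [] J n n2 [] = pc-no J n2
  chi-val (p ∷ l) J n n2 (a ∷ as) = trans (cong₂ _*_ (pc-no J a) (chi-val l J n n2 as)) (sym (sgn-xor (J p ∧ Hd p n) (lsum l J (λ p → Hd p n))))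

  AllT : ℕ → Bool
  AllT _ = true

  -- That l is complete is recorded through the two reciprocity laws only.
  record RList (l : List ℕ) : Set where
    field
      allR : All InR l
      dist : Decr l
      sum  : ∀ n → 0 < n → Adm l n → lsum l AllT (λ p → Hd p n) ≡ false
      chiq : ∀ {q} → OddPrime q → vp q -d ≡ false → H q (+ q) -d ≡ true → chi l AllT q ≡ - (+ 1)
    os : All OddPrime l
    os = All.map proj₁ allR

  module _ {l} (RL : RList l) where
    open RList RL

    abstract
      -- ψ = `chi l J` takes the value -1 at an admissible number once neither ψ nor its product
      -- with χ = `chi l AllT` is principal; `τ` and `τ′` witness these two conditions and yield the
      -- zero sums.
      character : ∀ J (τ τ′ : ℕ → Bool) → Odd₂ (τ 2) → Odd₂ (τ′ 2) →
        lsum l J τ ≡ true → lsum l AllT τ′ xor lsum l J τ′ ≡ true → ∃ λ n → Adm l n × lsum l J (λ p → Hd p n) ≡ true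
      character J τ τ′ w w′ e e′ = go (crt allR dist τ w) (crt allR dist τ′ w′)
        where
        D : ℕ
        D = Dl l
        Cψ : Char D (chi l J)
        Cψ = chi-char os J
        Cχ : Char D (chi l AllT)
        Cχ = chi-char os AllT
        chr : ∀ {f} → Char D f → f 0 ≡ + 0 → Chr D f
        chr C z = record { f≤1 = Char.bd C ; per = Char.prd C ; f0 = z }
        neg1 : ∀ {x} → x ≡ - (+ 1) → x ≢ + 0
        neg1 refl ()
        go : (∃ λ r → ∀ J → chi l J r ≡ sgn (lsum l J τ)) → (∃ λ r → ∀ J → chi l J r ≡ sgn (lsum l J τ′)) → ∃ λ n → Adm l n × lsum l J (λ p → Hd p n) ≡ true
        go (r , hr) (r′ , hr′) = fin (GenusLemma.genus-lemma (Dl>0 os) (chr Cχ (chi-0 l AllT)) (Char.mlt Cχ) (Char.mlt Cψ)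
            (record { chr = chr Cψ (chi-0 l J) ; zs = char-zero-sum (Dl>0 os) Cψ r ψr (Dl-cancel os dist J r (neg1 ψr)) })
            (record { chr = chr (char-* Cχ Cψ) (trans (cong (_* chi l J 0) (chi-0 l AllT)) (*-zeroˡ (chi l J 0))) ; zs = char-zero-sum (Dl>0 os) (char-* Cχ Cψ) r′ χψr (Dl-cancel os dist J r′ (λ z → neg1 χψr (trans (cong (chi l AllT r′ *_) z) (*-zeroʳ (chi l AllT r′))))) }))
          where
          ψr : chi l J r ≡ - (+ 1)
          ψr = trans (hr J) (cong sgn e)
          χψr : chi l AllT r′ * chi l J r′ ≡ - (+ 1)
          χψr = trans (cong₂ _*_ (hr′ AllT) (hr′ J)) (trans (sym (sgn-xor (lsum l AllT τ′) (lsum l J τ′))) (cong sgn e′))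
          fin : (∃ λ n → 0 < n × chi l J n ≡ - (+ 1) × (∀ {q} → Prime q → chi l AllT q ≡ - (+ 1) → vp q (+ n) ≡ false)) → ∃ λ n → Adm l n × lsum l J (λ p → Hd p n) ≡ true
          fin (n , n0 , ψn , gd) = n , record { pos = n0 ; odd = proj₁ cp ; cop = proj₂ cp ; good = λ oq v hq → gd (proj₁ oq) (chiq oq v hq) } , sgn-inj (trans (sym (chi-val l J n (proj₁ cp) (proj₂ cp))) ψn)
            where
            cp : ¬ (+ 2 ∣ + n) × All (λ p → ¬ (+ p ∣ + n)) l
            cp = chi-cop l J n (neg1 ψn)

-- Independence of the genus characters.

infix 4 _∈ˡ_
data _∈ˡ_ (x : ℕ) : List ℕ → Set where
  here  : ∀ {l} → x ∈ˡ x ∷ l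
  there : ∀ {y l} → x ∈ˡ l → x ∈ˡ y ∷ l

all-at : ∀ {P : ℕ → Set} {x l} → All P l → x ∈ˡ l → P x
all-at (a ∷ _) here = a
all-at (_ ∷ as) (there h) = all-at as h

upd : ℕ → Bool → (ℕ → Bool) → ℕ → Bool
upd p c J k = if does (k ℕ.≟ p) then c else J k

upd-≡ : ∀ p c J → upd p c J p ≡ c
upd-≡ p c J = cong (λ b → if b then c else J p) (dec-true (p ℕ.≟ p) refl)

upd-≢ : ∀ {p k} c J → k ≢ p → upd p c J k ≡ J k
upd-≢ {p} {k} c J ne = cong (λ b → if b then c else J k) (dec-false (k ℕ.≟ p) ne)

vs : List ℕ → (ℕ → Bool) → (ℕ → Bool) → Bool
vs []      J v = false
vs (p ∷ l) J v = (J p ∧ v p) xor vs l J v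

vs-upd : ∀ {p} l c J v → All (λ q → q < p) l → vs l (upd p c J) v ≡ vs l J v
vs-upd [] c J v [] = refl
vs-upd (q ∷ l) c J v (h ∷ hs′) = cong₂ _xor_ (cong (_∧ v q) (upd-≢ c J (<⇒≢ h))) (vs-upd l c J v hs′)

vs-xor : ∀ l J u v w → (∀ p → w p ≡ u p xor v p) → vs l J w ≡ vs l J u xor vs l J v
vs-xor [] J u v w e = refl
vs-xor (p ∷ l) J u v w e = trans (cong₂ (λ a b → (J p ∧ a) xor b) (e p) (vs-xor l J u v w e)) (taut 5 (λ { (j ∷ a ∷ b ∷ c ∷ d ∷ []) → (j ∧ (a xor b)) xor (c xor d) }) (λ { (j ∷ a ∷ b ∷ c ∷ d ∷ []) → ((j ∧ a) xor c) xor ((j ∧ b) xor d) }) refl (J p ∷ u p ∷ v p ∷ vs l J u ∷ vs l J v ∷ []))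

-- Duality over 𝔽₂: if no nonzero functional `J` vanishes on all the vectors with coordinates
-- `v p n`, they fill the space, multiplication in `A` being addition of vectors. A vector x with
-- coordinate 1 at `p` is the pivot that eliminates this coordinate.
span : ∀ l → Decr l → (A : ℕ → Set) → A 1 → (∀ {m n} → A m → A n → A (m *ᴺ n)) → (v : ℕ → ℕ → Bool) → (∀ {m n} → A m → A n → ∀ p → v p (m *ᴺ n) ≡ v p m xor v p n) →
  (∀ J p → p ∈ˡ l → J p ≡ true → ∃ λ n → A n × vs l J (λ p → v p n) ≡ true) → ∀ (τ : ℕ → Bool) → ∃ λ n → A n × All (λ p → v p n ≡ τ p) l
span [] _ A one mul v vm hyp τ = 1 , one , []
span (p ∷ l) (lt , ds) A one mul v vm hyp τ = start (hyp (upd p true (λ _ → false)) p here (upd-≡ p true (λ _ → false)))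
  where
  vs0 : ∀ l w → vs l (λ _ → false) w ≡ false
  vs0 [] w = refl
  vs0 (q ∷ l) w = vs0 l w
  start : (∃ λ n → A n × vs (p ∷ l) (upd p true (λ _ → false)) (λ p → v p n) ≡ true) → ∃ λ n → A n × All (λ p → v p n ≡ τ p) (p ∷ l)
  start (x , ax , ex) = pick (τ p) refl
    where
    vx : v p x ≡ true
    vx = trans (sym (trans (cong₂ (λ a b → (a ∧ v p x) xor b) (upd-≡ p true (λ _ → false)) (trans (vs-upd l true (λ _ → false) (λ q → v q x) lt) (vs0 l (λ q → v q x)))) (xor-identityʳ (v p x)))) ex
    A′ : ℕ → Set
    A′ n = A n × v p n ≡ false
    v1 : v p 1 ≡ false
    v1 = trans (vm one one p) (xor-same (v p 1))
    hyp′ : ∀ J q → q ∈ˡ l → J q ≡ true → ∃ λ n → A′ n × vs l J (λ p → v p n) ≡ true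
    hyp′ J q ql Jq = go (hyp (upd p c J) q (there ql) (trans (upd-≢ c J (<⇒≢ (all-at lt ql))) Jq))
      where
      -- The functional is extended to `p` so as to vanish at x; adding x to a vector then leaves
      -- its value unchanged.
      c : Bool
      c = vs l J (λ q → v q x)
      go : (∃ λ n → A n × vs (p ∷ l) (upd p c J) (λ p → v p n) ≡ true) → ∃ λ n → A′ n × vs l J (λ p → v p n) ≡ true
      go (y , ay , ey) = go′ (v p y) refl
        where
        ey′ : (c ∧ v p y) xor vs l J (λ q → v q y) ≡ true
        ey′ = trans (sym (cong₂ (λ a b → (a ∧ v p y) xor b) (upd-≡ p c J) (vs-upd l c J (λ q → v q y) lt))) ey
        go′ : ∀ b → v p y ≡ b → ∃ λ n → A′ n × vs l J (λ p → v p n) ≡ true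
        go′ false q = y , (ay , q) , trans (sym (cong (_xor vs l J (λ q → v q y)) (trans (cong (c ∧_) q) (∧-zeroʳ c)))) ey′
        go′ true q = x *ᴺ y , (mul ax ay , trans (vm ax ay p) (cong₂ _xor_ vx q)) , trans (vs-xor l J (λ q → v q x) (λ q → v q y) (λ q → v q (x *ᴺ y)) (vm ax ay)) (trans (sym (cong (_xor vs l J (λ q → v q y)) (trans (cong (c ∧_) q) (∧-identityʳ c)))) ey′)
    rec : ∀ (τ : ℕ → Bool) → ∃ λ n → A′ n × All (λ p → v p n ≡ τ p) l
    rec = span l ds A′ (one , v1) (λ (a , e) (b , f) → mul a b , trans (vm a b p) (cong₂ _xor_ e f)) v (λ (a , _) (b , _) → vm a b) hyp′
    shift : ∀ {y} → A y → ∀ {l} → All (λ q → v q y ≡ τ q xor v q x) l → All (λ q → v q (y *ᴺ x) ≡ τ q) l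
    shift ay [] = []
    shift {y} ay {q ∷ l} (e ∷ es) = trans (vm ay ax q) (trans (cong (_xor v q x) e) (taut 2 (λ { (a ∷ b ∷ []) → (a xor b) xor b }) (λ { (a ∷ b ∷ []) → a }) refl (τ q ∷ v q x ∷ []))) ∷ shift ay es
    pick : ∀ b → τ p ≡ b → ∃ λ n → A n × All (λ p → v p n ≡ τ p) (p ∷ l)
    pick false q = case rec τ of λ (n , (an , vn) , es) → n , an , trans vn (sym q) ∷ es
    pick true q = case rec (λ q → τ q xor v q x) of λ (n , (an , vn) , es) → n *ᴺ x , mul an ax , trans (vm an ax p) (trans (cong₂ _xor_ vn vx) (sym q)) ∷ shift an es

module Existence (d : ℕ) (d>0 : 0 < d) where
  open Genera d d>0

  lsum-vs : ∀ l J v → lsum l J v ≡ vs l J v xor (J 2 ∧ v 2)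
  lsum-vs [] J v = refl
  lsum-vs (p ∷ l) J v = trans (cong ((J p ∧ v p) xor_) (lsum-vs l J v)) (sym (xor-assoc (J p ∧ v p) (vs l J v) (J 2 ∧ v 2)))

  at : ℕ → ℕ → Bool
  at p k = does (k ℕ.≟ p)

  vs-zero : ∀ l J v → All (λ p → v p ≡ false) l → vs l J v ≡ false
  vs-zero [] J v [] = refl
  vs-zero (p ∷ l) J v (e ∷ es) = cong₂ _xor_ (trans (cong (J p ∧_) e) (∧-zeroʳ (J p))) (vs-zero l J v es)

  at-≢ : ∀ {p k} → k ≢ p → at p k ≡ false
  at-≢ {p} {k} ne = dec-false (k ℕ.≟ p) ne

  at-≡ : ∀ p → at p p ≡ true
  at-≡ p = dec-true (p ℕ.≟ p) refl

  vs-at : ∀ {l p} → Decr l → p ∈ˡ l → ∀ J → vs l J (at p) ≡ J p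
  vs-at {p ∷ l} (lt , _) here J = trans (cong₂ (λ a b → (J p ∧ a) xor b) (at-≡ p) (vs-zero l J (at p) (All.map (λ h → at-≢ (<⇒≢ h)) lt))) (trans (xor-identityʳ (J p ∧ true)) (∧-identityʳ (J p)))
  vs-at {q ∷ l} {p} (lt , ds) (there h) J = trans (cong (_xor vs l J (at p)) (trans (cong (J q ∧_) (at-≢ (λ e → <⇒≢ (all-at lt h) (sym e)))) (∧-zeroʳ (J q)))) (vs-at ds h J)

  vs-agree : ∀ {l} u v → All (λ p → u p ≡ v p) l → vs l AllT u ≡ vs l AllT v
  vs-agree u v [] = refl
  vs-agree u v (e ∷ es) = cong₂ _xor_ e (vs-agree u v es)

  w1 : Odd₂ false
  w1 = 1 , ¬2∣1 , H-1 2 -d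

  module _ {l} (RL : RList l) where
    open RList RL
    private
      vmul : ∀ {m n} → Adm l m → Adm l n → ∀ p → Hd p (m *ᴺ n) ≡ Hd p m xor Hd p n
      vmul a b p = Hd-* p (Adm.pos a) (Adm.pos b)

      Goal : (ℕ → Bool) → Set
      Goal τ = ∃ λ n → Adm l n × All (λ p → Hd p n ≡ τ p) l

      ≢2 : ∀ {p l} → All OddPrime l → p ∈ˡ l → p ≢ 2
      ≢2 os h = proj₂ (all-at os h)

    -- The dyadic component takes both signs on odd numbers and absorbs the product formula, so the
    -- signs at the odd ramified primes are free. The signs `at 2` show that a product avoiding 2
    -- differs from the full character.
    genus-ramified : Odd₂ true → ∀ (τ : ℕ → Bool) → Goal τ
    genus-ramified w2 τ = span l dist (Adm l) (Adm-1 os) (Adm-* os) Hd vmul hyp τ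
      where
      hyp : ∀ J p → p ∈ˡ l → J p ≡ true → ∃ λ n → Adm l n × vs l J (λ p → Hd p n) ≡ true
      hyp J p pl Jp = case character RL J₀ (at p) (at 2) (subst Odd₂ (sym (at-≢ (λ e → ≢2 os pl (sym e)))) w1) (subst Odd₂ (sym (at-≡ 2)) w2)
          (trans (lsum-vs l J₀ (at p)) (trans (cong₂ _xor_ (trans (vs-at dist pl J₀) (trans (upd-≢ false J (≢2 os pl)) Jp)) (cong (_∧ at p 2) (upd-≡ 2 false J))) refl))
          (cong₂ _xor_ (trans (lsum-vs l AllT (at 2)) (cong₂ _xor_ (vz AllT) (at-≡ 2))) (trans (lsum-vs l J₀ (at 2)) (cong₂ _xor_ (vz J₀) (cong (_∧ at 2 2) (upd-≡ 2 false J))))) of λ (n , an , e) → n , an , trans (sym (trans (lsum-vs l J₀ (λ p → Hd p n)) (trans (cong₂ _xor_ (vs-J os (λ p → Hd p n)) (cong (_∧ Hd 2 n) (upd-≡ 2 false J))) (xor-identityʳ (vs l J (λ p → Hd p n)))))) e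
        where
        J₀ : ℕ → Bool
        J₀ = upd 2 false J
        vz : ∀ J → vs l J (at 2) ≡ false
        vz J = vs-zero l J (at 2) (All.map (λ op → at-≢ (proj₂ op)) os)
        vs-J : ∀ {l} → All OddPrime l → ∀ v → vs l J₀ v ≡ vs l J v
        vs-J [] v = refl
        vs-J {q ∷ l} (op ∷ os) v = cong₂ (λ a b → (a ∧ v q) xor b) (upd-≢ false J (proj₂ op)) (vs-J os v)

  -- With 2 silent, the product formula is one relation among the signs. The first prime is left
  -- out, the others are free, and the sign at the first comes out right because `τ` obeys the same
  -- relation.
  genus-unramified : ∀ {l} → RList l → (∀ n → ¬ (+ 2 ∣ + n) → Hd 2 n ≡ false) → ∀ (τ : ℕ → Bool) → vs l AllT τ ≡ false → ∃ λ n → Adm l n × All (λ p → Hd p n ≡ τ p) l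
  genus-unramified {[]} RL tr τ _ = 1 , Adm-1 (RList.os RL) , []
  genus-unramified {p₁ ∷ l} RL tr τ sτ = case span l (proj₂ dist) (Adm (p₁ ∷ l)) (Adm-1 os) (Adm-* os) Hd vmul hyp τ of λ (n , an , es) → n , an , trans (xor-≡ (trans (cong (Hd p₁ n xor_) (sym (vs-agree (λ p → Hd p n) τ es))) (trans (sym (trans (lsum-vs (p₁ ∷ l) AllT (λ p → Hd p n)) (trans (cong (vs (p₁ ∷ l) AllT (λ p → Hd p n) xor_) (tr n (Adm.odd an))) (xor-identityʳ (vs (p₁ ∷ l) AllT (λ p → Hd p n)))))) (sum n (Adm.pos an) an)))) (sym (xor-≡ sτ)) ∷ es
    where
    open RList RL
    vmul : ∀ {m n} → Adm (p₁ ∷ l) m → Adm (p₁ ∷ l) n → ∀ p → Hd p (m *ᴺ n) ≡ Hd p m xor Hd p n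
    vmul a b p = Hd-* p (Adm.pos a) (Adm.pos b)
    o₁ : p₁ ≢ 2
    o₁ = proj₂ (all-at os here)
    hyp : ∀ J p → p ∈ˡ l → J p ≡ true → ∃ λ n → Adm (p₁ ∷ l) n × vs l J (λ p → Hd p n) ≡ true
    hyp J p pl Jp = case character RL J₁ (at p) (at p₁) (subst Odd₂ (sym (at-≢ (λ e → p≢2 (sym e)))) w1) (subst Odd₂ (sym (at-≢ (λ e → o₁ (sym e)))) w1)
        (trans (lsum-vs (p₁ ∷ l) J₁ (at p)) (cong₂ _xor_ (trans (vs-at dist (there pl) J₁) (trans (upd-≢ false J₀ p≢p₁) (trans (upd-≢ false J p≢2) Jp))) (cong (_∧ at p 2) J₁2)))
        (cong₂ _xor_ (trans (lsum-vs (p₁ ∷ l) AllT (at p₁)) (cong₂ _xor_ (vs-at dist here AllT) (at-≢ (λ e → o₁ (sym e))))) (trans (lsum-vs (p₁ ∷ l) J₁ (at p₁)) (cong₂ _xor_ (trans (vs-at dist here J₁) (upd-≡ p₁ false J₀)) (cong (_∧ at p₁ 2) J₁2)))) of λ (n , an , e) → n , an , trans (sym (trans (lsum-vs (p₁ ∷ l) J₁ (λ p → Hd p n)) (trans (cong₂ _xor_ (cong₂ (λ a b → (a ∧ Hd p₁ n) xor b) (upd-≡ p₁ false J₀) (trans (vs-upd l false J₀ (λ p → Hd p n) (proj₁ dist)) (vs-J (All.tail os) (λ p → Hd p n)))) (cong (_∧ Hd 2 n) J₁2)) (xor-identityʳ (vs l J (λ p → Hd p n)))))) e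
      where
      J₀ J₁ : ℕ → Bool
      J₀ = upd 2 false J
      J₁ = upd p₁ false J₀
      J₁2 : J₁ 2 ≡ false
      J₁2 = trans (upd-≢ false J₀ (λ e → o₁ (sym e))) (upd-≡ 2 false J)
      p≢2 : p ≢ 2
      p≢2 = proj₂ (all-at os (there pl))
      p≢p₁ : p ≢ p₁
      p≢p₁ = <⇒≢ (all-at (proj₁ dist) pl)
      vs-J : ∀ {m} → All OddPrime m → ∀ v → vs m J₀ v ≡ vs m J v
      vs-J [] v = refl
      vs-J {q ∷ m} (op ∷ os) v = cong₂ (λ a b → (a ∧ v q) xor b) (upd-≢ false J (proj₂ op)) (vs-J os v)

-- The ramified primes and the product formula.

sumB-ext : ∀ k n f → (∀ p → n ≤ p → f p ≡ false) → sumB (k +ᴺ n) f ≡ sumB n f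
sumB-ext zero n f z = refl
sumB-ext (suc k) n f z = cong₂ _xor_ (z (k +ᴺ n) (m≤n+m n k)) (sumB-ext k n f z)

bits-of : ∀ {x} b b′ q → x ≡ form8 b b′ q → ε₂ x ≡ b × β₂ x ≡ b′
bits-of {x} b b′ q e = proj₁ s , proj₁ (bit-of b′ q (proj₂ s))
  where
  s : bit (hf x) ≡ b × hf (hf x) ≡ BZ b′ + + 2 * q
  s = bit-of b (BZ b′ + + 2 * q) (proj₂ (bit-of true (BZ b + + 2 * (BZ b′ + + 2 * q)) e))

module Ramified (d : ℕ) (d>0 : 0 < d) where
  open Genera d d>0
  open Existence d d>0

  inR? : ∀ p → Dec (InR p)
  inR? p = (prime? p ×-dec ¬? (p ℕ.≟ 2)) ×-dec (vp p -d BoolP.≟ true)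

  add : ∀ n → Dec (InR n) → List ℕ → List ℕ
  add n (yes _) l = n ∷ l
  add n (no _)  l = l

  collect : ℕ → List ℕ
  collect zero    = []
  collect (suc n) = add n (inR? n) (collect n)

  collect-R : ∀ n → All InR (collect n)
  collect-R zero = []
  collect-R (suc n) = go (inR? n)
    where
    go : (x : Dec (InR n)) → All InR (add n x (collect n))
    go (yes r) = r ∷ collect-R n
    go (no _) = collect-R n

  collect-< : ∀ n → All (_< n) (collect n)
  collect-< zero = []
  collect-< (suc n) = go (inR? n)
    where
    up : All (_< suc n) (collect n)
    up = All.map m<n⇒m<1+n (collect-< n)
    go : (x : Dec (InR n)) → All (_< suc n) (add n x (collect n))
    go (yes r) = ≤-refl ∷ up
    go (no _) = up

  collect-dist : ∀ n → Decr (collect n)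
  collect-dist zero = tt
  collect-dist (suc n) = go (inR? n)
    where
    go : (x : Dec (InR n)) → Decr (add n x (collect n))
    go (yes r) = collect-< n , collect-dist n
    go (no _) = collect-dist n

  collect-vs : ∀ n f → (∀ p → ¬ InR p → f p ≡ false) → sumB n f ≡ vs (collect n) AllT f
  collect-vs zero f z = refl
  collect-vs (suc n) f z = go (inR? n)
    where
    go : (x : Dec (InR n)) → f n xor sumB n f ≡ vs (add n x (collect n)) AllT f
    go (yes r) = cong (f n xor_) (collect-vs n f z)
    go (no r) = cong₂ _xor_ (z n r) (collect-vs n f z)

  -- A prime with odd valuation in d divides d, so a search up to d finds every ramified odd prime.
  R : List ℕ
  R = collect (suc d)

  -d-abs : abs -d ≡ d
  -d-abs = ℤP.∣-i∣≡∣i∣ (+ d)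

  R-≤ : ∀ {p} → InR p → p ≤ d
  R-≤ {p} (op , v) = case + p ∣? -d of λ where
    (yes h) → ℕD.∣⇒≤ {{ℕ.>-nonZero d>0}} (subst (p ℕD.∣_) -d-abs (∣⇒∣ᵤ h))
    (no h) → case trans (sym v) (proj₁ (unit-cls (proj₁ op) h)) of λ ()

  sum-lsum : ∀ B f → d < B → 2 < B → (∀ p → p < B → p ≢ 2 → ¬ InR p → f p ≡ false) → sumB B f ≡ vs R AllT f xor f 2
  sum-lsum B f dB 2B z = trans (sumB-split B 2 f 2B) (trans (xor-comm (f 2) (sumB B f′)) (cong (_xor f 2) (trans (trans (cong (λ b → sumB b f′) (sym (m∸n+n≡m dB))) (trans (sumB-cong (B ∸ suc d +ᴺ suc d) (λ p h → sym (cut p (subst (p <_) (m∸n+n≡m dB) h)))) (trans (sumB-ext (B ∸ suc d) (suc d) f″ (λ p h → z″ p (λ r → <⇒≱ h (R-≤ r)))) (collect-vs (suc d) f″ z″)))) (vs-agree f″ f (All.map (λ {p} r → trans (f″≡ r) (off-≢ (proj₂ (proj₁ r)) (f p))) (collect-R (suc d)))))))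
    where
    f′ : ℕ → Bool
    f′ p = not (does (p ℕ.≟ 2)) ∧ f p
    f″ : ℕ → Bool
    f″ p = does (inR? p) ∧ f′ p
    z″ : ∀ p → ¬ InR p → f″ p ≡ false
    z″ p nr = cong (_∧ f′ p) (dec-false (inR? p) nr)
    f″≡ : ∀ {p} → InR p → f″ p ≡ f′ p
    f″≡ {p} r = cong (_∧ f′ p) (dec-true (inR? p) r)
    cut : ∀ p → p < B → f″ p ≡ f′ p
    cut p pB = go (inR? p) (p ℕ.≟ 2)
      where
      go : Dec (InR p) → Dec (p ≡ 2) → f″ p ≡ f′ p
      go (yes r) _ = f″≡ r
      go (no r) (yes e) = trans (z″ p r) (sym (off-≡ e (f p)))
      go (no r) (no e) = trans (z″ p r) (sym (trans (off-≢ e (f p)) (z p pB e r)))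

  unram : ∀ {p} → OddPrime p → ¬ InR p → vp p -d ≡ false
  unram {p} op nr = go (vp p -d) refl
    where
    go : ∀ b → vp p -d ≡ b → vp p -d ≡ false
    go false q = q
    go true q = ⊥-elim (nr (op , q))

  -- Up to a square -d is a unit at `p`; its symbol with a unit is trivial, so only the valuation of
  -- n counts.
  Hd-unram : ∀ {p} → OddPrime p → vp p -d ≡ false → ∀ n → Hd p n ≡ vp p (+ n) ∧ H p (+ p) -d
  Hd-unram {p} op v n = trans (eval n) (cong (vp p (+ n) ∧_) (sym (trans (eval p) (cong (_∧ m) (proj₁ (p-cls (proj₁ op)))))))
    where
    m : Bool
    m = OddSymbol.ℓ op -d
    eval : ∀ n → Hd p n ≡ vp p (+ n) ∧ m
    eval n = trans (H-odd op (+ n) -d) (trans (cong (λ t → OddSymbol.F op (vp p (+ n)) t (OddSymbol.ℓ op (+ n)) m) v) (cong (λ b → (b ∧ Odds.leg op (- (+ 1))) xor (vp p (+ n) ∧ m)) (∧-zeroʳ (vp p (+ n)))))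

  Hd-out : ∀ {p} n → p ≢ 2 → ¬ InR p → (OddPrime p → vp p -d ≡ false → H p (+ p) -d ≡ true → vp p (+ n) ≡ false) → Hd p n ≡ false
  Hd-out {p} n p2 nr g = go (prime? p)
    where
    go : Dec (Prime p) → Hd p n ≡ false
    go (no np) = H-np np (+ n) -d
    go (yes pr) = go′ (H p (+ p) -d) refl
      where
      v : vp p -d ≡ false
      v = unram (pr , p2) nr
      go′ : ∀ b → H p (+ p) -d ≡ b → Hd p n ≡ false
      go′ false q = trans (Hd-unram (pr , p2) v n) (trans (cong (vp p (+ n) ∧_) q) (∧-zeroʳ (vp p (+ n))))
      go′ true q = trans (Hd-unram (pr , p2) v n) (cong (_∧ H p (+ p) -d) (g (pr , p2) v q))

  bnd : ℕ → ℕ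
  bnd n = suc (n +ᴺ (d +ᴺ 2))

  n<bnd : ∀ n → n < bnd n
  n<bnd n = s≤s (m≤m+n n (d +ᴺ 2))

  d<bnd : ∀ n → d < bnd n
  d<bnd n = s≤s (≤-trans (m≤m+n d 2) (m≤n+m (d +ᴺ 2) n))

  2<bnd : ∀ n → 2 < bnd n
  2<bnd n = s≤s (≤-trans (m≤n+m 2 d) (m≤n+m (d +ᴺ 2) n))

  abstract
    R-sum : ∀ n → 0 < n → Adm R n → lsum R AllT (λ p → Hd p n) ≡ false
    R-sum n n0 an = trans (lsum-vs R AllT (λ p → Hd p n)) (trans (sym (sum-lsum (bnd n) (λ p → Hd p n) (d<bnd n) (2<bnd n) (λ p _ p2 nr → Hd-out n p2 nr (Adm.good an)))) (product-formula⁻ (bnd n) n0 d>0 (n<bnd n) (d<bnd n)))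

    -- In the product formula for (q, -d) only q, the odd ramified primes and 2 can contribute; the
    -- contribution of q is -1, so the others multiply to -1.
    R-chi : ∀ {q} → OddPrime q → vp q -d ≡ false → H q (+ q) -d ≡ true → chi R AllT q ≡ - (+ 1)
    R-chi {q} oq v h = trans (chi-val R AllT q (λ z → prime-∤ prime[2] (proj₁ oq) (λ e → proj₂ oq (sym e)) z) (All.map (λ {p} r → prime-∤ (proj₁ (proj₁ r)) (proj₁ oq) (ne r)) (collect-R (suc d)))) (cong sgn val≡)
      where
      ne : ∀ {p} → InR p → p ≢ q
      ne r refl = case trans (sym (proj₂ r)) v of λ ()
      f f′ : ℕ → Bool
      f p = Hd p q
      f′ p = not (does (p ℕ.≟ q)) ∧ f p
      z : ∀ p → p < bnd q → p ≢ 2 → ¬ InR p → f′ p ≡ false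
      z p _ p2 nr = go (p ℕ.≟ q)
        where
        go : Dec (p ≡ q) → f′ p ≡ false
        go (yes e) = off-≡ e (f p)
        go (no e) = trans (off-≢ e (f p)) (Hd-out q p2 nr (λ op _ _ → proj₁ (unit-cls (proj₁ op) (prime-∤ (proj₁ op) (proj₁ oq) e))))
      s : f q xor sumB (bnd q) f′ ≡ false
      s = trans (sym (sumB-split (bnd q) q f (n<bnd q))) (product-formula⁻ (bnd q) (<⇒≤ (prime>1 (proj₁ oq))) d>0 (n<bnd q) (d<bnd q))
      val≡ : lsum R AllT f ≡ true
      val≡ = trans (lsum-vs R AllT f) (trans (cong₂ _xor_ (sym (vs-agree f′ f (All.map (λ {p} r → off-≢ (ne r) (f p)) (collect-R (suc d))))) (sym (off-≢ (λ e → proj₂ oq (sym e)) (f 2)))) (trans (sym (sum-lsum (bnd q) f′ (d<bnd q) (2<bnd q) z)) (trans (sym (xor-≡ s)) h)))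

  R-list : RList R
  R-list = record { allR = collect-R (suc d) ; dist = collect-dist (suc d) ; sum = R-sum ; chiq = R-chi }

  -- 3 detects a unit part congruent to 3 modulo 4, and 5 detects an odd valuation; if neither is
  -- present, -d is unramified at 2.
  dyadic-cases : Odd₂ true ⊎ (vp 2 -d ≡ false × ε₂ (unit 2 -d) ≡ false)
  dyadic-cases = go (vp 2 -d) (ε₂ (unit 2 -d)) refl refl
    where
    W : Set
    W = Odd₂ true
    wit : ∀ n b b′ q → + n ≡ form8 b b′ q → ∀ v e → vp 2 -d ≡ v → ε₂ (unit 2 -d) ≡ e → (b ∧ e) xor (v ∧ (b xor b′)) ≡ true → W
    wit n b b′ q en v e ev ee t = n , odd , trans (Hd-2 n odd) (trans (cong₂ (λ u w → (ε₂ (+ n) ∧ u) xor (w ∧ ω₂ (+ n))) ee ev) (trans (cong₂ (λ x y → (x ∧ e) xor (v ∧ (x xor y))) (proj₁ bs) (proj₂ bs)) t))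
      where
      odd : ¬ (+ 2 ∣ + n)
      odd z = ¬2∣odd (BZ b + + 2 * (BZ b′ + + 2 * q)) (subst (+ 2 ∣_) en z)
      bs : ε₂ (+ n) ≡ b × β₂ (+ n) ≡ b′
      bs = bits-of b b′ q en
    go : ∀ v e → vp 2 -d ≡ v → ε₂ (unit 2 -d) ≡ e → W ⊎ (vp 2 -d ≡ false × ε₂ (unit 2 -d) ≡ false)
    go false false p q = inj₂ (p , q)
    go false true p q = inj₁ (wit 3 true false (+ 0) refl false true p q refl)
    go true e p q = inj₁ (wit 5 false true (+ 0) refl true e p q refl)

-- An integer with prescribed symbols against -d.

pick : Bool → ℕ → ℕ
pick b n = if b then n else 1

prodP : (ℕ → Bool) → ℕ → ℕ
prodP A zero    = 1
prodP A (suc n) = pick (A n) n *ᴺ prodP A n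

module _ (A : ℕ → Bool) (prime : ∀ {q} → A q ≡ true → Prime q) where
  pick>0 : ∀ n → 0 < pick (A n) n
  pick>0 n = go (A n) refl
    where
    go : ∀ b → A n ≡ b → 0 < pick b n
    go false _ = s≤s z≤n
    go true q = <⇒≤ (prime>1 (prime q))

  prodP>0 : ∀ n → 0 < prodP A n
  prodP>0 zero = s≤s z≤n
  prodP>0 (suc n) = *-mono-≤ (pick>0 n) (prodP>0 n)

  prodP-hom : (g : ℕ → Bool) → g 1 ≡ false → (∀ {m n} → 0 < m → 0 < n → g (m *ᴺ n) ≡ g m xor g n) → ∀ n → g (prodP A n) ≡ sumB n (λ q → A q ∧ g q)
  prodP-hom g g1 gm zero = g1
  prodP-hom g g1 gm (suc n) = trans (gm (pick>0 n) (prodP>0 n)) (cong₂ _xor_ (go (A n)) (prodP-hom g g1 gm n))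
    where
    go : ∀ b → g (pick b n) ≡ b ∧ g n
    go false = g1
    go true = refl

  prodP-odd : A 2 ≡ false → ∀ n → ¬ (+ 2 ∣ + prodP A n)
  prodP-odd a2 zero = ¬2∣1
  prodP-odd a2 (suc n) d = ∤-* prime[2] (go (A n) refl) (prodP-odd a2 n) (subst (+ 2 ∣_) (ℤP.pos-* (pick (A n) n) (prodP A n)) d)
    where
    go : ∀ b → A n ≡ b → ¬ (+ 2 ∣ + pick b n)
    go false _ = ¬2∣1
    go true q = prime-∤ prime[2] (prime q) (λ { refl → case trans (sym q) a2 of λ () })

  vp-prodP : ∀ {p} → Prime p → ∀ n → (n ≤ p → A p ≡ false) → vp p (+ prodP A n) ≡ A p
  vp-prodP {p} pr n big = trans (prodP-hom (λ m → vp p (+ m)) (proj₁ (unit-cls pr (¬p∣1 pr))) (λ {k} {m} k0 m0 → trans (cong (vp p) (ℤP.pos-* k m)) (vp-* pr (pos≢0 k0) (pos≢0 m0))) n) (go (p ℕ.<? n))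
    where
    z : ∀ q → q < n → q ≢ p → A q ∧ vp p (+ q) ≡ false
    z q _ ne = go′ (A q) refl
      where
      go′ : ∀ b → A q ≡ b → b ∧ vp p (+ q) ≡ false
      go′ false _ = refl
      go′ true e = proj₁ (unit-cls pr (prime-∤ pr (prime e) (λ e → ne (sym e))))
    go : Dec (p < n) → sumB n (λ q → A q ∧ vp p (+ q)) ≡ A p
    go (yes h) = trans (sumB-single n p (λ q → A q ∧ vp p (+ q)) h z) (trans (cong (A p ∧_) (proj₁ (p-cls pr))) (∧-identityʳ (A p)))
    go (no h) = trans (sumB-0 n (λ q q<n → z q q<n (λ { refl → h q<n }))) (sym (big (≮⇒≥ h)))

module Auxiliary (d : ℕ) (d>0 : 0 < d) where
  open Genera d d>0
  open Existence d d>0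
  open Ramified d d>0

  -- What signs of the form ε(p) = (a, -d)_p with a > 0 must satisfy: finite support, triviality
  -- where -d is a local square, and the product formula.
  record Locals (B : ℕ) (ε : ℕ → Bool) : Set where
    field
      np    : ∀ {p} → ¬ Prime p → ε p ≡ false
      big   : ∀ {p} → B ≤ p → ε p ≡ false
      odd   : ∀ {p} → OddPrime p → vp p -d ≡ false → H p (+ p) -d ≡ false → ε p ≡ false
      dyad  : vp 2 -d ≡ false → ε₂ (unit 2 -d) ≡ false → H 2 (+ 2) -d ≡ false → ε 2 ≡ false
      total : sumB B ε ≡ false

  -- 2 is inert and the sign wanted there is -1, so `a` must have odd valuation at 2.
  Exceptional : (ℕ → Bool) → Set
  Exceptional ε = vp 2 -d ≡ false × ε₂ (unit 2 -d) ≡ false × H 2 (+ 2) -d ≡ true × ε 2 ≡ true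

  module _ {B : ℕ} {ε : ℕ → Bool} (L : Locals B ε) where
    private
      module L = Locals L

      module Part (b : Bool) where
        g : ℕ → Bool
        g q = if does (q ℕ.≟ 2) then b else not (vp q -d)
        A : ℕ → Bool
        A q = ε q ∧ (H q (+ q) -d ∧ g q)
        A-ε : ∀ {q} → A q ≡ true → ε q ≡ true
        A-ε {q} e = go (ε q) e
          where
          go : ∀ c → c ∧ (H q (+ q) -d ∧ g q) ≡ true → c ≡ true
          go true _ = refl
        A-prime : ∀ {q} → A q ≡ true → Prime q
        A-prime {q} e = go (prime? q)
          where
          go : Dec (Prime q) → Prime q
          go (yes h) = h
          go (no h) = case trans (sym (A-ε e)) (L.np h) of λ ()
        A-big : ∀ {q} → B ≤ q → A q ≡ false
        A-big {q} h = cong (_∧ (H q (+ q) -d ∧ g q)) (L.big h)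
        a₀ : ℕ
        a₀ = prodP A B
        a₀>0 : 0 < a₀
        a₀>0 = prodP>0 A A-prime B
        A-unram : ∀ {q} → g q ≡ true → (H q (+ q) -d ≡ false → ε q ≡ false) → A q ∧ H q (+ q) -d ≡ ε q
        A-unram {q} gq z = go (H q (+ q) -d) refl
          where
          go : ∀ c → H q (+ q) -d ≡ c → A q ∧ H q (+ q) -d ≡ ε q
          go false e = trans (cong (A q ∧_) e) (trans (∧-zeroʳ (A q)) (sym (z e)))
          go true e = trans (cong₂ (λ x y → (ε q ∧ (x ∧ y)) ∧ x) e gq) (trans (∧-identityʳ (ε q ∧ true)) (∧-identityʳ (ε q)))
        unram-a₀ : ∀ {p} → OddPrime p → vp p -d ≡ false → Hd p a₀ ≡ ε p
        unram-a₀ {p} op v = trans (Hd-unram op v a₀) (trans (cong (_∧ H p (+ p) -d) (vp-prodP A A-prime (proj₁ op) B A-big)) (A-unram (trans (cong (λ c → if c then b else not (vp p -d)) (dec-false (p ℕ.≟ 2) (proj₂ op))) (cong not v)) (L.odd op v)))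
        τ : ℕ → Bool
        τ p = ε p xor Hd p a₀
        τ-out : ∀ p → p ≢ 2 → ¬ InR p → τ p ≡ false
        τ-out p p2 nr = go (prime? p)
          where
          go : Dec (Prime p) → τ p ≡ false
          go (no h) = cong₂ _xor_ (L.np h) (H-np h (+ a₀) -d)
          go (yes h) = trans (cong (ε p xor_) (unram-a₀ (h , p2) (unram (h , p2) nr))) (xor-same (ε p))
        B′ : ℕ
        B′ = bnd a₀ +ᴺ B
        up : ∀ {n} → n < bnd a₀ → n < B′
        up h = ≤-trans h (m≤m+n (bnd a₀) B)
        τ-sum : vs R AllT τ xor τ 2 ≡ false
        τ-sum = trans (sym (sum-lsum B′ τ (up (d<bnd a₀)) (up (2<bnd a₀)) (λ p _ → τ-out p))) (trans (sumB-xor B′ ε (λ p → Hd p a₀)) (cong₂ _xor_ (trans (sumB-ext (bnd a₀) B ε (λ p → L.big)) L.total) (product-formula⁻ B′ a₀>0 d>0 (up (n<bnd a₀)) (up (d<bnd a₀)))))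
        fin : ∀ {n} → Adm R n → All (λ p → Hd p n ≡ τ p) R → ∀ {p} → OddPrime p → Hd p (a₀ *ᴺ n) ≡ ε p
        fin {n} an es {p} op = go (inR? p)
          where
          mem : ∀ n {P : ℕ → Set} → InR p → p < n → All P (collect n) → P p
          mem (suc n) {P} r p<n ps = go′ (inR? n) ps
            where
            dn : p ≢ n → p < n
            dn ne = ≤∧≢⇒< (≤-pred p<n) ne
            go′ : (x : Dec (InR n)) → All P (add n x (collect n)) → P p
            go′ (yes _) (q ∷ qs) = case p ℕ.≟ n of λ where
              (yes e) → subst P (sym e) q
              (no e) → mem n r (dn e) qs
            go′ (no nr) qs = mem n r (dn (λ e → nr (subst InR e r))) qs
          go : Dec (InR p) → Hd p (a₀ *ᴺ n) ≡ ε p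
          go (yes r) = trans (Hd-* p a₀>0 (Adm.pos an)) (trans (cong (Hd p a₀ xor_) (mem (suc d) r (s≤s (R-≤ r)) es)) (taut 2 (λ { (x ∷ y ∷ []) → x xor (y xor x) }) (λ { (x ∷ y ∷ []) → y }) refl (Hd p a₀ ∷ ε p ∷ [])))
          go (no nr) = trans (Hd-* p a₀>0 (Adm.pos an)) (trans (cong₂ _xor_ (unram-a₀ op (unram op nr)) (Hd-out n (proj₂ op) nr (Adm.good an))) (xor-identityʳ (ε p)))
        odd′ : ∀ {n} → A 2 ≡ false → Adm R n → ¬ (+ 2 ∣ + (a₀ *ᴺ n))
        odd′ {n} a2 an z = ∤-* prime[2] (prodP-odd A A-prime a2 B) (Adm.odd an) (subst (+ 2 ∣_) (ℤP.pos-* a₀ n) z)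

    Goal : Set
    Goal = ∃ λ a → 0 < a × (∀ {p} → OddPrime p → Hd p a ≡ ε p) × (¬ (+ 2 ∣ + a) ⊎ Exceptional ε)

    abstract
      -- If 2 ramifies, the admissible factor may take any signs and `a` stays odd. If not, a factor
      -- 2 in `a₀` repairs the sign at 2 where needed, and the product formula supplies the relation
      -- required of `τ`.
      existence : Goal
      existence = go dyadic-cases
        where
        go : (Odd₂ true ⊎ (vp 2 -d ≡ false × ε₂ (unit 2 -d) ≡ false)) → Goal
        go (inj₁ w) = end (genus-ramified R-list w τ)
          where
          open Part false
          end : (∃ λ n → Adm R n × All (λ p → Hd p n ≡ τ p) R) → Goal
          end (n , an , es) = a₀ *ᴺ n , *-mono-≤ a₀>0 (Adm.pos an) , fin an es , inj₁ (odd′ (trans (cong (ε 2 ∧_) (∧-zeroʳ (H 2 (+ 2) -d))) (∧-zeroʳ (ε 2))) an)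
        go (inj₂ (v , e)) = end (genus-unramified R-list tr τ (trans (xor-≡ τ-sum) τ2))
          where
          open Part true
          tr : ∀ n → ¬ (+ 2 ∣ + n) → Hd 2 n ≡ false
          tr n nn = trans (Hd-2 n nn) (trans (cong₂ (λ u w → (ε₂ (+ n) ∧ u) xor (w ∧ ω₂ (+ n))) e v) (trans (xor-identityʳ (ε₂ (+ n) ∧ false)) (∧-zeroʳ (ε₂ (+ n)))))
          zz : ∀ q → q ≢ 2 → ∀ c → A q ≡ c → c ∧ Hd 2 q ≡ false
          zz q q2 false _ = refl
          zz q q2 true aq = tr q (prime-∤ prime[2] (A-prime aq) (λ e → q2 (sym e)))
          s2 : Dec (2 < B) → sumB B (λ q → A q ∧ Hd 2 q) ≡ A 2 ∧ Hd 2 2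
          s2 (yes h) = sumB-single B 2 (λ q → A q ∧ Hd 2 q) h (λ q _ q2 → zz q q2 (A q) refl)
          s2 (no h) = trans (sumB-0 B (λ q q<B → zz q (λ { refl → h q<B }) (A q) refl)) (sym (cong (_∧ Hd 2 2) (A-big (≮⇒≥ h))))
          h2a : Hd 2 a₀ ≡ ε 2
          h2a = trans (prodP-hom A A-prime (Hd 2) (H-1 2 -d) (Hd-* 2) B) (trans (s2 (2 ℕ.<? B)) (A-unram {2} refl (L.dyad v e)))
          τ2 : τ 2 ≡ false
          τ2 = trans (cong (ε 2 xor_) h2a) (xor-same (ε 2))
          end : (∃ λ n → Adm R n × All (λ p → Hd p n ≡ τ p) R) → Goal
          end (n , an , es) = a₀ *ᴺ n , *-mono-≤ a₀>0 (Adm.pos an) , fin an es , par2 (ε 2) (H 2 (+ 2) -d) refl refl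
            where
            par2 : ∀ x y → ε 2 ≡ x → H 2 (+ 2) -d ≡ y → ¬ (+ 2 ∣ + (a₀ *ᴺ n)) ⊎ Exceptional ε
            par2 true true ex ey = inj₂ (v , e , ey , ex)
            par2 false y ex ey = inj₁ (odd′ (cong (_∧ (H 2 (+ 2) -d ∧ g 2)) ex) an)
            par2 true false ex ey = inj₁ (odd′ (trans (cong (λ c → ε 2 ∧ (c ∧ true)) ey) (∧-zeroʳ (ε 2))) an)

-- Orthogonal complements

HS : ℕ → ∀ {n} → Vc n → Bool
HS p {zero}  a = false
HS p {suc n} a = H p (a zero) (prodℤ (a ∘ suc)) xor HS p (a ∘ suc)

HS-Sy : ∀ {p} (pr : Prime p) {n} (a : Vc n) → HS p a ≡ hs (Sy pr) a
HS-Sy pr {zero} a = refl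
HS-Sy pr {suc n} a = cong₂ _xor_ (H-Sy pr (a zero) (prodℤ (a ∘ suc))) (HS-Sy pr (a ∘ suc))

HS-odd : ∀ {p} (op : OddPrime p) {n} (a : Vc n) → HS p a ≡ hs (oddSymbol op) a
HS-odd op {zero} a = refl
HS-odd op {suc n} a = cong₂ _xor_ (H-odd op (a zero) (prodℤ (a ∘ suc))) (HS-odd op (a ∘ suc))

HS-np : ∀ {p} → ¬ Prime p → ∀ {n} (a : Vc n) → HS p a ≡ false
HS-np np {zero} a = refl
HS-np np {suc n} a = cong₂ _xor_ (H-np np (a zero) (prodℤ (a ∘ suc))) (HS-np np (a ∘ suc))

abs-pos : ∀ {x} → + 0 <ℤ x → 0 < abs x × x ≡ + abs x
abs-pos (ℤ.+<+ h) = h , refl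

abs-*-< : ∀ {x y B} → + 0 <ℤ x → + 0 <ℤ y → abs (x * y) < B → abs x < B × abs y < B
abs-*-< {x} {y} {B} px py h = ≤-<-trans (ℕP.m≤m*n (abs x) (abs y) {{ℕ.>-nonZero (proj₁ (abs-pos py))}}) h′ , ≤-<-trans (ℕP.m≤n*m (abs y) (abs x) {{ℕ.>-nonZero (proj₁ (abs-pos px))}}) h′
  where
  h′ : abs x *ᴺ abs y < B
  h′ = subst (_< B) (abs-* x y) h

T-pos : ∀ {B a b} → + 0 <ℤ a → + 0 <ℤ b → abs a < B → abs b < B → T B a b ≡ false
T-pos {B} pa pb ha hb = subst₂ (λ a b → T B a b ≡ false) (sym (proj₂ (abs-pos pa))) (sym (proj₂ (abs-pos pb))) (product-formula B (proj₁ (abs-pos pa)) (proj₁ (abs-pos pb)) ha hb)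

HS-total : ∀ {B n} (c : Vc n) → Pos c → abs (prodℤ c) < B → sumB B (λ p → HS p c) ≡ false
HS-total {B} {zero} c pc h = sumB-0 B (λ _ _ → refl)
HS-total {B} {suc n} c pc h = trans (sumB-xor B (λ p → H p (c zero) (prodℤ (c ∘ suc))) (λ p → HS p (c ∘ suc))) (cong₂ _xor_ (T-pos (pc zero) pp (proj₁ hh) (proj₂ hh)) (HS-total (c ∘ suc) (pc ∘ suc) (proj₂ hh)))
  where
  pp : + 0 <ℤ prodℤ (c ∘ suc)
  pp = prod-pos (c ∘ suc) (pc ∘ suc)
  hh : abs (c zero) < B × abs (prodℤ (c ∘ suc)) < B
  hh = abs-*-< {c zero} {prodℤ (c ∘ suc)} (pc zero) pp h

small-∤ : ∀ {p x} → + 0 <ℤ x → abs x < p → ¬ (+ p ∣ x)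
small-∤ {p} {x} px h d = <⇒≱ h (ℕD.∣⇒≤ {{ℕ.>-nonZero (proj₁ (abs-pos px))}} (∣⇒∣ᵤ d))

H-small : ∀ {p a b} → p ≢ 2 → + 0 <ℤ a → + 0 <ℤ b → abs a < p → abs b < p → H p a b ≡ false
H-small p2 pa pb ha hb = H-units p2 (λ _ → small-∤ pa ha) (λ _ → small-∤ pb hb)

HS-small : ∀ {p n} (c : Vc n) → p ≢ 2 → Pos c → abs (prodℤ c) < p → HS p c ≡ false
HS-small {p} {zero} c p2 pc h = refl
HS-small {p} {suc n} c p2 pc h = cong₂ _xor_ (H-small p2 (pc zero) pp (proj₁ hh) (proj₂ hh)) (HS-small (c ∘ suc) p2 (pc ∘ suc) (proj₂ hh))
  where
  pp : + 0 <ℤ prodℤ (c ∘ suc)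
  pp = prod-pos (c ∘ suc) (pc ∘ suc)
  hh : abs (c zero) < p × abs (prodℤ (c ∘ suc)) < p
  hh = abs-*-< {c zero} {prodℤ (c ∘ suc)} (pc zero) pp h

bil-⟂ : ∀ {n} a (G : Mat n) x → bil (a ⟂ G) x x ≡ x zero * (a * x zero) + bil G (x ∘ suc) (x ∘ suc)
bil-⟂ {n} a G x = cong₂ _+_ top (sum-cong low)
  where
  top : x zero * (a * x zero) + sumℤ (λ j → x zero * (+ 0 * x (suc j))) ≡ x zero * (a * x zero)
  top = +z (sum-0 {f = λ j → x zero * (+ 0 * x (suc j))} (λ j → *-zeroʳ (x zero)))
  low : ∀ i → x (suc i) * (+ 0 * x zero) + sumℤ (λ j → x (suc i) * (G i j * x (suc j))) ≡ sumℤ (λ j → x (suc i) * (G i j * x (suc j)))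
  low i = z+ (*-zeroʳ (x (suc i)))

lattice-⟂ : ∀ {n} {a} {G : Mat n} → + 0 <ℤ a → IsLattice G → IsLattice (a ⟂ G)
lattice-⟂ {n} {a} {G} pa (sy , pd) = sym′ , pd′
  where
  sym′ : Symmetric (a ⟂ G)
  sym′ zero zero = refl
  sym′ zero (suc j) = refl
  sym′ (suc i) zero = refl
  sym′ (suc i) (suc j) = sy i j
  re : ∀ a x → x * (a * x) ≡ a * (x * x)
  re = solve-∀
  instance
    nna : ℤ.NonNegative a
    nna = ℤ.nonNegative (ℤP.<⇒≤ pa)
  pd′ : PosDef (a ⟂ G)
  pd′ x (i , nz) = subst (+ 0 <ℤ_) (sym (bil-⟂ a G x)) (go (nonzero? (x ∘ suc)))
    where
    go : Dec (Nonzero (x ∘ suc)) → + 0 <ℤ x zero * (a * x zero) + bil G (x ∘ suc) (x ∘ suc)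
    go (yes h) = ℤP.+-mono-≤-< (subst (+ 0 ≤ℤ_) (sym (re a (x zero))) (subst (_≤ℤ a * (x zero * x zero)) (*-zeroʳ a) (ℤP.*-monoˡ-≤-nonNeg a (sq-nonneg (x zero))))) (pd (x ∘ suc) h)
    go (no h) = subst (+ 0 <ℤ_) (sym (trans (+ˡ (x zero * (a * x zero)) z) (trans (+-identityʳ (x zero * (a * x zero))) (re a (x zero))))) (pos-* pa (sq-pos x0))
      where
      z : bil G (x ∘ suc) (x ∘ suc) ≡ + 0
      z = sum-0 (λ r → sum-0 (λ s → trans (cong (_* (G r s * x (suc s))) (¬nonzero h r)) (*-zeroˡ (G r s * x (suc s)))))
      x0 : x zero ≢ + 0
      x0 q = at i nz
        where
        at : ∀ i → x i ≢ + 0 → ⊥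
        at zero n = n q
        at (suc i) n = h (i , n)

odd-⟂ : ∀ {n} a {G : Mat n} → Odd G → Odd (a ⟂ G)
odd-⟂ a {G} (x , nx) = cons (+ 0) x , λ d → nx (subst (+ 2 ℤU.∣_) (bil-cons0 (a ⟂ G) x x) d)

odd-head : ∀ {n} {a} (G : Mat n) → ¬ (+ 2 ∣ a) → Odd (a ⟂ G)
odd-head {n} {a} G na = ê zero , λ d → na (subst (+ 2 ∣_) (bil-e (a ⟂ G) zero zero) (∣ᵤ⇒∣ d))

embeds-tail : ∀ {m n a} {G : Mat n} → EmbedsInOddUnimodular m (a ⟂ G) → EmbedsInOddUnimodular m G
embeds-tail {m} {n} (U , lat , d , od , A , iso , inj) = U , lat , d , od , (λ r i → A r (suc i)) , (λ i j → iso (suc i) (suc j)) ,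
  λ x z i → inj (cons (+ 0) x) (λ r → trans (z+ (*-zeroʳ (A r zero))) (z r)) (suc i)

frame-⟂′ : ∀ {p n a} {G : Mat n} → + 0 <ℤ a → IsLattice G → Frame p G → Frame p (a ⟂ G)
frame-⟂′ {a = a} {G} pa lat fr = frame-⟂ {N = a ⟂ G} (λ _ → refl) (proj₁ (lattice-⟂ {G = G} pa lat)) fr

frame-orth : ∀ {n} {M : Mat n} → IsLattice M → (fr : Frame 3 M) → (∀ {p} (op : OddPrime p) → hs (oddSymbol op) (Frame.c fr) ≡ false) → OrthS M
frame-orth {M = M} lat fr z op = Frame.F fr , Frame.c fr , frame-pos {M = M} (proj₂ lat) fr , Frame.gram fr , z op

module _ {p} (S : LocalSymbol p) where
  open LocalSymbol S
  open SymbolProperties S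

  -- Of the symbols (a, d) two cancel and the third merges with (a, a) = (a, -1) into (a, -d).
  hs-plane : ∀ {n} {a d} (c : Vc n) → a ≢ + 0 → d ≢ + 0 → (∀ i → c i ≢ + 0) → SqEq d (prodℤ c) →
    hs S (cons a (cons (a * d) c)) ≡ h a (- d) xor (hs S c xor h d d)
  hs-plane {n} {a} {d} c a0 d0 c0 sq = trans (cong₂ (λ x y → x xor (y xor hs S c))
      (trans (h-*ʳ (*-nz a0 d0) Π0 a) (cong₂ _xor_ (h-*ʳ a0 d0 a) (hΠ a)))
      (trans (h-*ˡ a0 d0 Π) (cong₂ _xor_ (hΠ a) (hΠ d))))
    (trans (taut 4 (λ { (x ∷ y ∷ z ∷ w ∷ []) → ((x xor y) xor y) xor ((y xor z) xor w) }) (λ { (x ∷ y ∷ z ∷ w ∷ []) → (y xor x) xor (w xor z) }) refl (h a a ∷ h a d ∷ h d d ∷ hs S c ∷ []))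
      (cong (_xor (hs S c xor h d d)) (sym (trans (cong (h a) (neg≡ d)) (trans (h-*ʳ d0 (λ ()) a) (cong (h a d xor_) (sym (h-self a0))))))))
    where
    Π : ℤ
    Π = prodℤ c
    Π0 : Π ≢ + 0
    Π0 = prod-nz c0
    hΠ : ∀ z → h z Π ≡ h z d
    hΠ z = trans (h-comm z Π) (trans (sym (sqEq-h S d0 Π0 sq z)) (h-comm d z))

  hs-line : ∀ {n} {d} (c : Vc n) → d ≢ + 0 → (∀ i → c i ≢ + 0) → SqEq d (prodℤ c) → hs S (cons d c) ≡ h d d xor hs S c
  hs-line {n} {d} c d0 c0 sq = cong (_xor hs S c) (trans (h-comm d (prodℤ c)) (sym (sqEq-h S d0 (prod-nz c0) sq d)))

module Complement {n} {G : Mat n} (lat : IsLattice G) (fr : Frame 3 G) where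
  private
    d : ℤ
    d = det G
    pd : + 0 <ℤ d
    pd = pos-det {M = G} lat
    c : Vc n
    c = Frame.c fr
    c0 : ∀ i → c i ≢ + 0
    c0 i = pos-nz (frame-pos {M = G} (proj₂ lat) fr i)
    d0 : d ≢ + 0
    d0 = pos-nz pd
    sq : SqEq d (prodℤ c)
    sq = frame-sqEq (proj₁ prime3) {M = G} fr
    vpΠ : ∀ {p} → Prime p → vp p (prodℤ c) ≡ vp p d
    vpΠ pr = sym (sqEq-vp pr d0 (prod-nz c0) sq)

  -- The enlarged determinant is the square of a·det G, so its valuations are even, and the last
  -- hypothesis makes the odd symbols trivial. Oddness is inherited from G or comes from the vector
  -- of norm `a`.
  embed-plane : ∀ {a} → + 0 <ℤ a → Odd G ⊎ ¬ (+ 2 ∣ a) → (∀ {p} → OddPrime p → H p a (- d) ≡ HS p c xor H p d d) → EmbedsInOddUnimodular (suc (suc n)) G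
  embed-plane {a} pa od hyp = embeds-tail {a = a * d} {G} (embeds-tail {a = a} {M₁} (embeds-same M latM (odM od) even (frame-orth {M = M} latM frM zero′)))
    where
    a0 : a ≢ + 0
    a0 = pos-nz pa
    M₁ : Mat (suc n)
    M₁ = (a * d) ⟂ G
    M : Mat (suc (suc n))
    M = a ⟂ M₁
    lat₁ : IsLattice M₁
    lat₁ = lattice-⟂ {G = G} (pos-* pa pd) lat
    latM : IsLattice M
    latM = lattice-⟂ {G = M₁} pa lat₁
    frM : Frame 3 M
    frM = frame-⟂′ {G = M₁} pa lat₁ (frame-⟂′ {G = G} (pos-* pa pd) lat fr)
    odM : Odd G ⊎ ¬ (+ 2 ∣ a) → Odd M
    odM (inj₁ o) = odd-⟂ a {M₁} (odd-⟂ (a * d) {G} o)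
    odM (inj₂ o) = odd-head M₁ o
    Π0 : a * d * prodℤ c ≢ + 0
    Π0 = *-nz (*-nz a0 d0) (prod-nz c0)
    even : ∀ {p} → Prime p → vp p (det M) ≡ false
    even {p} pr = trans (sqEq-vp pr (pos-nz (pos-det {M = M} latM)) (*-nz a0 Π0) (frame-sqEq (proj₁ prime3) {M = M} frM))
      (trans (vp-* pr a0 Π0) (trans (cong (vp p a xor_) (trans (vp-* pr (*-nz a0 d0) (prod-nz c0)) (cong₂ _xor_ (vp-* pr a0 d0) (vpΠ pr))))
        (taut 2 (λ { (x ∷ y ∷ []) → x xor ((x xor y) xor y) }) (λ { (x ∷ y ∷ []) → false }) refl (vp p a ∷ vp p d ∷ []))))
    zero′ : ∀ {p} (op : OddPrime p) → hs (oddSymbol op) (cons a (cons (a * d) c)) ≡ false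
    zero′ {p} op = trans (hs-plane (oddSymbol op) c a0 d0 c0 sq) (trans (cong₂ _xor_ (sym (H-odd op a (- d))) (cong₂ _xor_ (sym (HS-odd op c)) (sym (H-odd op d d)))) (trans (cong (_xor (HS p c xor H p d d)) (hyp op)) (xor-same (HS p c xor H p d d))))

  embed-line : Odd G → (∀ {p} → OddPrime p → HS p c ≡ H p d d) → EmbedsInOddUnimodular (suc n) G
  embed-line od hyp = embeds-tail {a = d} {G} (embeds-same M latM (odd-⟂ d {G} od) even (frame-orth {M = M} latM frM zero′))
    where
    M : Mat (suc n)
    M = d ⟂ G
    latM : IsLattice M
    latM = lattice-⟂ {G = G} pd lat
    frM : Frame 3 M
    frM = frame-⟂′ {G = G} pd lat fr
    even : ∀ {p} → Prime p → vp p (det M) ≡ false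
    even {p} pr = trans (sqEq-vp pr (pos-nz (pos-det {M = M} latM)) (*-nz d0 (prod-nz c0)) (frame-sqEq (proj₁ prime3) {M = M} frM))
      (trans (vp-* pr d0 (prod-nz c0)) (trans (cong (vp p d xor_) (vpΠ pr)) (xor-same (vp p d))))
    zero′ : ∀ {p} (op : OddPrime p) → hs (oddSymbol op) (cons d c) ≡ false
    zero′ {p} op = trans (hs-line (oddSymbol op) c d0 c0 sq) (trans (cong₂ _xor_ (sym (H-odd op d d)) (trans (sym (HS-odd op c)) (hyp op))) (xor-same (H p d d)))

module PlaneCase {n} {G : Mat n} (lat : IsLattice G) (fr : Frame 3 G) where
  c : Vc n
  c = Frame.c fr

  pc : Pos c
  pc = frame-pos {M = G} (proj₂ lat) fr

  d : ℕ
  d = abs (det G)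

  d>0 : 0 < d
  d>0 = proj₁ (abs-pos (pos-det {M = G} lat))

  det≡ : det G ≡ + d
  det≡ = proj₂ (abs-pos (pos-det {M = G} lat))

  -- The sign demanded of (a, -d)_p.
  E : ℕ → Bool
  E p = HS p c xor H p (+ d) (+ d)

  open Genera d d>0 using (-d)
  open Auxiliary d d>0

  B : ℕ
  B = 3 +ᴺ (d +ᴺ abs (prodℤ c))

  d<B : d < B
  d<B = s≤s (≤-trans (m≤m+n d (abs (prodℤ c))) (m≤n+m (d +ᴺ abs (prodℤ c)) 2))

  c<B : abs (prodℤ c) < B
  c<B = s≤s (≤-trans (m≤n+m (abs (prodℤ c)) d) (m≤n+m (d +ᴺ abs (prodℤ c)) 2))

  -- The first two hypotheses express consistency where -d is a local square. The last one deals
  -- with the exceptional situation, in which `a` comes out even.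
  embeds : (∀ {p} → OddPrime p → vp p -d ≡ false → H p (+ p) -d ≡ false → E p ≡ false) →
    (vp 2 -d ≡ false → ε₂ (unit 2 -d) ≡ false → H 2 (+ 2) -d ≡ false → E 2 ≡ false) →
    Odd G ⊎ ¬ Exceptional E → EmbedsInOddUnimodular (suc (suc n)) G
  embeds ho hd ho′ = fin (existence L)
    where
    +d : + 0 <ℤ + d
    +d = ℤ.+<+ d>0
    L : Locals B E
    L = record
      { np = λ h → cong₂ _xor_ (HS-np h c) (H-np h (+ d) (+ d))
      ; big = λ {p} h → cong₂ _xor_ (HS-small c (λ e → <⇒≢ (≤-trans (s≤s (s≤s (s≤s z≤n))) h) (sym e)) pc (<-≤-trans c<B h)) (H-small (λ e → <⇒≢ (≤-trans (s≤s (s≤s (s≤s z≤n))) h) (sym e)) +d +d (<-≤-trans d<B h) (<-≤-trans d<B h))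
      ; odd = ho ; dyad = hd
      ; total = trans (sumB-xor B (λ p → HS p c) (λ p → H p (+ d) (+ d))) (cong₂ _xor_ (HS-total c pc c<B) (T-pos +d +d d<B d<B)) }
    fin : (∃ λ a → 0 < a × (∀ {p} → OddPrime p → H p (+ a) -d ≡ E p) × (¬ (+ 2 ∣ + a) ⊎ Exceptional E)) → EmbedsInOddUnimodular (suc (suc n)) G
    fin (a , a0 , ha , ex) = Complement.embed-plane {G = G} lat fr {+ a} (ℤ.+<+ a0) (od ho′ ex) (λ {p} op → subst (λ z → H p (+ a) (- z) ≡ HS p c xor H p z z) (sym det≡) (ha op))
      where
      od : Odd G ⊎ ¬ Exceptional E → ¬ (+ 2 ∣ + a) ⊎ Exceptional E → Odd G ⊎ ¬ (+ 2 ∣ + a)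
      od (inj₁ o) _ = inj₁ o
      od (inj₂ _) (inj₁ o) = inj₂ o
      od (inj₂ x) (inj₂ y) = ⊥-elim (x y)

-- Local square classes and codimension at most two.

vp-neg : ∀ {p} → Prime p → ∀ {x} → x ≢ + 0 → vp p (- x) ≡ vp p x
vp-neg {p} pr {x} x0 = trans (cong (vp p) (neg≡ x)) (trans (vp-* pr x0 (λ ())) (trans (cong (vp p x xor_) (proj₁ (unit-cls pr (-1∤ pr)))) (xor-identityʳ (vp p x))))

par-even : ∀ n → par n ≡ false → ∃ λ k → n ≡ k +ᴺ k
par-even n e = go (half n)
  where
  go : (∃ λ h → n ≡ h +ᴺ h) ⊎ (∃ λ h → n ≡ suc (h +ᴺ h)) → ∃ λ k → n ≡ k +ᴺ k
  go (inj₁ h) = h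
  go (inj₂ (h , q)) = case trans (sym e) (trans (cong par q) (cong not (par-double h))) of λ ()

root-scale : ∀ {p u} k → Root p u → Root p (pk p (k +ᴺ k) * u)
root-scale {p} {u} k (w , r) = Z* (pk p k) w , λ i → ∣-lc1 (r i) (pk p k * pk p k) (trans (cong (λ z → pk p k * seq w i * (pk p k * seq w i) - z * u) (pk-+ p k k)) (re (pk p k) (seq w i) u))
  where
  re : ∀ P w u → P * w * (P * w) - P * P * u ≡ P * P * (w * w - u)
  re = solve-∀

root-unit : ∀ {p} → Prime p → ∀ {x} → x ≢ + 0 → vp p x ≡ false → Root p (unit p x) → Root p x
root-unit {p} pr {x} x0 v r = go (par-even (val p x) v)
  where
  go : (∃ λ k → val p x ≡ k +ᴺ k) → Root p x
  go (k , e) = subst (Root p) (sym (trans (val-spec pr x0) (cong (λ n → pk p n * unit p x) e))) (root-scale {p} {unit p x} k r)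

root⇒minusOne : ∀ {p d} → Root p (- d) → SqClassEq p d minusOne
root⇒minusOne {p} {d} (w , r) = 0 , w , λ k → ∣⇒∣ᵤ {pk p k} {d * (pk p 0 * pk p 0) - minusOne * (seq w k * seq w k)} (subst (pk p k ∣_) (re d (seq w k)) (r k))
  where
  re : ∀ d w → w * w - - d ≡ d * (+ 1 * + 1) - - (+ 1) * (w * w)
  re = solve-∀

-- 1/3 = −(1 + 4 + 16 + ⋯) in ℤ₂.
third : ℕ → ℤ
third zero    = + 0
third (suc k) = third k - pk 2 k * pk 2 k

third-spec : ∀ k → + 3 * third k ≡ + 1 - pk 2 k * pk 2 k
third-spec zero = refl
third-spec (suc k) = trans (re1 (third k) (pk 2 k)) (trans (cong (_- + 3 * (pk 2 k * pk 2 k)) (third-spec k)) (trans (re2 (pk 2 k)) (cong (λ z → + 1 - z * z) (sym (pk-suc 2 k)))))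
  where
  re1 : ∀ t P → + 3 * (t - P * P) ≡ + 3 * t - + 3 * (P * P)
  re1 = solve-∀
  re2 : ∀ P → + 1 - P * P - + 3 * (P * P) ≡ + 1 - + 2 * P * (+ 2 * P)
  re2 = solve-∀

-- w = √(3d)/3 satisfies 3w² = d, with 1/3 approximated by `third`.
root⇒three : ∀ {d} → Root 2 (+ 3 * d) → SqClassEq 2 d three
root⇒three {d} (r , rr) = 0 , w , λ k → ∣⇒∣ᵤ {pk 2 k} {d * (pk 2 0 * pk 2 0) - three * (seq w k * seq w k)} (main k)
  where
  re0 : ∀ r′ r t Q → r′ * (t - Q) - r * t ≡ t * (r′ - r) + - r′ * Q
  re0 = solve-∀
  w : Zp 2
  w = (λ k → seq r k * third k) , λ k → ∣⇒∣ᵤ {pk 2 k} {seq r (suc k) * third (suc k) - seq r k * third k} (∣-lc2 (∣ᵤ⇒∣ {pk 2 k} {seq r (suc k) - seq r k} (proj₂ r k)) (∣m⇒∣m*n (pk 2 k) ∣-refl) (third k) (- seq r (suc k)) (re0 (seq r (suc k)) (seq r k) (third k) (pk 2 k * pk 2 k)))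
  main : ∀ k → pk 2 k ∣ d * (+ 1 * + 1) - + 3 * (seq r k * third k * (seq r k * third k))
  main k = ∣-lc2 (rr k) (subst (pk 2 k ∣_) (sym (trans (cong (λ z → + 1 - z * z) (third-spec k)) (re2 (pk 2 k)))) (∣m⇒∣m*n (+ 2 * pk 2 k - pk 2 k * pk 2 k * pk 2 k) ∣-refl)) (- (+ 3) * (third k * third k)) d (re1 d (seq r k) (third k))
    where
    re1 : ∀ d r t → d * (+ 1 * + 1) - + 3 * (r * t * (r * t)) ≡ - (+ 3) * (t * t) * (r * r - + 3 * d) + d * (+ 1 - (+ 3 * t) * (+ 3 * t))
    re1 = solve-∀
    re2 : ∀ P → + 1 - (+ 1 - P * P) * (+ 1 - P * P) ≡ P * (+ 2 * P - P * P * P)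
    re2 = solve-∀

-- Truncation one digit beyond the valuation of d·p²ʲ gives an integer square of the same valuation.
sqClass-one⇒even : ∀ {p} → Prime p → ∀ {d} → d ≢ + 0 → SqClassEq p d one → vp p d ≡ false
sqClass-one⇒even {p} pr {d} d0 (j , w , eq) = fin (∣ᵤ⇒∣ {pk p (suc v)} {N - + 1 * (x * x)} (eq (suc v)))
  where
  P : ℤ
  P = pk p j
  P0 : P ≢ + 0
  P0 = pk≢0 pr j
  N : ℤ
  N = d * (P * P)
  N0 : N ≢ + 0
  N0 = *-nz d0 (*-nz P0 P0)
  v : ℕ
  v = val p N
  u x : ℤ
  u = unit p N
  x = seq w (suc v)
  vN : vp p N ≡ vp p d
  vN = trans (vp-* pr d0 (*-nz P0 P0)) (trans (cong (vp p d xor_) (trans (vp-* pr P0 P0) (xor-same (vp p P)))) (xor-identityʳ (vp p d)))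
  fin : pk p (suc v) ∣ N - + 1 * (x * x) → vp p d ≡ false
  fin (divides q e) = trans (sym vN) (trans (cong par (sym (proj₁ (val-of pr v u′ xx nu)))) (trans (vp-* pr x0 x0) (xor-same (vp p x))))
    where
    u′ : ℤ
    u′ = u - + p * q
    re1 : ∀ N X → X ≡ N - (N - + 1 * X)
    re1 = solve-∀
    re2 : ∀ V u q p → V * u - q * (p * V) ≡ V * (u - p * q)
    re2 = solve-∀
    xx : x * x ≡ pk p v * u′
    xx = trans (re1 N (x * x)) (trans (cong₂ _-_ (val-spec pr N0) (trans e (cong (q *_) (pk-suc p v)))) (re2 (pk p v) u q (+ p)))
    re3 : ∀ u p q → u - p * q + p * q ≡ u
    re3 = solve-∀
    nu : ¬ (+ p ∣ u′)
    nu z = unit-∤ pr N0 (subst (+ p ∣_) (re3 u (+ p) q) (∣m∣n⇒∣m+n z (∣m⇒∣m*n q ∣-refl)))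
    x0 : x ≢ + 0
    x0 z = *-nz (pk≢0 pr v) (w≢0 nu) (trans (sym xx) (cong₂ _*_ z z))

globalFrame : ∀ {n} {G : Mat n} → IsLattice G → Frame 3 G
globalFrame {n} {G} lat = frame prime3 n G lat

hasse-value : ∀ {p} (S : LocalSymbol p) {n} {G : Mat n} (lat : IsLattice G) b → HasseIs G p (sgn b) → hs S (Frame.c (globalFrame {G = G} lat)) ≡ b
hasse-value S {G = G} lat b h = sym (sgn-inj {b} (hasse⇒ S {G = G} lat h (globalFrame {G = G} lat)))

caseA : ∀ {n} {G : Mat n} → IsLattice G → Odd G → (∀ p → Prime p → DetVpIs G p one × HasseIs G p one) → EmbedsInOddUnimodular n G
caseA {n} {G} lat od hyp = embeds-same G lat od (λ {p} pr → sqClass-one⇒even pr (pos-nz (pos-det {M = G} lat)) (proj₁ (hyp p pr)))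
  (frame-orth {M = G} lat (globalFrame {G = G} lat) (λ {p} op → hasse-value (oddSymbol op) {G = G} lat false (proj₂ (hyp p (proj₁ op)))))

caseB : ∀ {n} {G : Mat n} → IsLattice G → Odd G → (∀ p → Prime p → Σ ℤ λ s → HasseIs G p s × HilbertIs p (toℚ (det G)) (toℚ (det G)) s) → EmbedsInOddUnimodular (suc n) G
caseB {n} {G} lat od hyp = Complement.embed-line {G = G} lat fr od (λ {p} op → loc op (hyp p (proj₁ op)))
  where
  fr : Frame 3 G
  fr = globalFrame {G = G} lat
  d : ℤ
  d = det G
  loc : ∀ {p} (op : OddPrime p) → (Σ ℤ λ s → HasseIs G p s × HilbertIs p (toℚ d) (toℚ d) s) → HS p (Frame.c fr) ≡ H p d d
  loc {p} op (s , hs′ , hil) = trans (HS-odd op (Frame.c fr)) (trans (sgn-inj (trans (sym (hasse⇒ S {G = G} lat hs′ fr)) (trans (hilbertIs-unique {toℚ d} {toℚ d} hil (hilbertIs (toℚ d) (toℚ d) nz nz)) (cong sgn (cong₂ (hodd op) cld cld))))) (sym (H-odd op d d)))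
    where
    S : LocalSymbol p
    S = oddSymbol op
    open SymbolProperties S using (cl; hilbertIs; hilbertIs-unique)
    nz : ↥ (toℚ d) ≢ + 0
    nz q = pos-nz (pos-det {M = G} lat) (trans (sym (↥toℚ d)) q)
    cld : cl (toℚ d) ≡ d
    cld = trans (cong₂ _*_ (↥toℚ d) (↧toℚ d)) (*-identityʳ d)

module _ {d : ℕ} (d>0 : 0 < d) where
  open Genera d d>0 using (-d; -d≢0)

  private
    d≡ : + d ≡ -d * - (+ 1)
    d≡ = trans (sym (neg-involutive (+ d))) (neg≡ -d)

  odd-self : ∀ {p} (op : OddPrime p) → vp p -d ≡ false → H p (+ d) (+ d) ≡ false
  odd-self {p} op v = trans (H-odd op (+ d) (+ d)) (cong (λ b → OddSymbol.F op b b (OddSymbol.ℓ op (+ d)) (OddSymbol.ℓ op (+ d))) (trans (sym (vp-neg (proj₁ op) (pos≢0 d>0))) v))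

  -- (d, d) = (d, -1) = (-d, -1)(-1, -1). For -d ≡ 1 modulo 4 up to squares the first factor is
  -- trivial and the second is -1; this is the origin of the sign -1 in the dyadic condition.
  dyadic-self : vp 2 -d ≡ false → ε₂ (unit 2 -d) ≡ false → H 2 (+ d) (+ d) ≡ true
  dyadic-self v e = trans (H-self 2 (pos≢0 d>0)) (trans (cong (λ z → H 2 z (- (+ 1))) d≡) (trans (H-*ˡ 2 -d≢0 (λ ()) (- (+ 1))) (cong₂ _xor_
      (trans (H-2 -d (- (+ 1))) (cong₂ (λ (s , b) t → F₂ s t b (β₂ (unit 2 -d)) (ε₂ (unit 2 (- (+ 1)))) (β₂ (unit 2 (- (+ 1))))) (cong₂ _,_ v e) (proj₁ (unit-cls prime[2] (-1∤ prime[2])))))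
      (trans (H-2 (- (+ 1)) (- (+ 1))) (trans (h2-units (-1∤ prime[2]) (-1∤ prime[2])) (cong₂ _∧_ ε₂-neg1 ε₂-neg1))))))

  -- For unramified -d the symbol (p, -d) is the residue character of its unit part, so triviality
  -- makes -d a square by Hensel.
  odd-square : ∀ {p} (op : OddPrime p) → vp p -d ≡ false → H p (+ p) -d ≡ false → SqClassEq p (+ d) minusOne
  odd-square {p} op v hp = root⇒minusOne {d = + d} (root-unit (proj₁ op) -d≢0 v (hensel-odd op (unit-∤ (proj₁ op) -d≢0) (Odds.leg-false op lg)))
    where
    lg : Odds.leg op (unit p -d) ≡ false
    lg = trans (sym (trans (H-odd op (+ p) -d) (cong₂ (λ s t → OddSymbol.F op s t (OddSymbol.ℓ op (+ p)) (OddSymbol.ℓ op -d)) (proj₁ (p-cls (proj₁ op))) v))) hp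

  dyadic-β : vp 2 -d ≡ false → ε₂ (unit 2 -d) ≡ false → H 2 (+ 2) -d ≡ β₂ (unit 2 -d)
  dyadic-β v e = trans (H-2 (+ 2) -d) (trans (cong₂ (λ s (t , c) → F₂ s t (ε₂ (unit 2 (+ 2))) (β₂ (unit 2 (+ 2))) c (β₂ (unit 2 -d))) (proj₁ (p-cls prime[2])) (cong₂ _,_ v e)) (taut 2 (λ { (x ∷ y ∷ []) → (x ∧ false) xor (y xor false) }) (λ { (x ∷ y ∷ []) → y }) refl (ε₂ (unit 2 (+ 2)) ∷ β₂ (unit 2 -d) ∷ [])))

  private
    mod8′ : ∀ {b} → ε₂ (unit 2 -d) ≡ false → β₂ (unit 2 -d) ≡ b → ∃ λ q → unit 2 -d ≡ form8 false b q
    mod8′ {b} e f = proj₁ m , trans (proj₂ m) (cong₂ (λ x y → form8 x y (proj₁ m)) e f)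
      where
      m : ∃ λ q → unit 2 -d ≡ form8 (ε₂ (unit 2 -d)) (β₂ (unit 2 -d)) q
      m = mod8 (unit-∤ prime[2] -d≢0)

  dyadic-square : vp 2 -d ≡ false → ε₂ (unit 2 -d) ≡ false → H 2 (+ 2) -d ≡ false → SqClassEq 2 (+ d) minusOne
  dyadic-square v e hp = root⇒minusOne {d = + d} (root-unit prime[2] -d≢0 v (go (mod8′ e (trans (sym (dyadic-β v e)) hp))))
    where
    re : ∀ q → + 1 + + 2 * (+ 0 + + 2 * (+ 0 + + 2 * q)) - + 1 ≡ q * + 8
    re = solve-∀
    go : (∃ λ q → unit 2 -d ≡ form8 false false q) → Root 2 (unit 2 -d)
    go (q , eq) = hensel-2 {unit 2 -d} (divides q (trans (cong (_- + 1) eq) (re q)))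

  -- The unit part of -d is 5 modulo 8, so -3 times it is 1 modulo 8 and 3d is a square.
  dyadic-three : vp 2 -d ≡ false → ε₂ (unit 2 -d) ≡ false → H 2 (+ 2) -d ≡ true → SqClassEq 2 (+ d) three
  dyadic-three v e hp = root⇒three {+ d} (go (par-even (val 2 -d) v) (mod8′ e (trans (sym (dyadic-β v e)) hp)))
    where
    re : ∀ q → - (+ 3) * (+ 1 + + 2 * (+ 0 + + 2 * (+ 1 + + 2 * q))) - + 1 ≡ (- (+ 2) - + 3 * q) * + 8
    re = solve-∀
    re2 : ∀ d → + 3 * d ≡ - (+ 3) * - d
    re2 = solve-∀
    re3 : ∀ P u → - (+ 3) * (P * u) ≡ P * (- (+ 3) * u)
    re3 = solve-∀
    go : (∃ λ k → val 2 -d ≡ k +ᴺ k) → (∃ λ q → unit 2 -d ≡ form8 false true q) → Root 2 (+ 3 * + d)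
    go (k , ek) (q , eq) = subst (Root 2) (sym (trans (re2 (+ d)) (trans (cong (- (+ 3) *_) (trans (val-spec prime[2] -d≢0) (cong (λ n → pk 2 n * unit 2 -d) ek))) (re3 (pk 2 (k +ᴺ k)) (unit 2 -d)))))
      (root-scale {2} {u} k (hensel-2 {u} (divides (- (+ 2) - + 3 * q) (trans (cong (λ z → - (+ 3) * z - + 1) eq) (re q)))))
      where
      u : ℤ
      u = - (+ 3) * unit 2 -d

caseC : ∀ {n} {G : Mat n} → IsLattice G → Odd G ⊎ ¬ (DetVpIs G 2 three × HasseIs G 2 one) →
  (∀ p → Prime p → (2 < p → DetVpIs G p minusOne → HasseIs G p one) × (p ≡ 2 → DetVpIs G 2 minusOne → HasseIs G 2 minusOne)) → EmbedsInOddUnimodular (suc (suc n)) G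
caseC {n} {G} lat od hyp = embeds ho hd (od′ od)
  where
  open PlaneCase {G = G} lat (globalFrame {G = G} lat)
  open Genera d d>0 using (-d)
  open Auxiliary d d>0 using (Exceptional)
  det′ : ∀ p c → SqClassEq p (+ d) c → DetVpIs G p c
  det′ p c = subst (λ z → SqClassEq p z c) (sym det≡)
  ho : ∀ {p} → OddPrime p → vp p -d ≡ false → H p (+ p) -d ≡ false → E p ≡ false
  ho {p} op v hp = cong₂ _xor_ (trans (HS-odd op c) (hasse-value (oddSymbol op) {G = G} lat false (proj₁ (hyp p (proj₁ op)) (≤∧≢⇒< (prime>1 (proj₁ op)) (λ e → proj₂ op (sym e))) (det′ p minusOne (odd-square d>0 op v hp))))) (odd-self d>0 op v)
  hd : vp 2 -d ≡ false → ε₂ (unit 2 -d) ≡ false → H 2 (+ 2) -d ≡ false → E 2 ≡ false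
  hd v e hp = cong₂ _xor_ (trans (HS-Sy prime[2] c) (hasse-value (Sy prime[2]) {G = G} lat true (proj₂ (hyp 2 prime[2]) refl (det′ 2 minusOne (dyadic-square d>0 v e hp))))) (dyadic-self d>0 v e)
  -- Being exceptional means det = 3 at 2 and, because (d, d)₂ = -1 there, S₂ = 1: exactly the
  -- excluded pair.
  exc : Exceptional E → DetVpIs G 2 three × HasseIs G 2 one
  exc (v , e , hp , E2) = det′ 2 three (dyadic-three d>0 v e hp) , subst (HasseIs G 2) (cong sgn hs≡) (hasse⇐ (Sy prime[2]) {G = G} lat (globalFrame {G = G} lat))
    where
    hs≡ : hs (Sy prime[2]) c ≡ false
    hs≡ = trans (sym (HS-Sy prime[2] c)) (flip (HS 2 c) (trans (cong (HS 2 c xor_) (sym (dyadic-self d>0 v e))) E2))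
      where
      flip : ∀ b → b xor true ≡ true → b ≡ false
      flip false _ = refl
  od′ : Odd G ⊎ ¬ (DetVpIs G 2 three × HasseIs G 2 one) → Odd G ⊎ ¬ Exceptional E
  od′ (inj₁ o) = inj₁ o
  od′ (inj₂ x) = inj₂ (λ z → x (exc z))

-- Codimension at least three.

HS-units : ∀ {p} → OddPrime p → ∀ {n} (c : Vc n) → ¬ (+ p ∣ prodℤ c) → HS p c ≡ false
HS-units op {zero} c _ = refl
HS-units {p} op {suc n} c nd = cong₂ _xor_ (H-units (proj₂ op) (λ _ h → nd (∣m⇒∣m*n (prodℤ (c ∘ suc)) h)) (λ _ → nt)) (HS-units op (c ∘ suc) nt)
  where
  nt : ¬ (+ p ∣ prodℤ (c ∘ suc))
  nt h = nd (∣n⇒∣m*n (c zero) h)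

-- A frame at `p` then has unit entries only, and symbols of units are trivial.
unimodular-hasse : ∀ {p} (op : OddPrime p) {n} {G : Mat n} → IsLattice G → ¬ (+ p ∣ det G) → (fr : Frame 3 G) → HS p (Frame.c fr) ≡ false
unimodular-hasse {p} op {n} {G} lat nd fr = trans (HS-odd op (Frame.c fr)) (trans (sym (heq (orth-equ {M = G} (proj₂ lat) fp (Frame.F fr) (Frame.c fr) (frame-pos {M = G} (proj₂ lat) fr) (Frame.gram fr)) (oddSymbol op)))
    (trans (sym (HS-odd op (Frame.c fp))) (HS-units op (Frame.c fp) (λ h → ∤-* (proj₁ op) nd (∤-* (proj₁ op) nF nF) (subst (+ p ∣_) (sym (frame-det {M = G} fp)) h)))))
  where
  fp : Frame p G
  fp = frame op n G lat
  nF : ¬ (+ p ∣ det (Frame.F fp))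
  nF = frame-det∤ (proj₁ op) {M = G} fp

module Stabilise {n} {G : Mat n} (lat : IsLattice G) where
  fr : Frame 3 G
  fr = globalFrame {G = G} lat

  d : ℤ
  d = det G

  d0 : d ≢ + 0
  d0 = pos-nz (pos-det {M = G} lat)

  -- Chosen so that a·det G has odd valuation at every prime dividing 2·det G:
  -- then −a·det G is a local square at no such prime.
  A : ℕ → Bool
  A p = does (prime? p) ∧ (does (+ p ∣? + 2 * d) ∧ not (vp p d))

  A-prime : ∀ {p} → A p ≡ true → Prime p
  A-prime {p} e = go (prime? p) e
    where
    go : (x : Dec (Prime p)) → does x ∧ (does (+ p ∣? + 2 * d) ∧ not (vp p d)) ≡ true → Prime p
    go (yes pr) _ = pr
    go (no _) ()

  a : ℤ
  a = + prodP A (suc (abs (+ 2 * d)))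

  pa : + 0 <ℤ a
  pa = ℤ.+<+ (prodP>0 A A-prime (suc (abs (+ 2 * d))))

  a0 : a ≢ + 0
  a0 = pos-nz pa

  vp-a : ∀ {p} → Prime p → vp p a ≡ A p
  vp-a {p} pr = vp-prodP A A-prime pr (suc (abs (+ 2 * d))) (λ h → trans (cong (λ b → does (prime? p) ∧ (b ∧ not (vp p d))) (dec-false (+ p ∣? + 2 * d) (small-∤ {p} {+ 2 * d} (pos-* {+ 2} {d} (ℤ.+<+ (s≤s z≤n)) (pos-det {M = G} lat)) h))) (∧-zeroʳ (does (prime? p))))

  ramified : ∀ {p} → Prime p → + p ∣ + 2 * d → vp p a xor vp p d ≡ true
  ramified {p} pr h = trans (cong (_xor vp p d) (trans (vp-a pr) (cong₂ (λ x y → x ∧ (y ∧ not (vp p d))) (dec-true (prime? p) pr) (dec-true (+ p ∣? + 2 * d) h)))) (taut 1 (λ { (x ∷ []) → not x xor x }) (λ { (x ∷ []) → true }) refl (vp p d ∷ []))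

  unramified : ∀ {p} → Prime p → ¬ (+ p ∣ + 2 * d) → vp p a ≡ false
  unramified {p} pr h = trans (vp-a pr) (trans (cong (λ y → does (prime? p) ∧ (y ∧ not (vp p d))) (dec-false (+ p ∣? + 2 * d) h)) (∧-zeroʳ (does (prime? p))))

  -- Copies of ⟨1⟩ bring the rank up to m - 2 without changing the determinant class or the symbols.
  K : ∀ k → Mat (k +ᴺ suc n)
  K zero    = a ⟂ G
  K (suc k) = + 1 ⟂ K k

  latK : ∀ k → IsLattice (K k)
  latK zero = lattice-⟂ {G = G} pa lat
  latK (suc k) = lattice-⟂ {G = K k} (ℤ.+<+ (s≤s z≤n)) (latK k)

  frK : ∀ k → Frame 3 (K k)
  frK zero = frame-⟂′ {G = G} pa lat fr
  frK (suc k) = frame-⟂′ {G = K k} (ℤ.+<+ (s≤s z≤n)) (latK k) (frK k)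

  embeds-K : ∀ {m} k → EmbedsInOddUnimodular m (K k) → EmbedsInOddUnimodular m G
  embeds-K zero e = embeds-tail {a = a} {G} e
  embeds-K (suc k) e = embeds-K k (embeds-tail {a = + 1} {K k} e)

  prodK : ∀ k → prodℤ (Frame.c (frK k)) ≡ a * prodℤ (Frame.c fr)
  prodK zero = refl
  prodK (suc k) = trans (*-identityˡ (prodℤ (Frame.c (frK k)))) (prodK k)

  hsK : ∀ p k → HS p (Frame.c (frK k)) ≡ H p a (prodℤ (Frame.c fr)) xor HS p (Frame.c fr)
  hsK p zero = refl
  hsK p (suc k) = trans (cong (_xor HS p (Frame.c (frK k))) (H-1 p (prodℤ (Frame.c (frK k))))) (hsK p k)

  c0 : ∀ i → Frame.c fr i ≢ + 0
  c0 i = pos-nz (frame-pos {M = G} (proj₂ lat) fr i)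

  vpΠ : ∀ {p} → Prime p → vp p (prodℤ (Frame.c fr)) ≡ vp p d
  vpΠ pr = sym (sqEq-vp pr d0 (prod-nz c0) (frame-sqEq (proj₁ prime3) {M = G} fr))

  vpK : ∀ {p} → Prime p → ∀ k → vp p (det (K k)) ≡ vp p a xor vp p d
  vpK {p} pr k = trans (sqEq-vp pr (pos-nz (pos-det {M = K k} (latK k))) (λ z → *-nz a0 (prod-nz c0) (trans (sym (prodK k)) z)) (frame-sqEq (proj₁ prime3) {M = K k} (frK k)))
    (trans (cong (vp p) (prodK k)) (trans (vp-* pr a0 (prod-nz c0)) (cong (vp p a xor_) (vpΠ pr))))

  -- At 2 the determinant has odd valuation, so the dyadic condition and the exception are both
  -- void. At an odd prime where its valuation is even, 2·det G is a unit and `a` has even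
  -- valuation, hence every symbol is trivial.
  embeds-stable : ∀ k → EmbedsInOddUnimodular (suc (suc (k +ᴺ suc n))) G
  embeds-stable k = embeds-K k (PC.embeds ho (λ v _ _ → ⊥-elim (dy v)) (inj₂ (λ x → dy (proj₁ x))))
    where
    module PC = PlaneCase {G = K k} (latK k) (frK k)
    -D : ℤ
    -D = - + PC.d
    vpD : ∀ {p} → Prime p → vp p -D ≡ vp p a xor vp p d
    vpD {p} pr = trans (vp-neg pr (pos≢0 PC.d>0)) (trans (cong (vp p) (sym PC.det≡)) (vpK pr k))
    dy : vp 2 -D ≡ false → ⊥
    dy v = case trans (sym (trans (vpD prime[2]) (ramified prime[2] (∣m⇒∣m*n d ∣-refl)))) v of λ ()
    ho : ∀ {p} → OddPrime p → vp p -D ≡ false → H p (+ p) -D ≡ false → PC.E p ≡ false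
    ho {p} op v _ = cong₂ _xor_ (trans (hsK p k) (cong₂ _xor_ ha (unimodular-hasse op {G = G} lat nd fr))) (odd-self PC.d>0 op v)
      where
      n2d : ¬ (+ p ∣ + 2 * d)
      n2d h = case trans (sym (trans (vpD (proj₁ op)) (ramified (proj₁ op) h))) v of λ ()
      nd : ¬ (+ p ∣ d)
      nd h = n2d (∣n⇒∣m*n (+ 2) h)
      ha : H p a (prodℤ (Frame.c fr)) ≡ false
      ha = trans (H-odd op a (prodℤ (Frame.c fr))) (cong₂ (λ s t → OddSymbol.F op s t (OddSymbol.ℓ op a) (OddSymbol.ℓ op (prodℤ (Frame.c fr)))) (unramified (proj₁ op) n2d) (trans (vpΠ (proj₁ op)) (proj₁ (unit-cls (proj₁ op) nd))))

caseD : ∀ {m n} {G : Mat n} → IsLattice G → 3 +ᴺ n ≤ m → EmbedsInOddUnimodular m G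
caseD {m} {n} {G} lat h = subst (λ m → EmbedsInOddUnimodular m G) eq (Stabilise.embeds-stable {G = G} lat (m ∸ (3 +ᴺ n)))
  where
  re : ∀ k n → 2 +ᴺ (k +ᴺ (1 +ᴺ n)) ≡ k +ᴺ (3 +ᴺ n)
  re = ℕR.solve-∀
  eq : suc (suc (m ∸ (3 +ᴺ n) +ᴺ suc n)) ≡ m
  eq = trans (re (m ∸ (3 +ᴺ n)) n) (m∸n+n≡m h)

theorem5p10 : (m n : ℕ) → 1 ≤ m → (G : Mat n) → IsLattice G →
    Cases m G → Extra m G → EmbedsInOddUnimodular m G
theorem5p10 m n _ G lat cases extra = go cases extra
  where
  go : Cases m G → Extra m G → EmbedsInOddUnimodular m G
  go (inj₂ (inj₂ (inj₂ h))) _ = caseD {G = G} lat h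
  go _ (inj₂ (inj₂ h)) = caseD {G = G} lat h
  go (inj₁ (refl , hyp)) (inj₁ od) = caseA {G = G} lat od hyp
  go (inj₁ (refl , hyp)) (inj₂ (inj₁ (e , _))) = ⊥-elim (<⇒≢ (m<n⇒m<1+n ≤-refl) e)
  go (inj₂ (inj₁ (refl , hyp))) (inj₁ od) = caseB {G = G} lat od hyp
  go (inj₂ (inj₁ (refl , hyp))) (inj₂ (inj₁ (e , _))) = ⊥-elim (<⇒≢ ≤-refl e)
  go (inj₂ (inj₂ (inj₁ (refl , hyp)))) (inj₁ od) = caseC {G = G} lat (inj₁ od) hyp
  go (inj₂ (inj₂ (inj₁ (refl , hyp)))) (inj₂ (inj₁ (_ , nx))) = caseC {G = G} lat (inj₂ nx) hyp
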